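{- Let $G$ be a $3$-connected cubic graph. Then $\lambda(G) \geqslant \beta(G)$. If $G$ is bipartite, then $\lambda(G)=\beta(G)=0$. If $G$ is nonbipartite, then the following are equivalent: (i) $\lambda(G)=\beta(G)$; (ii) $\beta(G)=n(G)$; (iii) $G \in \mathcal{G}$.
   Context: Graphs are loopless but may have parallel edges; $n(G)$ is the number of vertices. For a vertex $v$ of a $2$-connected cubic graph $G$, a $v$-matching is a spanning subgraph in which $v$ has degree $3$ and every other vertex has degree $1$; $v$ is $\lambda$-matchable if $G$ has a $v$-matching; $\Lambda(G)$ is the set and $\lambda(G)$ the number of $\lambda$-matchable vertices. A graph is matching covered if it is connected, of order at least two, and every edge lies in a perfect matching ($2$-connected cubic graphs are matching covered). For $X\subseteq V(G)$, $\partial(X)$ is the set of edges with exactly one end in $X$; $G/X$ denotes the graph obtained by shrinking $X$ to a single vertex. A cut $C$ of a matching covered graph is tight if $|C\cap M|=1$ for every perfect matching $M$; it is trivial if one shore has at most one vertex. Repeatedly replacing a graph with a nontrivial tight cut $\partial(X)$ by its two contractions $G/X$ and $G/\overline{X}$ ends with graphs free of nontrivial tight cuts; those that are bipartite are braces, the others are bricks; this list is independent of the choices made (up to edge multiplicities). $\beta(G)$ is the sum of the orders of the bricks of $G$. Splicing: given disjoint graphs $G_1,G_2$ with vertices $u\in V(G_1)$, $v\in V(G_2)$ of equal degree and a bijection $\pi:\partial_{G_1}(u)\to\partial_{G_2}(v)$, the splicing is obtained from $(G_1-u)\cup(G_2-v)$ by adding, for each $e\in\partial_{G_1}(u)$,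 an edge joining the end of $e$ other than $u$ to the end of $\pi(e)$ other than $v$. The family $\mathcal{G}$ is defined recursively: every cubic brick belongs to $\mathcal{G}$; and if $H[A,B]$ is any $3$-connected bipartite cubic graph, then every graph obtained from $H$ by splicing, at each vertex of $A$, with a member of $\mathcal{G}$ (at any of its vertices, with any bijection) belongs to $\mathcal{G}$. -}

module Defs where

open import Data.Bool using (_∧_; _xor_)
open import Data.Fin using (Fin; zero; suc)
open import Data.Fin.Properties using (all?) renaming (_≟_ to _≟ᶠ_)
open import Data.Fin.Subset using (Subset; inside; outside; _∈_; _∉_; ∁; _∩_; ⁅_⁆; ∣_∣; Empty)
open import Data.Fin.Subset.Properties using (_∈?_; x∉p⇒x∈∁p; x∈∁p⇒x∉p; ∣p∣≤n; ∣∁p∣≡n∸∣p∣; anySubset?)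
open import Data.Maybe using (Maybe; just; nothing)
open import Data.Nat using (ℕ; suc; _+_; _≤_; _<_; _≟_; _≤?_)
open import Data.Nat.Induction using (<-wellFounded)
open import Data.Nat.Properties using (≤-trans; ≤-reflexive; +-monoˡ-≤; m+[n∸m]≡n)
open import Data.Product using (∃; _×_; _,_; proj₁; proj₂)
open import Data.Sum using (_⊎_; inj₁; inj₂; [_,_]′)
open import Data.Vec using (tabulate; lookup; _∷_; here; there)
open import Data.Vec.Properties using (lookup∘tabulate; []=⇒lookup; lookup⇒[]=)
open import Function using (const)
open import Function.Bundles using (_↔_; mk↔ₛ′; Inverse)
open import Induction.WellFounded using (Acc; acc)
open import Relation.Binary.Construct.Closure.ReflexiveTransitive using (Star)
open import Relation.Binary.PropositionalEquality using (_≡_; _≢_; refl; sym; trans; cong; cong₂)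
open import Relation.Nullary using (¬_; Dec; yes; no; does; contradiction)
open import Relation.Nullary.Decidable using (_×-dec_; _→-dec_; ¬?; decidable-stable)

-- The order of src and tgt carries no meaning: every notion below is
-- symmetric in the two ends of an edge.
record Graph : Set where
  field
    order    : ℕ
    size     : ℕ
    src tgt  : Fin size → Fin order
    loopless : ∀ e → src e ≢ tgt e

  V E : Set
  V = Fin order
  E = Fin size

  VSet ESet : Set
  VSet = Subset order
  ESet = Subset size

  Joins : E → V → V → Set
  Joins e u v = (src e ≡ u × tgt e ≡ v) ⊎ (src e ≡ v × tgt e ≡ u)

  Adjacent : V → V → Set
  Adjacent u v = ∃ λ e → Joins e u v

  ∂ : VSet → ESet
  ∂ X = tabulate λ e → lookup X (src e) xor lookup X (tgt e)

  -- By looplessness these are all the edges incident with v.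
  ∂ᵥ : V → ESet
  ∂ᵥ v = ∂ ⁅ v ⁆

  -- Edges with both ends in X.
  within : VSet → ESet
  within X = tabulate λ e → lookup X (src e) ∧ lookup X (tgt e)

  -- A spanning subgraph is identified with its edge set.
  degreeIn : ESet → V → ℕ
  degreeIn F v = ∣ ∂ᵥ v ∩ F ∣

open Graph public using (order)

module _ (G : Graph) where
  open Graph G hiding (order)

  Cubic : Set
  Cubic = ∀ v → ∣ ∂ᵥ v ∣ ≡ 3

  Connected : Set
  Connected = ∀ u v → Star Adjacent u v

  AdjacentOff : VSet → V → V → Set
  AdjacentOff S u v = Adjacent u v × u ∉ S × v ∉ S

  -- Following the convention for graphs with parallel edges, the graph with
  -- two vertices joined by three edges counts as 3-connected; it is the only
  -- cubic graph for which asking for order at least 4 would matter.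
  ThreeConnected : Set
  ThreeConnected = 2 ≤ order G
    × (∀ S → ∣ S ∣ < 3 → ∀ u v → u ∉ S → v ∉ S → Star (AdjacentOff S) u v)

  -- A and its complement are the two colour classes.
  IsBipartition : VSet → Set
  IsBipartition A = ∀ e → e ∈ ∂ A

  Bipartite : Set
  Bipartite = ∃ IsBipartition

  IsPerfectMatching : ESet → Set
  IsPerfectMatching M = ∀ v → degreeIn M v ≡ 1

  IsVMatching : V → ESet → Set
  IsVMatching v F = degreeIn F v ≡ 3 × (∀ u → u ≢ v → degreeIn F u ≡ 1)

  LambdaMatchable : V → Set
  LambdaMatchable v = ∃ (IsVMatching v)

  lambdaMatchable? : ∀ v → Dec (LambdaMatchable v)
  lambdaMatchable? v = anySubset? λ F →
    (degreeIn F v ≟ 3) ×-dec all? (λ u → ¬? (u ≟ᶠ v) →-dec (degreeIn F u ≟ 1))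

  Λ : VSet
  Λ = tabulate λ v → does (lambdaMatchable? v)

  λ# : ℕ
  λ# = ∣ Λ ∣

  MatchingCovered : Set
  MatchingCovered = Connected × 2 ≤ order G
    × (∀ e → ∃ λ M → IsPerfectMatching M × e ∈ M)

  TightCut : VSet → Set
  TightCut X = ∀ M → IsPerfectMatching M → ∣ ∂ X ∩ M ∣ ≡ 1

  NontrivialTightCut : VSet → Set
  NontrivialTightCut X = 2 ≤ ∣ X ∣ × 2 ≤ ∣ ∁ X ∣ × TightCut X

  TightCutFree : Set
  TightCutFree = ∀ X → ¬ NontrivialTightCut X

  IsBrick : Set
  IsBrick = MatchingCovered × TightCutFree × ¬ Bipartite

-- A subset viewed as a type; membership proofs are unique.
El : ∀ {k} → Subset k → Set
El p = ∃ (_∈ p)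

collapse : ∀ {k} (X : Subset k) → Fin k → Maybe (El (∁ X))
collapse X v with v ∈? X
... | yes _   = nothing
... | no  v∉X = just (v , x∉p⇒x∈∁p v∉X)

-- H is (isomorphic to) G/X, where 'nothing' is the vertex to which X is shrunk.
record Contraction (G : Graph) (X : Graph.VSet G) (H : Graph) : Set where
  private
    module G = Graph G
    module H = Graph H
  field
    vertices : Maybe (El (∁ X)) ↔ H.V
    edges    : El (∁ (G.within X)) ↔ H.E
  vertex : Maybe (El (∁ X)) → H.V
  vertex = Inverse.to vertices
  edge : El (∁ (G.within X)) → H.E
  edge = Inverse.to edges
  field
    ends : ∀ e u v → G.Joins (proj₁ e) u v →
           H.Joins (edge e) (vertex (collapse X u)) (vertex (collapse X v))

-- A run of the tight cut decomposition procedure. The leaves of a run that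
-- starts at a matching covered graph are matching covered, because both
-- contractions across a tight cut of such a graph are; so they are indeed
-- bricks and braces.
data TightCutDecomposition (G : Graph) : Set where
  brick : TightCutFree G → ¬ Bipartite G → TightCutDecomposition G
  brace : TightCutFree G → Bipartite G → TightCutDecomposition G
  split : ∀ X {H₁ H₂} → NontrivialTightCut G X →
          Contraction G X H₁ → Contraction G (∁ X) H₂ →
          TightCutDecomposition H₁ → TightCutDecomposition H₂ →
          TightCutDecomposition G

β : ∀ {G} → TightCutDecomposition G → ℕ
β {G} (brick _ _)       = order G
β     (brace _ _)       = 0
β (split _ _ _ _ D₁ D₂) = β D₁ + β D₂

-- G is (isomorphic to) the splicing of G₁ at u with G₂ at v along π.
record Splicing (G₁ : Graph) (u : Graph.V G₁) (G₂ : Graph) (v : Graph.V G₂) (G : Graph) : Set where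
  private
    module G₁ = Graph G₁
    module G₂ = Graph G₂
    module G  = Graph G
  field
    π        : El (G₁.∂ᵥ u) ↔ El (G₂.∂ᵥ v)
    vertices : (El (∁ ⁅ u ⁆) ⊎ El (∁ ⁅ v ⁆)) ↔ G.V
    edges    : (El (∁ (G₁.∂ᵥ u)) ⊎ El (∁ (G₂.∂ᵥ v)) ⊎ El (G₁.∂ᵥ u)) ↔ G.E
  vertex : El (∁ ⁅ u ⁆) ⊎ El (∁ ⁅ v ⁆) → G.V
  vertex = Inverse.to vertices
  edge : El (∁ (G₁.∂ᵥ u)) ⊎ El (∁ (G₂.∂ᵥ v)) ⊎ El (G₁.∂ᵥ u) → G.E
  edge = Inverse.to edges
  field
    ends₁ : ∀ e x y → G₁.Joins (proj₁ e) (proj₁ x) (proj₁ y) →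
            G.Joins (edge (inj₁ e)) (vertex (inj₁ x)) (vertex (inj₁ y))
    ends₂ : ∀ e x y → G₂.Joins (proj₁ e) (proj₁ x) (proj₁ y) →
            G.Joins (edge (inj₂ (inj₁ e))) (vertex (inj₂ x)) (vertex (inj₂ y))
    ends× : ∀ e x y → G₁.Joins (proj₁ e) u (proj₁ x) →
            G₂.Joins (proj₁ (Inverse.to π e)) v (proj₁ y) →
            G.Joins (edge (inj₂ (inj₂ e))) (vertex (inj₁ x)) (vertex (inj₂ y))

  -- The set of vertices of G that stem from R - u, for R a vertex set of G₁.
  transfer : G₁.VSet → G.VSet
  transfer R = tabulate λ x →
    [ (λ y → lookup R (proj₁ y)) , const outside ]′ (Inverse.from vertices x)

-- SplicedAt K R G: G arises from K by splicing, one after the other, at each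
-- vertex of R with some member of 𝒢.
mutual
  data 𝒢 : Graph → Set where
    cubicBrick : ∀ {G} → Cubic G → IsBrick G → 𝒢 G
    spliced    : ∀ {G} H A → ThreeConnected H → Cubic H → IsBipartition H A →
                 SplicedAt H A G → 𝒢 G

  data SplicedAt : (K : Graph) → Graph.VSet K → Graph → Set where
    done : ∀ {K R} → Empty R → SplicedAt K R K
    step : ∀ {K R G J K′} a w → a ∈ R → 𝒢 J → (s : Splicing K a J w K′) →
           SplicedAt K′ (Splicing.transfer s R) G → SplicedAt K R G

-- Every graph has a tight cut decomposition, so quantifying over all of them
-- is never vacuous.

private
  sucEl : ∀ {k s} {p : Subset k} → El p → El (s ∷ p)
  sucEl (x , x∈p) = suc x , there x∈p

  enum : ∀ {k} (p : Subset k) → Fin ∣ p ∣ → El p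
  enum (inside  ∷ p) zero    = zero , here
  enum (inside  ∷ p) (suc i) = sucEl (enum p i)
  enum (outside ∷ p) i       = sucEl (enum p i)

  index : ∀ {k} (p : Subset k) → El p → Fin ∣ p ∣
  index (inside  ∷ p) (zero  , here)    = zero
  index (inside  ∷ p) (suc x , there q) = suc (index p (x , q))
  index (outside ∷ p) (suc x , there q) = index p (x , q)

  index-enum : ∀ {k} (p : Subset k) i → index p (enum p i) ≡ i
  index-enum (inside  ∷ p) zero    = refl
  index-enum (inside  ∷ p) (suc i) = cong suc (index-enum p i)
  index-enum (outside ∷ p) i       = index-enum p i

  enum-index : ∀ {k} (p : Subset k) x → enum p (index p x) ≡ x
  enum-index (inside  ∷ p) (zero  , here)    = refl
  enum-index (inside  ∷ p) (suc x , there q) = cong sucEl (enum-index p (x , q))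
  enum-index (outside ∷ p) (suc x , there q) = cong sucEl (enum-index p (x , q))

  index↔ : ∀ {k} (p : Subset k) → El p ↔ Fin ∣ p ∣
  index↔ p = mk↔ₛ′ (index p) (enum p) (index-enum p) (enum-index p)

  index⁺ : ∀ {k} (p : Subset k) → Maybe (El p) → Fin (suc ∣ p ∣)
  index⁺ p nothing  = zero
  index⁺ p (just x) = suc (index p x)

  index⁺↔ : ∀ {k} (p : Subset k) → Maybe (El p) ↔ Fin (suc ∣ p ∣)
  index⁺↔ p = mk↔ₛ′ (index⁺ p) enum⁺ right left
    where
    enum⁺ : Fin (suc ∣ p ∣) → Maybe (El p)
    enum⁺ zero    = nothing
    enum⁺ (suc i) = just (enum p i)
    right : ∀ i → index⁺ p (enum⁺ i) ≡ i
    right zero    = refl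
    right (suc i) = cong suc (index-enum p i)
    left : ∀ x → enum⁺ (index⁺ p x) ≡ x
    left nothing  = refl
    left (just x) = cong just (enum-index p x)

  index⁺-injective : ∀ {k} (p : Subset k) {x y} → index⁺ p x ≡ index⁺ p y → x ≡ y
  index⁺-injective p {x} {y} eq =
    trans (sym (Inverse.strictlyInverseʳ (index⁺↔ p) x))
      (trans (cong (Inverse.from (index⁺↔ p)) eq) (Inverse.strictlyInverseʳ (index⁺↔ p) y))

  collapse-injective : ∀ {k} (X : Subset k) u v → collapse X u ≡ collapse X v → u ≢ v → u ∈ X × v ∈ X
  collapse-injective X u v eq u≢v with u ∈? X | v ∈? X
  collapse-injective X u v eq   u≢v | yes p | yes q = p , q
  collapse-injective X u v ()   u≢v | yes p | no  q
  collapse-injective X u v ()   u≢v | no  p | yes q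
  collapse-injective X u v refl u≢v | no  p | no  q = contradiction refl u≢v

  module _ (G : Graph) (X : Graph.VSet G) where
    open Graph G hiding (order)

    kept : ESet
    kept = ∁ (within X)

    kept-not-within : (e : El kept) → ¬ (src (proj₁ e) ∈ X × tgt (proj₁ e) ∈ X)
    kept-not-within (e , e∈) (p , q) = x∈∁p⇒x∉p e∈
      (lookup⇒[]= e (within X)
        (trans (lookup∘tabulate _ e) (cong₂ _∧_ ([]=⇒lookup p) ([]=⇒lookup q))))

    place : V → Fin (suc ∣ ∁ X ∣)
    place v = index⁺ (∁ X) (collapse X v)

    contract : Graph
    contract = record
      { order    = suc ∣ ∁ X ∣
      ; size     = ∣ kept ∣
      ; src      = λ i → place (src (proj₁ (enum kept i)))
      ; tgt      = λ i → place (tgt (proj₁ (enum kept i)))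
      ; loopless = λ i eq → kept-not-within (enum kept i)
          (collapse-injective X _ _ (index⁺-injective (∁ X) eq) (loopless (proj₁ (enum kept i))))
      }

    contraction : Contraction G X contract
    contraction = record
      { vertices = index⁺↔ (∁ X)
      ; edges    = index↔ kept
      ; ends     = ends
      }
      where
      ends : ∀ e u v → Joins (proj₁ e) u v →
             Graph.Joins contract (index kept e) (place u) (place v)
      ends e u v j rewrite enum-index kept e with j
      ... | inj₁ (refl , refl) = inj₁ (refl , refl)
      ... | inj₂ (refl , refl) = inj₂ (refl , refl)

    contract-< : 2 ≤ ∣ X ∣ → order contract < order G
    contract-< 2≤ = ≤-trans (+-monoˡ-≤ ∣ ∁ X ∣ 2≤)
      (≤-reflexive (trans (cong (∣ X ∣ +_) (∣∁p∣≡n∸∣p∣ X)) (m+[n∸m]≡n (∣p∣≤n X))))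

  allSubset? : ∀ {k} {P : Subset k → Set} → (∀ s → Dec (P s)) → Dec (∀ s → P s)
  allSubset? P? with anySubset? (λ s → ¬? (P? s))
  ... | yes (s , ¬p) = no (λ f → ¬p (f s))
  ... | no  ∄       = yes (λ s → decidable-stable (P? s) (λ ¬p → ∄ (s , ¬p)))

  nontrivialTightCut? : ∀ G X → Dec (NontrivialTightCut G X)
  nontrivialTightCut? G X = (2 ≤? ∣ X ∣) ×-dec (2 ≤? ∣ ∁ X ∣) ×-dec
    allSubset? (λ M → all? (λ v → Graph.degreeIn G M v ≟ 1) →-dec (∣ Graph.∂ G X ∩ M ∣ ≟ 1))

  bipartite? : ∀ G → Dec (Bipartite G)
  bipartite? G = anySubset? λ A → all? (λ e → e ∈? Graph.∂ G A)

  run : ∀ G → Acc _<_ (order G) → TightCutDecomposition G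
  run G (acc rec) with anySubset? (nontrivialTightCut? G)
  ... | yes (X , t@(2≤X , 2≤∁X , _)) =
    split X t (contraction G X) (contraction G (∁ X))
      (run (contract G X) (rec (contract-< G X 2≤X)))
      (run (contract G (∁ X)) (rec (contract-< G (∁ X) 2≤∁X)))
  ... | no ∄ with bipartite? G
  ...   | yes b = brace (λ X t → ∄ (X , t)) b
  ...   | no ¬b = brick (λ X t → ∄ (X , t)) ¬b

decompose : ∀ G → TightCutDecomposition G
decompose G = run G (<-wellFounded (order G))

{-# OPTIONS --safe #-}
module Submission where

-- Call y, v doubly matchable if some spanning subgraph has degree 3 at y and v and degree 1 elsewhere. For a set Y
-- of vertices let W(Y) consist of the λ-matchable vertices and of those doubly matchable with a vertex of Y. If Y is
-- disjoint from W(Y), then β + |Y| ≤ |W(Y)|; and if equality holds and Y is nonempty or G is nonbipartite, then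
-- W(Y) and Y cover G and every way of splicing members of 𝒢 at all vertices of Y yields a member of 𝒢. The case
-- Y = ∅ gives (i) ⇒ (ii) ⇒ (iii). The proof is by induction on the decomposition. In a brick every vertex is
-- λ-matchable, as a Tutte set would yield a tight cut. In a bipartite graph adjacent vertices are doubly matchable,
-- so W(Y) contains the neighbours of Y, and counting edges shows that equality forces Y to be a colour class. Across
-- a tight cut the two contraction vertices are not both λ-matchable, and an unmatchable one is added to Y on its
-- side. Splicing is associative, which transports the statement about 𝒢.
--
-- Tight cuts have exactly three edges because the constant vector 1/3 is a combination of perfect matchings: if two
-- functionals agree on all perfect matchings, they agree on every r-regular weighting whose odd cuts weigh at least r.
--
-- For (iii) ⇒ (ii), 3-cuts of a 3-connected cubic graph do not cross, so any decomposition can be rearranged along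
-- the cuts created by the splicings; no vertex set of the colour class A can be matched with degree 3, which makes
-- these cuts tight.

open import Defs
import Algebra.Properties.Semiring.Sum as SemiringSum
open import Data.Bool using (Bool; true; false; _∧_; _∨_; not; _xor_; if_then_else_)
import Data.Bool.Properties as Bool
open import Data.Empty using (⊥; ⊥-elim)
open import Data.Fin using (Fin; zero; suc; _↑ˡ_; _↑ʳ_)
open import Data.Fin.Properties using (_≟_; any?; all?; ↑ˡ-injective; ↑ʳ-injective; suc-injective)
open import Data.Fin.Subset using (Subset; _∈_; _∉_; ∁; _∩_; ⁅_⁆; ∣_∣; Empty)
open import Data.Fin.Subset.Properties using (anySubset?; _∈?_; x∈⁅x⁆; x∈⁅y⁆⇒x≡y; x∈∁p⇒x∉p; x∉p⇒x∈∁p)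
open import Data.Maybe using (Maybe; just; nothing)
open import Data.Nat as ℕ using (ℕ; zero; suc; _+_; _*_; _∸_; _≤_; _<_; _≥_; z≤n; s≤s; _≤?_; _<?_)
open import Data.Nat.Properties hiding (_≟_; ≡-irrelevant; suc-injective; _≤?_; _<?_)
open import Data.Nat.Tactic.RingSolver using (solve-∀)
open import Data.Product using (∃; _×_; _,_; proj₁; proj₂)
open import Data.Sum using (_⊎_; inj₁; inj₂; [_,_]′)
open import Data.Vec using (Vec; lookup; tabulate; _∷_; []; here; there)
open import Data.Vec.Properties using (lookup∘tabulate; []=⇒lookup; lookup⇒[]=; lookup-zipWith; lookup-map; tabulate∘lookup; tabulate-cong)
open import Function using (_∘_; id; const)
open import Function.Bundles using (_⇔_; mk⇔; mk↔ₛ′; Inverse)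
open import Function.Construct.Symmetry using (↔-sym)
open import Relation.Binary.Construct.Closure.ReflexiveTransitive as Star using (Star; ε; _◅_; _◅◅_)
open import Relation.Binary.PropositionalEquality hiding (J)
open import Relation.Nullary using (¬_; Dec; yes; no; does; contradiction)
open import Relation.Nullary.Decidable using (dec-true; dec-false; _×-dec_; _⊎-dec_; _→-dec_; ¬?; map′)

-- A direct induction on β ≤ λ breaks down when the contraction vertex x₂ is λ-matchable in G₂: it
-- is counted there but is no vertex of G. The loss is made good on the other side. A vertex doubly
-- matchable with x₁ in G₁ becomes λ-matchable in G, because the two factors both use all three cut
-- edges and can be glued. Hence x₁ is added to Y in G₁. Its own stability has to be checked: a
-- vertex of Y doubly matchable with x₁ would itself be reached in G. 3-connectedness is replaced by
-- a condition on edge cuts because every cut of a contraction is a cut of G of the same size. The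
-- polytope theorem of Edmonds enters only through the size of tight cuts. Comparing two functionals
-- with natural coefficients avoids both rational combinations and negative numbers. Its input, a
-- perfect matching through every edge of the support, comes from Tutte's theorem, which serves
-- again for bricks.

module Counting where

  -- Boolean predicates, finite sums and parity

  module Σℕ = SemiringSum +-*-semiring

  Pred : ℕ → Set
  Pred n = Fin n → Bool

  infix 4 _⊑_
  _⊑_ : ∀ {n} → Pred n → Pred n → Set
  p ⊑ q = ∀ i → p i ≡ true → q i ≡ true

  true≢false : ∀ {b} → b ≡ true → b ≡ false → ⊥
  true≢false refl ()

  bool : ∀ b → b ≡ true ⊎ b ≡ false
  bool true  = inj₁ refl
  bool false = inj₂ refl

  ≢true⇒false : ∀ {b} → ¬ b ≡ true → b ≡ false
  ≢true⇒false {true}  n = contradiction refl n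
  ≢true⇒false {false} n = refl

  ≢false⇒true : ∀ {b} → ¬ b ≡ false → b ≡ true
  ≢false⇒true {true}  n = refl
  ≢false⇒true {false} n = contradiction refl n

  ∧⁻ : ∀ {a b} → a ∧ b ≡ true → a ≡ true × b ≡ true
  ∧⁻ {true} {true} _ = refl , refl

  ∧⁺ : ∀ {a b} → a ≡ true → b ≡ true → a ∧ b ≡ true
  ∧⁺ refl refl = refl

  ∨⁻ : ∀ {a b} → a ∨ b ≡ true → a ≡ true ⊎ b ≡ true
  ∨⁻ {true}  _ = inj₁ refl
  ∨⁻ {false} p = inj₂ p

  ∨⁺ˡ : ∀ {a b} → a ≡ true → a ∨ b ≡ true
  ∨⁺ˡ refl = refl

  ∨⁺ʳ : ∀ {a b} → b ≡ true → a ∨ b ≡ true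
  ∨⁺ʳ {true}  _ = refl
  ∨⁺ʳ {false} p = p

  not⁻ : ∀ {a} → not a ≡ true → a ≡ false
  not⁻ {false} _ = refl

  not⁺ : ∀ {a} → a ≡ false → not a ≡ true
  not⁺ refl = refl

  ≡-by-truth : ∀ {a b} → (a ≡ true → b ≡ true) → (b ≡ true → a ≡ true) → a ≡ b
  ≡-by-truth {true}  {b}     f g = sym (f refl)
  ≡-by-truth {false} {true}  f g = g refl
  ≡-by-truth {false} {false} f g = refl

  does⁻ : ∀ {A : Set} (a? : Dec A) → does a? ≡ true → A
  does⁻ (yes a) _ = a

  abstract
    δ : ∀ {n} → Fin n → Pred n
    δ i j = does (i ≟ j)

    δ-refl : ∀ {n} (i : Fin n) → δ i i ≡ true
    δ-refl i = dec-true (i ≟ i) refl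

    δ-true : ∀ {n} {i j : Fin n} → δ i j ≡ true → i ≡ j
    δ-true {i = i} {j} = does⁻ (i ≟ j)

    δ-false : ∀ {n} {i j : Fin n} → i ≢ j → δ i j ≡ false
    δ-false {i = i} {j} = dec-false (i ≟ j)

    δ-false⁻ : ∀ {n} {i j : Fin n} → δ i j ≡ false → i ≢ j
    δ-false⁻ {i = i} p refl = true≢false (δ-refl i) p

  abstract
    some : ∀ {n} → Pred n → Bool
    some p = does (any? λ i → p i Bool.≟ true)

    some⁺ : ∀ {n} {p : Pred n} i → p i ≡ true → some p ≡ true
    some⁺ {p = p} i pi = dec-true (any? λ i → p i Bool.≟ true) (i , pi)

    some⁻ : ∀ {n} {p : Pred n} → some p ≡ true → ∃ λ i → p i ≡ true
    some⁻ {p = p} = does⁻ (any? λ i → p i Bool.≟ true)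

  -- Finite choice. In Tutte's theorem it collects matchings for all deleted vertices at once,
  -- unless one deletion leaves an obstruction.
  all⊎any : ∀ {n} {A B : Fin n → Set} → (∀ i → A i ⊎ B i) → (∀ i → A i) ⊎ ∃ B
  all⊎any {zero}  f = inj₁ λ ()
  all⊎any {suc n} f with f zero | all⊎any (f ∘ suc)
  ... | inj₂ b | _            = inj₂ (zero , b)
  ... | inj₁ a | inj₂ (i , b) = inj₂ (suc i , b)
  ... | inj₁ a | inj₁ g       = inj₁ λ { zero → a ; (suc i) → g i }

  ⟦_⟧ : Bool → ℕ
  ⟦ true  ⟧ = 1
  ⟦ false ⟧ = 0

  ⟦⟧≤1 : ∀ b → ⟦ b ⟧ ≤ 1
  ⟦⟧≤1 true  = ≤-refl
  ⟦⟧≤1 false = z≤n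

  ⟦⟧-mono : ∀ {a b} → (a ≡ true → b ≡ true) → ⟦ a ⟧ ≤ ⟦ b ⟧
  ⟦⟧-mono {true}  f rewrite f refl = ≤-refl
  ⟦⟧-mono {false} f = z≤n

  ⟦⟧-true : ∀ {a} → 1 ≤ ⟦ a ⟧ → a ≡ true
  ⟦⟧-true {true} _ = refl

  ⟦∧⟧ : ∀ a b → ⟦ a ∧ b ⟧ ≡ ⟦ a ⟧ * ⟦ b ⟧
  ⟦∧⟧ true  b = sym (+-identityʳ ⟦ b ⟧)
  ⟦∧⟧ false b = refl

  -- Abstract, so that sums and counts unify structurally.
  abstract
    sum : ∀ {n} → (Fin n → ℕ) → ℕ
    sum = Σℕ.sum

    count : ∀ {n} → Pred n → ℕ
    count p = sum λ i → ⟦ p i ⟧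

    count≡sum : ∀ {n} (p : Pred n) → count p ≡ sum (λ i → ⟦ p i ⟧)
    count≡sum p = refl

    sum-suc : ∀ {n} (f : Fin (suc n) → ℕ) → sum f ≡ f zero + sum (f ∘ suc)
    sum-suc f = refl

    sum-cong : ∀ {n} {f g : Fin n → ℕ} → (∀ i → f i ≡ g i) → sum f ≡ sum g
    sum-cong {f = f} {g} h = Σℕ.sum-cong-≗ {x = f} {g} h

    sum-+ : ∀ {n} (f g : Fin n → ℕ) → sum (λ i → f i + g i) ≡ sum f + sum g
    sum-+ = Σℕ.∑-distrib-+

    sum-swap : ∀ {m n} (f : Fin m → Fin n → ℕ) → sum (λ i → sum (f i)) ≡ sum (λ j → sum (λ i → f i j))
    sum-swap = Σℕ.∑-comm

    *-sum : ∀ {n} c (f : Fin n → ℕ) → sum (λ i → c * f i) ≡ c * sum f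
    *-sum c f = sym (Σℕ.*-distribˡ-sum c f)

    sum-mono-≤ : ∀ {n} {f g : Fin n → ℕ} → (∀ i → f i ≤ g i) → sum f ≤ sum g
    sum-mono-≤ {zero}  le = z≤n
    sum-mono-≤ {suc n} le = +-mono-≤ (le zero) (sum-mono-≤ (le ∘ suc))

    sum-zero : ∀ {n} {f : Fin n → ℕ} → (∀ i → f i ≡ 0) → sum f ≡ 0
    sum-zero {zero}  z = refl
    sum-zero {suc n} z rewrite z zero = sum-zero (z ∘ suc)

    ≤-sum : ∀ {n} (f : Fin n → ℕ) i → f i ≤ sum f
    ≤-sum f zero    = m≤m+n _ _
    ≤-sum f (suc i) = ≤-trans (≤-sum (f ∘ suc) i) (m≤n+m _ _)

    sum-pos⁻ : ∀ {n} {f : Fin n → ℕ} → 1 ≤ sum f → ∃ λ i → 1 ≤ f i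
    sum-pos⁻ {suc n} {f} p with f zero in eq
    ... | suc m = zero , subst (1 ≤_) (sym eq) (s≤s z≤n)
    ... | zero  with sum-pos⁻ {f = f ∘ suc} p
    ...   | i , q = suc i , q

    -- The equality cases of the later counting arguments (barriers, braces, full stars) rest on
    -- this, directly or through `count-⊑-≡`.
    sum-≡⇒≡ : ∀ {n} {f g : Fin n → ℕ} → (∀ i → f i ≤ g i) → sum g ≤ sum f → ∀ i → f i ≡ g i
    sum-≡⇒≡ {suc n} {f} {g} le eq zero = ≤-antisym (le zero)
      (+-cancelʳ-≤ (sum (g ∘ suc)) _ _ (≤-trans eq (+-monoʳ-≤ (f zero) (sum-mono-≤ (le ∘ suc)))))
    sum-≡⇒≡ {suc n} {f} {g} le eq (suc i) = sum-≡⇒≡ (le ∘ suc)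
      (+-cancelˡ-≤ (g zero) _ _ (≤-trans eq (+-monoˡ-≤ (sum (f ∘ suc)) (le zero)))) i

    sum-δ : ∀ {n} (f : Fin n → ℕ) i → sum (λ j → ⟦ δ i j ⟧ * f j) ≡ f i
    sum-δ {suc n} f zero = trans (cong₂ _+_ (+-identityʳ (f zero)) (sum-zero {n} λ j → refl)) (+-identityʳ (f zero))
    sum-δ f (suc i) = sum-δ (f ∘ suc) i

  δ-sym : ∀ {n} (i j : Fin n) → δ i j ≡ δ j i
  δ-sym i j = ≡-by-truth (λ p → subst (λ x → δ x i ≡ true) (δ-true p) (δ-refl i))
                         (λ p → subst (λ x → δ x j ≡ true) (δ-true p) (δ-refl j))

  count-cong : ∀ {n} {p q : Pred n} → (∀ i → p i ≡ q i) → count p ≡ count q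
  count-cong {p = p} {q} h = trans (count≡sum p) (trans (sum-cong (cong ⟦_⟧ ∘ h)) (sym (count≡sum q)))

  count-δ : ∀ {n} (i : Fin n) → count (δ i) ≡ 1
  count-δ i = trans (count≡sum _) (trans (sum-cong λ j → sym (*-identityʳ ⟦ δ i j ⟧)) (sum-δ (const 1) i))

  abstract
    count-mono : ∀ {n} {p q : Pred n} → p ⊑ q → count p ≤ count q
    count-mono h = sum-mono-≤ λ i → ⟦⟧-mono (h i)

    count-pos : ∀ {n} {p : Pred n} i → p i ≡ true → 1 ≤ count p
    count-pos {p = p} i pi = ≤-trans (≤-reflexive (cong ⟦_⟧ (sym pi))) (≤-sum (⟦_⟧ ∘ p) i)

    count-pos⁻ : ∀ {n} {p : Pred n} → 1 ≤ count p → ∃ λ i → p i ≡ true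
    count-pos⁻ pos with sum-pos⁻ pos
    ... | i , q = i , ⟦⟧-true q

    count-zero : ∀ {n} {p : Pred n} → count p ≡ 0 → ∀ i → p i ≡ false
    count-zero {p = p} z i = ≢true⇒false λ pi → contradiction (subst (1 ≤_) z (count-pos i pi)) λ ()

    count-empty : ∀ {n} {p : Pred n} → (∀ i → p i ≡ false) → count p ≡ 0
    count-empty h = sum-zero (cong ⟦_⟧ ∘ h)

    count-⊑-≡ : ∀ {n} {p q : Pred n} → p ⊑ q → count q ≤ count p → q ⊑ p
    count-⊑-≡ {p = p} {q} h le i qi =
      ⟦⟧-true (subst (1 ≤_) (sym (sum-≡⇒≡ (λ j → ⟦⟧-mono (h j)) le i)) (≤-reflexive (cong ⟦_⟧ (sym qi))))

    count-+ : ∀ {n} (p q r : Pred n) → (∀ i → ⟦ p i ⟧ ≡ ⟦ q i ⟧ + ⟦ r i ⟧) → count p ≡ count q + count r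
    count-+ p q r h = trans (sum-cong {g = λ i → ⟦ q i ⟧ + ⟦ r i ⟧} h) (sum-+ (λ i → ⟦ q i ⟧) (λ i → ⟦ r i ⟧))

    count-++ : ∀ {n} (p q r s : Pred n) → (∀ i → ⟦ p i ⟧ + ⟦ q i ⟧ ≡ ⟦ r i ⟧ + ⟦ s i ⟧) →
               count p + count q ≡ count r + count s
    count-++ p q r s h = trans (sym (sum-+ (λ i → ⟦ p i ⟧) (λ i → ⟦ q i ⟧)))
      (trans (sum-cong {f = λ i → ⟦ p i ⟧ + ⟦ q i ⟧} {λ i → ⟦ r i ⟧ + ⟦ s i ⟧} h) (sum-+ (λ i → ⟦ r i ⟧) (λ i → ⟦ s i ⟧)))

  count-split : ∀ {n} (p q : Pred n) → count p ≡ count (λ i → p i ∧ q i) + count (λ i → p i ∧ not (q i))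
  count-split p q = count-+ _ _ _ λ i → lem (p i) (q i)
    where
    lem : ∀ a b → ⟦ a ⟧ ≡ ⟦ a ∧ b ⟧ + ⟦ a ∧ not b ⟧
    lem true  true  = refl
    lem true  false = refl
    lem false b     = refl

  count-∨ : ∀ {n} (p q : Pred n) → count (λ i → p i ∨ q i) + count (λ i → p i ∧ q i) ≡ count p + count q
  count-∨ p q = count-++ _ _ _ _ λ i → lem (p i) (q i)
    where
    lem : ∀ a b → ⟦ a ∨ b ⟧ + ⟦ a ∧ b ⟧ ≡ ⟦ a ⟧ + ⟦ b ⟧
    lem true  true  = refl
    lem true  false = refl
    lem false b     = +-identityʳ _

  count-⊎ : ∀ {n} (p q : Pred n) → (∀ i → p i ≡ true → q i ≡ true → ⊥) → count (λ i → p i ∨ q i) ≡ count p + count q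
  count-⊎ p q dis = trans (sym (trans (cong (count (λ i → p i ∨ q i) +_)
    (count-empty λ i → ≢true⇒false λ h → dis i (proj₁ (∧⁻ h)) (proj₂ (∧⁻ {p i} h)))) (+-identityʳ _))) (count-∨ p q)

  infixl 6 _∖_ _⊕_
  _∖_ : ∀ {n} → Pred n → Fin n → Pred n
  (p ∖ i) j = p j ∧ not (δ i j)

  _⊕_ : ∀ {n} → Pred n → Fin n → Pred n
  (p ⊕ i) j = p j ∨ δ i j

  ∖⁻ : ∀ {n} (p : Pred n) {i j} → (p ∖ i) j ≡ true → p j ≡ true × i ≢ j
  ∖⁻ p {i} {j} h = proj₁ (∧⁻ h) , δ-false⁻ (not⁻ (proj₂ (∧⁻ {p j} h)))

  ∖⁺ : ∀ {n} (p : Pred n) {i j} → p j ≡ true → i ≢ j → (p ∖ i) j ≡ true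
  ∖⁺ p h ne = ∧⁺ h (not⁺ (δ-false ne))

  ⊕⁻ : ∀ {n} (p : Pred n) {i j} → (p ⊕ i) j ≡ true → p j ≡ true ⊎ i ≡ j
  ⊕⁻ p {i} {j} h with ∨⁻ {p j} h
  ... | inj₁ a = inj₁ a
  ... | inj₂ b = inj₂ (δ-true b)

  count-∖ : ∀ {n} {p : Pred n} i → p i ≡ true → count p ≡ suc (count (p ∖ i))
  count-∖ {p = p} i pi = trans (count-split p (δ i)) (cong (_+ count (p ∖ i))
    (trans (count-cong λ j → ≡-by-truth (λ h → proj₂ (∧⁻ {p j} h))
       (λ h → ∧⁺ (subst (λ x → p x ≡ true) (δ-true h) pi) h)) (count-δ i)))

  count-⊕ : ∀ {n} {p : Pred n} i → p i ≡ false → count (p ⊕ i) ≡ suc (count p)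
  count-⊕ {p = p} i pi = trans (count-⊎ p (δ i) λ j pj e → true≢false pj (subst (λ x → p x ≡ false) (δ-true e) pi))
    (trans (cong (count p +_) (count-δ i)) (+-comm _ 1))

  odd : ℕ → Bool
  odd zero    = false
  odd (suc n) = not (odd n)

  odd-+ : ∀ m n → odd (m + n) ≡ odd m xor odd n
  odd-+ zero    n = refl
  odd-+ (suc m) n rewrite odd-+ m n with odd m | odd n
  ... | true  | true  = refl
  ... | true  | false = refl
  ... | false | true  = refl
  ... | false | false = refl

  odd-double : ∀ m → odd (m + m) ≡ false
  odd-double m rewrite odd-+ m m with odd m
  ... | true  = refl
  ... | false = refl

  odd-pos : ∀ {m} → odd m ≡ true → 1 ≤ m
  odd-pos {suc m} _ = s≤s z≤n

  odd-⟦⟧ : ∀ b → odd ⟦ b ⟧ ≡ b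
  odd-⟦⟧ true  = refl
  odd-⟦⟧ false = refl

  abstract
    odd-sum-cong : ∀ {n} {f g : Fin n → ℕ} → (∀ i → odd (f i) ≡ odd (g i)) → odd (sum f) ≡ odd (sum g)
    odd-sum-cong {zero}          h = refl
    odd-sum-cong {suc n} {f} {g} h = trans (odd-+ (f zero) _)
      (trans (cong₂ _xor_ (h zero) (odd-sum-cong (h ∘ suc))) (sym (odd-+ (g zero) _)))

  -- In a vertex set of even size, a Tutte obstruction thereby has a surplus of at least two odd
  -- parts. The second one pays for vertices added to the barrier.
  parity-gap : ∀ {m n} → odd m ≡ odd n → m < n → 2 + m ≤ n
  parity-gap {zero}  {suc zero}    () lt
  parity-gap {zero}  {suc (suc n)} e  lt = s≤s (s≤s z≤n)
  parity-gap {suc m} {suc n}       e  (s≤s lt) = s≤s (parity-gap (Bool.not-injective e) lt)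

open Counting

-- Hall's marriage theorem

module HallTheorem where

  abstract
    -- A search over subsets reaches a predicate only up to pointwise equality, so `C` has to
    -- respect that equality.
    anyPred? : ∀ {n} {C : Pred n → Set} → (∀ p → Dec (C p)) → (∀ {p q} → (∀ i → p i ≡ q i) → C p → C q) → Dec (∃ C)
    anyPred? {C = C} C? resp = map′ (λ { (s , c) → lookup s , c })
      (λ { (p , c) → tabulate p , resp (λ i → sym (lookup∘tabulate p i)) c }) (anySubset? (C? ∘ lookup))

  ⊑? : ∀ {n} (p q : Pred n) → Dec (p ⊑ q)
  ⊑? p q = all? λ i → (p i Bool.≟ true) →-dec (q i Bool.≟ true)

  count≤1+∖ : ∀ {n} (p : Pred n) i → count p ≤ suc (count (p ∖ i))
  count≤1+∖ p i with bool (p i)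
  ... | inj₁ t = ≤-reflexive (count-∖ i t)
  ... | inj₂ f = m≤n⇒m≤1+n (count-mono λ j pj → ∖⁺ p pj λ { refl → true≢false pj f })

  count-∨-≤ : ∀ {n} (p q : Pred n) → count (λ i → p i ∨ q i) ≤ count p + count q
  count-∨-≤ p q = ≤-trans (m≤m+n _ _) (≤-reflexive (count-∨ p q))

  count-⊏ : ∀ {n} {p q : Pred n} i → p ⊑ q → p i ≡ false → q i ≡ true → count p < count q
  count-⊏ {p = p} {q} i s pi qi = ≤-trans (s≤s (count-mono λ j pj → ∖⁺ q (s j pj) λ { refl → true≢false pj pi }))
    (≤-reflexive (sym (count-∖ i qi)))

  module _ {a b : ℕ} (R : Fin a → Fin b → Bool) where

    Nb : Pred a → Pred b
    Nb I j = some λ i → I i ∧ R i j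

    Nb⁺ : ∀ {I : Pred a} {i j} → I i ≡ true → R i j ≡ true → Nb I j ≡ true
    Nb⁺ {i = i} p r = some⁺ i (∧⁺ p r)

    Nb⁻ : ∀ {I : Pred a} {j} → Nb I j ≡ true → ∃ λ i → I i ≡ true × R i j ≡ true
    Nb⁻ {I} h with some⁻ h
    ... | i , q = i , proj₁ (∧⁻ q) , proj₂ (∧⁻ {I i} q)

    Nb-mono : ∀ {I J : Pred a} → I ⊑ J → Nb I ⊑ Nb J
    Nb-mono s j h with Nb⁻ h
    ... | i , p , r = Nb⁺ (s i p) r

    record Matching (P : Pred a) (Q : Pred b) : Set where
      field
        to      : Fin a → Fin b
        to-∈    : ∀ i → P i ≡ true → Q (to i) ≡ true
        to-edge : ∀ i → P i ≡ true → R i (to i) ≡ true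
        to-inj  : ∀ i j → P i ≡ true → P j ≡ true → to i ≡ to j → i ≡ j

    HallCondition : Pred a → Pred b → Set
    HallCondition P Q = ∀ I → I ⊑ P → count I ≤ count (λ j → Q j ∧ Nb I j)

    private
      -- The critical sets of the Halmos-Vaughan induction: nonempty, proper, and without a spare
      -- neighbour.
      Tight : Pred a → Pred b → Pred a → Set
      Tight P Q I = I ⊑ P × (∃ λ i → I i ≡ true) × (∃ λ j → P j ≡ true × I j ≡ false)
                  × count (λ j → Q j ∧ Nb I j) ≤ count I

      tight? : ∀ P Q → Dec (∃ (Tight P Q))
      tight? P Q = anyPred?
        (λ I → ⊑? I P ×-dec any? (λ i → I i Bool.≟ true)
               ×-dec any? (λ j → (P j Bool.≟ true) ×-dec (I j Bool.≟ false)) ×-dec (_ ≤? _))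
        λ {p} {q} e (s , (i , pi) , (j , Pj , pj) , le) →
            (λ k qk → s k (trans (e k) qk)) , (i , trans (sym (e i)) pi) , (j , Pj , trans (sym (e j)) pj)
          , ≤-trans (count-mono λ k h → ∧⁺ (proj₁ (∧⁻ h)) (Nb-mono (λ m qm → trans (e m) qm) k (proj₂ (∧⁻ {Q k} h))))
              (≤-trans le (≤-reflexive (count-cong e)))

    -- If a critical set exists, it and the remainder are matched separately. Otherwise every
    -- nonempty proper subset has a neighbour to spare, so an arbitrary edge at `p` may be fixed.
    -- The element `b₀` only gives `to` a value when nothing is to be matched.
    hall-marriage : Fin b → ∀ m P Q → count P ≤ m → HallCondition P Q → Matching P Q
    hall-marriage b₀ m P Q le hc with any? (λ i → P i Bool.≟ true)
    ... | no empty = record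
      { to = const b₀ ; to-∈ = λ i p → contradiction (i , p) empty
      ; to-edge = λ i p → contradiction (i , p) empty ; to-inj = λ i _ p → contradiction (i , p) empty }
    hall-marriage b₀ zero P Q le hc | yes (p , Pp) = contradiction (≤-trans (count-pos p Pp) le) λ ()
    hall-marriage b₀ (suc m) P Q le hc | yes (p , Pp) with tight? P Q
    ... | yes (I , I⊑P , (i , Ii) , (j , Pj , Ij) , tight) = record
      { to = to ; to-∈ = to-∈ ; to-edge = to-edge ; to-inj = to-inj }
      where
      P′ : Pred a
      P′ k = P k ∧ not (I k)
      Q′ : Pred b
      Q′ k = Q k ∧ not (Nb I k)
      M₁ : Matching I Q
      M₁ = hall-marriage b₀ m I Q (≤-pred (≤-trans (count-⊏ j I⊑P Ij Pj) le)) λ J s → hc J λ k → I⊑P k ∘ s k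
      -- Hall's condition for the union of I and J, minus the equality attained by the critical set
      -- I, is Hall's condition for J in the remainder.
      hc′ : HallCondition P′ Q′
      hc′ J s = +-cancelˡ-≤ (count I) _ _ (begin
        count I + count J
          ≡⟨ count-⊎ I J (λ k Ik Jk → true≢false Ik (not⁻ (proj₂ (∧⁻ {P k} (s k Jk))))) ⟨
        count K
          ≤⟨ hc K (λ k h → K⊑P k (∨⁻ h)) ⟩
        count (λ k → Q k ∧ Nb K k)
          ≤⟨ count-mono covered ⟩
        count (λ k → (Q k ∧ Nb I k) ∨ (Q′ k ∧ Nb J k))
          ≤⟨ count-∨-≤ (λ k → Q k ∧ Nb I k) (λ k → Q′ k ∧ Nb J k) ⟩
        count (λ k → Q k ∧ Nb I k) + count (λ k → Q′ k ∧ Nb J k)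
          ≤⟨ +-monoˡ-≤ _ tight ⟩
        count I + count (λ k → Q′ k ∧ Nb J k) ∎)
        where
        open ≤-Reasoning
        K : Pred a
        K k = I k ∨ J k
        K⊑P : ∀ k → I k ≡ true ⊎ J k ≡ true → P k ≡ true
        K⊑P k (inj₁ h) = I⊑P k h
        K⊑P k (inj₂ h) = proj₁ (∧⁻ (s k h))
        covered : (λ k → Q k ∧ Nb K k) ⊑ (λ k → (Q k ∧ Nb I k) ∨ (Q′ k ∧ Nb J k))
        covered k h with ∧⁻ {Q k} h
        ... | Qk , NK with bool (Nb I k)
        ...   | inj₁ t = ∨⁺ˡ (∧⁺ Qk t)
        ...   | inj₂ f with Nb⁻ NK
        ...     | l , Kl , r with ∨⁻ {I l} Kl
        ...       | inj₁ Il = contradiction f (true≢false (Nb⁺ Il r))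
        ...       | inj₂ Jl = ∨⁺ʳ {Q k ∧ Nb I k} (∧⁺ (∧⁺ Qk (not⁺ f)) (Nb⁺ Jl r))
      M₂ : Matching P′ Q′
      M₂ = hall-marriage b₀ m P′ Q′ (≤-pred (≤-trans (count-⊏ i (λ k → proj₁ ∘ ∧⁻)
             (trans (cong (P i ∧_) (cong not Ii)) (Bool.∧-zeroʳ (P i))) (I⊑P i Ii)) le)) hc′
      module M₁ = Matching M₁
      module M₂ = Matching M₂
      to : Fin a → Fin b
      to k = if I k then M₁.to k else M₂.to k
      to-∈ : ∀ k → P k ≡ true → Q (to k) ≡ true
      to-∈ k Pk with I k in eq
      ... | true  = M₁.to-∈ k eq
      ... | false = proj₁ (∧⁻ (M₂.to-∈ k (∧⁺ Pk (not⁺ eq))))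
      to-edge : ∀ k → P k ≡ true → R k (to k) ≡ true
      to-edge k Pk with I k in eq
      ... | true  = M₁.to-edge k eq
      ... | false = M₂.to-edge k (∧⁺ Pk (not⁺ eq))
      apart : ∀ k l → I k ≡ true → P′ l ≡ true → M₁.to k ≢ M₂.to l
      apart k l Ik P′l e = true≢false (Nb⁺ Ik (M₁.to-edge k Ik))
        (subst (λ x → Nb I x ≡ false) (sym e) (not⁻ (proj₂ (∧⁻ {Q (M₂.to l)} (M₂.to-∈ l P′l)))))
      to-inj : ∀ k l → P k ≡ true → P l ≡ true → to k ≡ to l → k ≡ l
      to-inj k l Pk Pl e with I k in eqk | I l in eql
      ... | true  | true  = M₁.to-inj k l eqk eql e
      ... | true  | false = contradiction e (apart k l eqk (∧⁺ Pl (not⁺ eql)))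
      ... | false | true  = contradiction (sym e) (apart l k eql (∧⁺ Pk (not⁺ eqk)))
      ... | false | false = M₂.to-inj k l (∧⁺ Pk (not⁺ eqk)) (∧⁺ Pl (not⁺ eql)) e
    ... | no none = record { to = to ; to-∈ = to-∈ ; to-edge = to-edge ; to-inj = to-inj }
      where
      first : ∃ λ q → (Q q ∧ Nb (δ p) q) ≡ true
      first = count-pos⁻ (≤-trans (≤-reflexive (sym (count-δ p)))
        (hc (δ p) λ k e → subst (λ x → P x ≡ true) (δ-true e) Pp))
      q : Fin b
      q = proj₁ first
      Qq : Q q ≡ true
      Qq = proj₁ (∧⁻ (proj₂ first))
      pq : R p q ≡ true
      pq with Nb⁻ (proj₂ (∧⁻ {Q q} (proj₂ first)))
      ... | i , e , r = subst (λ x → R x q ≡ true) (sym (δ-true e)) r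
      -- A nonempty J avoids `p`, so it is proper and not critical; the strict inequality covers the
      -- loss of `q`.
      hc′ : HallCondition (P ∖ p) (Q ∖ q)
      hc′ J s with any? (λ i → J i Bool.≟ true)
      ... | no ∅ = ≤-trans (≤-reflexive (count-empty λ i → ≢true⇒false λ h → ∅ (i , h))) z≤n
      ... | yes (i , Ji) = ≤-pred (begin
        suc (count J)                              ≤⟨ ≰⇒> (λ le′ → none (J , (λ k → proj₁ ∘ ∖⁻ P ∘ s k) , (i , Ji)
                                                        , (p , Pp , ≢true⇒false λ Jp → proj₂ (∖⁻ P (s p Jp)) refl) , le′)) ⟩
        count (λ k → Q k ∧ Nb J k)                 ≤⟨ count≤1+∖ _ q ⟩
        suc (count ((λ k → Q k ∧ Nb J k) ∖ q))     ≤⟨ s≤s (count-mono λ k h → let (QN , ne) = ∖⁻ (λ k → Q k ∧ Nb J k) h in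
                                                        ∧⁺ (∖⁺ Q (proj₁ (∧⁻ QN)) ne) (proj₂ (∧⁻ {Q k} QN))) ⟩
        suc (count (λ k → (Q ∖ q) k ∧ Nb J k))     ∎)
        where open ≤-Reasoning
      M : Matching (P ∖ p) (Q ∖ q)
      M = hall-marriage b₀ m (P ∖ p) (Q ∖ q) (≤-pred (≤-trans (≤-reflexive (sym (count-∖ p Pp))) le)) hc′
      module M = Matching M
      to : Fin a → Fin b
      to k = if δ p k then q else M.to k
      to-∈ : ∀ k → P k ≡ true → Q (to k) ≡ true
      to-∈ k Pk with δ p k in eq
      ... | true  = Qq
      ... | false = proj₁ (∖⁻ Q (M.to-∈ k (∖⁺ P Pk (δ-false⁻ eq))))
      to-edge : ∀ k → P k ≡ true → R k (to k) ≡ true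
      to-edge k Pk with δ p k in eq
      ... | true  = subst (λ x → R x q ≡ true) (δ-true eq) pq
      ... | false = M.to-edge k (∖⁺ P Pk (δ-false⁻ eq))
      to-inj : ∀ k l → P k ≡ true → P l ≡ true → to k ≡ to l → k ≡ l
      to-inj k l Pk Pl e with δ p k in eqk | δ p l in eql
      ... | true  | true  = trans (sym (δ-true eqk)) (δ-true eql)
      ... | true  | false = contradiction e (proj₂ (∖⁻ Q (M.to-∈ l (∖⁺ P Pl (δ-false⁻ eql)))))
      ... | false | true  = contradiction (sym e) (proj₂ (∖⁻ Q (M.to-∈ k (∖⁺ P Pk (δ-false⁻ eqk)))))
      ... | false | false = M.to-inj k l (∖⁺ P Pk (δ-false⁻ eqk)) (∖⁺ P Pl (δ-false⁻ eql)) e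

    abstract
      hall : Fin b → ∀ P Q → Matching P Q ⊎ ∃ λ I → I ⊑ P × count (λ j → Q j ∧ Nb I j) < count I
      hall b₀ P Q with anyPred? {C = λ I → I ⊑ P × count (λ j → Q j ∧ Nb I j) < count I}
                        (λ I → ⊑? I P ×-dec (_ ≤? _))
                        (λ {p} {q} e (s , lt) → (λ k qk → s k (trans (e k) qk))
                          , ≤-trans (s≤s (count-mono λ k h → ∧⁺ (proj₁ (∧⁻ h)) (Nb-mono (λ m qm → trans (e m) qm) k (proj₂ (∧⁻ {Q k} h)))))
                              (≤-trans lt (≤-reflexive (count-cong e))))
      ... | yes v = inj₂ v
      ... | no ∄  = inj₁ (hall-marriage b₀ (count P) P Q ≤-refl λ I s → ≮⇒≥ λ lt → ∄ (I , s , lt))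

open HallTheorem

-- Tutte's theorem for a symmetric relation on a vertex set

module TutteTheorem where

  count-suc : ∀ {n} (p : Pred (suc n)) → count p ≡ ⟦ p zero ⟧ + count (p ∘ suc)
  count-suc p = trans (count≡sum p) (trans (sum-suc _) (cong (⟦ p zero ⟧ +_) (sym (count≡sum (p ∘ suc)))))

  count-join : ∀ m {n} (p : Pred (m + n)) → count p ≡ count (λ i → p (i ↑ˡ n)) + count (λ j → p (m ↑ʳ j))
  count-join zero    {n} p = sym (cong (_+ count p) (none (λ i → p (i ↑ˡ n))))
    where
    none : (q : Pred 0) → count q ≡ 0
    none q = count-empty λ ()
  count-join (suc m) p = trans (count-suc p) (trans (cong (⟦ p zero ⟧ +_) (count-join m (p ∘ suc)))
    (trans (sym (+-assoc ⟦ p zero ⟧ _ _)) (cong (_+ count (λ j → p (suc m ↑ʳ j))) (sym (count-suc _)))))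

  ↑ˡ≢↑ʳ : ∀ m {n} (i : Fin m) (j : Fin n) → i ↑ˡ n ≢ m ↑ʳ j
  ↑ˡ≢↑ʳ (suc m) (suc i) j e = ↑ˡ≢↑ʳ m i j (suc-injective e)

  abstract
    -- A choice function made total by the default `d`. Being abstract, it is known outside only
    -- through `pick-∈`.
    pick : ∀ {n} → Pred n → Fin n → Fin n
    pick p d with any? (λ i → p i Bool.≟ true)
    ... | yes (i , _) = i
    ... | no  _       = d

    pick-∈ : ∀ {n} (p : Pred n) d {i} → p i ≡ true → p (pick p d) ≡ true
    pick-∈ p d {i} pi with any? (λ i → p i Bool.≟ true)
    ... | yes (j , pj) = pj
    ... | no  ∄        = contradiction (i , pi) ∄

  abstract
    count-unique : ∀ {n} (p : Pred n) → (∀ i j → p i ≡ true → p j ≡ true → i ≡ j) → count p ≤ 1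
    count-unique p u with any? (λ i → p i Bool.≟ true)
    ... | no ∄        = ≤-trans (≤-reflexive (count-empty λ i → ≢true⇒false λ h → ∄ (i , h))) z≤n
    ... | yes (i , h) = ≤-trans (count-mono λ j pj → subst (λ x → δ i x ≡ true) (u i j h pj) (δ-refl i)) (≤-reflexive (count-δ i))

  count-fibre : ∀ {m n} (p : Pred m) (f : Fin m → Fin n) → sum (λ j → count (λ i → p i ∧ δ j (f i))) ≡ count p
  count-fibre p f = begin
    sum (λ j → count (λ i → p i ∧ δ j (f i)))     ≡⟨ sum-cong (λ j → count≡sum _) ⟩
    sum (λ j → sum (λ i → ⟦ p i ∧ δ j (f i) ⟧))   ≡⟨ sum-swap _ ⟩
    sum (λ i → sum (λ j → ⟦ p i ∧ δ j (f i) ⟧))   ≡⟨ sum-cong (λ i → trans (sum-cong λ j → trans (⟦∧⟧ (p i) _)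
                                                       (trans (*-comm ⟦ p i ⟧ _) (cong (λ b → ⟦ b ⟧ * ⟦ p i ⟧) (δ-sym j (f i)))))
                                                       (sum-δ (const ⟦ p i ⟧) (f i))) ⟩
    sum (λ i → ⟦ p i ⟧)                           ≡⟨ count≡sum p ⟨
    count p                                       ∎
    where open ≡-Reasoning

  -- Fibres of an injection have at most one element, so the image has at least `count p` elements
  -- and fills `q`.
  injection-onto′ : ∀ {m n} (p : Pred m) (q : Pred n) (f : Fin m → Fin n) →
    (∀ i → p i ≡ true → q (f i) ≡ true) → (∀ i j → p i ≡ true → p j ≡ true → f i ≡ f j → i ≡ j) →
    count q ≤ count p → ∀ j → q j ≡ true → ∃ λ i → p i ≡ true × f i ≡ j
  injection-onto′ p q f into inj le j qj with some⁻ {p = λ i → p i ∧ δ j (f i)} (count-⊑-≡ image⊑q full j qj)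
    where
    image : Pred _
    image j = some λ i → p i ∧ δ j (f i)
    image⊑q : image ⊑ q
    image⊑q j h with some⁻ {p = λ i → p i ∧ δ j (f i)} h
    ... | i , e = subst (λ x → q x ≡ true) (sym (δ-true (proj₂ (∧⁻ {p i} e)))) (into i (proj₁ (∧⁻ e)))
    fibre≤ : ∀ j → count (λ i → p i ∧ δ j (f i)) ≤ ⟦ image j ⟧
    fibre≤ j with bool (image j)
    ... | inj₁ t rewrite t = count-unique _ λ i k h h′ → inj i k (proj₁ (∧⁻ h)) (proj₁ (∧⁻ h′))
                   (trans (sym (δ-true (proj₂ (∧⁻ {p i} h)))) (δ-true (proj₂ (∧⁻ {p k} h′))))
    ... | inj₂ e rewrite e = ≤-reflexive (count-empty λ i → ≢true⇒false λ h → true≢false (some⁺ {p = λ i → p i ∧ δ j (f i)} i h) e)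
    full : count q ≤ count image
    full = ≤-trans le (≤-trans (≤-reflexive (sym (count-fibre p f)))
      (≤-trans (sum-mono-≤ fibre≤) (≤-reflexive (sym (count≡sum image)))))
  ... | i , h = i , proj₁ (∧⁻ h) , sym (δ-true (proj₂ (∧⁻ {p i} h)))

  -- Existence results are re-exported abstractly, so that their witnesses never unfold.
  abstract
    injection-onto : ∀ {m n} (p : Pred m) (q : Pred n) (f : Fin m → Fin n) →
      (∀ i → p i ≡ true → q (f i) ≡ true) → (∀ i j → p i ≡ true → p j ≡ true → f i ≡ f j → i ≡ j) →
      count q ≤ count p → ∀ j → q j ≡ true → ∃ λ i → p i ≡ true × f i ≡ j
    injection-onto = injection-onto′

  module Tutte {n : ℕ} (R : Fin n → Fin n → Bool) (R-sym : ∀ u v → R u v ≡ R v u) where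

    record IsPM (P : Pred n) (mate : Fin n → Fin n) : Set where
      field
        mate-∈    : ∀ v → P v ≡ true → P (mate v) ≡ true
        mate-edge : ∀ v → P v ≡ true → R v (mate v) ≡ true
        mate-≢    : ∀ v → P v ≡ true → mate v ≢ v
        mate-mate : ∀ v → P v ≡ true → mate (mate v) ≡ v

    -- The parts are unions of components of P - S; the components themselves are never needed.
    record Separation (P : Pred n) : Set where
      field
        S      : Pred n
        S⊑P    : S ⊑ P
        L      : ℕ
        ℓ      : Fin n → Fin L
      D : Pred n
      D v = P v ∧ not (S v)
      field
        closed : ∀ u v → D u ≡ true → D v ≡ true → R u v ≡ true → ℓ u ≡ ℓ v
      part : Fin L → Pred n
      part i v = D v ∧ δ i (ℓ v)
      odds : Pred L
      odds i = odd (count (part i))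

      count-D : count P ≡ count S + count D
      count-D = trans (count-split P S) (cong (_+ count D)
        (count-cong λ v → ≡-by-truth (λ h → proj₂ (∧⁻ {P v} h)) λ h → ∧⁺ (S⊑P v h) h))

      -- S and the parts make up P, and even parts vanish modulo 2.
      odds-parity : odd (count S + count odds) ≡ odd (count P)
      odds-parity = trans (odd-+ (count S) (count odds)) (trans (cong (odd (count S) xor_)
          (trans (cong odd (count≡sum odds)) (trans (odd-sum-cong λ i → odd-⟦⟧ (odds i)) (cong odd (count-fibre D ℓ)))))
        (trans (sym (odd-+ (count S) (count D))) (cong odd (sym count-D))))

    Obstruction : Pred n → Set
    Obstruction P = ∃ λ (s : Separation P) → count (Separation.S s) < count (Separation.odds s)

    module _ {P : Pred n} (s : Separation P) where
      open Separation s

      D⁻ : ∀ {v} → D v ≡ true → P v ≡ true × S v ≡ false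
      D⁻ {v} h = proj₁ (∧⁻ h) , not⁻ (proj₂ (∧⁻ {P v} h))

      D⁺ : ∀ {v} → P v ≡ true → S v ≡ false → D v ≡ true
      D⁺ p q = ∧⁺ p (not⁺ q)

      part⁻ : ∀ {i v} → part i v ≡ true → D v ≡ true × i ≡ ℓ v
      part⁻ {i} {v} h = proj₁ (∧⁻ h) , δ-true (proj₂ (∧⁻ {D v} h))

      part⁺ : ∀ {v} → D v ≡ true → part (ℓ v) v ≡ true
      part⁺ {v} h = ∧⁺ h (δ-refl (ℓ v))

      -- Taking one vertex out of an even part makes that part odd, so S and the number of odd parts
      -- grow together.
      absorb-even : ∀ v → D v ≡ true → odds (ℓ v) ≡ false →
        ∃ λ (s′ : Separation P) → count (Separation.S s′) ≡ suc (count S) × suc (count odds) ≤ count (Separation.odds s′)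
      absorb-even v Dv even = s′ , count-⊕ v (proj₂ (D⁻ Dv))
        , ≤-trans (≤-reflexive (sym (count-⊕ (ℓ v) even))) (count-mono bigger)
        where
        s′ : Separation P
        s′ = record
          { S = S ⊕ v ; L = L ; ℓ = ℓ
          ; S⊑P = λ u h → S′⊑P u (⊕⁻ S h)
          ; closed = λ x y Dx Dy → closed x y (weaken x Dx) (weaken y Dy) }
          where
          S′⊑P : ∀ u → S u ≡ true ⊎ v ≡ u → P u ≡ true
          S′⊑P u (inj₁ h)    = S⊑P u h
          S′⊑P u (inj₂ refl) = proj₁ (D⁻ Dv)
          weaken : ∀ x → (P x ∧ not ((S ⊕ v) x)) ≡ true → D x ≡ true
          weaken x h = D⁺ (proj₁ (∧⁻ h)) (≢true⇒false λ Sx → true≢false (∨⁺ˡ {S x} Sx) (not⁻ (proj₂ (∧⁻ {P x} h))))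
        module s′ = Separation s′
        bigger : (odds ⊕ ℓ v) ⊑ s′.odds
        bigger i h with ℓ v ≟ i
        ... | yes refl = trans (cong odd (count-cong {q = part (ℓ v) ∖ v} λ u → lem (P u) (S u) (δ v u) (δ (ℓ v) (ℓ u))))
                (trans (sym (Bool.not-involutive _)) (cong not (trans (sym (cong odd (count-∖ {p = part (ℓ v)} v (part⁺ Dv)))) even)))
          where
          lem : ∀ p s d e → (p ∧ not (s ∨ d)) ∧ e ≡ ((p ∧ not s) ∧ e) ∧ not d
          lem true  true  d     true  = refl
          lem true  true  d     false = refl
          lem true  false true  true  = refl
          lem true  false true  false = refl
          lem true  false false true  = refl
          lem true  false false false = refl
          lem false s     d     e     = refl
        ... | no ne with ⊕⁻ odds h
        ...   | inj₂ e = contradiction e ne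
        ...   | inj₁ o = trans (cong odd (count-cong {q = part i} same)) o
          where
          same : ∀ u → ((P u ∧ not ((S ⊕ v) u)) ∧ δ i (ℓ u)) ≡ part i u
          same u with v ≟ u
          ... | no v≢u rewrite δ-false v≢u | Bool.∨-identityʳ (S u) = refl
          ... | yes refl rewrite δ-false (ne ∘ sym) = trans (Bool.∧-zeroʳ _) (sym (Bool.∧-zeroʳ _))

      -- Without `u` its odd part has even size, so by parity the obstruction found there has a
      -- surplus of at least two. One of these odd parts replaces the part that is broken up, the
      -- other pays for moving `u` into S. Old labels go to the left of `Fin (L + o.L)`, new ones to
      -- the right.
      refine : ∀ u → D u ≡ true → odds (ℓ u) ≡ true → Obstruction (part (ℓ u) ∖ u) →
        ∃ λ (s′ : Separation P) → (suc (count S) ≤ count (Separation.S s′)) ×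
          (count S ≤ count odds → count (Separation.S s′) ≤ count (Separation.odds s′))
      refine u Du odd-u (o , lt) = s″ , ≤-trans (s≤s (m≤m+n _ _)) (≤-reflexive (sym (trans count-S″ (+-suc _ _)))) , enough
        where
        C : Pred n
        C = part (ℓ u) ∖ u
        module o = Separation o
        S″ : Pred n
        S″ v = S v ∨ (o.S ⊕ u) v
        ℓ″ : Fin n → Fin (L + o.L)
        ℓ″ v = if C v then L ↑ʳ o.ℓ v else ℓ v ↑ˡ o.L
        C⇒D : ∀ {v} → C v ≡ true → D v ≡ true × ℓ u ≡ ℓ v × u ≢ v
        C⇒D h = let (p , ne) = ∖⁻ (part (ℓ u)) h in proj₁ (part⁻ p) , proj₂ (part⁻ p) , ne
        D″⁻ : ∀ {v} → (P v ∧ not (S″ v)) ≡ true → D v ≡ true × o.S v ≡ false × u ≢ v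
        D″⁻ {v} h = D⁺ (proj₁ (∧⁻ h)) (≢true⇒false λ Sv → true≢false (∨⁺ˡ Sv) nS)
                 , ≢true⇒false (λ oSv → true≢false (∨⁺ʳ {S v} (∨⁺ˡ oSv)) nS)
                 , λ { refl → true≢false (∨⁺ʳ {S v} (∨⁺ʳ {o.S v} (δ-refl u))) nS }
          where nS = not⁻ (proj₂ (∧⁻ {P v} h))
        oD⁺ : ∀ {v} → C v ≡ true → o.S v ≡ false → o.D v ≡ true
        oD⁺ c q = ∧⁺ c (not⁺ q)
        stay : ∀ {x y} → D x ≡ true → D y ≡ true → u ≢ y → C x ≡ true → R x y ≡ true → C y ≡ true
        stay Dx Dy ne Cx r = ∖⁺ (part (ℓ u)) (∧⁺ Dy (trans (cong (δ (ℓ u)) (sym (trans (proj₁ (proj₂ (C⇒D Cx))) (closed _ _ Dx Dy r)))) (δ-refl (ℓ u)))) ne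
        closed″ : ∀ x y → (P x ∧ not (S″ x)) ≡ true → (P y ∧ not (S″ y)) ≡ true → R x y ≡ true → ℓ″ x ≡ ℓ″ y
        closed″ x y Dx Dy r with C x in Cx | C y in Cy
        ... | true  | true  = cong (L ↑ʳ_) (o.closed x y (oD⁺ Cx (proj₁ (proj₂ (D″⁻ Dx)))) (oD⁺ Cy (proj₁ (proj₂ (D″⁻ Dy)))) r)
        ... | false | false = cong (_↑ˡ o.L) (closed x y (proj₁ (D″⁻ Dx)) (proj₁ (D″⁻ Dy)) r)
        ... | true  | false = ⊥-elim (true≢false (stay (proj₁ (D″⁻ Dx)) (proj₁ (D″⁻ Dy)) (proj₂ (proj₂ (D″⁻ Dy))) Cx r) Cy)
        ... | false | true  = ⊥-elim (true≢false (stay (proj₁ (D″⁻ Dy)) (proj₁ (D″⁻ Dx)) (proj₂ (proj₂ (D″⁻ Dx))) Cy (trans (R-sym y x) r)) Cx)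
        S″⊑P : S″ ⊑ P
        S″⊑P v h with ∨⁻ {S v} h
        ... | inj₁ Sv = S⊑P v Sv
        ... | inj₂ h′ with ⊕⁻ o.S h′
        ...   | inj₁ oS   = proj₁ (D⁻ (proj₁ (C⇒D (o.S⊑P v oS))))
        ...   | inj₂ refl = proj₁ (D⁻ Du)
        s″ : Separation P
        s″ = record { S = S″ ; L = L + o.L ; ℓ = ℓ″ ; S⊑P = S″⊑P ; closed = closed″ }
        module s″ = Separation s″
        oSu : o.S u ≡ false
        oSu = ≢true⇒false λ h → proj₂ (proj₂ (C⇒D (o.S⊑P u h))) refl
        count-S″ : count S″ ≡ count S + suc (count o.S)
        count-S″ = trans (count-⊎ S (o.S ⊕ u) disjoint) (cong (count S +_) (count-⊕ u oSu))
          where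
          disjoint : ∀ v → S v ≡ true → (o.S ⊕ u) v ≡ true → ⊥
          disjoint v Sv h with ⊕⁻ o.S h
          ... | inj₁ oS   = true≢false Sv (proj₂ (D⁻ (proj₁ (C⇒D (o.S⊑P v oS)))))
          ... | inj₂ refl = true≢false Sv (proj₂ (D⁻ Du))
        oldPart : ∀ i → ℓ u ≢ i → ∀ v → s″.part (i ↑ˡ o.L) v ≡ part i v
        oldPart i ne v = ≡-by-truth to from
          where
          to : s″.part (i ↑ˡ o.L) v ≡ true → part i v ≡ true
          to h with ∧⁻ {s″.D v} h
          ... | D″v , e with C v in Cv
          ...   | true  = contradiction (δ-true e) (↑ˡ≢↑ʳ L i (o.ℓ v))
          ...   | false = ∧⁺ (proj₁ (D″⁻ D″v)) (subst (λ x → δ i x ≡ true) (↑ˡ-injective o.L i (ℓ v) (δ-true e)) (δ-refl i))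
          from : part i v ≡ true → s″.part (i ↑ˡ o.L) v ≡ true
          from h with part⁻ h
          ... | Dv , refl = ∧⁺ (∧⁺ (proj₁ (D⁻ Dv)) (not⁺ notS)) labelled
            where
            ¬C : C v ≡ false
            ¬C = ≢true⇒false λ c → ne (proj₁ (proj₂ (C⇒D c)))
            notS : S″ v ≡ false
            notS = ≢true⇒false λ h → case (∨⁻ {S v} h)
              where
              case : S v ≡ true ⊎ (o.S ⊕ u) v ≡ true → ⊥
              case (inj₁ Sv) = true≢false Sv (proj₂ (D⁻ Dv))
              case (inj₂ h′) with ⊕⁻ o.S h′
              ... | inj₁ oS   = true≢false (o.S⊑P v oS) ¬C
              ... | inj₂ refl = ne refl
            labelled : δ (ℓ v ↑ˡ o.L) (ℓ″ v) ≡ true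
            labelled rewrite ¬C = δ-refl _
        newPart : ∀ j v → s″.part (L ↑ʳ j) v ≡ o.part j v
        newPart j v = ≡-by-truth to from
          where
          to : s″.part (L ↑ʳ j) v ≡ true → o.part j v ≡ true
          to h with ∧⁻ {s″.D v} h
          ... | D″v , e with C v in Cv
          ...   | true  = ∧⁺ (not⁺ (proj₁ (proj₂ (D″⁻ D″v)))) (subst (λ x → δ j x ≡ true) (↑ʳ-injective L j (o.ℓ v) (δ-true e)) (δ-refl j))
          ...   | false = contradiction (sym (δ-true e)) (↑ˡ≢↑ʳ L (ℓ v) j)
          from : o.part j v ≡ true → s″.part (L ↑ʳ j) v ≡ true
          from h with ∧⁻ {o.D v} h
          ... | oD , e with ∧⁻ {C v} oD
          ...   | Cv , noS with C⇒D Cv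
          ...     | Dv , _ , ne = ∧⁺ (∧⁺ (proj₁ (D⁻ Dv)) (not⁺ notS)) labelled
            where
            notS : S″ v ≡ false
            notS rewrite proj₂ (D⁻ Dv) | not⁻ noS | δ-false ne = refl
            labelled : δ (L ↑ʳ j) (ℓ″ v) ≡ true
            labelled rewrite Cv = subst (λ x → δ (L ↑ʳ j) (L ↑ʳ x) ≡ true) (δ-true e) (δ-refl _)
        gap : 2 + count o.S ≤ count o.odds
        gap = parity-gap (xor-≡ (odd (count o.S)) _ (trans (sym (odd-+ (count o.S) _)) (trans o.odds-parity C-even))) lt
          where
          C-even : odd (count C) ≡ false
          C-even = trans (sym (Bool.not-involutive _)) (cong not (trans (cong odd (sym (count-∖ u (part⁺ Du)))) odd-u))
          xor-≡ : ∀ a b → a xor b ≡ false → a ≡ b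
          xor-≡ true  true  _ = refl
          xor-≡ false false _ = refl
        enough : count S ≤ count odds → count S″ ≤ count s″.odds
        enough le = begin
          count S″                                   ≡⟨ count-S″ ⟩
          count S + suc (count o.S)                  ≤⟨ +-monoˡ-≤ _ le ⟩
          count odds + suc (count o.S)               ≡⟨ cong (_+ suc (count o.S)) (count-∖ {p = odds} (ℓ u) odd-u) ⟩
          suc (count (odds ∖ ℓ u)) + suc (count o.S) ≡⟨ +-suc (count (odds ∖ ℓ u)) (suc (count o.S)) ⟨
          count (odds ∖ ℓ u) + (2 + count o.S)       ≤⟨ +-mono-≤ (count-mono λ i h → let (oi , ne) = ∖⁻ odds h in
                                                          trans (cong odd (count-cong (oldPart i ne))) oi) gap ⟩
          count (λ i → s″.odds (i ↑ˡ o.L)) + count o.odds ≤⟨ +-monoʳ-≤ (count (λ i → s″.odds (i ↑ˡ o.L)))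
                                                          (count-mono λ j h → trans (cong odd (count-cong (newPart j))) h) ⟩
          count (λ i → s″.odds (i ↑ˡ o.L)) + count (λ j → s″.odds (L ↑ʳ j)) ≡⟨ count-join L s″.odds ⟨
          count s″.odds                              ∎
          where open ≤-Reasoning

      Link : Fin L → Fin n → Bool
      Link i x = some λ v → part i v ∧ R v x

      -- The new S keeps only the neighbours of the violating odd parts. Those parts stay separate;
      -- everything else, including the vertices dropped from S, is merged under the label `zero`,
      -- whose parity is irrelevant.
      hall-obstruction : ∀ I → I ⊑ odds → count (λ x → S x ∧ Nb Link I x) < count I → Obstruction P
      hall-obstruction I I⊑ lt = s* , ≤-trans lt (begin
          count I                                 ≤⟨ count-mono (λ i Ii → trans (cong odd (count-cong (samePart i Ii))) (I⊑ i Ii)) ⟩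
          count (s*.odds ∘ suc)                   ≤⟨ m≤n+m _ ⟦ s*.odds zero ⟧ ⟩
          ⟦ s*.odds zero ⟧ + count (s*.odds ∘ suc) ≡⟨ count-suc s*.odds ⟨
          count s*.odds                           ∎)
        where
        open ≤-Reasoning
        S* : Pred n
        S* x = S x ∧ Nb Link I x
        g : Pred n
        g v = D v ∧ I (ℓ v)
        ℓ* : Fin n → Fin (suc L)
        ℓ* v = if g v then suc (ℓ v) else zero
        D*⇒P : ∀ {v} → (P v ∧ not (S* v)) ≡ true → P v ≡ true × S* v ≡ false
        D*⇒P {v} h = proj₁ (∧⁻ h) , not⁻ (proj₂ (∧⁻ {P v} h))
        spread : ∀ x y → (P y ∧ not (S* y)) ≡ true → g x ≡ true → R x y ≡ true → D y ≡ true × ℓ x ≡ ℓ y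
        spread x y D*y gx r with ∧⁻ {D x} gx
        ... | Dx , Ix = Dy , closed x y Dx Dy r
          where
          Dy : D y ≡ true
          Dy = D⁺ (proj₁ (D*⇒P D*y)) (≢true⇒false λ Sy → true≢false
            (∧⁺ Sy (Nb⁺ Link Ix (some⁺ x (∧⁺ (part⁺ Dx) r)))) (proj₂ (D*⇒P D*y)))
        closed* : ∀ x y → (P x ∧ not (S* x)) ≡ true → (P y ∧ not (S* y)) ≡ true → R x y ≡ true → ℓ* x ≡ ℓ* y
        closed* x y Dx Dy r with g x in gx | g y in gy
        ... | true  | true  = cong suc (proj₂ (spread x y Dy gx r))
        ... | false | false = refl
        ... | true  | false with spread x y Dy gx r
        ...   | D′ , e = ⊥-elim (true≢false (∧⁺ D′ (subst (λ i → I i ≡ true) e (proj₂ (∧⁻ {D x} gx)))) gy)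
        closed* x y Dx Dy r | false | true with spread y x Dx gy (trans (R-sym y x) r)
        ...   | D′ , e = ⊥-elim (true≢false (∧⁺ D′ (subst (λ i → I i ≡ true) e (proj₂ (∧⁻ {D y} gy)))) gx)
        s* : Separation P
        s* = record { S = S* ; L = suc L ; ℓ = ℓ* ; S⊑P = λ v h → S⊑P v (proj₁ (∧⁻ h)) ; closed = closed* }
        module s* = Separation s*
        samePart : ∀ i → I i ≡ true → ∀ v → s*.part (suc i) v ≡ part i v
        samePart i Ii v = ≡-by-truth to from
          where
          to : s*.part (suc i) v ≡ true → part i v ≡ true
          to h with ∧⁻ {s*.D v} h
          ... | D*v , e with g v in gv
          ...   | true  = ∧⁺ (proj₁ (∧⁻ {D v} gv)) (subst (λ x → δ i x ≡ true) (suc-injective (δ-true e)) (δ-refl i))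
          ...   | false = contradiction (δ-true e) λ ()
          from : part i v ≡ true → s*.part (suc i) v ≡ true
          from h with part⁻ h
          ... | Dv , refl = ∧⁺ (∧⁺ (proj₁ (D⁻ Dv)) (not⁺ notS)) labelled
            where
            notS : S* v ≡ false
            notS rewrite proj₂ (D⁻ Dv) = refl
            labelled : δ (suc (ℓ v)) (ℓ* v) ≡ true
            labelled rewrite ∧⁺ Dv Ii = δ-refl _

      -- One vertex of each odd part, its `entry`, is matched into S by the Hall matching, and the
      -- rest of the part by `mates`. As S has exactly as many vertices as there are odd parts, the
      -- Hall matching covers S, and `owner` inverts it. The vertex `v₀` is only a default.
      assemble : (v₀ : Fin n) → count S ≡ count odds → (∀ v → D v ≡ true → odds (ℓ v) ≡ true) →
        (mates : Fin n → Fin n → Fin n) → (∀ u → D u ≡ true → IsPM (part (ℓ u) ∖ u) (mates u)) →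
        Matching Link odds S → ∃ (IsPM P)
      assemble v₀ eq all-odd mates isPM M = mate , record
        { mate-∈ = λ v Pv → proj₁ (good v Pv) ; mate-edge = λ v Pv → proj₁ (proj₂ (good v Pv))
        ; mate-≢ = λ v Pv → proj₁ (proj₂ (proj₂ (good v Pv))) ; mate-mate = λ v Pv → proj₂ (proj₂ (proj₂ (good v Pv))) }
        where
        open Matching M renaming (to to f; to-∈ to f-S; to-edge to f-link; to-inj to f-inj)
        entry : Fin L → Fin n
        entry i = pick (λ v → part i v ∧ R v (f i)) v₀
        entry-ok : ∀ i → odds i ≡ true → D (entry i) ≡ true × i ≡ ℓ (entry i) × R (entry i) (f i) ≡ true
        entry-ok i oi with some⁻ {p = λ v → part i v ∧ R v (f i)} (f-link i oi)
        ... | v , h with ∧⁻ {part i (entry i)} (pick-∈ (λ v → part i v ∧ R v (f i)) v₀ h)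
        ...   | p , r = proj₁ (part⁻ p) , proj₂ (part⁻ p) , r
        owner : Fin n → Fin L
        owner x = pick (λ i → odds i ∧ δ (f i) x) (ℓ v₀)
        owner-ok : ∀ x → S x ≡ true → odds (owner x) ≡ true × f (owner x) ≡ x
        owner-ok x Sx with injection-onto odds S f f-S f-inj (≤-reflexive eq) x Sx
        ... | i , oi , refl with ∧⁻ {odds (owner x)} (pick-∈ (λ i → odds i ∧ δ (f i) x) (ℓ v₀) (∧⁺ oi (δ-refl (f i))))
        ...   | a , b = a , δ-true b
        mate : Fin n → Fin n
        mate v = if S v then entry (owner v) else (if δ (entry (ℓ v)) v then f (ℓ v) else mates (entry (ℓ v)) v)
        mate-S : ∀ v → S v ≡ true → mate v ≡ entry (owner v)
        mate-S v Sv rewrite Sv = refl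
        mate-entry : ∀ v → S v ≡ false → entry (ℓ v) ≡ v → mate v ≡ f (ℓ v)
        mate-entry v Sv e rewrite Sv | subst (λ x → δ x v ≡ true) (sym e) (δ-refl v) = refl
        mate-inner : ∀ v → S v ≡ false → entry (ℓ v) ≢ v → mate v ≡ mates (entry (ℓ v)) v
        mate-inner v Sv ne rewrite Sv | δ-false ne = refl
        good : ∀ v → P v ≡ true → P (mate v) ≡ true × R v (mate v) ≡ true × mate v ≢ v × mate (mate v) ≡ v
        good v Pv with bool (S v)
        ... | inj₁ Sv with owner-ok v Sv
        ...   | oi , fi≡v with entry-ok (owner v) oi
        ...     | Du , i≡ , r rewrite mate-S v Sv =
                  proj₁ (D⁻ Du) , trans (R-sym v (entry (owner v))) (subst (λ x → R (entry (owner v)) x ≡ true) fi≡v r)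
                , (λ e → true≢false Sv (subst (λ x → S x ≡ false) e (proj₂ (D⁻ Du))))
                , trans (mate-entry (entry (owner v)) (proj₂ (D⁻ Du)) (cong entry (sym i≡))) (trans (cong f (sym i≡)) fi≡v)
        good v Pv | inj₂ Sv with all-odd v (D⁺ Pv Sv)
        ... | oi with entry-ok (ℓ v) oi | entry (ℓ v) ≟ v
        ...   | Du , i≡ , r | yes e rewrite mate-entry v Sv e =
                  S⊑P _ Sf , subst (λ x → R x (f (ℓ v)) ≡ true) e r
                , (λ e′ → true≢false (subst (λ x → S x ≡ true) e′ Sf) Sv)
                , trans (mate-S (f (ℓ v)) Sf) (trans (cong entry (f-inj _ _ (proj₁ (owner-ok _ Sf)) oi (proj₂ (owner-ok _ Sf)))) e)
          where
          Sf : S (f (ℓ v)) ≡ true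
          Sf = f-S (ℓ v) oi
        ...   | Du , i≡ , r | no ne rewrite mate-inner v Sv ne =
                  proj₁ (D⁻ Dw) , mate-edge v Cv , mate-≢ v Cv
                , trans (mate-inner w (proj₂ (D⁻ Dw)) (λ e → u≢w (trans (cong entry ℓw) e)))
                    (trans (cong (λ i → mates (entry i) w) (sym ℓw)) (mate-mate v Cv))
          where
          u = entry (ℓ v)
          open IsPM (isPM u Du)
          Cv : (part (ℓ u) ∖ u) v ≡ true
          Cv = ∖⁺ (part (ℓ u)) (subst (λ i → part i v ≡ true) i≡ (part⁺ (D⁺ Pv Sv))) ne
          w = mates u v
          w∈ = ∖⁻ (part (ℓ u)) (mate-∈ v Cv)
          Dw : D w ≡ true
          Dw = proj₁ (part⁻ (proj₁ w∈))
          ℓw : ℓ v ≡ ℓ w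
          ℓw = trans i≡ (proj₂ (part⁻ (proj₁ w∈)))
          u≢w : u ≢ w
          u≢w = proj₂ w∈

    -- S is enlarged while the number of odd parts stays at least its size. When no enlargement
    -- applies, all parts are odd and, by induction on the size of P, each part without any one of
    -- its vertices has a perfect matching. Hall's theorem between odd parts and S then gives a
    -- matching or an obstruction.
    tutte-fuel : ∀ m P → count P ≤ m → ∃ (IsPM P) ⊎ Obstruction P
    tutte-fuel m P le with any? (λ v → P v Bool.≟ true)
    ... | no ∅ = inj₁ (id , record
      { mate-∈ = λ v p → p ; mate-edge = λ v p → contradiction (v , p) ∅
      ; mate-≢ = λ v p → contradiction (v , p) ∅ ; mate-mate = λ v p → refl })
    tutte-fuel zero    P le | yes (v₀ , Pv₀) = contradiction (≤-trans (count-pos v₀ Pv₀) le) λ ()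
    tutte-fuel (suc m) P le | yes (v₀ , Pv₀) = improve (count P) start (≤-trans (≤-reflexive (count-empty λ v → refl)) z≤n)
        (m≤n+m _ _)
      where
      start : Separation P
      start = record { S = const false ; L = 1 ; ℓ = const zero ; S⊑P = λ v () ; closed = λ _ _ _ _ _ → refl }
      -- The fuel `k` bounds the number of vertices outside S.
      improve : ∀ k (s : Separation P) → count (Separation.S s) ≤ count (Separation.odds s) →
                count P ≤ count (Separation.S s) + k → ∃ (IsPM P) ⊎ Obstruction P
      improve k s ge bound with count (Separation.S s) ℕ.<? count (Separation.odds s)
      ... | yes lt = inj₂ (s , lt)
      ... | no ≮ with any? (λ v → (Separation.D s v Bool.≟ true) ×-dec (Separation.odds s (Separation.ℓ s v) Bool.≟ false))
      ...   | yes (v , Dv , even) = next k bound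
        where
        open Separation s
        s′ = absorb-even s v Dv even
        next : ∀ k → count P ≤ count S + k → ∃ (IsPM P) ⊎ Obstruction P
        next zero b = contradiction (≤-trans (≤-reflexive (sym count-D)) b)
          (<⇒≱ (+-monoʳ-< (count S) (count-pos v Dv)))
        next (suc k) b = improve k (proj₁ s′) (≤-trans (≤-reflexive (proj₁ (proj₂ s′))) (≤-trans (s≤s ge) (proj₂ (proj₂ s′))))
          (≤-trans b (≤-reflexive (trans (+-suc _ k) (cong (_+ k) (sym (proj₁ (proj₂ s′)))))))
      ...   | no ∄even = go
        where
        open Separation s
        all-odd : ∀ v → D v ≡ true → odds (ℓ v) ≡ true
        all-odd v Dv = ≢false⇒true λ e → ∄even (v , Dv , e)
        tryAll : ∀ u → (∃ λ (mate : Fin n → Fin n) → D u ≡ true → IsPM (part (ℓ u) ∖ u) mate)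
                       ⊎ (D u ≡ true × Obstruction (part (ℓ u) ∖ u))
        tryAll u with bool (D u)
        ... | inj₂ f = inj₁ (id , λ t → ⊥-elim (true≢false t f))
        ... | inj₁ t with tutte-fuel m (part (ℓ u) ∖ u)
               (≤-pred (≤-trans (≤-reflexive (sym (count-∖ u (part⁺ s t)))) (≤-trans (count-mono λ v h → proj₁ (D⁻ s (proj₁ (part⁻ s h)))) le)))
        ...   | inj₁ (mt , pm) = inj₁ (mt , λ _ → pm)
        ...   | inj₂ o         = inj₂ (t , o)
        go : ∃ (IsPM P) ⊎ Obstruction P
        go with all⊎any tryAll
        ... | inj₂ (u , Du , o) = next k bound
          where
          s′ = refine s u Du (all-odd u Du) o
          next : ∀ k → count P ≤ count S + k → ∃ (IsPM P) ⊎ Obstruction P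
          next zero b = contradiction (≤-trans (≤-reflexive (sym count-D)) b)
            (<⇒≱ (+-monoʳ-< (count S) (count-pos u Du)))
          next (suc k) b = improve k (proj₁ s′) (proj₂ (proj₂ s′) ge)
            (≤-trans b (≤-trans (≤-reflexive (+-suc _ k)) (+-monoˡ-≤ k (proj₁ (proj₂ s′)))))
        ... | inj₁ pms with hall (Link s) v₀ odds S
        ...   | inj₁ M = inj₁ (assemble s v₀ (≤-antisym ge (≮⇒≥ ≮)) all-odd (proj₁ ∘ pms) (λ u → proj₂ (pms u)) M)
        ...   | inj₂ (I , I⊑ , lt) = inj₂ (hall-obstruction s I I⊑ lt)

    abstract
      tutte : ∀ P → ∃ (IsPM P) ⊎ Obstruction P
      tutte P = tutte-fuel (count P) P ≤-refl

open TutteTheorem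

-- Edge weightings, barriers, and perfect matchings through a given edge

module WeightedGraphs where

  pos : ℕ → Bool
  pos zero    = false
  pos (suc _) = true

  pos⁻ : ∀ {m} → pos m ≡ true → 1 ≤ m
  pos⁻ {suc m} _ = s≤s z≤n

  pos⁺ : ∀ {m} → 1 ≤ m → pos m ≡ true
  pos⁺ {suc m} _ = refl

  pos-zero : ∀ {m} → pos m ≡ false → m ≡ 0
  pos-zero {zero} _ = refl

  first : ∀ {k} → Pred k → Pred k
  first p zero    = p zero
  first p (suc i) = not (p zero) ∧ first (p ∘ suc) i

  first-⊑ : ∀ {k} (p : Pred k) → first p ⊑ p
  first-⊑ p zero    h = h
  first-⊑ p (suc i) h = first-⊑ (p ∘ suc) i (proj₂ (∧⁻ {not (p zero)} h))

  first-cong : ∀ {k} {p q : Pred k} → (∀ i → p i ≡ q i) → ∀ i → first p i ≡ first q i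
  first-cong e zero    = e zero
  first-cong e (suc i) = cong₂ _∧_ (cong not (e zero)) (first-cong (e ∘ suc) i)

  count-first : ∀ {k} (p : Pred k) i → p i ≡ true → count (first p) ≡ 1
  count-first {suc k} p i pi = trans (count-suc (first p)) (lem (p zero) refl i pi)
    where
    lem : ∀ b → p zero ≡ b → ∀ i → p i ≡ true → ⟦ p zero ⟧ + count (λ i → not (p zero) ∧ first (p ∘ suc) i) ≡ 1
    lem true  e i pi rewrite e = cong suc (count-empty λ i → refl)
    lem false e zero pi = ⊥-elim (true≢false pi e)
    lem false e (suc i) pi rewrite e = count-first (p ∘ suc) i pi

  abstract
    lin : ∀ {k} → (c w : Fin k → ℕ) → ℕ
    lin c w = sum λ e → c e * w e

    lin≡sum : ∀ {k} (c w : Fin k → ℕ) → lin c w ≡ sum (λ e → c e * w e)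
    lin≡sum c w = refl

    lin-cong : ∀ {k} {c c′ w w′ : Fin k → ℕ} → (∀ e → c e * w e ≡ c′ e * w′ e) → lin c w ≡ lin c′ w′
    lin-cong h = sum-cong h

    lin-+ : ∀ {k} (c f g : Fin k → ℕ) → lin c (λ e → f e + g e) ≡ lin c f + lin c g
    lin-+ c f g = trans (sum-cong λ e → *-distribˡ-+ (c e) (f e) (g e)) (sum-+ (λ e → c e * f e) (λ e → c e * g e))

    lin-* : ∀ {k} (c f : Fin k → ℕ) a → lin c (λ e → a * f e) ≡ a * lin c f
    lin-* c f a = trans (sum-cong λ e → x*[a*y] (c e) a (f e)) (*-sum a (λ e → c e * f e))
      where
      x*[a*y] : ∀ x a y → x * (a * y) ≡ a * (x * y)
      x*[a*y] = solve-∀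

    lin-0 : ∀ {k} {c w : Fin k → ℕ} → (∀ e → c e * w e ≡ 0) → lin c w ≡ 0
    lin-0 h = sum-zero h

    lin-mono : ∀ {k} {c c′ w w′ : Fin k → ℕ} → (∀ e → c e * w e ≤ c′ e * w′ e) → lin c w ≤ lin c′ w′
    lin-mono h = sum-mono-≤ h

    lin-sum : ∀ {k} {c w f : Fin k → ℕ} → (∀ e → c e * w e ≡ f e) → lin c w ≡ sum f
    lin-sum h = sum-cong h

  module Edges {n k : ℕ} (s t : Fin k → Fin n) where

    cut : Pred n → Pred k
    cut U e = U (s e) xor U (t e)

    inside : Pred n → Pred k
    inside U e = U (s e) ∧ U (t e)

    wt : (Fin k → ℕ) → Pred n → ℕ
    wt w U = lin (λ e → ⟦ cut U e ⟧) w

    -- Unlike `wt w (δ v)` this counts a loop twice, which makes the handshake identity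
    -- unconditional. `wt-δ` identifies the two when loops have weight zero.
    dg : (Fin k → ℕ) → Fin n → ℕ
    dg w v = lin (λ e → ⟦ δ v (s e) ⟧ + ⟦ δ v (t e) ⟧) w

    wt-cong : ∀ w {U U′ : Pred n} → (∀ v → U v ≡ U′ v) → wt w U ≡ wt w U′
    wt-cong w h = lin-cong λ e → cong (λ b → ⟦ b ⟧ * w e) (cong₂ _xor_ (h (s e)) (h (t e)))

    inner : (Fin k → ℕ) → Pred n → ℕ
    inner w U = lin (λ e → ⟦ inside U e ⟧) w

    -- The integral points of the cone over Edmonds' perfect matching polytope, at height r.
    -- Vertices outside P and edges of weight zero count as deleted; contraction can thus keep the
    -- types `Fin n` and `Fin k`.
    record Regular (P : Pred n) (w : Fin k → ℕ) (r : ℕ) : Set where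
      field
        ends    : ∀ e → 1 ≤ w e → P (s e) ≡ true × P (t e) ≡ true
        noloop  : ∀ e → 1 ≤ w e → s e ≢ t e
        deg     : ∀ v → P v ≡ true → wt w (δ v) ≡ r
        oddcut  : ∀ U → U ⊑ P → odd (count U) ≡ true → r ≤ wt w U
        even    : odd (count P) ≡ false

    record PerfectM (P : Pred n) (w : Fin k → ℕ) (M : Pred k) : Set where
      field
        supp : ∀ e → M e ≡ true → 1 ≤ w e
        deg  : ∀ v → P v ≡ true → wt (⟦_⟧ ∘ M) (δ v) ≡ 1

  module EdgeLemmas {n k : ℕ} (s t : Fin k → Fin n) where
    open Edges s t

    wt-δ : ∀ w v → (∀ e → 1 ≤ w e → s e ≢ t e) → wt w (δ v) ≡ dg w v
    wt-δ w v nl = lin-cong pt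
      where
      pt : ∀ e → ⟦ δ v (s e) xor δ v (t e) ⟧ * w e ≡ (⟦ δ v (s e) ⟧ + ⟦ δ v (t e) ⟧) * w e
      pt e with δ v (s e) in p | δ v (t e) in q
      ... | false | _     = refl
      ... | true  | false = refl
      ... | true  | true  with w e in eq
      ...   | zero  = refl
      ...   | suc m = contradiction (trans (sym (δ-true p)) (δ-true q)) (nl e (subst (1 ≤_) (sym eq) (s≤s z≤n)))

    handshake : ∀ w (U : Pred n) → sum (λ v → ⟦ U v ⟧ * dg w v) ≡ sum (λ e → (⟦ U (s e) ⟧ + ⟦ U (t e) ⟧) * w e)
    handshake w U = begin
      sum (λ v → ⟦ U v ⟧ * dg w v)
        ≡⟨ sum-cong (λ v → trans (cong (⟦ U v ⟧ *_) (lin≡sum _ w)) (sym (*-sum ⟦ U v ⟧ _))) ⟩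
      sum (λ v → sum (λ e → ⟦ U v ⟧ * ((⟦ δ v (s e) ⟧ + ⟦ δ v (t e) ⟧) * w e)))
        ≡⟨ sum-swap _ ⟩
      sum (λ e → sum (λ v → ⟦ U v ⟧ * ((⟦ δ v (s e) ⟧ + ⟦ δ v (t e) ⟧) * w e)))
        ≡⟨ sum-cong (λ e → trans (sum-cong λ v → trans (regroup ⟦ U v ⟧ ⟦ δ v (s e) ⟧ ⟦ δ v (t e) ⟧ (w e))
             (cong₂ (λ a b → ⟦ a ⟧ * (⟦ U v ⟧ * w e) + ⟦ b ⟧ * (⟦ U v ⟧ * w e)) (δ-sym v (s e)) (δ-sym v (t e))))
           (trans (sum-+ _ _) (trans (cong₂ _+_ (sum-δ (λ v → ⟦ U v ⟧ * w e) (s e)) (sum-δ (λ v → ⟦ U v ⟧ * w e) (t e)))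
             (sym (*-distribʳ-+ (w e) ⟦ U (s e) ⟧ ⟦ U (t e) ⟧))))) ⟩
      sum (λ e → (⟦ U (s e) ⟧ + ⟦ U (t e) ⟧) * w e) ∎
      where
      open ≡-Reasoning
      regroup : ∀ u a b w → u * ((a + b) * w) ≡ a * (u * w) + b * (u * w)
      regroup = solve-∀

    handshake-cut : ∀ w (U : Pred n) → sum (λ v → ⟦ U v ⟧ * dg w v) ≡ wt w U + (inner w U + inner w U)
    handshake-cut w U = trans (handshake w U) (trans (sum-cong λ e → trans (cong (_* w e) (endpoints (U (s e)) (U (t e))))
        (distr ⟦ cut U e ⟧ ⟦ inside U e ⟧ (w e)))
      (trans (sum-+ _ _) (cong₂ _+_ (sym (lin≡sum _ w)) (trans (sum-+ _ _) (cong₂ _+_ (sym (lin≡sum _ w)) (sym (lin≡sum _ w)))))))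
      where
      endpoints : ∀ a b → ⟦ a ⟧ + ⟦ b ⟧ ≡ ⟦ a xor b ⟧ + (⟦ a ∧ b ⟧ + ⟦ a ∧ b ⟧)
      endpoints true  true  = refl
      endpoints true  false = refl
      endpoints false true  = refl
      endpoints false false = refl
      distr : ∀ a b w → (a + (b + b)) * w ≡ a * w + (b * w + b * w)
      distr = solve-∀

    sum-const-deg : ∀ w (U : Pred n) r → (∀ v → U v ≡ true → dg w v ≡ r) → sum (λ v → ⟦ U v ⟧ * dg w v) ≡ r * count U
    sum-const-deg w U r h = trans (sum-cong pt) (trans (*-sum r _) (cong (r *_) (sym (count≡sum U))))
      where
      pt : ∀ v → ⟦ U v ⟧ * dg w v ≡ r * ⟦ U v ⟧
      pt v with U v in eq
      ... | true  = trans (+-identityʳ _) (trans (h v eq) (sym (*-identityʳ r)))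
      ... | false = sym (*-zeroʳ r)

    -- In the handshake identity the edges inside U are counted twice and disappear modulo 2.
    cut-parity : ∀ w (U : Pred n) → (∀ v → U v ≡ true → odd (dg w v) ≡ true) → odd (wt w U) ≡ odd (count U)
    cut-parity w U h = begin
      odd (wt w U)                                        ≡⟨ Bool.xor-identityʳ _ ⟨
      odd (wt w U) xor false                              ≡⟨ cong (odd (wt w U) xor_) (odd-double (inner w U)) ⟨
      odd (wt w U) xor odd (inner w U + inner w U)        ≡⟨ odd-+ (wt w U) _ ⟨
      odd (wt w U + (inner w U + inner w U))              ≡⟨ cong odd (handshake-cut w U) ⟨
      odd (sum (λ v → ⟦ U v ⟧ * dg w v))                  ≡⟨ odd-sum-cong pt ⟩
      odd (sum (λ v → ⟦ U v ⟧))                           ≡⟨ cong odd (count≡sum U) ⟨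
      odd (count U)                                       ∎
      where
      open ≡-Reasoning
      pt : ∀ v → odd (⟦ U v ⟧ * dg w v) ≡ odd ⟦ U v ⟧
      pt v with U v in eq
      ... | true  = trans (cong odd (+-identityʳ (dg w v))) (h v eq)
      ... | false = refl

    module Barrier (P T : Pred n) {L : ℕ} (ℓ : Fin n → Fin L) where

      D : Pred n
      D v = P v ∧ not (T v)

      part : Fin L → Pred n
      part i v = D v ∧ δ i (ℓ v)

      -- No edge of positive weight joins two different parts, so one that leaves a part ends in T.
      -- The cuts of the parts, together with the edges inside T counted twice, therefore make up
      -- all degrees in T.
      barrier-count : ∀ w → (∀ e → 1 ≤ w e → P (s e) ≡ true × P (t e) ≡ true) →
        (∀ e → 1 ≤ w e → D (s e) ≡ true → D (t e) ≡ true → ℓ (s e) ≡ ℓ (t e)) →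
        sum (λ i → wt w (part i)) + (inner w T + inner w T) ≡ sum (λ v → ⟦ T v ⟧ * dg w v)
      barrier-count w ends closed = trans (cong₂ _+_ lhs (cong₂ _+_ (lin≡sum _ w) (lin≡sum _ w)))
        (trans (cong (sum (λ e → sum (λ i → ⟦ cut (part i) e ⟧ * w e)) +_) (sym (sum-+ _ _)))
        (trans (sym (sum-+ _ _)) (trans (sum-cong pt) (sym (handshake w T)))))
        where
        lhs : sum (λ i → wt w (part i)) ≡ sum (λ e → sum (λ i → ⟦ cut (part i) e ⟧ * w e))
        lhs = trans (sum-cong λ i → lin≡sum _ w) (sum-swap _)
        one : ∀ u m → sum (λ i → ⟦ δ i u ⟧ * m) ≡ m
        one u m = trans (sum-cong λ i → cong (λ b → ⟦ b ⟧ * m) (δ-sym i u)) (sum-δ (const m) u)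
        pt : ∀ e → sum (λ i → ⟦ cut (part i) e ⟧ * w e) + (⟦ inside T e ⟧ * w e + ⟦ inside T e ⟧ * w e)
                 ≡ (⟦ T (s e) ⟧ + ⟦ T (t e) ⟧) * w e
        pt e with w e in eq
        ... | zero = trans (cong₂ _+_ (sum-zero λ i → *-zeroʳ ⟦ cut (part i) e ⟧) (cong₂ _+_ (*-zeroʳ ⟦ inside T e ⟧) (*-zeroʳ ⟦ inside T e ⟧)))
                       (sym (*-zeroʳ (⟦ T (s e) ⟧ + ⟦ T (t e) ⟧)))
        ... | suc m with ends e (subst (1 ≤_) (sym eq) (s≤s z≤n)) | closed e (subst (1 ≤_) (sym eq) (s≤s z≤n))
        ...   | Ps , Pt | cl with T (s e) | T (t e)
        ...     | true  | true  rewrite Ps | Pt = trans (cong (_+ _) (sum-zero λ i → refl)) (twice (suc m))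
          where
          twice : ∀ m → 0 + ((m + 0) + (m + 0)) ≡ 2 * m
          twice = solve-∀
        ...     | true  | false rewrite Ps | Pt = trans (+-identityʳ _) (trans (one (ℓ (t e)) (suc m)) (sym (+-identityʳ _)))
        ...     | false | true  rewrite Ps | Pt = trans (+-identityʳ _) (trans (sum-cong λ i → cong (λ b → ⟦ b ⟧ * suc m) (Bool.xor-identityʳ (δ i (ℓ (s e)))))
                                                    (trans (one (ℓ (s e)) (suc m)) (sym (+-identityʳ _))))
        ...     | false | false rewrite Ps | Pt | cl refl refl = trans (+-identityʳ _) (sum-zero λ i → cong (λ b → ⟦ b ⟧ * suc m) (Bool.xor-same (δ i (ℓ (t e)))))

    join : (Fin k → ℕ) → Fin n → Fin n → Pred k
    join w u v e = pos (w e) ∧ ((δ u (s e) ∧ δ v (t e)) ∨ (δ v (s e) ∧ δ u (t e)))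

    join-sym : ∀ w u v e → join w u v e ≡ join w v u e
    join-sym w u v e = cong (pos (w e) ∧_) (Bool.∨-comm (δ u (s e) ∧ δ v (t e)) _)

    adj : (Fin k → ℕ) → Fin n → Fin n → Bool
    adj w u v = some (join w u v)

    adj-sym : ∀ w u v → adj w u v ≡ adj w v u
    adj-sym w u v = ≡-by-truth (half u v) (half v u)
      where
      half : ∀ u v → adj w u v ≡ true → adj w v u ≡ true
      half u v h with some⁻ h
      ... | e , j = some⁺ e (trans (join-sym w v u e) j)

    join⁻ : ∀ {w u v e} → join w u v e ≡ true → 1 ≤ w e × ((u ≡ s e × v ≡ t e) ⊎ (v ≡ s e × u ≡ t e))
    join⁻ {w} {u} {v} {e} h with ∧⁻ {pos (w e)} h
    ... | p , q with ∨⁻ {δ u (s e) ∧ δ v (t e)} q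
    ...   | inj₁ a = pos⁻ p , inj₁ (δ-true (proj₁ (∧⁻ a)) , δ-true (proj₂ (∧⁻ {δ u (s e)} a)))
    ...   | inj₂ a = pos⁻ p , inj₂ (δ-true (proj₁ (∧⁻ a)) , δ-true (proj₂ (∧⁻ {δ v (s e)} a)))

    join⁺ : ∀ {w} e → 1 ≤ w e → join w (s e) (t e) e ≡ true
    join⁺ e p = ∧⁺ (pos⁺ p) (∨⁺ˡ (∧⁺ (δ-refl (s e)) (δ-refl (t e))))

    adj⁺ : ∀ {w} e → 1 ≤ w e → adj w (s e) (t e) ≡ true
    adj⁺ {w} e p = some⁺ e (join⁺ {w} e p)

    module _ (w : Fin k → ℕ) where
      open Tutte (adj w) (adj-sym w) using (IsPM; module IsPM)

      -- A matching of vertices is realised by the least edge joining each matched pair.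
      realise′ : ∀ P mate → IsPM P mate → ∃ λ (M : Pred k) →
        (∀ e → M e ≡ true → 1 ≤ w e) × (∀ e → M e ≡ true → P (s e) ≡ true × P (t e) ≡ true)
        × (∀ v → P v ≡ true → dg (⟦_⟧ ∘ M) v ≡ 1)
      realise′ P mate pm = M , (λ e h → proj₁ (join⁻ {w} (M⇒join e h))) , (λ e h → M⇒P e h) , degree
        where
        open IsPM pm
        M : Pred k
        M e = (P (s e) ∧ P (t e)) ∧ first (join w (s e) (mate (s e))) e
        M⇒P : ∀ e → M e ≡ true → P (s e) ≡ true × P (t e) ≡ true
        M⇒P e h = ∧⁻ (proj₁ (∧⁻ h))
        M⇒first : ∀ e → M e ≡ true → first (join w (s e) (mate (s e))) e ≡ true
        M⇒first e h = proj₂ (∧⁻ {P (s e) ∧ P (t e)} h)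
        M⇒join : ∀ e → M e ≡ true → join w (s e) (mate (s e)) e ≡ true
        M⇒join e h = first-⊑ (join w (s e) (mate (s e))) e (M⇒first e h)
        degree : ∀ v → P v ≡ true → dg (⟦_⟧ ∘ M) v ≡ 1
        degree v Pv = trans (lin-sum pt) (trans (sym (count≡sum (first J))) (count-first J (proj₁ w≥) (proj₂ w≥)))
          where
          J : Pred k
          J = join w v (mate v)
          w≥ : ∃ λ e → J e ≡ true
          w≥ = some⁻ (mate-edge v Pv)
          swap : ∀ e → first (join w (mate v) (mate (mate v))) e ≡ first J e
          swap e = trans (first-cong (λ f → cong (λ x → join w (mate v) x f) (mate-mate v Pv)) e) (first-cong (join-sym w (mate v) v) e)
          fromFirst : ∀ e → first J e ≡ true → (⟦ δ v (s e) ⟧ + ⟦ δ v (t e) ⟧) * ⟦ M e ⟧ ≡ 1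
          fromFirst e f with join⁻ {w} (first-⊑ J e f)
          ... | _ , inj₁ (v≡s , m≡t) rewrite sym v≡s | sym m≡t | Pv | mate-∈ v Pv | f | δ-refl v | δ-false (mate-≢ v Pv ∘ sym) = refl
          ... | _ , inj₂ (m≡s , v≡t) rewrite sym v≡t | sym m≡s | Pv | mate-∈ v Pv | swap e | f | δ-refl v | δ-false (mate-≢ v Pv ∘ sym) = refl
          pt : ∀ e → (⟦ δ v (s e) ⟧ + ⟦ δ v (t e) ⟧) * ⟦ M e ⟧ ≡ ⟦ first J e ⟧
          pt e with bool (first J e)
          ... | inj₁ f = trans (fromFirst e f) (cong ⟦_⟧ (sym f))
          ... | inj₂ f with bool (M e)
          ...   | inj₂ ¬M rewrite ¬M | f = *-zeroʳ (⟦ δ v (s e) ⟧ + ⟦ δ v (t e) ⟧)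
          ...   | inj₁ h = trans (cong (_* ⟦ M e ⟧) (cong₂ _+_ (cong ⟦_⟧ (≢true⇒false at-s)) (cong ⟦_⟧ (≢true⇒false at-t)))) (cong ⟦_⟧ (sym f))
            where
            at-s : δ v (s e) ≡ true → ⊥
            at-s d = true≢false (subst (λ x → first (join w x (mate x)) e ≡ true) (sym (δ-true d)) (M⇒first e h)) f
            at-t : δ v (t e) ≡ true → ⊥
            at-t d with join⁻ {w} (M⇒join e h)
            ... | _ , inj₂ (m≡s , _) = mate-≢ (s e) (proj₁ (M⇒P e h)) m≡s
            ... | _ , inj₁ (_ , m≡t) = true≢false (trans (sym (swap e))
                  (subst (λ x → first (join w x (mate x)) e ≡ true) s≡ (M⇒first e h))) f
              where
              s≡ : s e ≡ mate v
              s≡ = trans (sym (mate-mate (s e) (proj₁ (M⇒P e h)))) (cong mate (trans m≡t (sym (δ-true d))))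

      abstract
        realise : ∀ P mate → IsPM P mate → ∃ λ (M : Pred k) →
          (∀ e → M e ≡ true → 1 ≤ w e) × (∀ e → M e ≡ true → P (s e) ≡ true × P (t e) ≡ true)
          × (∀ v → P v ≡ true → dg (⟦_⟧ ∘ M) v ≡ 1)
        realise = realise′

    dg-outside : ∀ (P : Pred n) M → (∀ e → M e ≡ true → P (s e) ≡ true × P (t e) ≡ true) →
                 ∀ v → P v ≡ false → dg (⟦_⟧ ∘ M) v ≡ 0
    dg-outside P M h v ¬Pv = lin-0 pt
      where
      pt : ∀ e → (⟦ δ v (s e) ⟧ + ⟦ δ v (t e) ⟧) * ⟦ M e ⟧ ≡ 0
      pt e with M e in eq
      ... | false = *-zeroʳ (⟦ δ v (s e) ⟧ + ⟦ δ v (t e) ⟧)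
      ... | true rewrite δ-false {i = v} {s e} (λ { refl → true≢false (proj₁ (h e eq)) ¬Pv })
                       | δ-false {i = v} {t e} (λ { refl → true≢false (proj₂ (h e eq)) ¬Pv }) = refl

    dg-∨ : ∀ (M N : Pred k) → (∀ e → M e ≡ true → N e ≡ true → ⊥) → ∀ v →
           dg (λ e → ⟦ M e ∨ N e ⟧) v ≡ dg (⟦_⟧ ∘ M) v + dg (⟦_⟧ ∘ N) v
    dg-∨ M N dis v = trans (lin-cong λ e → cong ((⟦ δ v (s e) ⟧ + ⟦ δ v (t e) ⟧) *_) (pt e)) (lin-+ _ (⟦_⟧ ∘ M) (⟦_⟧ ∘ N))
      where
      pt : ∀ e → ⟦ M e ∨ N e ⟧ ≡ ⟦ M e ⟧ + ⟦ N e ⟧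
      pt e with M e in p | N e in q
      ... | true  | true  = ⊥-elim (dis e p q)
      ... | true  | false = refl
      ... | false | _     = refl

    dg-single : ∀ e₀ v → dg (⟦_⟧ ∘ δ e₀) v ≡ ⟦ δ v (s e₀) ⟧ + ⟦ δ v (t e₀) ⟧
    dg-single e₀ v = trans (lin-sum λ e → *-comm (⟦ δ v (s e) ⟧ + ⟦ δ v (t e) ⟧) _) (sum-δ _ e₀)

    -- Many odd parts already exhaust the degrees of a barrier, so no edge has both ends in it.
    barrier-inner : ∀ {P w r} → Regular P w r → ∀ T → T ⊑ P → ∀ {L} (ℓ : Fin n → Fin L) → let open Barrier P T ℓ in
      (∀ e → 1 ≤ w e → D (s e) ≡ true → D (t e) ≡ true → ℓ (s e) ≡ ℓ (t e)) →
      count T ≤ count (λ i → odd (count (part i))) → inner w T ≡ 0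
    barrier-inner {P} {w} {r} reg T T⊑P ℓ closed le = m+n≡0⇒m≡0 (inner w T) (n≤0⇒n≡0
        (+-cancelˡ-≤ (r * count T) _ 0 (≤-trans (+-monoˡ-≤ _ many) (≤-reflexive (trans (barrier-count w ends closed)
          (trans (sum-const-deg w T r (λ v Tv → trans (sym (wt-δ w v noloop)) (deg v (T⊑P v Tv)))) (sym (+-identityʳ _))))))))
      where
      open Regular reg
      open Barrier P T ℓ
      many : r * count T ≤ sum (λ i → wt w (part i))
      many = ≤-trans (*-monoʳ-≤ r le) (≤-trans (≤-reflexive (trans (cong (r *_) (count≡sum _)) (sym (*-sum r _)))) (sum-mono-≤ pt))
        where
        pt : ∀ i → r * ⟦ odd (count (part i)) ⟧ ≤ wt w (part i)
        pt i with odd (count (part i)) in eq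
        ... | true  = ≤-trans (≤-reflexive (*-identityʳ r)) (oddcut (part i) (λ v h → proj₁ (∧⁻ (proj₁ (∧⁻ h)))) eq)
        ... | false = ≤-trans (≤-reflexive (*-zeroʳ r)) z≤n

    -- The two ends of `e₀` are deleted and the rest is to be matched. A Tutte obstruction, enlarged
    -- by the two ends, has by parity still at least as many odd parts as vertices. By
    -- `barrier-inner` no weight is then left inside it, although `e₀` lies there.
    perfect-through′ : ∀ {P w r} → Regular P w r → ∀ e₀ → 1 ≤ w e₀ → ∃ λ M → PerfectM P w M × M e₀ ≡ true
    perfect-through′ {P} {w} {r} reg e₀ w₀ with Tutte.tutte (adj w) (adj-sym w) ((P ∖ s e₀) ∖ t e₀)
    ... | inj₁ (mate , pm) with realise w ((P ∖ s e₀) ∖ t e₀) mate pm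
    ...   | M , supp , within , degM = M′ , record { supp = supp′ ; deg = deg′ } , ∨⁺ʳ {M e₀} (δ-refl e₀)
      where
      open Regular reg
      a = s e₀
      b = t e₀
      P′ : Pred n
      P′ = (P ∖ a) ∖ b
      P′⁻ : ∀ {v} → P′ v ≡ true → P v ≡ true × a ≢ v × b ≢ v
      P′⁻ h = let (h′ , nb) = ∖⁻ (P ∖ a) h ; (p , na) = ∖⁻ P h′ in p , na , nb
      M′ : Pred k
      M′ e = M e ∨ δ e₀ e
      supp′ : ∀ e → M′ e ≡ true → 1 ≤ w e
      supp′ e h with ⊕⁻ M h
      ... | inj₁ m    = supp e m
      ... | inj₂ refl = w₀
      total : ∀ v → wt (⟦_⟧ ∘ M′) (δ v) ≡ dg (⟦_⟧ ∘ M) v + (⟦ δ v a ⟧ + ⟦ δ v b ⟧)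
      total v = trans (wt-δ _ v (λ e h → noloop e (supp′ e (⟦⟧-true h))))
        (trans (dg-∨ M (δ e₀) (λ e m d → proj₁ (proj₂ (P′⁻ (subst (λ x → P′ (s x) ≡ true) (sym (δ-true d)) (proj₁ (within e m))))) refl) v)
          (cong (dg (⟦_⟧ ∘ M) v +_) (dg-single e₀ v)))
      out : ∀ v → P′ v ≡ false → dg (⟦_⟧ ∘ M) v ≡ 0
      out = dg-outside P′ M within
      a≢b : a ≢ b
      a≢b = noloop e₀ w₀
      deg′ : ∀ v → P v ≡ true → wt (⟦_⟧ ∘ M′) (δ v) ≡ 1
      deg′ v Pv with v ≟ a | v ≟ b
      ... | yes refl | _ = trans (total a) (trans (cong₂ _+_ (out a (≢true⇒false λ h → proj₁ (proj₂ (P′⁻ h)) refl))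
              (cong₂ _+_ (cong ⟦_⟧ (δ-refl a)) (cong ⟦_⟧ (δ-false a≢b)))) refl)
      ... | no _ | yes refl = trans (total b) (trans (cong₂ _+_ (out b (≢true⇒false λ h → proj₂ (proj₂ (P′⁻ h)) refl))
              (cong₂ _+_ (cong ⟦_⟧ (δ-false (a≢b ∘ sym))) (cong ⟦_⟧ (δ-refl b)))) refl)
      ... | no na | no nb = trans (total v) (trans (cong₂ _+_ (degM v (∖⁺ (P ∖ a) (∖⁺ P Pv (na ∘ sym)) (nb ∘ sym)))
              (cong₂ _+_ (cong ⟦_⟧ (δ-false na)) (cong ⟦_⟧ (δ-false nb)))) refl)
    perfect-through′ {P} {w} {r} reg e₀ w₀ | inj₂ (sep , lt) = contradiction inner≥1 (subst (λ x → ¬ 1 ≤ x) (sym inner≡0) λ ())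
      where
      open Regular reg
      a = s e₀
      b = t e₀
      P′ : Pred n
      P′ = (P ∖ a) ∖ b
      open Tutte.Separation sep
      T : Pred n
      T = (S ⊕ a) ⊕ b
      a≢b : a ≢ b
      a≢b = noloop e₀ w₀
      S⊑ : ∀ v → S v ≡ true → P v ≡ true × a ≢ v × b ≢ v
      S⊑ v h = let (h′ , nb) = ∖⁻ (P ∖ a) (S⊑P v h) ; (p , na) = ∖⁻ P h′ in p , na , nb
      T⊑P : T ⊑ P
      T⊑P v h with ⊕⁻ (S ⊕ a) h
      ... | inj₂ refl = proj₂ (ends e₀ w₀)
      ... | inj₁ h′ with ⊕⁻ S h′
      ...   | inj₁ Sv   = proj₁ (S⊑ v Sv)
      ...   | inj₂ refl = proj₁ (ends e₀ w₀)
      module B = Barrier P T ℓ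
      D≡ : ∀ v → B.D v ≡ D v
      D≡ v = lem (P v) (S v) (δ a v) (δ b v)
        where
        lem : ∀ p s x y → p ∧ not ((s ∨ x) ∨ y) ≡ ((p ∧ not x) ∧ not y) ∧ not s
        lem false s     x     y     = refl
        lem true  s     true  true  = trans (cong not (trans (cong (_∨ true) (Bool.∨-zeroʳ s)) refl)) refl
        lem true  s     true  false = cong not (trans (Bool.∨-identityʳ _) (Bool.∨-zeroʳ s))
        lem true  s     false true  = cong not (Bool.∨-zeroʳ _)
        lem true  s     false false = cong not (trans (Bool.∨-identityʳ _) (Bool.∨-identityʳ s))
      count-T : count T ≡ 2 + count S
      count-T = trans (count-⊕ b (≢true⇒false λ h → lemb (⊕⁻ S h)))
        (cong suc (count-⊕ a (≢true⇒false λ h → proj₁ (proj₂ (S⊑ a h)) refl)))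
        where
        lemb : S b ≡ true ⊎ a ≡ b → ⊥
        lemb (inj₁ h) = proj₂ (proj₂ (S⊑ b h)) refl
        lemb (inj₂ e) = a≢b e
      count-P : count P ≡ 2 + count P′
      count-P = trans (count-∖ a (proj₁ (ends e₀ w₀))) (cong suc (count-∖ b (∖⁺ P (proj₂ (ends e₀ w₀)) a≢b)))
      gap : count T ≤ count (λ i → odd (count (B.part i)))
      gap = ≤-trans (≤-reflexive count-T) (≤-trans (parity-gap (xor-≡ (odd (count S)) _
              (trans (sym (odd-+ (count S) (count odds))) (trans odds-parity
                (trans (sym (trans (cong odd count-P) (Bool.not-involutive _))) even)))) lt)
            (≤-reflexive (count-cong λ i → cong odd (count-cong λ v → cong (_∧ δ i (ℓ v)) (sym (D≡ v))))))
        where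
        xor-≡ : ∀ a b → a xor b ≡ false → a ≡ b
        xor-≡ true  true  _ = refl
        xor-≡ false false _ = refl
      inner≡0 : inner w T ≡ 0
      inner≡0 = barrier-inner reg T T⊑P ℓ (λ e w≥ p q → closed (s e) (t e) (trans (sym (D≡ _)) p) (trans (sym (D≡ _)) q) (adj⁺ {w} e w≥)) gap
      inner≥1 : 1 ≤ inner w T
      inner≥1 = ≤-trans w₀ (≤-trans (≤-trans (≤-reflexive (sym (trans (cong (λ b → ⟦ b ⟧ * w e₀)
        (∧⁺ {T a} {T b} (∨⁺ˡ {(S ⊕ a) a} (∨⁺ʳ {S a} (δ-refl a))) (∨⁺ʳ {(S ⊕ a) b} (δ-refl b)))) (+-identityʳ _))))
        (≤-sum (λ e → ⟦ inside T e ⟧ * w e) e₀)) (≤-reflexive (sym (lin≡sum _ w))))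

    abstract
      perfect-through : ∀ {P w r} → Regular P w r → ∀ e₀ → 1 ≤ w e₀ → ∃ λ M → PerfectM P w M × M e₀ ≡ true
      perfect-through = perfect-through′

open WeightedGraphs

-- Contraction of a tight odd cut in a regular weighting

module WeightedContraction where

  module Contract {n k : ℕ} (s t : Fin k → Fin n) (P U : Pred n) (u₀ : Fin n) where
    open Edges s t

    ρ : Fin n → Fin n
    ρ v = if U v then u₀ else v

    s₁ t₁ : Fin k → Fin n
    s₁ = ρ ∘ s
    t₁ = ρ ∘ t

    rest : Pred n
    rest v = P v ∧ not (U v)

    P₁ : Pred n
    P₁ = rest ⊕ u₀

    restrict : (Fin k → ℕ) → Fin k → ℕ
    restrict w e = if inside U e then 0 else w e

    module E₁ = Edges s₁ t₁

    restrict-pos : ∀ {w e} → 1 ≤ restrict w e → inside U e ≡ false × 1 ≤ w e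
    restrict-pos {w} {e} h with inside U e
    ... | false = refl , h

    wt-restrict : ∀ w X → E₁.wt (restrict w) X ≡ wt w (X ∘ ρ)
    wt-restrict w X = lin-cong pt
      where
      pt : ∀ e → ⟦ X (ρ (s e)) xor X (ρ (t e)) ⟧ * restrict w e ≡ ⟦ X (ρ (s e)) xor X (ρ (t e)) ⟧ * w e
      pt e with U (s e) | U (t e)
      ... | true  | true  rewrite Bool.xor-same (X u₀) = refl
      ... | true  | false = refl
      ... | false | true  = refl
      ... | false | false = refl

    module _ (Uu₀ : U u₀ ≡ true) where

      δ-ρ-in : ∀ v → δ u₀ (ρ v) ≡ U v
      δ-ρ-in v with U v in eq
      ... | true  = δ-refl u₀
      ... | false = δ-false λ { refl → true≢false Uu₀ eq }

      δ-ρ-out : ∀ {v} → U v ≡ false → ∀ x → δ v (ρ x) ≡ δ v x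
      δ-ρ-out {v} ¬Uv x with U x in eq
      ... | false = refl
      ... | true  = trans (δ-false λ { refl → true≢false Uu₀ ¬Uv }) (sym (δ-false λ { refl → true≢false eq ¬Uv }))

      module _ (U⊑P : U ⊑ P) {w : Fin k → ℕ} {r : ℕ} (reg : Regular P w r) where
        open Regular reg

        count-P : count P ≡ count U + count rest
        count-P = trans (count-split P U) (cong (_+ count rest)
          (count-cong λ v → ≡-by-truth (λ h → proj₂ (∧⁻ {P v} h)) λ h → ∧⁺ (U⊑P v h) h))

        count-P₁ : count P₁ ≡ suc (count rest)
        count-P₁ = count-⊕ {p = rest} u₀ (trans (cong (λ b → P u₀ ∧ not b) Uu₀) (Bool.∧-zeroʳ (P u₀)))

        -- An odd set pulls back either to a set avoiding U or to one containing all of U. In the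
        -- latter case the odd number of vertices of U replaces the single vertex `u₀`, so the
        -- pullback is again odd.
        contract-regular : odd (count U) ≡ true → wt w U ≡ r → E₁.Regular P₁ (restrict w) r
        contract-regular oddU tight = record { ends = ends₁ ; noloop = noloop₁ ; deg = deg₁ ; oddcut = oddcut₁ ; even = even₁ }
          where
          ρ∈ : ∀ v → P v ≡ true → P₁ (ρ v) ≡ true
          ρ∈ v Pv with U v in eq
          ... | true  = ∨⁺ʳ {rest u₀} (δ-refl u₀)
          ... | false = ∨⁺ˡ {rest v} (∧⁺ Pv (not⁺ eq))
          ends₁ : ∀ e → 1 ≤ restrict w e → P₁ (s₁ e) ≡ true × P₁ (t₁ e) ≡ true
          ends₁ e h with ends e (proj₂ (restrict-pos {w} h))
          ... | a , b = ρ∈ (s e) a , ρ∈ (t e) b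
          noloop₁ : ∀ e → 1 ≤ restrict w e → s₁ e ≢ t₁ e
          noloop₁ e h eq with restrict-pos {w} h
          ... | ni , w≥ with U (s e) in us | U (t e) in ut
          ...   | true  | false = true≢false Uu₀ (subst (λ x → U x ≡ false) (sym eq) ut)
          ...   | false | true  = true≢false Uu₀ (subst (λ x → U x ≡ false) eq us)
          ...   | false | false = noloop e w≥ eq
          deg₁ : ∀ v → P₁ v ≡ true → E₁.wt (restrict w) (δ v) ≡ r
          deg₁ v h with ⊕⁻ rest h
          ... | inj₁ h′ = trans (wt-restrict w (δ v)) (trans (wt-cong w (δ-ρ-out (not⁻ (proj₂ (∧⁻ {P v} h′))))) (deg v (proj₁ (∧⁻ h′))))
          ... | inj₂ refl = trans (wt-restrict w (δ v)) (trans (wt-cong w δ-ρ-in) tight)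
          oddcut₁ : ∀ X → X ⊑ P₁ → odd (count X) ≡ true → r ≤ E₁.wt (restrict w) X
          oddcut₁ X X⊑ oddX = ≤-trans (oddcut Y (λ v h → proj₁ (∧⁻ h)) (trans (parity (bool (X u₀))) oddX))
              (≤-reflexive (trans (lin-cong same) (sym (wt-restrict w X))))
            where
            Y : Pred n
            Y v = P v ∧ X (ρ v)
            same : ∀ e → ⟦ cut Y e ⟧ * w e ≡ ⟦ cut (X ∘ ρ) e ⟧ * w e
            same e with w e in eq
            ... | zero  = trans (*-zeroʳ ⟦ cut Y e ⟧) (sym (*-zeroʳ ⟦ cut (X ∘ ρ) e ⟧))
            ... | suc m with ends e (subst (1 ≤_) (sym eq) (s≤s z≤n))
            ...   | a , b rewrite a | b = refl
            X⇒rest : ∀ v → X v ≡ true → u₀ ≢ v → rest v ≡ true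
            X⇒rest v Xv ne with ⊕⁻ rest (X⊑ v Xv)
            ... | inj₁ h = h
            ... | inj₂ e = contradiction e ne
            rest-Y : ∀ v → rest v ≡ true → X v ≡ true → Y v ≡ true
            rest-Y v h Xv rewrite not⁻ (proj₂ (∧⁻ {P v} h)) = ∧⁺ (proj₁ (∧⁻ h)) Xv
            parity : X u₀ ≡ true ⊎ X u₀ ≡ false → odd (count Y) ≡ odd (count X)
            parity (inj₂ f) = cong odd (count-cong λ v → ≡-by-truth (to v) (from v))
              where
              to : ∀ v → Y v ≡ true → X v ≡ true
              to v h with U v
              ... | true  = ⊥-elim (true≢false (proj₂ (∧⁻ {P v} h)) f)
              ... | false = proj₂ (∧⁻ {P v} h)
              from : ∀ v → X v ≡ true → Y v ≡ true
              from v Xv = rest-Y v (X⇒rest v Xv λ { refl → true≢false Xv f }) Xv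
            parity (inj₁ tr) = begin
              odd (count Y)                               ≡⟨ cong odd (count-cong λ v → ≡-by-truth (to v) (from v)) ⟩
              odd (count (λ v → U v ∨ (X ∖ u₀) v))        ≡⟨ cong odd (count-⊎ U (X ∖ u₀) λ v Uv h → let (Xv , ne) = ∖⁻ X h in
                                                               true≢false Uv (not⁻ (proj₂ (∧⁻ {P v} (X⇒rest v Xv ne))))) ⟩
              odd (count U + count (X ∖ u₀))              ≡⟨ odd-+ (count U) _ ⟩
              odd (count U) xor odd (count (X ∖ u₀))      ≡⟨ cong (_xor odd (count (X ∖ u₀))) oddU ⟩
              not (odd (count (X ∖ u₀)))                  ≡⟨ cong odd (count-∖ u₀ tr) ⟨
              odd (count X)                               ∎
              where
              open ≡-Reasoning
              to : ∀ v → Y v ≡ true → (U v ∨ (X ∖ u₀) v) ≡ true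
              to v h with U v in eq
              ... | true  = refl
              ... | false = ∖⁺ X (proj₂ (∧⁻ {P v} h)) λ { refl → true≢false Uu₀ eq }
              from : ∀ v → (U v ∨ (X ∖ u₀) v) ≡ true → Y v ≡ true
              from v h with U v in eq
              ... | true  = ∧⁺ (U⊑P v eq) tr
              ... | false = let (Xv , ne) = ∖⁻ X h in ∧⁺ (proj₁ (∧⁻ (X⇒rest v Xv ne))) Xv
          even₁ : odd (count P₁) ≡ false
          even₁ = trans (cong odd count-P₁) (trans (sym (trans (cong odd count-P) (trans (odd-+ (count U) _) (cong (_xor odd (count rest)) oddU)))) even)

        lift-deg : ∀ {M} → E₁.PerfectM P₁ (restrict w) M → ∀ N → (∀ e → inside U e ≡ false → N e ≡ M e) →
                   ∀ v → P v ≡ true → U v ≡ false → wt (⟦_⟧ ∘ N) (δ v) ≡ 1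
        lift-deg {M} pm N agree v Pv ¬Uv = trans {j = wt (⟦_⟧ ∘ M) (δ v)} (lin-cong pt)
            (trans (wt-cong (⟦_⟧ ∘ M) (λ x → sym (δ-ρ-out ¬Uv x))) (E₁.PerfectM.deg pm v (∨⁺ˡ {rest v} (∧⁺ Pv (not⁺ ¬Uv)))))
          where
          pt : ∀ e → ⟦ cut (δ v) e ⟧ * ⟦ N e ⟧ ≡ ⟦ cut (δ v) e ⟧ * ⟦ M e ⟧
          pt e with bool (inside U e)
          ... | inj₂ f rewrite agree e f = refl
          ... | inj₁ i rewrite δ-false {i = v} {s e} (λ { refl → true≢false (proj₁ (∧⁻ i)) ¬Uv })
                             | δ-false {i = v} {t e} (λ { refl → true≢false (proj₂ (∧⁻ {U (s e)} i)) ¬Uv }) = refl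

        crosses-once : ∀ {M} → E₁.PerfectM P₁ (restrict w) M → wt (⟦_⟧ ∘ M) U ≡ 1
        crosses-once {M} pm = trans (wt-cong (⟦_⟧ ∘ M) (λ v → sym (δ-ρ-in v))) (E₁.PerfectM.deg pm u₀ (∨⁺ʳ {rest u₀} (δ-refl u₀)))

  count-one : ∀ {n} (p : Pred n) → count p ≡ 1 → ∀ i j → p i ≡ true → p j ≡ true → i ≡ j
  count-one p one i j pi pj with i ≟ j
  ... | yes e = e
  ... | no ne = contradiction (count-pos j (∖⁺ p pj ne)) (subst (λ x → ¬ 1 ≤ x) (sym (cong ℕ.pred (trans (sym (count-∖ i pi)) one))) λ ())

  lin-∧ : ∀ {k} (c M : Pred k) → lin (⟦_⟧ ∘ c) (⟦_⟧ ∘ M) ≡ count (λ e → c e ∧ M e)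
  lin-∧ c M = trans (lin-sum λ e → sym (⟦∧⟧ (c e) (M e))) (sym (count≡sum _))

  -- M meets the cut only in `e`, so of the values of `g` on the cut only `g e` is seen.
  lin-crossing : ∀ {k} (c M : Pred k) → lin (⟦_⟧ ∘ c) (⟦_⟧ ∘ M) ≡ 1 → ∀ e → c e ≡ true → M e ≡ true →
    ∀ (f g : Fin k → ℕ) → (∀ x → c x ≡ true → f x ≡ 0) →
    lin (λ x → if c x then g x else f x) (⟦_⟧ ∘ M) ≡ lin f (⟦_⟧ ∘ M) + g e
  lin-crossing c M one e ce Me f g fz = trans (lin-sum pt) (trans (sum-+ _ _) (cong₂ _+_ (sym (lin≡sum f _)) (sum-δ g e)))
    where
    uniq : ∀ x → c x ≡ true → M x ≡ true → e ≡ x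
    uniq x cx Mx = count-one _ (trans (sym (lin-∧ c M)) one) e x (∧⁺ ce Me) (∧⁺ cx Mx)
    pt : ∀ x → (if c x then g x else f x) * ⟦ M x ⟧ ≡ f x * ⟦ M x ⟧ + ⟦ δ e x ⟧ * g x
    pt x with c x in cx | M x in Mx
    ... | false | m rewrite δ-false {i = e} {x} (λ { refl → true≢false ce cx }) = sym (+-identityʳ _)
    ... | true  | false rewrite δ-false {i = e} {x} (λ { refl → true≢false Me Mx }) | fz x cx = *-zeroʳ (g x)
    ... | true  | true  rewrite sym (uniq x cx Mx) | δ-refl e | fz e ce = *-comm (g e) 1

  module _ {n k : ℕ} where

    Balanced : (s t : Fin k → Fin n) (P : Pred n) (w c d : Fin k → ℕ) → Set
    Balanced s t P w c d = ∀ M → Edges.PerfectM s t P w M → lin c (⟦_⟧ ∘ M) ≡ lin d (⟦_⟧ ∘ M)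

    -- The dual form of Edmonds' theorem. An equality between two functionals with natural
    -- coefficients stands for the vanishing of their difference, so that neither rational nor
    -- negative numbers occur.
    Claim : ℕ → Set
    Claim N = ∀ s t P w r c d → count P ≤ N → Edges.Regular s t P w r → Balanced s t P w c d → lin c w ≡ lin d w

    module Split (s t : Fin k → Fin n) {P : Pred n} {w : Fin k → ℕ} {r : ℕ} (reg : Edges.Regular s t P w r)
      (U : Pred n) (U⊑P : U ⊑ P) (oddU : odd (count U) ≡ true) (tight : Edges.wt s t w U ≡ r)
      (u₁ : Fin n) (Uu₁ : U u₁ ≡ true) (u₂ : Fin n) (U′u₂ : (P u₂ ∧ not (U u₂)) ≡ true) where
      open Edges s t
      open Regular reg

      U′ : Pred n
      U′ v = P v ∧ not (U v)

      U′⊑P : U′ ⊑ P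
      U′⊑P v h = proj₁ (∧⁻ h)

      module C₁ = Contract s t P U u₁
      module C₂ = Contract s t P U′ u₂

      U′-supp : ∀ e → 1 ≤ w e → U′ (s e) ≡ not (U (s e)) × U′ (t e) ≡ not (U (t e))
      U′-supp e h with ends e h
      ... | a , b rewrite a | b = refl , refl

      cut-supp : ∀ e → 1 ≤ w e → cut U′ e ≡ cut U e
      cut-supp e h rewrite proj₁ (U′-supp e h) | proj₂ (U′-supp e h) = not-xor-not (U (s e)) (U (t e))
        where
        not-xor-not : ∀ a b → not a xor not b ≡ a xor b
        not-xor-not true  b = refl
        not-xor-not false true = refl
        not-xor-not false false = refl

      wt-U′ : ∀ f → (∀ e → 1 ≤ f e → 1 ≤ w e) → wt f U′ ≡ wt f U
      wt-U′ f h = lin-cong pt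
        where
        pt : ∀ e → ⟦ cut U′ e ⟧ * f e ≡ ⟦ cut U e ⟧ * f e
        pt e with f e in eq
        ... | zero  = trans (*-zeroʳ ⟦ cut U′ e ⟧) (sym (*-zeroʳ ⟦ cut U e ⟧))
        ... | suc m = cong (λ b → ⟦ b ⟧ * suc m) (cut-supp e (h e (subst (1 ≤_) (sym eq) (s≤s z≤n))))

      oddU′ : odd (count U′) ≡ true
      oddU′ = trans (sym (Bool.not-involutive _)) (cong not (trans (sym (trans (cong odd (C₁.count-P Uu₁ U⊑P reg))
        (trans (odd-+ (count U) _) (cong (_xor odd (count U′)) oddU)))) even))

      reg₁ : C₁.E₁.Regular C₁.P₁ (C₁.restrict w) r
      reg₁ = C₁.contract-regular Uu₁ U⊑P reg oddU tight

      reg₂ : C₂.E₁.Regular C₂.P₁ (C₂.restrict w) r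
      reg₂ = C₂.contract-regular U′u₂ U′⊑P reg oddU′ (trans (wt-U′ w (λ e h → h)) tight)

      -- The parts of `c` carried by the edges that only one of the two contractions sees. Both
      -- vanish on the cut, whose values are distributed separately.
      cA cB : (Fin k → ℕ) → Fin k → ℕ
      cA c e = c e * ⟦ inside U′ e ⟧
      cB c e = c e * ⟦ inside U e ⟧

      cA-cut : ∀ c x → cut U x ≡ true → cA c x ≡ 0
      cA-cut c x h = trans (cong (λ b → c x * ⟦ b ⟧) (≢true⇒false λ i → true≢false h (lem i))) (*-zeroʳ (c x))
        where
        lem : inside U′ x ≡ true → cut U x ≡ false
        lem i rewrite not⁻ (proj₂ (∧⁻ {P (s x)} (proj₁ (∧⁻ i)))) | not⁻ (proj₂ (∧⁻ {P (t x)} (proj₂ (∧⁻ {U′ (s x)} i)))) = refl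

      cB-cut : ∀ c x → cut U x ≡ true → cB c x ≡ 0
      cB-cut c x h with U (s x) | U (t x)
      ... | true  | false = *-zeroʳ (c x)
      ... | false | true  = *-zeroʳ (c x)

      module Glue {M₁ M₂ : Pred k} (pm₁ : C₁.E₁.PerfectM C₁.P₁ (C₁.restrict w) M₁)
                  (pm₂ : C₂.E₁.PerfectM C₂.P₁ (C₂.restrict w) M₂)
                  (e₀ : Fin k) (cut₀ : cut U e₀ ≡ true) (M₁e₀ : M₁ e₀ ≡ true) (M₂e₀ : M₂ e₀ ≡ true) where

        supp₁ : ∀ e → M₁ e ≡ true → inside U e ≡ false × 1 ≤ w e
        supp₁ e h = C₁.restrict-pos {w} (C₁.E₁.PerfectM.supp pm₁ e h)

        supp₂ : ∀ e → M₂ e ≡ true → inside U′ e ≡ false × 1 ≤ w e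
        supp₂ e h = C₂.restrict-pos {w} (C₂.E₁.PerfectM.supp pm₂ e h)

        M : Pred k
        M e = M₁ e ∨ M₂ e

        suppM : ∀ e → M e ≡ true → 1 ≤ w e
        suppM e h with ∨⁻ {M₁ e} h
        ... | inj₁ a = proj₂ (supp₁ e a)
        ... | inj₂ b = proj₂ (supp₂ e b)

        once₁ : wt (⟦_⟧ ∘ M₁) U ≡ 1
        once₁ = C₁.crosses-once Uu₁ U⊑P reg pm₁

        once₂ : wt (⟦_⟧ ∘ M₂) U ≡ 1
        once₂ = trans (sym (wt-U′ (⟦_⟧ ∘ M₂) λ e h → proj₂ (supp₂ e (⟦⟧-true h)))) (C₂.crosses-once U′u₂ U′⊑P reg pm₂)

        uniq₁ : ∀ x → cut U x ≡ true → M₁ x ≡ true → e₀ ≡ x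
        uniq₁ x cx Mx = count-one _ (trans (sym (lin-∧ (cut U) M₁)) once₁) e₀ x (∧⁺ cut₀ M₁e₀) (∧⁺ cx Mx)

        uniq₂ : ∀ x → cut U x ≡ true → M₂ x ≡ true → e₀ ≡ x
        uniq₂ x cx Mx = count-one _ (trans (sym (lin-∧ (cut U) M₂)) once₂) e₀ x (∧⁺ cut₀ M₂e₀) (∧⁺ cx Mx)

        not-inside⇒cut : ∀ e → 1 ≤ w e → inside U e ≡ false → inside U′ e ≡ false → cut U e ≡ true
        not-inside⇒cut e h i j rewrite proj₁ (U′-supp e h) | proj₂ (U′-supp e h) with U (s e) | U (t e)
        ... | true  | false = refl
        ... | false | true  = refl

        agree₁ : ∀ e → inside U e ≡ false → M e ≡ M₁ e
        agree₁ e i = ≡-by-truth to ∨⁺ˡ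
          where
          to : M e ≡ true → M₁ e ≡ true
          to h with ∨⁻ {M₁ e} h
          ... | inj₁ a = a
          ... | inj₂ b = subst (λ x → M₁ x ≡ true) (uniq₂ e (not-inside⇒cut e (proj₂ (supp₂ e b)) i (proj₁ (supp₂ e b))) b) M₁e₀

        agree₂ : ∀ e → inside U′ e ≡ false → M e ≡ M₂ e
        agree₂ e i = ≡-by-truth to (∨⁺ʳ {M₁ e})
          where
          to : M e ≡ true → M₂ e ≡ true
          to h with ∨⁻ {M₁ e} h
          ... | inj₂ b = b
          ... | inj₁ a = subst (λ x → M₂ x ≡ true) (uniq₁ e (not-inside⇒cut e (proj₂ (supp₁ e a)) (proj₁ (supp₁ e a)) i) a) M₂e₀

        perfect : PerfectM P w M
        perfect = record { supp = suppM ; deg = deg′ }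
          where
          deg′ : ∀ v → P v ≡ true → wt (⟦_⟧ ∘ M) (δ v) ≡ 1
          deg′ v Pv with bool (U v)
          ... | inj₂ f = C₁.lift-deg Uu₁ U⊑P reg pm₁ M agree₁ v Pv f
          ... | inj₁ h = C₂.lift-deg U′u₂ U′⊑P reg pm₂ M agree₂ v Pv (trans (cong (λ b → P v ∧ not b) h) (Bool.∧-zeroʳ (P v)))

        lin-glue : ∀ c → lin c (⟦_⟧ ∘ M) ≡ (lin (cA c) (⟦_⟧ ∘ M₁) + lin (cB c) (⟦_⟧ ∘ M₂)) + c e₀
        lin-glue c = trans (lin-sum pt) (trans (sum-+ _ _) (cong₂ _+_
            (trans (sum-+ _ _) (cong₂ _+_ (sym (lin≡sum _ _)) (sym (lin≡sum _ _)))) (sum-δ c e₀)))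
          where
          pt : ∀ e → c e * ⟦ M e ⟧ ≡ (cA c e * ⟦ M₁ e ⟧ + cB c e * ⟦ M₂ e ⟧) + ⟦ δ e₀ e ⟧ * c e
          pt e with bool (cut U e)
          pt e | inj₁ ce rewrite cA-cut c e ce | cB-cut c e ce with δ e₀ e in de
          ... | true  rewrite sym (δ-true de) | M₁e₀ = *-comm (c e₀) 1
          ... | false rewrite ≢true⇒false {M₁ e} (λ m → δ-false⁻ de (uniq₁ e ce m))
                            | ≢true⇒false {M₂ e} (λ m → δ-false⁻ de (uniq₂ e ce m)) = *-zeroʳ (c e)
          pt e | inj₂ ¬ce rewrite δ-false {i = e₀} {e} (λ { refl → true≢false cut₀ ¬ce }) with bool (M e)
          ... | inj₂ f rewrite f | ≢true⇒false {M₁ e} (λ m → true≢false (∨⁺ˡ {M₁ e} m) f)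
                             | ≢true⇒false {M₂ e} (λ m → true≢false (∨⁺ʳ {M₁ e} m) f) = zeros (c e) ⟦ inside U′ e ⟧ ⟦ inside U e ⟧
            where
            zeros : ∀ c a b → c * 0 ≡ c * a * 0 + c * b * 0 + 0
            zeros = solve-∀
          ... | inj₁ m with suppM e m | bool (inside U e)
          ...   | w≥ | inj₁ i rewrite ≢true⇒false {M₁ e} (λ m₁ → true≢false i (proj₁ (supp₁ e m₁)))
                       | ≢true⇒false {inside U′ e} (λ i′ → true≢false (proj₁ (∧⁻ {U (s e)} i)) (not⁻ (proj₂ (∧⁻ {P (s e)} (proj₁ (∧⁻ {U′ (s e)} i′))))))
                       | i = one (c e) ⟦ M₂ e ⟧
            where
            one : ∀ c m → c * m ≡ c * 0 * 0 + c * 1 * m + 0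
            one = solve-∀
          ...   | w≥ | inj₂ ni with bool (inside U′ e)
          ...     | inj₂ ni′ = ⊥-elim (true≢false (not-inside⇒cut e w≥ ni ni′) ¬ce)
          ...     | inj₁ i′ rewrite ≢true⇒false {M₂ e} (λ m₂ → true≢false i′ (proj₁ (supp₂ e m₂))) | i′ | ni | Bool.∨-identityʳ (M₁ e) = one (c e) ⟦ M₁ e ⟧
            where
            one : ∀ c m → c * m ≡ c * 1 * m + c * 0 * 0 + 0
            one = solve-∀

      -- The matchings have to be fixed once for all edges because the coefficients on the two sides
      -- are built from them. The property is conditional so that edges off the cut or without
      -- weight may carry a dummy.
      Chosen : Fin k → Set
      Chosen e = ∃ λ (N : Pred k × Pred k) → cut U e ≡ true → 1 ≤ w e →
        (C₁.E₁.PerfectM C₁.P₁ (C₁.restrict w) (proj₁ N) × proj₁ N e ≡ true)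
        × (C₂.E₁.PerfectM C₂.P₁ (C₂.restrict w) (proj₂ N) × proj₂ N e ≡ true)

      choose : ∀ e → Chosen e
      choose e with bool (cut U e) | bool (pos (w e))
      ... | inj₂ f | _      = (const false , const false) , λ h → ⊥-elim (true≢false h f)
      ... | inj₁ _ | inj₂ f = (const false , const false) , λ _ h → ⊥-elim (true≢false (pos⁺ h) f)
      ... | inj₁ h | inj₁ p with EdgeLemmas.perfect-through C₁.s₁ C₁.t₁ reg₁ e (kept₁ (pos⁻ p)) | EdgeLemmas.perfect-through C₂.s₁ C₂.t₁ reg₂ e (kept₂ (pos⁻ p))
        where
        kept₁ : 1 ≤ w e → 1 ≤ C₁.restrict w e
        kept₁ q with U (s e) | U (t e)
        ... | true  | false = q
        ... | false | true  = q
        kept₂ : 1 ≤ w e → 1 ≤ C₂.restrict w e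
        kept₂ q rewrite proj₁ (U′-supp e q) | proj₂ (U′-supp e q) with U (s e) | U (t e)
        ... | true  | false = q
        ... | false | true  = q
      ...   | N₁ , a | N₂ , b = (N₁ , N₂) , λ _ _ → a , b

      -- On a cut edge e the values of c and d on the chosen matching through e are moved between the two sides,
      -- crosswise, so that both contractions stay balanced without negative coefficients.
      contract-step : (∀ e → Chosen e) → ∀ N → Claim N → ∀ c d → count C₁.P₁ ≤ N → count C₂.P₁ ≤ N → Balanced s t P w c d → lin c w ≡ lin d w
      contract-step choose N claim c d le₁ le₂ bal = +-cancelʳ-≡ (lin extra w) _ _ (trans (sym (total c c₁ c₂ ca cb))
          (trans (cong₂ _+_ eq₁ eq₂) (total d d₁ d₂ da db)))
        where
        A B : Fin k → Pred k
        A e = proj₁ (proj₁ (choose e))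
        B e = proj₂ (proj₁ (choose e))
        ac ad : Fin k → ℕ
        ac e = lin (cA c) (⟦_⟧ ∘ A e)
        ad e = lin (cA d) (⟦_⟧ ∘ A e)
        c₁ d₁ c₂ d₂ : Fin k → ℕ
        c₁ e = if cut U e then ad e else cA c e
        d₁ e = if cut U e then ac e else cA d e
        c₂ e = if cut U e then c e + ac e else cB c e
        d₂ e = if cut U e then d e + ad e else cB d e
        extra : Fin k → ℕ
        extra e = ⟦ cut U e ⟧ * (ac e + ad e)
        ca : ∀ e → cut U e ≡ true → c₁ e + c₂ e ≡ c e + (ac e + ad e)
        ca e h rewrite h = shuffle (ad e) (c e) (ac e)
          where
          shuffle : ∀ x y z → x + (y + z) ≡ y + (z + x)
          shuffle = solve-∀
        cb : ∀ e → cut U e ≡ false → c₁ e ≡ cA c e × c₂ e ≡ cB c e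
        cb e h rewrite h = refl , refl
        da : ∀ e → cut U e ≡ true → d₁ e + d₂ e ≡ d e + (ac e + ad e)
        da e h rewrite h = shuffle (ac e) (d e) (ad e)
          where
          shuffle : ∀ x y z → x + (y + z) ≡ y + (x + z)
          shuffle = solve-∀
        db : ∀ e → cut U e ≡ false → d₁ e ≡ cA d e × d₂ e ≡ cB d e
        db e h rewrite h = refl , refl
        total : ∀ c c₁ c₂ → (∀ e → cut U e ≡ true → c₁ e + c₂ e ≡ c e + (ac e + ad e)) →
                (∀ e → cut U e ≡ false → c₁ e ≡ cA c e × c₂ e ≡ cB c e) →
                lin c₁ (C₁.restrict w) + lin c₂ (C₂.restrict w) ≡ lin c w + lin extra w
        total c c₁ c₂ ca cb = trans (cong₂ _+_ (lin≡sum _ _) (lin≡sum _ _)) (trans (sym (sum-+ _ _))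
            (trans (sum-cong pt) (trans (sum-+ _ _) (sym (cong₂ _+_ (lin≡sum _ _) (lin≡sum _ _))))))
          where
          pt : ∀ e → c₁ e * C₁.restrict w e + c₂ e * C₂.restrict w e ≡ c e * w e + extra e * w e
          pt e with bool (pos (w e))
          ... | inj₂ z = trans (cong₂ _+_ (trans (cong (c₁ e *_) (r₁ (inside U e))) (*-zeroʳ (c₁ e))) (trans (cong (c₂ e *_) (r₁ (inside U′ e))) (*-zeroʳ (c₂ e))))
                           (sym (cong₂ _+_ (trans (cong (c e *_) (pos-zero z)) (*-zeroʳ (c e))) (trans (cong (extra e *_) (pos-zero z)) (*-zeroʳ (extra e)))))
            where
            r₁ : ∀ b → (if b then 0 else w e) ≡ 0
            r₁ true  = refl
            r₁ false = pos-zero z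
          ... | inj₁ p with ca e | cb e
          ...   | ca′ | cb′ rewrite proj₁ (U′-supp e (pos⁻ p)) | proj₂ (U′-supp e (pos⁻ p)) with U (s e) | U (t e)
          ...     | true  | true  rewrite proj₂ (cb′ refl) = side₁ (c₁ e) (c e) (w e)
            where
            side₁ : ∀ x y z → x * 0 + y * 1 * z ≡ y * z + 0
            side₁ = solve-∀
          ...     | false | false rewrite proj₁ (cb′ refl) = side₂ (c₂ e) (c e) (w e)
            where
            side₂ : ∀ x y z → y * 1 * z + x * 0 ≡ y * z + 0
            side₂ = solve-∀
          ...     | true  | false = trans (sym (*-distribʳ-+ (w e) (c₁ e) (c₂ e))) (trans (cong (_* w e) (ca′ refl))
                                      (trans (*-distribʳ-+ (w e) (c e) _) (cong (λ x → c e * w e + x * w e) (sym (+-identityʳ (ac e + ad e))))))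
          ...     | false | true  = trans (sym (*-distribʳ-+ (w e) (c₁ e) (c₂ e))) (trans (cong (_* w e) (ca′ refl))
                                      (trans (*-distribʳ-+ (w e) (c e) _) (cong (λ x → c e * w e + x * w e) (sym (+-identityʳ (ac e + ad e))))))
        crossing : ∀ {M} → lin (λ e → ⟦ cut U e ⟧) (⟦_⟧ ∘ M) ≡ 1 → ∃ λ e → cut U e ≡ true × M e ≡ true
        crossing {M} one with count-pos⁻ (≤-reflexive (sym (trans (sym (lin-∧ (cut U) M)) one)))
        ... | e , h = e , proj₁ (∧⁻ h) , proj₂ (∧⁻ {cut U e} h)
        cancel : ∀ x x′ y y′ K K′ → x + K ≡ x′ + K′ → y + K ≡ y′ + K′ → x + y′ ≡ x′ + y
        cancel x x′ y y′ K K′ p q = +-cancelʳ-≡ (K + K′) (x + y′) (x′ + y)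
          (trans (swap₁ x y′ K K′) (trans (cong₂ _+_ p (sym q)) (swap₂ x′ K′ y K)))
          where
          swap₁ : ∀ a b c d → a + b + (c + d) ≡ (a + c) + (b + d)
          swap₁ = solve-∀
          swap₂ : ∀ a b c d → (a + b) + (c + d) ≡ a + c + (d + b)
          swap₂ = solve-∀
        -- Both M and the chosen matching `A e` glue with `B e` to perfect matchings of the whole.
        -- Combining the two balance equations eliminates everything contributed by `B e` and by the
        -- edge `e`.
        bal₁ : Balanced C₁.s₁ C₁.t₁ C₁.P₁ (C₁.restrict w) c₁ d₁
        bal₁ M pm with crossing (C₁.crosses-once Uu₁ U⊑P reg pm)
        ... | e , ce , Me with proj₂ (choose e) ce (proj₂ (C₁.restrict-pos {w} (C₁.E₁.PerfectM.supp pm e Me)))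
        ...   | (pmA , Ae) , (pmB , Be) = trans (lin-crossing (cut U) M once e ce Me (cA c) ad (cA-cut c))
                (trans (cancel (lin (cA c) (⟦_⟧ ∘ M)) (lin (cA d) (⟦_⟧ ∘ M)) (ac e) (ad e)
                         (lin (cB c) (⟦_⟧ ∘ B e) + c e) (lin (cB d) (⟦_⟧ ∘ B e) + d e) (via pm Me) (via pmA Ae))
                  (sym (lin-crossing (cut U) M once e ce Me (cA d) ac (cA-cut d))))
          where
          once = C₁.crosses-once Uu₁ U⊑P reg pm
          via : ∀ {M} → C₁.E₁.PerfectM C₁.P₁ (C₁.restrict w) M → M e ≡ true →
                lin (cA c) (⟦_⟧ ∘ M) + (lin (cB c) (⟦_⟧ ∘ B e) + c e) ≡ lin (cA d) (⟦_⟧ ∘ M) + (lin (cB d) (⟦_⟧ ∘ B e) + d e)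
          via {M} pm′ Me′ = trans (sym (+-assoc (lin (cA c) (⟦_⟧ ∘ M)) _ _)) (trans (sym (G.lin-glue c)) (trans (bal G.M G.perfect)
              (trans (G.lin-glue d) (+-assoc (lin (cA d) (⟦_⟧ ∘ M)) _ _))))
            where module G = Glue pm′ pmB e ce Me′ Be
        once₂ : ∀ {M} → C₂.E₁.PerfectM C₂.P₁ (C₂.restrict w) M → wt (⟦_⟧ ∘ M) U ≡ 1
        once₂ {M} pm = trans (sym (wt-U′ (⟦_⟧ ∘ M) λ e h → proj₂ (C₂.restrict-pos {w} (C₂.E₁.PerfectM.supp pm e (⟦⟧-true h)))))
          (C₂.crosses-once U′u₂ U′⊑P reg pm)
        -- Here M is glued to `A e`, whose value is already built into `c₂` and `d₂` on the cut.
        bal₂ : Balanced C₂.s₁ C₂.t₁ C₂.P₁ (C₂.restrict w) c₂ d₂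
        bal₂ M pm with crossing (once₂ pm)
        ... | e , ce , Me with proj₂ (choose e) ce (proj₂ (C₂.restrict-pos {w} (C₂.E₁.PerfectM.supp pm e Me)))
        ...   | (pmA , Ae) , _ = trans (lin-crossing (cut U) M (once₂ pm) e ce Me (cB c) (λ e → c e + ac e) (cB-cut c))
                (trans (rot (lin (cB c) (⟦_⟧ ∘ M)) (c e) (ac e)) (trans (sym (G.lin-glue c)) (trans (bal G.M G.perfect)
                (trans (G.lin-glue d) (trans (sym (rot (lin (cB d) (⟦_⟧ ∘ M)) (d e) (ad e)))
                  (sym (lin-crossing (cut U) M (once₂ pm) e ce Me (cB d) (λ e → d e + ad e) (cB-cut d))))))))
          where
          module G = Glue pmA pm e ce Ae Me
          rot : ∀ x y z → x + (y + z) ≡ z + x + y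
          rot = solve-∀
        eq₁ : lin c₁ (C₁.restrict w) ≡ lin d₁ (C₁.restrict w)
        eq₁ = claim C₁.s₁ C₁.t₁ C₁.P₁ (C₁.restrict w) r c₁ d₁ le₁ reg₁ bal₁
        eq₂ : lin c₂ (C₂.restrict w) ≡ lin d₂ (C₂.restrict w)
        eq₂ = claim C₂.s₁ C₂.t₁ C₂.P₁ (C₂.restrict w) r c₂ d₂ le₂ reg₂ bal₂

open WeightedContraction

-- Edmonds' theorem by repeated removal of perfect matchings

module PerfectMatchingWeights where

  minimum : ∀ {k} (p : Pred k) (g : Fin k → ℕ) m i → p i ≡ true → g i ≤ m →
            ∃ λ j → p j ≡ true × (∀ i → p i ≡ true → g j ≤ g i)
  minimum p g m i pi le with any? (λ j → (p j Bool.≟ true) ×-dec (g j <? g i))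
  ... | no ∄ = i , pi , λ j pj → ≮⇒≥ λ lt → ∄ (j , pj , lt)
  minimum p g zero    i pi le | yes (j , pj , lt) = contradiction (≤-trans lt le) λ ()
  minimum p g (suc m) i pi le | yes (j , pj , lt) = minimum p g m j pj (≤-pred (≤-trans lt le))

  -- Transitivity is required only through a middle element satisfying C. The order used below
  -- compares fractions by cross-multiplication, which is transitive only when the middle
  -- denominator is positive.
  minimal-subset : ∀ n (C : Subset n → Set) → (∀ x → Dec (C x)) → (_≼_ : Subset n → Subset n → Set) →
    (∀ x y → x ≼ y ⊎ y ≼ x) → (∀ {x y z} → C y → x ≼ y → y ≼ z → x ≼ z) → ∃ C →
    ∃ λ x → C x × (∀ y → C y → x ≼ y)
  minimal-subset zero C C? _≼_ total tr ([] , c) = [] , c , λ { [] _ → refl′ (total [] []) }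
    where
    refl′ : [] ≼ [] ⊎ [] ≼ [] → [] ≼ []
    refl′ (inj₁ h) = h
    refl′ (inj₂ h) = h
  minimal-subset (suc n) C C? _≼_ total tr (z , Cz) with half true | half false
    where
    half : ∀ b → (∃ λ x → C (b ∷ x) × (∀ y → C (b ∷ y) → (b ∷ x) ≼ (b ∷ y))) ⊎ (∀ x → ¬ C (b ∷ x))
    half b with anySubset? (λ x → C? (b ∷ x))
    ... | no ∄  = inj₂ λ x c → ∄ (x , c)
    ... | yes c = inj₁ (minimal-subset n (λ x → C (b ∷ x)) (λ x → C? (b ∷ x)) (λ x y → (b ∷ x) ≼ (b ∷ y))
                    (λ x y → total (b ∷ x) (b ∷ y)) tr c)
  ... | inj₂ ∄t | inj₂ ∄f = ⊥-elim (nothing′ z Cz)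
    where
    nothing′ : ∀ z → C z → ⊥
    nothing′ (true  ∷ z) = ∄t z
    nothing′ (false ∷ z) = ∄f z
  ... | inj₁ (x , Cx , mx) | inj₂ ∄f = true ∷ x , Cx , λ { (true ∷ y) Cy → mx y Cy ; (false ∷ y) Cy → contradiction Cy (∄f y) }
  ... | inj₂ ∄t | inj₁ (x , Cx , mx) = false ∷ x , Cx , λ { (false ∷ y) Cy → mx y Cy ; (true ∷ y) Cy → contradiction Cy (∄t y) }
  ... | inj₁ (x , Cx , mx) | inj₁ (y , Cy , my) with total (true ∷ x) (false ∷ y)
  ...   | inj₁ le = true ∷ x , Cx , λ { (true ∷ v) Cv → mx v Cv ; (false ∷ v) Cv → tr Cy le (my v Cv) }
  ...   | inj₂ le = false ∷ y , Cy , λ { (false ∷ v) Cv → my v Cv ; (true ∷ v) Cv → tr Cx le (mx v Cv) }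

  module _ {n k : ℕ} (s t : Fin k → Fin n) where
    open Edges s t

    odd-crossing : ∀ {P w r M} → Regular P w r → PerfectM P w M → ∀ U → U ⊑ P → odd (wt (⟦_⟧ ∘ M) U) ≡ odd (count U)
    odd-crossing {M = M} reg pm U U⊑P = EdgeLemmas.cut-parity s t (⟦_⟧ ∘ M) U λ v Uv → cong odd
      (trans (sym (EdgeLemmas.wt-δ s t (⟦_⟧ ∘ M) v (λ e h → Regular.noloop reg e (PerfectM.supp pm e (⟦⟧-true h))))) (PerfectM.deg pm v (U⊑P v Uv)))

    -- From `a` copies of w, `b` copies of M are removed: the step length is the fraction b/a, kept
    -- as a pair of natural numbers. `cut-ok` is the odd cut condition for the difference,
    -- rearranged so that no subtraction occurs.
    module Scale {P w r M} (reg : Regular P w r) (pm : PerfectM P w M) (a b : ℕ) (a≥1 : 1 ≤ a)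
      (edge-ok : ∀ e → b * ⟦ M e ⟧ ≤ a * w e) (r-ok : b ≤ a * r)
      (cut-ok : ∀ U → U ⊑ P → odd (count U) ≡ true → a * r + b * wt (⟦_⟧ ∘ M) U ≤ a * wt w U + b) where
      open Regular reg

      w′ : Fin k → ℕ
      w′ e = a * w e ∸ b * ⟦ M e ⟧

      lin-w′ : ∀ c → lin c w′ + b * lin c (⟦_⟧ ∘ M) ≡ a * lin c w
      lin-w′ c = trans (cong (lin c w′ +_) (sym (lin-* c (⟦_⟧ ∘ M) b))) (trans (sym (lin-+ c w′ _))
        (trans (lin-cong λ e → cong (c e *_) (m∸n+n≡m (edge-ok e))) (lin-* c w a)))

      supp′ : ∀ e → 1 ≤ w′ e → 1 ≤ w e
      supp′ e h with w e in eq
      ... | suc m = s≤s z≤n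
      ... | zero rewrite *-zeroʳ a | 0∸n≡0 (b * ⟦ M e ⟧) = h

      reg′ : Regular P w′ (a * r ∸ b)
      reg′ = record
        { ends = λ e h → ends e (supp′ e h) ; noloop = λ e h → noloop e (supp′ e h) ; even = even
        ; deg = λ v Pv → sym (trans (cong (_∸ b) (trans (cong (a *_) (sym (deg v Pv))) (sym (trans (cong (wt w′ (δ v) +_) (sym (trans (cong (b *_) (PerfectM.deg pm v Pv)) (*-identityʳ b)))) (lin-w′ _))))) (m+n∸n≡m _ b))
        ; oddcut = λ U U⊑P o → +-cancelʳ-≤ (b + b * wt (⟦_⟧ ∘ M) U) _ _ (begin
            (a * r ∸ b) + (b + b * wt (⟦_⟧ ∘ M) U)  ≡⟨ +-assoc (a * r ∸ b) b _ ⟨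
            (a * r ∸ b) + b + b * wt (⟦_⟧ ∘ M) U    ≡⟨ cong (_+ b * wt (⟦_⟧ ∘ M) U) (m∸n+n≡m r-ok) ⟩
            a * r + b * wt (⟦_⟧ ∘ M) U              ≤⟨ cut-ok U U⊑P o ⟩
            a * wt w U + b                          ≡⟨ cong (_+ b) (lin-w′ _) ⟨
            wt w′ U + b * wt (⟦_⟧ ∘ M) U + b        ≡⟨ rot (wt w′ U) (b * wt (⟦_⟧ ∘ M) U) b ⟩
            wt w′ U + (b + b * wt (⟦_⟧ ∘ M) U)      ∎) }
        where
        open ≤-Reasoning
        rot : ∀ x y z → x + y + z ≡ x + (z + y)
        rot = solve-∀

      balanced′ : ∀ {c d} → Balanced s t P w c d → Balanced s t P w′ c d
      balanced′ bal N pmN = bal N record { supp = λ e h → supp′ e (PerfectM.supp pmN e h) ; deg = PerfectM.deg pmN }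

      conclude : ∀ {c d} → Balanced s t P w c d → lin c w′ ≡ lin d w′ → lin c w ≡ lin d w
      conclude {c} {d} bal eq = *-cancelˡ-≡ (lin c w) (lin d w) a {{ℕ.>-nonZero a≥1}}
        (trans (sym (lin-w′ c)) (trans (cong₂ _+_ eq (cong (b *_) (bal M pm))) (lin-w′ d)))

  -- The multiple of M removed is the largest one allowed: then either an edge of M disappears from the support
  -- or some odd cut crossed more than once by M becomes tight and can be contracted.
  claim : ∀ {n k} N → Claim {n} {k} N
  claim {n} {k} zero s t P w r c d le reg bal = trans (zeros c) (sym (zeros d))
    where
    open Edges s t
    open Regular reg
    zeros : ∀ c → lin c w ≡ 0
    zeros c = lin-0 pt
      where
      pt : ∀ e → c e * w e ≡ 0
      pt e with w e in eq
      ... | zero  = *-zeroʳ (c e)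
      ... | suc m = contradiction (≤-trans (count-pos (s e) (proj₁ (ends e (subst (1 ≤_) (sym eq) (s≤s z≤n))))) le) λ ()
  claim {n} {k} (suc N) s t P w₀ r₀ c d le reg₀ bal₀ = loop (count (pos ∘ w₀)) w₀ r₀ reg₀ bal₀ ≤-refl
    where
    open Edges s t
    loop : ∀ K w r → Regular P w r → Balanced s t P w c d → count (pos ∘ w) ≤ K → lin c w ≡ lin d w
    loop K w r reg bal leK with any? (λ e → pos (w e) Bool.≟ true)
    ... | no ∄ = trans (zeros c) (sym (zeros d))
      where
      zeros : ∀ c → lin c w ≡ 0
      zeros c = lin-0 λ e → trans (cong (c e *_) (pos-zero (≢true⇒false λ h → ∄ (e , h)))) (*-zeroʳ (c e))
    loop zero    w r reg bal leK | yes (e₀ , p₀) = contradiction (≤-trans (count-pos e₀ p₀) leK) λ ()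
    loop (suc K) w r reg bal leK | yes (e₀ , p₀) with EdgeLemmas.perfect-through s t reg e₀ (pos⁻ p₀)
    ... | M , pm , Me₀ with minimum M w (w e₀) e₀ Me₀ ≤-refl
    ...   | f , Mf , fmin = decide (anySubset? violated?)
      where
      open Regular reg
      -- Removing λ copies of M keeps the condition at the odd cut U exactly when λ times the excess
      -- `a U` is at most the slack `b U`. The edges allow λ up to `w f`, the least weight on M. A
      -- set is `Violated` when its ratio `b U / a U` is a stricter limit than that.
      x a b : Pred n → ℕ
      x U = wt (⟦_⟧ ∘ M) U
      a U = x U ∸ 1
      b U = wt w U ∸ r
      C : Subset n → Set
      C y = lookup y ⊑ P × odd (count (lookup y)) ≡ true × 2 ≤ x (lookup y)
      C? : ∀ y → Dec (C y)
      C? y = ⊑? _ _ ×-dec (_ Bool.≟ _) ×-dec (_ ≤? _)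
      Violated : Subset n → Set
      Violated y = C y × b (lookup y) < w f * a (lookup y)
      violated? : ∀ y → Dec (Violated y)
      violated? y = C? y ×-dec (_ <? _)
      r≥w : ∀ e → 1 ≤ w e → w e ≤ r
      r≥w e h = ≤-trans (≤-trans (≤-reflexive (sym (trans (cong (λ b → ⟦ b ⟧ * w e) crosses) (+-identityʳ (w e)))))
          (≤-trans (≤-sum (λ e′ → ⟦ cut (δ (s e)) e′ ⟧ * w e′) e) (≤-reflexive (sym (lin≡sum _ w)))))
          (≤-reflexive (deg (s e) (proj₁ (ends e h))))
        where
        crosses : cut (δ (s e)) e ≡ true
        crosses rewrite δ-refl (s e) | δ-false (noloop e h) = refl
      x≥1 : ∀ U → U ⊑ P → odd (count U) ≡ true → 1 ≤ x U
      x≥1 U U⊑ o = odd-pos (trans (odd-crossing s t reg pm U U⊑) o)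
      from-ratio : ∀ a₀ b₀ U → U ⊑ P → odd (count U) ≡ true → b₀ * a U ≤ a₀ * b U → a₀ * r + b₀ * x U ≤ a₀ * wt w U + b₀
      from-ratio a₀ b₀ U U⊑ o h = begin
        a₀ * r + b₀ * x U              ≡⟨ cong (λ z → a₀ * r + b₀ * z) (m+[n∸m]≡n (x≥1 U U⊑ o)) ⟨
        a₀ * r + b₀ * (1 + a U)        ≡⟨ expand a₀ b₀ r (a U) ⟩
        a₀ * r + b₀ + b₀ * a U         ≤⟨ +-monoʳ-≤ (a₀ * r + b₀) h ⟩
        a₀ * r + b₀ + a₀ * b U         ≡⟨ collect a₀ b₀ r (b U) ⟩
        a₀ * (r + b U) + b₀            ≡⟨ cong (λ z → a₀ * z + b₀) (m+[n∸m]≡n (oddcut U U⊑ o)) ⟩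
        a₀ * wt w U + b₀               ∎
        where
        open ≤-Reasoning
        expand : ∀ a b r x → a * r + b * (1 + x) ≡ a * r + b + b * x
        expand = solve-∀
        collect : ∀ a b r y → a * r + b + a * y ≡ a * (r + y) + b
        collect = solve-∀
      edge-from : ∀ a₀ b₀ → (∀ e → M e ≡ true → b₀ ≤ a₀ * w e) → ∀ e → b₀ * ⟦ M e ⟧ ≤ a₀ * w e
      edge-from a₀ b₀ h e with M e in eq
      ... | true  = ≤-trans (≤-reflexive (*-identityʳ b₀)) (h e eq)
      ... | false = ≤-trans (≤-reflexive (*-zeroʳ b₀)) z≤n
      small-x : ∀ a₀ b₀ U → ¬ 2 ≤ x U → b₀ * a U ≤ a₀ * b U
      small-x a₀ b₀ U h = ≤-trans (≤-reflexive (trans (cong (b₀ *_) (m≤n⇒m∸n≡0 (≤-pred (≰⇒> h)))) (*-zeroʳ b₀))) z≤n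
      a-cong : ∀ {p q : Pred n} → (∀ i → p i ≡ q i) → a p ≡ a q
      a-cong e = cong (_∸ 1) (wt-cong (⟦_⟧ ∘ M) e)
      b-cong : ∀ {p q : Pred n} → (∀ i → p i ≡ q i) → b p ≡ b q
      b-cong e = cong (_∸ r) (wt-cong w e)
      C-tab : ∀ U → U ⊑ P → odd (count U) ≡ true → 2 ≤ x U → C (tabulate U)
      C-tab U U⊑ o x≥ = (λ i h → U⊑ i (trans (sym (lookup∘tabulate U i)) h)) , trans (cong odd (count-cong (lookup∘tabulate U))) o
        , ≤-trans x≥ (≤-reflexive (wt-cong (⟦_⟧ ∘ M) λ i → sym (lookup∘tabulate U i)))
      decide : Dec (∃ Violated) → lin c w ≡ lin d w
      decide (no ∄) = Sc.conclude bal (loop K Sc.w′ _ Sc.reg′ (Sc.balanced′ bal) (≤-pred (≤-trans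
          (count-⊏ f (λ e h → pos⁺ (Sc.supp′ e (pos⁻ h))) gone (pos⁺ (PerfectM.supp pm f Mf))) leK)))
        where
        ratio : ∀ U → U ⊑ P → odd (count U) ≡ true → w f * a U ≤ 1 * b U
        ratio U U⊑ o with 2 ≤? x U
        ... | no h  = small-x 1 (w f) U h
        ... | yes h = ≤-trans (≮⇒≥ λ lt → ∄ (tabulate U , C-tab U U⊑ o h
                , subst₂ (λ y z → y < w f * z) (b-cong λ i → sym (lookup∘tabulate U i)) (a-cong λ i → sym (lookup∘tabulate U i)) lt))
                (≤-reflexive (sym (*-identityˡ (b U))))
        module Sc = Scale s t reg pm 1 (w f) ≤-refl
          (edge-from 1 (w f) λ e Me → ≤-trans (fmin e Me) (≤-reflexive (sym (*-identityˡ (w e)))))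
          (≤-trans (r≥w f (PerfectM.supp pm f Mf)) (≤-reflexive (sym (*-identityˡ r))))
          (λ U U⊑ o → from-ratio 1 (w f) U U⊑ o (ratio U U⊑ o))
        gone : pos (Sc.w′ f) ≡ false
        gone rewrite Mf | *-identityʳ (w f) | +-identityʳ (w f) | n∸n≡0 (w f) = refl
      decide (yes (y₀ , Cy₀ , viol)) with minimal-subset n C C? (λ y z → b (lookup y) * a (lookup z) ≤ b (lookup z) * a (lookup y))
          (λ y z → ≤-total _ _) (λ {y} {z} {v} Cz p q → cross (b (lookup y)) (a (lookup y)) (b (lookup z)) (a (lookup z)) (b (lookup v)) (a (lookup v))
            (a≥ {z} Cz) p q) (y₀ , Cy₀)
        where
        a≥ : ∀ {z} → C z → 1 ≤ a (lookup z)
        a≥ (_ , _ , h) = ∸-monoˡ-≤ 1 h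
        cross : ∀ b₁ a₁ b₂ a₂ b₃ a₃ → 1 ≤ a₂ → b₁ * a₂ ≤ b₂ * a₁ → b₂ * a₃ ≤ b₃ * a₂ → b₁ * a₃ ≤ b₃ * a₁
        cross b₁ a₁ b₂ a₂ b₃ a₃ pa p q = *-cancelˡ-≤ a₂ {{ℕ.>-nonZero pa}} (begin
          a₂ * (b₁ * a₃)  ≡⟨ e₁ a₂ b₁ a₃ ⟩
          b₁ * a₂ * a₃    ≤⟨ *-monoˡ-≤ a₃ p ⟩
          b₂ * a₁ * a₃    ≡⟨ e₂ b₂ a₁ a₃ ⟩
          b₂ * a₃ * a₁    ≤⟨ *-monoˡ-≤ a₁ q ⟩
          b₃ * a₂ * a₁    ≡⟨ e₃ b₃ a₂ a₁ ⟩
          a₂ * (b₃ * a₁)  ∎)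
          where
          open ≤-Reasoning
          e₁ : ∀ x y z → x * (y * z) ≡ y * x * z
          e₁ = solve-∀
          e₂ : ∀ x y z → x * y * z ≡ x * z * y
          e₂ = solve-∀
          e₃ : ∀ x y z → x * y * z ≡ y * (x * z)
          e₃ = solve-∀
      ... | y , (U⊑ , oU , x≥2) , least = Sc.conclude bal
            (Split.contract-step s t Sc.reg′ U U⊑ oU tight u₁ Uu₁ u₂ U′u₂
              (Split.choose s t Sc.reg′ U U⊑ oU tight u₁ Uu₁ u₂ U′u₂) N (claim N) c d le₁ le₂ (Sc.balanced′ bal))
        where
        U : Pred n
        U = lookup y
        a≥1 : 1 ≤ a U
        a≥1 = ∸-monoˡ-≤ 1 x≥2
        a₀≥1 : 1 ≤ a (lookup y₀)
        a₀≥1 = ∸-monoˡ-≤ 1 (proj₂ (proj₂ Cy₀))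
        ratio : ∀ X → X ⊑ P → odd (count X) ≡ true → b U * a X ≤ a U * b X
        ratio X X⊑ o with 2 ≤? x X
        ... | no h  = small-x (a U) (b U) X h
        ... | yes h = ≤-trans (subst₂ (λ z z′ → b U * z ≤ z′ * a U) (a-cong (lookup∘tabulate X)) (b-cong (lookup∘tabulate X))
                (least (tabulate X) (C-tab X X⊑ o h))) (≤-reflexive (*-comm (b X) (a U)))
        bU≤ : b U ≤ a U * w f
        bU≤ = *-cancelʳ-≤ (b U) (a U * w f) (a (lookup y₀)) {{ℕ.>-nonZero a₀≥1}} (begin
          b U * a (lookup y₀)            ≤⟨ least y₀ Cy₀ ⟩
          b (lookup y₀) * a U            ≤⟨ *-monoˡ-≤ (a U) (<⇒≤ viol) ⟩
          w f * a (lookup y₀) * a U      ≡⟨ e (w f) (a (lookup y₀)) (a U) ⟩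
          a U * w f * a (lookup y₀)      ∎)
          where
          open ≤-Reasoning
          e : ∀ x y z → x * y * z ≡ z * x * y
          e = solve-∀
        module Sc = Scale s t reg pm (a U) (b U) a≥1
          (edge-from (a U) (b U) λ e Me → ≤-trans bU≤ (*-monoʳ-≤ (a U) (fmin e Me)))
          (≤-trans bU≤ (*-monoʳ-≤ (a U) (r≥w f (PerfectM.supp pm f Mf))))
          (λ X X⊑ o → from-ratio (a U) (b U) X X⊑ o (ratio X X⊑ o))
        tight : wt Sc.w′ U ≡ a U * r ∸ b U
        tight = +-cancelʳ-≡ (b U * x U) _ _ (trans (Sc.lin-w′ _) (begin
          a U * wt w U                            ≡⟨ cong (a U *_) (m+[n∸m]≡n (oddcut U U⊑ oU)) ⟨
          a U * (r + b U)                         ≡⟨ *-distribˡ-+ (a U) r (b U) ⟩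
          a U * r + a U * b U                     ≡⟨ cong (_+ a U * b U) (m∸n+n≡m (≤-trans bU≤ (*-monoʳ-≤ (a U) (r≥w f (PerfectM.supp pm f Mf))))) ⟨
          (a U * r ∸ b U) + b U + a U * b U       ≡⟨ e (a U * r ∸ b U) (b U) (a U) ⟩
          (a U * r ∸ b U) + b U * (1 + a U)       ≡⟨ cong (λ z → (a U * r ∸ b U) + b U * z) (m+[n∸m]≡n (≤-trans (s≤s z≤n) x≥2)) ⟩
          (a U * r ∸ b U) + b U * x U             ∎))
          where
          open ≡-Reasoning
          e : ∀ x y z → x + y + z * y ≡ x + y * (1 + z)
          e = solve-∀
        -- A single vertex is met once by M, while M crosses U at least twice. So both shores have
        -- at least two vertices and both contractions are smaller.
        big : ∀ X → X ⊑ P → 2 ≤ x X → ∀ u → X u ≡ true → ∃ λ v → X v ≡ true × u ≢ v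
        big X X⊑ h u Xu with any? (λ v → (X ∖ u) v Bool.≟ true)
        ... | yes (v , q) = v , ∖⁻ X q
        ... | no ∄ = contradiction (≤-trans h (≤-reflexive (trans (wt-cong (⟦_⟧ ∘ M) only) (PerfectM.deg pm u (X⊑ u Xu))))) λ { (s≤s ()) }
          where
          only : ∀ v → X v ≡ δ u v
          only v with u ≟ v
          ... | yes refl = trans Xu (sym (δ-refl u))
          ... | no ne = trans (≢true⇒false λ Xv → ∄ (v , ∖⁺ X Xv ne)) (sym (δ-false ne))
        U′ : Pred n
        U′ v = P v ∧ not (U v)
        count-P : count P ≡ count U + count U′
        count-P = trans (count-split P U) (cong (_+ count U′)
          (count-cong λ v → ≡-by-truth (λ h → proj₂ (∧⁻ {P v} h)) λ h → ∧⁺ (U⊑ v h) h))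
        u₁∈ : ∃ λ u → U u ≡ true
        u₁∈ = count-pos⁻ (odd-pos oU)
        oU′ : odd (count U′) ≡ true
        oU′ = trans (sym (Bool.not-involutive _)) (cong not (trans (sym (trans (cong odd count-P)
          (trans (odd-+ (count U) _) (cong (_xor odd (count U′)) oU)))) even))
        u₂∈ : ∃ λ u → U′ u ≡ true
        u₂∈ = count-pos⁻ (odd-pos oU′)
        u₁ = proj₁ u₁∈
        Uu₁ = proj₂ u₁∈
        u₂ = proj₁ u₂∈
        U′u₂ = proj₂ u₂∈
        x-U′ : x U′ ≡ x U
        x-U′ = lin-cong pt
          where
          nx : ∀ p q → not p xor not q ≡ p xor q
          nx true  q = refl
          nx false true = refl
          nx false false = refl
          pt : ∀ e → ⟦ cut U′ e ⟧ * ⟦ M e ⟧ ≡ ⟦ cut U e ⟧ * ⟦ M e ⟧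
          pt e with M e in eq
          ... | false = trans (*-zeroʳ ⟦ cut U′ e ⟧) (sym (*-zeroʳ ⟦ cut U e ⟧))
          ... | true with ends e (PerfectM.supp pm e eq)
          ...   | p , q rewrite p | q = cong (λ b → ⟦ b ⟧ * 1) (nx (U (s e)) (U (t e)))
        two : ∀ X → X ⊑ P → 2 ≤ x X → ∀ u → X u ≡ true → 2 ≤ count X
        two X X⊑ h u Xu with big X X⊑ h u Xu
        ... | v , Xv , ne = ≤-trans (s≤s (count-pos v (∖⁺ X Xv ne))) (≤-reflexive (sym (count-∖ u Xu)))
        2≤U : 2 ≤ count U
        2≤U = two U U⊑ x≥2 (proj₁ u₁∈) (proj₂ u₁∈)
        2≤U′ : 2 ≤ count U′
        2≤U′ = two U′ (λ v h → proj₁ (∧⁻ h)) (≤-trans x≥2 (≤-reflexive (sym x-U′))) (proj₁ u₂∈) (proj₂ u₂∈)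
        le₁ : count (Contract.P₁ s t P U u₁) ≤ N
        le₁ = ≤-pred (≤-trans (s≤s (≤-reflexive (Contract.count-P₁ s t P U u₁ Uu₁ U⊑ Sc.reg′)))
          (≤-trans (+-monoˡ-≤ (count U′) 2≤U) (≤-trans (≤-reflexive (sym count-P)) le)))
        le₂ : count (Contract.P₁ s t P U′ u₂) ≤ N
        le₂ = ≤-pred (≤-trans (s≤s (≤-reflexive (trans (Contract.count-P₁ s t P U′ u₂ U′u₂ (λ v h → proj₁ (∧⁻ h)) Sc.reg′) (cong suc (count-cong rest≡)))))
          (≤-trans (+-monoˡ-≤ (count U) 2≤U′) (≤-trans (≤-reflexive (trans (+-comm (count U′) (count U)) (sym count-P))) le)))
          where
          rest≡ : ∀ v → (P v ∧ not (U′ v)) ≡ U v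
          rest≡ v with U v in eq
          ... | true  rewrite U⊑ v eq = refl
          ... | false with P v
          ...   | true  = refl
          ...   | false = refl

open PerfectMatchingWeights

-- Cubic graphs: degrees, tight cuts, and 3-connectedness by edge cuts

module CubicGraphs where

  -- Truth tables. Submodular inequalities for cuts are checked one edge at a time, as statements
  -- about the membership of its two ends in the sets concerned.
  tautology : ∀ k → (Vec Bool k → Bool) → Bool
  tautology zero    f = f []
  tautology (suc k) f = tautology k (f ∘ (true ∷_)) ∧ tautology k (f ∘ (false ∷_))

  tautology⁻ : ∀ k f → tautology k f ≡ true → ∀ bs → f bs ≡ true
  tautology⁻ zero    f h []          = h
  tautology⁻ (suc k) f h (true  ∷ bs) = tautology⁻ k (f ∘ (true ∷_)) (proj₁ (∧⁻ h)) bs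
  tautology⁻ (suc k) f h (false ∷ bs) = tautology⁻ k (f ∘ (false ∷_)) (proj₂ (∧⁻ {tautology k (f ∘ (true ∷_))} h)) bs

  infixr 3 _⇒ᵇ_
  _⇒ᵇ_ : Bool → Bool → Bool
  a ⇒ᵇ b = not a ∨ b

  ⇒ᵇ⁻ : ∀ {a b} → (a ⇒ᵇ b) ≡ true → a ≡ true → b ≡ true
  ⇒ᵇ⁻ h refl = h

  ⇒ᵇ⁺ : ∀ {a b} → (a ≡ true → b ≡ true) → (a ⇒ᵇ b) ≡ true
  ⇒ᵇ⁺ {true}  h = h refl
  ⇒ᵇ⁺ {false} h = refl

  ≤ᵇ⁻ : ∀ {m n} → (m ℕ.≤ᵇ n) ≡ true → m ≤ n
  ≤ᵇ⁻ {m} {n} h = ≤ᵇ⇒≤ m n (subst Data.Bool.T (sym h) _)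

  ∣∣≡count : ∀ {n} (p : Subset n) → ∣ p ∣ ≡ count (lookup p)
  ∣∣≡count []          = sym (count-empty λ ())
  ∣∣≡count (true  ∷ p) = trans (cong suc (∣∣≡count p)) (sym (count-suc _))
  ∣∣≡count (false ∷ p) = trans (∣∣≡count p) (sym (count-suc _))

  ∈⇒true : ∀ {n} {p : Subset n} {i} → i ∈ p → lookup p i ≡ true
  ∈⇒true = []=⇒lookup

  true⇒∈ : ∀ {n} {p : Subset n} {i} → lookup p i ≡ true → i ∈ p
  true⇒∈ {p = p} {i} = lookup⇒[]= i p

  ∉⇒false : ∀ {n} {p : Subset n} {i} → i ∉ p → lookup p i ≡ false
  ∉⇒false h = ≢true⇒false (h ∘ true⇒∈)

  lookup-⁅⁆ : ∀ {n} (v u : Fin n) → lookup ⁅ v ⁆ u ≡ δ v u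
  lookup-⁅⁆ v u = ≡-by-truth (λ h → trans (cong (δ v) (x∈⁅y⁆⇒x≡y v (true⇒∈ h))) (δ-refl v))
    (λ h → subst (λ x → lookup ⁅ v ⁆ x ≡ true) (δ-true h) (∈⇒true (x∈⁅x⁆ v)))

  count-full : ∀ n → count {n} (const true) ≡ n
  count-full zero    = count-empty λ ()
  count-full (suc n) = trans (count-suc _) (cong suc (count-full n))

  module _ (G : Graph) where
    open Graph G using (src; tgt; size; loopless; ∂; ∂ᵥ; degreeIn; V; E)

    cutᴳ : Pred (order G) → Pred size
    cutᴳ = Edges.cut src tgt

    wtᴳ : (Fin size → ℕ) → Pred (order G) → ℕ
    wtᴳ = Edges.wt src tgt

    cutSize : Pred (order G) → ℕ
    cutSize = wtᴳ (const 1)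

    degᴳ : Pred size → V → ℕ
    degᴳ F v = wtᴳ (⟦_⟧ ∘ F) (δ v)

    wt-δᴳ : ∀ w v → wtᴳ w (δ v) ≡ Edges.dg src tgt w v
    wt-δᴳ w v = EdgeLemmas.wt-δ src tgt w v λ e _ → loopless e

    lookup-∂ : ∀ X e → lookup (∂ X) e ≡ cutᴳ (lookup X) e
    lookup-∂ X e = lookup∘tabulate _ e

    ∣∂∩∣≡ : ∀ X F → ∣ ∂ X ∩ F ∣ ≡ wtᴳ (⟦_⟧ ∘ lookup F) (lookup X)
    ∣∂∩∣≡ X F = trans (∣∣≡count (∂ X ∩ F)) (trans (count-cong λ e → trans (lookup-zipWith _∧_ e (∂ X) F) (cong (_∧ lookup F e) (lookup-∂ X e)))
      (sym (lin-∧ (cutᴳ (lookup X)) (lookup F))))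

    cutSize≡count : ∀ U → cutSize U ≡ count (cutᴳ U)
    cutSize≡count U = trans (lin-sum λ e → *-identityʳ _) (sym (count≡sum _))

    ∣∂∣≡ : ∀ X → ∣ ∂ X ∣ ≡ cutSize (lookup X)
    ∣∂∣≡ X = trans (∣∣≡count (∂ X)) (trans (count-cong (lookup-∂ X)) (sym (cutSize≡count (lookup X))))

    degreeIn≡ : ∀ F v → degreeIn F v ≡ degᴳ (lookup F) v
    degreeIn≡ F v = trans (∣∂∩∣≡ ⁅ v ⁆ F) (Edges.wt-cong src tgt _ (lookup-⁅⁆ v))

    degᴳ-cong : ∀ {F F′ : Pred size} → (∀ e → F e ≡ F′ e) → ∀ v → degᴳ F v ≡ degᴳ F′ v
    degᴳ-cong h v = lin-cong λ e → cong (λ b → ⟦ cutᴳ (δ v) e ⟧ * ⟦ b ⟧) (h e)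

    degreeIn-tabulate : ∀ F v → degreeIn (tabulate F) v ≡ degᴳ F v
    degreeIn-tabulate F v = trans (degreeIn≡ (tabulate F) v) (degᴳ-cong (lookup∘tabulate F) v)

    ∣∂ᵥ∣≡ : ∀ v → ∣ ∂ᵥ v ∣ ≡ cutSize (δ v)
    ∣∂ᵥ∣≡ v = trans (∣∂∣≡ ⁅ v ⁆) (Edges.wt-cong src tgt _ (lookup-⁅⁆ v))

    cut-intro : ∀ {U e x y} → Graph.Joins G e x y → U x ≡ true → U y ≡ false → cutᴳ U e ≡ true
    cut-intro (inj₁ (refl , refl)) p q rewrite p | q = refl
    cut-intro (inj₂ (refl , refl)) p q rewrite p | q = refl

    cut-elim : ∀ U e → cutᴳ U e ≡ true → ∃ λ x → ∃ λ y → Graph.Joins G e x y × U x ≡ true × U y ≡ false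
    cut-elim U e h with bool (U (src e)) | bool (U (tgt e))
    ... | inj₁ a | inj₂ b = src e , tgt e , inj₁ (refl , refl) , a , b
    ... | inj₂ a | inj₁ b = tgt e , src e , inj₂ (refl , refl) , b , a
    ... | inj₁ a | inj₁ b = ⊥-elim (true≢false h (cong₂ _xor_ a b))
    ... | inj₂ a | inj₂ b = ⊥-elim (true≢false h (cong₂ _xor_ a b))

    cut-not : ∀ U e → cutᴳ (not ∘ U) e ≡ cutᴳ U e
    cut-not U e with U (src e) | U (tgt e)
    ... | true  | _     = refl
    ... | false | true  = refl
    ... | false | false = refl

    wt-not : ∀ w U → wtᴳ w (not ∘ U) ≡ wtᴳ w U
    wt-not w U = lin-cong λ e → cong (λ b → ⟦ b ⟧ * w e) (cut-not U e)

    -- For cubic graphs this is 3-connectedness, phrased with edge cuts.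
    record Good : Set where
      field
        cubic : ∀ v → cutSize (δ v) ≡ 3
        three : ∀ U u v → U u ≡ true → U v ≡ false → 3 ≤ cutSize U
        large : 2 ≤ order G

    Perfect : Pred size → Set
    Perfect F = ∀ v → degᴳ F v ≡ 1

    perfect⁺ : ∀ M → IsPerfectMatching G M → Perfect (lookup M)
    perfect⁺ M pm v = trans (sym (degreeIn≡ M v)) (pm v)

    perfect⁻ : ∀ F → Perfect F → IsPerfectMatching G (tabulate F)
    perfect⁻ F pm v = trans (degreeIn-tabulate F v) (pm v)

    odd-cut : ∀ F U → (∀ v → odd (degᴳ F v) ≡ true) → odd (wtᴳ (⟦_⟧ ∘ F) U) ≡ odd (count U)
    odd-cut F U h = EdgeLemmas.cut-parity src tgt (⟦_⟧ ∘ F) U λ v _ → trans (cong odd (sym (wt-δᴳ _ v))) (h v)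

    cubic-parity : (∀ v → cutSize (δ v) ≡ 3) → ∀ U → odd (cutSize U) ≡ odd (count U)
    cubic-parity cub U = EdgeLemmas.cut-parity src tgt (const 1) U λ v _ → cong odd (trans (sym (wt-δᴳ _ v)) (cub v))

    even-order : (∀ v → cutSize (δ v) ≡ 3) → odd (order G) ≡ false
    even-order cub = trans (cong odd (sym (count-full (order G)))) (trans (sym (cubic-parity cub (const true))) (cong odd (lin-0 λ e → refl)))

    module _ (good : Good) where
      open Good good

      regular : Edges.Regular src tgt (const true) (const 1) 3
      regular = record
        { ends = λ e _ → refl , refl ; noloop = λ e _ → loopless e ; deg = λ v _ → cubic v
        ; oddcut = oddcut ; even = trans (cong odd (count-full _)) (even-order cubic) }
        where
        oddcut : ∀ U → U ⊑ const true → odd (count U) ≡ true → 3 ≤ cutSize U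
        oddcut U _ o with count-pos⁻ (odd-pos o) | any? (λ v → U v Bool.≟ false)
        ... | u , Uu | yes (v , Uv) = three U u v Uu Uv
        ... | u , Uu | no ∄ = ⊥-elim (true≢false o (trans (cong odd (trans (count-cong λ v → ≢false⇒true λ h → ∄ (v , h)) (count-full _))) (even-order cubic)))

      abstract
        perfect-edge : ∀ e → ∃ λ F → Perfect F × F e ≡ true
        perfect-edge e with EdgeLemmas.perfect-through src tgt regular e ≤-refl
        ... | M , pm , Me = M , (λ v → Edges.PerfectM.deg pm v refl) , Me

        some-edge : E
        some-edge = proj₁ (count-pos⁻ {p = cutᴳ (δ (Data.Fin.fromℕ< large))}
          (≤-trans (s≤s z≤n) (≤-reflexive (trans (sym (cubic _)) (cutSize≡count (δ (Data.Fin.fromℕ< large)))))))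

      -- The number of crossings of X and the degree at `v₀` both equal 1 on every perfect matching.
      -- On the constant weighting 1 they are the size of the cut and the degree 3.
      tight⇒3 : ∀ X → (∀ F → Perfect F → wtᴳ (⟦_⟧ ∘ F) X ≡ 1) → cutSize X ≡ 3
      tight⇒3 X tight = trans (claim (count {order G} (const true)) src tgt (const true) (const 1) 3 _ _ ≤-refl regular
        (λ M pm → trans (tight M (pmG pm)) (sym (pmG pm v₀)))) (cubic v₀)
        where
        v₀ : V
        v₀ = src some-edge
        pmG : ∀ {M} → Edges.PerfectM src tgt (const true) (const 1) M → Perfect M
        pmG pm v = Edges.PerfectM.deg pm v refl

  few : ∀ {n} (p : Pred n) → count p ≤ 2 →
        (∀ i → p i ≡ false) ⊎ (∃ λ i → ∃ λ j → p i ≡ true × p j ≡ true × (∀ k → p k ≡ true → k ≡ i ⊎ k ≡ j))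
  few p le with any? (λ i → p i Bool.≟ true)
  ... | no ∄ = inj₁ λ i → ≢true⇒false λ h → ∄ (i , h)
  ... | yes (i , pi) with any? (λ j → (p ∖ i) j Bool.≟ true)
  ...   | no ∄ = inj₂ (i , i , pi , pi , λ k pk → inj₁ (only k pk))
    where
    only : ∀ k → p k ≡ true → k ≡ i
    only k pk with k ≟ i
    ... | yes e = e
    ... | no ne = contradiction (k , ∖⁺ p pk (ne ∘ sym)) ∄
  ...   | yes (j , pj) = inj₂ (i , j , pi , proj₁ (∖⁻ p pj) , cover)
    where
    cover : ∀ k → p k ≡ true → k ≡ i ⊎ k ≡ j
    cover k pk with k ≟ i | k ≟ j
    ... | yes e | _     = inj₁ e
    ... | no _  | yes e = inj₂ e
    ... | no ni | no nj = contradiction (≤-trans three le) λ { (s≤s (s≤s ())) }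
      where
      three : 3 ≤ count p
      three = ≤-trans (s≤s (≤-trans (s≤s (count-pos k (∖⁺ (p ∖ i) (∖⁺ p pk (ni ∘ sym)) (nj ∘ sym)))) (≤-reflexive (sym (count-∖ j pj)))))
                (≤-reflexive (sym (count-∖ i pi)))

  crossing-step : ∀ {n} {R : Fin n → Fin n → Set} (U : Pred n) {u v} → Star R u v → U u ≡ true → U v ≡ false →
                  ∃ λ x → ∃ λ y → R x y × U x ≡ true × U y ≡ false
  crossing-step U ε p q = ⊥-elim (true≢false p q)
  crossing-step U {u} (_◅_ {j = w} r rs) p q with bool (U w)
  ... | inj₁ t = crossing-step U rs t q
  ... | inj₂ f = u , w , r , p , f

  another : ∀ {n} (U : Pred n) u → U u ≡ true → (∀ v → U v ≡ δ u v) ⊎ ∃ λ v → U v ≡ true × u ≢ v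
  another U u Uu with any? (λ v → (U ∖ u) v Bool.≟ true)
  ... | yes (v , h) = inj₂ (v , ∖⁻ U h)
  ... | no ∄ = inj₁ only
    where
    only : ∀ v → U v ≡ δ u v
    only v with u ≟ v
    ... | yes refl = trans Uu (sym (δ-refl u))
    ... | no ne = trans (≢true⇒false λ Uv → ∄ (v , ∖⁺ U Uv ne)) (sym (δ-false ne))

  -- An edge cut with at most two edges is destroyed by deleting two vertices on opposite shores,
  -- one end of each edge. A shore consisting of one vertex has three cut edges, so otherwise each
  -- shore keeps a vertex and the deletion separates the graph.
  good⁺ : ∀ G → ThreeConnected G → Cubic G → Good G
  good⁺ G (big , conn) cub = record { cubic = cubic ; three = three ; large = big }
    where
    open Graph G using (src; tgt; size; V; E; Joins)
    cubic : ∀ v → cutSize G (δ v) ≡ 3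
    cubic v = trans (sym (∣∂ᵥ∣≡ G v)) (cub v)
    separated : ∀ (U : Pred (order G)) a d → (∀ e x y → Joins e x y → U x ≡ true → U y ≡ false → a ≡ x ⊎ d ≡ y) →
      ∀ u v → U u ≡ true → U v ≡ false → a ≢ u → d ≢ u → a ≢ v → d ≢ v → ⊥
    separated U a d cover u v Uu Uv au du av dv with crossing-step U (conn S small u v (∉S u au du) (∉S v av dv)) Uu Uv
      where
      S : Subset (order G)
      S = tabulate λ x → δ a x ∨ δ d x
      small : ∣ S ∣ < 3
      small = s≤s (≤-trans (≤-reflexive (trans (∣∣≡count S) (count-cong (lookup∘tabulate _))))
        (≤-trans (count-∨-≤ (δ a) (δ d)) (≤-reflexive (cong₂ _+_ (count-δ a) (count-δ d)))))
      ∉S : ∀ x → a ≢ x → d ≢ x → x ∉ S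
      ∉S x p q h = true≢false (trans (sym (lookup∘tabulate _ x)) (∈⇒true h)) (cong₂ _∨_ (δ-false p) (δ-false q))
    ... | x , y , ((e , j) , x∉ , y∉) , Ux , Uy with cover e x y j Ux Uy
    ...   | inj₁ refl = x∉ (true⇒∈ (trans (lookup∘tabulate _ a) (∨⁺ˡ (δ-refl a))))
    ...   | inj₂ refl = y∉ (true⇒∈ (trans (lookup∘tabulate _ d) (∨⁺ʳ {δ a d} (δ-refl d))))
    three : ∀ U u v → U u ≡ true → U v ≡ false → 3 ≤ cutSize G U
    three U u v Uu Uv with another U u Uu | another (not ∘ U) v (not⁺ Uv)
    ... | inj₁ e | _ = ≤-reflexive (sym (trans (Edges.wt-cong src tgt _ e) (cubic u)))
    ... | inj₂ _ | inj₁ e = ≤-reflexive (sym (trans (sym (wt-not G _ U)) (trans (Edges.wt-cong src tgt _ e) (cubic v))))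
    ... | inj₂ (u₂ , Uu₂ , u≢u₂) | inj₂ (v₂ , Uv₂′ , v≢v₂) with 3 ≤? cutSize G U
    ...   | yes le = le
    ...   | no ≰ = ⊥-elim (go (few (cutᴳ G U) (≤-trans (≤-reflexive (sym (cutSize≡count G U))) (≤-pred (≰⇒> ≰)))))
      where
      Uv₂ : U v₂ ≡ false
      Uv₂ = not⁻ Uv₂′
      apart : ∀ {x y} → U x ≡ true → U y ≡ false → x ≢ y
      apart p q refl = true≢false p q
      finish : ∀ a d → U a ≡ true → U d ≡ false → (∀ e x y → Joins e x y → U x ≡ true → U y ≡ false → a ≡ x ⊎ d ≡ y) → ⊥
      finish a d Ua Ud cover with a ≟ u | d ≟ v
      ... | yes refl | yes refl = separated U a d cover u₂ v₂ Uu₂ Uv₂ u≢u₂ (apart Uu₂ Ud ∘ sym) (apart Ua Uv₂) v≢v₂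
      ... | yes refl | no dv    = separated U a d cover u₂ v Uu₂ Uv u≢u₂ (apart Uu₂ Ud ∘ sym) (apart Ua Uv) dv
      ... | no au | yes refl    = separated U a d cover u v₂ Uu Uv₂ au (apart Uu Ud ∘ sym) (apart Ua Uv₂) v≢v₂
      ... | no au | no dv       = separated U a d cover u v Uu Uv au (apart Uu Ud ∘ sym) (apart Ua Uv) dv
      pair : ∀ {e x y x′ y′} → Joins e x y → Joins e x′ y′ → U x ≡ true → U y ≡ false → U x′ ≡ true → U y′ ≡ false → x ≡ x′ × y ≡ y′
      pair (inj₁ (refl , refl)) (inj₁ (refl , refl)) _ _ _ _ = refl , refl
      pair (inj₂ (refl , refl)) (inj₂ (refl , refl)) _ _ _ _ = refl , refl
      pair (inj₁ (refl , refl)) (inj₂ (refl , refl)) p _ _ q = ⊥-elim (true≢false p q)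
      pair (inj₂ (refl , refl)) (inj₁ (refl , refl)) p _ _ q = ⊥-elim (true≢false p q)
      go : (∀ e → cutᴳ G U e ≡ false) ⊎ (∃ λ e → ∃ λ f → cutᴳ G U e ≡ true × cutᴳ G U f ≡ true × (∀ k → cutᴳ G U k ≡ true → k ≡ e ⊎ k ≡ f)) → ⊥
      go (inj₁ none) = finish u v Uu Uv λ e x y j p q → ⊥-elim (true≢false (cut-intro G {U} j p q) (none e))
      go (inj₂ (e , f , ce , cf , cover)) with cut-elim G U e ce | cut-elim G U f cf
      ... | a , b , je , Ua , Ub | c , d , jf , Uc , Ud = finish a d Ua Ud cov
        where
        cov : ∀ g x y → Joins g x y → U x ≡ true → U y ≡ false → a ≡ x ⊎ d ≡ y
        cov g x y j p q with cover g (cut-intro G {U} j p q)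
        ... | inj₁ refl = inj₁ (proj₁ (pair je j Ua Ub p q))
        ... | inj₂ refl = inj₂ (proj₂ (pair jf j Uc Ud p q))

  reachable : ∀ {n} {R : Fin n → Fin n → Set} → (∀ x y → Dec (R x y)) → ∀ u →
    ∃ λ (C : Pred n) → C u ≡ true × (∀ x → C x ≡ true → Star R u x) × (∀ x y → C x ≡ true → R x y → C y ≡ true)
  reachable {n} {R} R? u = grow n (δ u) (δ-refl u) (λ x h → subst (Star R u) (δ-true h) ε) (m≤n+m n _)
    where
    grow : ∀ k (C : Pred n) → C u ≡ true → (∀ x → C x ≡ true → Star R u x) → n ≤ count C + k →
      ∃ λ (C : Pred n) → C u ≡ true × (∀ x → C x ≡ true → Star R u x) × (∀ x y → C x ≡ true → R x y → C y ≡ true)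
    grow k C Cu st bound with any? (λ x → any? λ y → (C x Bool.≟ true) ×-dec R? x y ×-dec (C y Bool.≟ false))
    ... | no ∄ = C , Cu , st , λ x y Cx r → ≢false⇒true λ Cy → ∄ (x , y , Cx , r , Cy)
    grow zero C Cu st bound | yes (x , y , Cx , r , Cy) =
      contradiction (≤-trans (count-⊏ {q = const true} y (λ _ _ → refl) Cy refl) (≤-reflexive (count-full n)))
        (≤⇒≯ (≤-trans bound (≤-reflexive (+-identityʳ _))))
    grow (suc k) C Cu st bound | yes (x , y , Cx , r , Cy) = grow k (C ⊕ y) (∨⁺ˡ Cu) st′
        (≤-trans bound (≤-reflexive (trans (+-suc _ k) (cong (_+ k) (sym (count-⊕ y Cy))))))
      where
      st′ : ∀ z → (C ⊕ y) z ≡ true → Star R u z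
      st′ z h with ⊕⁻ C h
      ... | inj₁ Cz   = st z Cz
      ... | inj₂ refl = st x Cx ◅◅ (r ◅ ε)

  joins? : ∀ G e u v → Dec (Graph.Joins G e u v)
  joins? G e u v = (Graph.src G e ≟ u ×-dec Graph.tgt G e ≟ v) ⊎-dec (Graph.src G e ≟ v ×-dec Graph.tgt G e ≟ u)

  -- Let deleting p and q split off C. Edges leaving C end in p or q, so the cuts of C and of C with
  -- p and q added have at most 6 edges together, and likewise the cuts of C with p and of C with q.
  -- All of these have at least three edges, so C and C with p added both have cuts of size 3, hence
  -- odd size. This is absurd, as they differ by one vertex.
  good⁻ : ∀ G → Good G → ThreeConnected G × Cubic G
  good⁻ G good = (large , conn) , λ v → trans (∣∂ᵥ∣≡ G v) (cubic v)
    where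
    open Good good
    open Graph G using (src; tgt; Joins)
    conn : ∀ S → ∣ S ∣ < 3 → ∀ u v → u ∉ S → v ∉ S → Star (AdjacentOff G S) u v
    conn S small u v u∉ v∉ with reachable {R = AdjacentOff G S}
        (λ x y → any? (λ e → joins? G e x y) ×-dec ¬? (x ∈? S) ×-dec ¬? (y ∈? S)) u
    ... | C , Cu , star , closed with bool (C v)
    ...   | inj₁ Cv = star v Cv
    ...   | inj₂ Cv = ⊥-elim (go (few (lookup S) (≤-trans (≤-reflexive (sym (∣∣≡count S))) (≤-pred small))))
      where
      last∉ : ∀ {x y} → x ∉ S → Star (AdjacentOff G S) x y → y ∉ S
      last∉ h ε = h
      last∉ h ((_ , _ , y∉) ◅ rs) = last∉ y∉ rs
      C∉S : ∀ x → C x ≡ true → x ∉ S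
      C∉S x Cx = last∉ u∉ (star x Cx)
      boundary : ∀ {e x y} → Joins e x y → C x ≡ true → C y ≡ false → y ∈ S
      boundary {e} {x} {y} j Cx Cy with y ∈? S
      ... | yes h = h
      ... | no h = ⊥-elim (true≢false (closed x y Cx ((e , j) , C∉S x Cx , h)) Cy)
      three≰ : ∀ {m n} → 3 ≤ m → 3 ≤ n → m + n ≤ 6 → m ≡ 3
      three≰ {m} {n} p q le = ≤-antisym (+-cancelʳ-≤ 3 m 3 (≤-trans (+-monoʳ-≤ m q) le)) p
      go : (∀ i → lookup S i ≡ false) ⊎ (∃ λ p → ∃ λ q → lookup S p ≡ true × lookup S q ≡ true × (∀ k → lookup S k ≡ true → k ≡ p ⊎ k ≡ q)) → ⊥
      go (inj₁ none) = contradiction (≤-trans (three C u v Cu Cv) (≤-reflexive (lin-0 λ e → cong (λ b → ⟦ b ⟧ * 1) (uncut e)))) λ ()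
        where
        uncut : ∀ e → cutᴳ G C e ≡ false
        uncut e = ≢true⇒false λ h → let (x , y , j , Cx , Cy) = cut-elim G C e h in true≢false (∈⇒true (boundary j Cx Cy)) (none y)
      go (inj₂ (p , q , Sp , Sq , cover)) = true≢false (trans (sym (cubic-parity G cubic X₁)) (cong odd X₁≡3))
          (trans (cong odd (count-⊕ p Cp)) (cong not (trans (sym (cubic-parity G cubic C)) (cong odd C≡3))))
        where
        Cp : C p ≡ false
        Cp = ≢true⇒false λ h → C∉S p h (true⇒∈ Sp)
        X₁ X₂ X₃ : Pred (order G)
        X₁ = C ⊕ p
        X₂ = C ⊕ q
        X₃ x = C x ∨ (δ p x ∨ δ q x)
        v≢ : ∀ {y} → lookup S y ≡ true → y ≢ v
        v≢ h refl = v∉ (true⇒∈ h)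
        Xv : (C v ∨ (δ p v ∨ δ q v)) ≡ false
        Xv rewrite Cv | δ-false (v≢ Sp) | δ-false (v≢ Sq) = refl
        -- The two inequalities for one edge, its ends described by membership in C and equality
        -- with p and q. The premises say that C avoids p and q and that an edge leaving C ends in
        -- one of them.
        fact : Bool → Bool → Bool → Bool → Bool → Bool → Bool
        fact c p q c′ p′ q′ = (c ⇒ᵇ not (p ∨ q)) ⇒ᵇ (c′ ⇒ᵇ not (p′ ∨ q′)) ⇒ᵇ ((c ∧ not c′) ⇒ᵇ (p′ ∨ q′)) ⇒ᵇ ((c′ ∧ not c) ⇒ᵇ (p ∨ q)) ⇒ᵇ
          (((⟦ c xor c′ ⟧ + ⟦ (c ∨ (p ∨ q)) xor (c′ ∨ (p′ ∨ q′)) ⟧) ℕ.≤ᵇ (⟦ p xor p′ ⟧ + ⟦ q xor q′ ⟧)) ∧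
           ((⟦ (c ∨ p) xor (c′ ∨ p′) ⟧ + ⟦ (c ∨ q) xor (c′ ∨ q′) ⟧) ℕ.≤ᵇ (⟦ p xor p′ ⟧ + ⟦ q xor q′ ⟧)))
        fact-holds : ∀ c p q c′ p′ q′ → fact c p q c′ p′ q′ ≡ true
        fact-holds c p q c′ p′ q′ = tautology⁻ 6 (λ { (c ∷ p ∷ q ∷ c′ ∷ p′ ∷ q′ ∷ []) → fact c p q c′ p′ q′ }) refl (c ∷ p ∷ q ∷ c′ ∷ p′ ∷ q′ ∷ [])
        C⇒ : ∀ x → (C x ⇒ᵇ not (δ p x ∨ δ q x)) ≡ true
        C⇒ x = ⇒ᵇ⁺ λ Cx → cong not (cong₂ _∨_ (δ-false λ { refl → C∉S p Cx (true⇒∈ Sp) }) (δ-false λ { refl → C∉S q Cx (true⇒∈ Sq) }))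
        leave : ∀ {e x y} → Joins e x y → ((C x ∧ not (C y)) ⇒ᵇ (δ p y ∨ δ q y)) ≡ true
        leave {e} {x} {y} j = ⇒ᵇ⁺ λ h → lem (cover y (∈⇒true (boundary j (proj₁ (∧⁻ h)) (not⁻ (proj₂ (∧⁻ {C x} h))))))
          where
          lem : y ≡ p ⊎ y ≡ q → (δ p y ∨ δ q y) ≡ true
          lem (inj₁ refl) = ∨⁺ˡ (δ-refl p)
          lem (inj₂ refl) = ∨⁺ʳ {δ p q} (δ-refl q)
        pt : ∀ e → (⟦ cutᴳ G C e ⟧ + ⟦ cutᴳ G X₃ e ⟧ ≤ ⟦ cutᴳ G (δ p) e ⟧ + ⟦ cutᴳ G (δ q) e ⟧)
                 × (⟦ cutᴳ G X₁ e ⟧ + ⟦ cutᴳ G X₂ e ⟧ ≤ ⟦ cutᴳ G (δ p) e ⟧ + ⟦ cutᴳ G (δ q) e ⟧)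
        pt e = let h = ⇒ᵇ⁻ (⇒ᵇ⁻ (⇒ᵇ⁻ (⇒ᵇ⁻ (fact-holds (C (src e)) (δ p (src e)) (δ q (src e)) (C (tgt e)) (δ p (tgt e)) (δ q (tgt e)))
                     (C⇒ (src e))) (C⇒ (tgt e))) (leave {e} (inj₁ (refl , refl)))) (leave {e} (inj₂ (refl , refl)))
               in ≤ᵇ⁻ (proj₁ (∧⁻ h)) , ≤ᵇ⁻ (proj₂ (∧⁻ {(⟦ cutᴳ G C e ⟧ + ⟦ cutᴳ G X₃ e ⟧) ℕ.≤ᵇ (⟦ cutᴳ G (δ p) e ⟧ + ⟦ cutᴳ G (δ q) e ⟧)} h))
        sums : ∀ (A B : Pred (order G)) → (∀ e → ⟦ cutᴳ G A e ⟧ + ⟦ cutᴳ G B e ⟧ ≤ ⟦ cutᴳ G (δ p) e ⟧ + ⟦ cutᴳ G (δ q) e ⟧) → cutSize G A + cutSize G B ≤ 6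
        sums A B h = begin
          cutSize G A + cutSize G B                                       ≡⟨ cong₂ _+_ (lin-sum λ e → *-identityʳ _) (lin-sum λ e → *-identityʳ _) ⟩
          sum (λ e → ⟦ cutᴳ G A e ⟧) + sum (λ e → ⟦ cutᴳ G B e ⟧)          ≡⟨ sum-+ _ _ ⟨
          sum (λ e → ⟦ cutᴳ G A e ⟧ + ⟦ cutᴳ G B e ⟧)                      ≤⟨ sum-mono-≤ h ⟩
          sum (λ e → ⟦ cutᴳ G (δ p) e ⟧ + ⟦ cutᴳ G (δ q) e ⟧)              ≡⟨ sum-+ _ _ ⟩
          sum (λ e → ⟦ cutᴳ G (δ p) e ⟧) + sum (λ e → ⟦ cutᴳ G (δ q) e ⟧)  ≡⟨ cong₂ _+_ (lin-sum λ e → *-identityʳ _) (lin-sum λ e → *-identityʳ _) ⟨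
          cutSize G (δ p) + cutSize G (δ q)                               ≡⟨ cong₂ _+_ (cubic p) (cubic q) ⟩
          6                                                               ∎
          where open ≤-Reasoning
        C≡3 : cutSize G C ≡ 3
        C≡3 = three≰ (three C u v Cu Cv) (three X₃ u v (∨⁺ˡ Cu) Xv) (sums C X₃ (proj₁ ∘ pt))
        X₁≡3 : cutSize G X₁ ≡ 3
        X₁≡3 = three≰ (three X₁ u v (∨⁺ˡ Cu) (cong₂ _∨_ Cv (δ-false (v≢ Sp)))) (three X₂ u v (∨⁺ˡ Cu) (cong₂ _∨_ Cv (δ-false (v≢ Sq)))) (sums X₁ X₂ (proj₂ ∘ pt))

open CubicGraphs

-- Factors with degrees 1 and 3, and the λ-matchability of bricks

module Factors where

  want : ∀ {n} → Pred n → Fin n → ℕ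
  want Q v = if Q v then 3 else 1

  -- A v-matching is a factor for δ v.
  Factor : (G : Graph) → Pred (order G) → Set
  Factor G Q = ∃ λ F → ∀ v → degᴳ G F v ≡ want Q v

  abstract
    factor? : ∀ G Q → Dec (Factor G Q)
    factor? G Q = anyPred? (λ F → all? λ v → degᴳ G F v ℕ.≟ want Q v)
      (λ e h v → trans (sym (degᴳ-cong G e v)) (h v))

  factor-cong : ∀ G {Q Q′ : Pred (order G)} → (∀ v → Q v ≡ Q′ v) → Factor G Q → Factor G Q′
  factor-cong G e (F , h) = F , λ v → trans (h v) (cong (λ b → if b then 3 else 1) (e v))

  Double : (G : Graph) → Fin (order G) → Fin (order G) → Set
  Double G y v = y ≢ v × Factor G (λ x → δ y x ∨ δ v x)

  abstract
    double? : ∀ G y v → Dec (Double G y v)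
    double? G y v = ¬? (y ≟ v) ×-dec factor? G _

  double-sym : ∀ G {y v} → Double G y v → Double G v y
  double-sym G {y} {v} (ne , f) = ne ∘ sym , factor-cong G (λ x → Bool.∨-comm (δ y x) (δ v x)) f

  odd-want : ∀ {n} (Q : Pred n) v → odd (want Q v) ≡ true
  odd-want Q v with Q v
  ... | true  = refl
  ... | false = refl

  want≡ : ∀ {n} (Q : Pred n) v → want Q v ≡ 1 + 2 * ⟦ Q v ⟧
  want≡ Q v with Q v
  ... | true  = refl
  ... | false = refl

  tightᴳ⁺ : ∀ G (U : Pred (order G)) → 2 ≤ count U → 2 ≤ count (not ∘ U) →
    (∀ F → Perfect G F → wtᴳ G (⟦_⟧ ∘ F) U ≡ 1) → NontrivialTightCut G (tabulate U)
  tightᴳ⁺ G U p q tight = ≤-trans p (≤-reflexive (sym (trans (∣∣≡count (tabulate U)) (count-cong (lookup∘tabulate U)))))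
    , ≤-trans q (≤-reflexive (sym (trans (∣∣≡count (∁ (tabulate U))) (count-cong λ v → trans (lookup-map v not (tabulate U)) (cong not (lookup∘tabulate U v))))))
    , λ M pm → trans (∣∂∩∣≡ G (tabulate U) M) (trans (Edges.wt-cong _ _ _ (lookup∘tabulate U)) (tight (lookup M) (perfect⁺ G M pm)))

  tightᴳ⁻ : ∀ G X → NontrivialTightCut G X → 2 ≤ count (lookup X) × 2 ≤ count (not ∘ lookup X) ×
    (∀ F → Perfect G F → wtᴳ G (⟦_⟧ ∘ F) (lookup X) ≡ 1)
  tightᴳ⁻ G X (p , q , tight) = ≤-trans p (≤-reflexive (∣∣≡count X))
    , ≤-trans q (≤-reflexive (trans (∣∣≡count (∁ X)) (count-cong λ v → lookup-map v not X)))
    , λ F pm → trans (lin-cong λ e → cong (λ b → ⟦ cutᴳ G (lookup X) e ⟧ * ⟦ b ⟧) (sym (lookup∘tabulate F e)))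
        (trans (sym (∣∂∩∣≡ G X (tabulate F))) (tight (tabulate F) (perfect⁻ G F pm)))

  bipartite⁺ : ∀ G (A : Pred (order G)) → (∀ e → cutᴳ G A e ≡ true) → IsBipartition G (tabulate A)
  bipartite⁺ G A h e = true⇒∈ (trans (lookup-∂ G (tabulate A) e) (trans (cong₂ _xor_ (lookup∘tabulate A _) (lookup∘tabulate A _)) (h e)))

  bipartite⁻ : ∀ G X → IsBipartition G X → ∀ e → cutᴳ G (lookup X) e ≡ true
  bipartite⁻ G X h e = trans (sym (lookup-∂ G X e)) (∈⇒true (h e))

  Adj : (G : Graph) → Fin (order G) → Pred (order G)
  Adj G = EdgeLemmas.adj (Graph.src G) (Graph.tgt G) (const 1)

  adj-joins : ∀ G {u v} → Adj G u v ≡ true → ∃ λ e → Graph.Joins G e u v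
  adj-joins G {u} {v} h with some⁻ h
  ... | e , j with EdgeLemmas.join⁻ (Graph.src G) (Graph.tgt G) {const 1} {u} {v} {e} j
  ...   | _ , inj₁ (refl , refl) = e , inj₁ (refl , refl)
  ...   | _ , inj₂ (refl , refl) = e , inj₂ (refl , refl)

  joins-adj : ∀ G {e u v} → Graph.Joins G e u v → Adj G u v ≡ true
  joins-adj G {e} (inj₁ (refl , refl)) = EdgeLemmas.adj⁺ (Graph.src G) (Graph.tgt G) {const 1} e ≤-refl
  joins-adj G {e} (inj₂ (refl , refl)) = trans (EdgeLemmas.adj-sym (Graph.src G) (Graph.tgt G) (const 1) (Graph.tgt G e) (Graph.src G e)) (EdgeLemmas.adj⁺ (Graph.src G) (Graph.tgt G) {const 1} e ≤-refl)

  adj-sym : ∀ G u v → Adj G u v ≡ Adj G v u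
  adj-sym G = EdgeLemmas.adj-sym (Graph.src G) (Graph.tgt G) (const 1)

  joins-≢ : ∀ G {e u v} → Graph.Joins G e u v → u ≢ v
  joins-≢ G {e} (inj₁ (refl , refl)) = Graph.loopless G e
  joins-≢ G {e} (inj₂ (refl , refl)) = Graph.loopless G e ∘ sym

  adj-irrefl : ∀ G v → Adj G v v ≡ false
  adj-irrefl G v = ≢true⇒false λ h → joins-≢ G (proj₂ (adj-joins G h)) refl

  module _ (G : Graph) where
    open Graph G using (src; tgt; size; loopless; V; E; Joins)

    star : V → Pred size
    star u = cutᴳ G (δ u)

    -- For distinct vertices this is the number of edges joining them. On the diagonal it is the
    -- degree, which `star-degree` therefore leaves out.
    mult : V → V → ℕ
    mult u v = degᴳ G (star u) v

    star-joins : ∀ {u v e} → u ≢ v → star u e ≡ true → star v e ≡ true → Joins e u v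
    star-joins {u} {v} {e} ne p q with cut-elim G (δ u) e p | cut-elim G (δ v) e q
    ... | x , y , j , du , _ | x′ , y′ , j′ , dv , _ with δ-true du | δ-true dv
    ... | refl | refl with j | j′
    ...   | inj₁ (refl , refl) | inj₁ (refl , refl) = contradiction refl ne
    ...   | inj₁ (refl , refl) | inj₂ (refl , refl) = inj₁ (refl , refl)
    ...   | inj₂ (refl , refl) | inj₁ (refl , refl) = inj₂ (refl , refl)
    ...   | inj₂ (refl , refl) | inj₂ (refl , refl) = contradiction refl ne

    joins-star : ∀ {u v e} → Joins e u v → star u e ≡ true
    joins-star {u} {v} {e} j = cut-intro G {δ u} j (δ-refl u) (δ-false (joins-≢ G {e} j))

    joins-swap : ∀ {e u v} → Joins e u v → Joins e v u
    joins-swap (inj₁ p) = inj₂ p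
    joins-swap (inj₂ p) = inj₁ p

    mult-pos : ∀ {u v} → Adj G u v ≡ true → 1 ≤ mult u v
    mult-pos {u} {v} h with adj-joins G h
    ... | e , j = ≤-trans (≤-reflexive (sym (cong₂ (λ a b → ⟦ a ⟧ * ⟦ b ⟧) (joins-star {e = e} (joins-swap {e} j)) (joins-star {e = e} j))))
                    (≤-trans (≤-sum (λ e → ⟦ star v e ⟧ * ⟦ star u e ⟧) e) (≤-reflexive (sym (lin≡sum _ _))))

    mult-zero : ∀ {u v} → u ≢ v → Adj G u v ≡ false → mult u v ≡ 0
    mult-zero {u} {v} ne h = lin-0 pt
      where
      pt : ∀ e → ⟦ star v e ⟧ * ⟦ star u e ⟧ ≡ 0
      pt e with star v e in p | star u e in q
      ... | false | _     = refl
      ... | true  | false = refl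
      ... | true  | true  = ⊥-elim (true≢false (joins-adj G {e} (star-joins {e = e} ne q p)) h)

    cutSize≡sum : ∀ U → cutSize G U ≡ sum (λ e → ⟦ cutᴳ G U e ⟧)
    cutSize≡sum U = lin-sum λ e → *-identityʳ _

    module _ (good : Good G) where
      open Good good

      pair-cut : ∀ {u v} → u ≢ v → cutSize G (λ x → δ u x ∨ δ v x) + (mult u v + mult u v) ≡ 6
      pair-cut {u} {v} ne = begin
        cutSize G (λ x → δ u x ∨ δ v x) + (mult u v + mult u v)
          ≡⟨ cong₂ _+_ (cutSize≡sum (λ x → δ u x ∨ δ v x)) (cong₂ _+_ (lin≡sum _ _) (lin≡sum _ _)) ⟩
        sum (λ e → ⟦ cutᴳ G (λ x → δ u x ∨ δ v x) e ⟧) + (sum (λ e → ⟦ star v e ⟧ * ⟦ star u e ⟧) + sum (λ e → ⟦ star v e ⟧ * ⟦ star u e ⟧))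
          ≡⟨ cong (sum (λ e → ⟦ cutᴳ G (λ x → δ u x ∨ δ v x) e ⟧) +_) (sum-+ _ _) ⟨
        sum (λ e → ⟦ cutᴳ G (λ x → δ u x ∨ δ v x) e ⟧) + sum (λ e → ⟦ star v e ⟧ * ⟦ star u e ⟧ + ⟦ star v e ⟧ * ⟦ star u e ⟧)
          ≡⟨ sum-+ _ _ ⟨
        sum (λ e → ⟦ cutᴳ G (λ x → δ u x ∨ δ v x) e ⟧ + (⟦ star v e ⟧ * ⟦ star u e ⟧ + ⟦ star v e ⟧ * ⟦ star u e ⟧))
          ≡⟨ sum-cong pt ⟩
        sum (λ e → ⟦ star u e ⟧ + ⟦ star v e ⟧)
          ≡⟨ sum-+ _ _ ⟩
        sum (λ e → ⟦ star u e ⟧) + sum (λ e → ⟦ star v e ⟧)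
          ≡⟨ cong₂ _+_ (cutSize≡sum (δ u)) (cutSize≡sum (δ v)) ⟨
        cutSize G (δ u) + cutSize G (δ v)
          ≡⟨ cong₂ _+_ (cubic u) (cubic v) ⟩
        6 ∎
        where
        open ≡-Reasoning
        eq : ∀ a b c d → (a ≡ true → b ≡ false) → (c ≡ true → d ≡ false) →
          ⟦ (a ∨ b) xor (c ∨ d) ⟧ + (⟦ b xor d ⟧ * ⟦ a xor c ⟧ + ⟦ b xor d ⟧ * ⟦ a xor c ⟧) ≡ ⟦ a xor c ⟧ + ⟦ b xor d ⟧
        eq true  true  c d p q = ⊥-elim (true≢false refl (p refl))
        eq a b true true p q = ⊥-elim (true≢false refl (q refl))
        eq true  false true  false p q = refl
        eq true  false false true  p q = refl
        eq true  false false false p q = refl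
        eq false true  true  false p q = refl
        eq false true  false true  p q = refl
        eq false true  false false p q = refl
        eq false false true  false p q = refl
        eq false false false true  p q = refl
        eq false false false false p q = refl
        disj : ∀ x → δ u x ≡ true → δ v x ≡ false
        disj x p = δ-false λ { refl → ne (δ-true p) }
        pt : ∀ e → ⟦ cutᴳ G (λ x → δ u x ∨ δ v x) e ⟧ + (⟦ star v e ⟧ * ⟦ star u e ⟧ + ⟦ star v e ⟧ * ⟦ star u e ⟧) ≡ ⟦ star u e ⟧ + ⟦ star v e ⟧
        pt e = eq (δ u (src e)) (δ v (src e)) (δ u (tgt e)) (δ v (tgt e)) (disj (src e)) (disj (tgt e))

      -- Two parallel edges would leave at most two edges in the cut around the pair, so there can
      -- be no third vertex.
      simple : ∀ {u v} → u ≢ v → (∀ z → z ≡ u ⊎ z ≡ v) ⊎ mult u v ≤ 1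
      simple {u} {v} ne with mult u v ≤? 1
      ... | yes le = inj₂ le
      ... | no ≰ with any? (λ z → (δ u z ∨ δ v z) Bool.≟ false)
      ...   | yes (z , h) = contradiction (≤-trans (+-mono-≤ (three (λ x → δ u x ∨ δ v x) u z (∨⁺ˡ (δ-refl u)) h) (+-mono-≤ (≰⇒> ≰) (≰⇒> ≰))) (≤-reflexive (pair-cut ne))) λ
              { (s≤s (s≤s (s≤s (s≤s (s≤s (s≤s ())))))) }
      ...   | no ∄ = inj₁ λ z → lem z (∨⁻ {δ u z} (≢false⇒true λ h → ∄ (z , h)))
        where
        lem : ∀ z → δ u z ≡ true ⊎ δ v z ≡ true → z ≡ u ⊎ z ≡ v
        lem z (inj₁ p) = inj₁ (sym (δ-true p))
        lem z (inj₂ p) = inj₂ (sym (δ-true p))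

      star-degree : ∀ u → sum (λ v → ⟦ not (δ u v) ⟧ * mult u v) ≡ 3
      star-degree u = trans (sum-cong λ v → cong (⟦ not (δ u v) ⟧ *_) (wt-δᴳ G _ v)) (trans (EdgeLemmas.handshake-cut src tgt (⟦_⟧ ∘ star u) (not ∘ δ u))
        (trans (cong₂ _+_ (trans (wt-not G (⟦_⟧ ∘ star u) (δ u)) (trans (lin-cong λ e → square (star u e)) (cubic u)))
          (cong₂ _+_ none none)) refl))
        where
        square : ∀ b → ⟦ b ⟧ * ⟦ b ⟧ ≡ ⟦ b ⟧ * 1
        square true  = refl
        square false = refl
        none : Edges.inner src tgt (⟦_⟧ ∘ star u) (not ∘ δ u) ≡ 0
        none = lin-0 λ e → lem (δ u (src e)) (δ u (tgt e))
          where
          lem : ∀ a b → ⟦ not a ∧ not b ⟧ * ⟦ a xor b ⟧ ≡ 0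
          lem true  b     = refl
          lem false true  = refl
          lem false false = refl

      count-Adj : ∀ u → (∀ z → u ≢ z → mult u z ≤ 1) → count (Adj G u) ≡ 3
      count-Adj u smp = trans (count≡sum _) (trans (sum-cong pt) (star-degree u))
        where
        pt : ∀ v → ⟦ Adj G u v ⟧ ≡ ⟦ not (δ u v) ⟧ * mult u v
        pt v with u ≟ v
        ... | yes refl rewrite δ-refl u | adj-irrefl G u = refl
        ... | no ne with bool (Adj G u v)
        ...   | inj₁ h rewrite h | δ-false ne = sym (trans (+-identityʳ _) (≤-antisym (smp v ne) (mult-pos h)))
        ...   | inj₂ h rewrite h | mult-zero ne h = sym (*-zeroʳ ⟦ not (δ u v) ⟧)

      mult-self : ∀ u → mult u u ≡ 3
      mult-self u = trans (lin-cong λ e → square (star u e)) (cubic u)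
        where
        square : ∀ b → ⟦ b ⟧ * ⟦ b ⟧ ≡ ⟦ b ⟧ * 1
        square true  = refl
        square false = refl

      module BarrierStructure (T : Pred (order G)) {L : ℕ} (ℓ : V → Fin L)
        (closed : ∀ e → T (src e) ≡ false → T (tgt e) ≡ false → ℓ (src e) ≡ ℓ (tgt e))
        (many : count T ≤ count (λ i → odd (count (EdgeLemmas.Barrier.part src tgt (const true) T ℓ i)))) where

        part : Fin L → Pred (order G)
        part = EdgeLemmas.Barrier.part src tgt (const true) T ℓ

        odds : Pred L
        odds i = odd (count (part i))

        closed′ : ∀ e → not (T (src e)) ≡ true → not (T (tgt e)) ≡ true → ℓ (src e) ≡ ℓ (tgt e)
        closed′ e p q = closed e (not⁻ p) (not⁻ q)

        inner-zero : Edges.inner src tgt (const 1) T ≡ 0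
        inner-zero = EdgeLemmas.barrier-inner src tgt (regular G good) T (λ _ _ → refl) ℓ (λ e _ → closed′ e) many

        independent : ∀ e → T (src e) ≡ true → T (tgt e) ≡ true → ⊥
        independent e p q = contradiction (≤-trans (≤-reflexive (sym (cong (λ b → ⟦ b ⟧ * 1) (∧⁺ p q))))
          (≤-trans (≤-sum (λ e → ⟦ Edges.inside src tgt T e ⟧ * 1) e) (≤-reflexive (trans (sym (lin≡sum _ _)) inner-zero)))) λ ()

        -- T has total degree r times its size and every odd part takes at least r of it. With at
        -- least as many odd parts as vertices in T all these bounds are attained. For r = 3 and r =
        -- 1 this says that odd parts have 3-cuts and that every perfect matching crosses them once.
        part-weight : ∀ w r → (∀ v → wtᴳ G w (δ v) ≡ r) → (∀ i → odds i ≡ true → r ≤ wtᴳ G w (part i)) →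
          ∀ i → r * ⟦ odds i ⟧ ≡ wtᴳ G w (part i)
        part-weight w r dg≡ lower = sum-≡⇒≡ pt (≤-trans (≤-trans (m≤m+n _ _) (≤-reflexive (trans
            (EdgeLemmas.Barrier.barrier-count src tgt (const true) T ℓ w (λ _ _ → refl , refl) (λ e _ → closed′ e))
            (EdgeLemmas.sum-const-deg src tgt w T r λ v _ → trans (sym (wt-δᴳ G w v)) (dg≡ v)))))
            (≤-trans (*-monoʳ-≤ r many) (≤-reflexive (trans (cong (r *_) (count≡sum odds)) (sym (*-sum r _))))))
          where
          pt : ∀ i → r * ⟦ odds i ⟧ ≤ wtᴳ G w (part i)
          pt i with bool (odds i)
          ... | inj₁ t = ≤-trans (≤-reflexive (trans (cong (λ b → r * ⟦ b ⟧) t) (*-identityʳ r))) (lower i t)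
          ... | inj₂ f = ≤-trans (≤-reflexive (trans (cong (λ b → r * ⟦ b ⟧) f) (*-zeroʳ r))) z≤n

        part-size : ∀ i → 3 * ⟦ odds i ⟧ ≡ cutSize G (part i)
        part-size = part-weight (const 1) 3 cubic λ i o → Edges.Regular.oddcut (regular G good) (part i) (λ _ _ → refl) o

        part-crossing : ∀ F → Perfect G F → ∀ i → 1 * ⟦ odds i ⟧ ≡ wtᴳ G (⟦_⟧ ∘ F) (part i)
        part-crossing F pm = part-weight (⟦_⟧ ∘ F) 1 pm λ i o → odd-pos (trans (odd-cut G F (part i) (λ v → cong odd (pm v))) o)

      -- The vertex x is λ-matchable if the graph without x and its three neighbours has a perfect
      -- matching. Otherwise the Tutte set and the neighbours of x form a barrier T with x as a part
      -- of its own. Its odd parts are tight cuts, hence single vertices, and T is independent, so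
      -- the graph would be bipartite.
      brick⇒matchable′ : TightCutFree G → ¬ Bipartite G → ∀ x → Factor G (δ x)
      brick⇒matchable′ free nonbip x = go (Tutte.tutte (Adj G) (adj-sym G) P)
        where
        smp : ∀ z → x ≢ z → mult x z ≤ 1
        smp z ne with simple ne
        ... | inj₂ le = le
        ... | inj₁ two = contradiction (tabulate (δ x) , bipartite⁺ G (δ x) λ e → lem e (two (src e)) (two (tgt e))) nonbip
          where
          lem : ∀ e → src e ≡ x ⊎ src e ≡ z → tgt e ≡ x ⊎ tgt e ≡ z → star x e ≡ true
          lem e (inj₁ p) (inj₁ q) = contradiction (trans p (sym q)) (loopless e)
          lem e (inj₂ p) (inj₂ q) = contradiction (trans p (sym q)) (loopless e)
          lem e (inj₁ p) (inj₂ q) = joins-star {x} {z} {e} (inj₁ (p , q))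
          lem e (inj₂ p) (inj₁ q) = joins-star {x} {z} {e} (inj₂ (p , q))
        N : Pred (order G)
        N = Adj G x
        P : Pred (order G)
        P v = not (δ x v) ∧ not (N v)
        P⁻ : ∀ {v} → P v ≡ true → x ≢ v × N v ≡ false
        P⁻ {v} h = δ-false⁻ (not⁻ (proj₁ (∧⁻ h))) , not⁻ (proj₂ (∧⁻ {not (δ x v)} h))
        go : ∃ (Tutte.IsPM (Adj G) (adj-sym G) P) ⊎ Tutte.Obstruction (Adj G) (adj-sym G) P → Factor G (δ x)
        go (inj₁ (mate , pm)) with EdgeLemmas.realise src tgt (const 1) P mate pm
        ... | M , _ , within , degM = (λ e → M e ∨ star x e) , degrees
          where
          total : ∀ v → degᴳ G (λ e → M e ∨ star x e) v ≡ Edges.dg src tgt (⟦_⟧ ∘ M) v + mult x v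
          total v = trans (wt-δᴳ G _ v) (trans (EdgeLemmas.dg-∨ src tgt M (star x) disjoint v) (cong (_ +_) (sym (wt-δᴳ G _ v))))
            where
            disjoint : ∀ e → M e ≡ true → star x e ≡ true → ⊥
            disjoint e m st with within e m
            ... | a , b = true≢false st (cong₂ _xor_ (δ-false (proj₁ (P⁻ a))) (δ-false (proj₁ (P⁻ b))))
          out : ∀ v → P v ≡ false → Edges.dg src tgt (⟦_⟧ ∘ M) v ≡ 0
          out = EdgeLemmas.dg-outside src tgt P M within
          degrees : ∀ v → degᴳ G (λ e → M e ∨ star x e) v ≡ want (δ x) v
          degrees v with x ≟ v
          ... | yes refl rewrite δ-refl x = trans (total x) (cong₂ _+_ (out x (cong (λ b → not b ∧ not (N x)) (δ-refl x))) (mult-self x))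
          ... | no ne with bool (N v)
          ...   | inj₁ h rewrite δ-false ne = trans (total v) (cong₂ _+_ (out v (trans (cong (λ b → not (δ x v) ∧ not b) h) (Bool.∧-zeroʳ _))) (≤-antisym (smp v ne) (mult-pos h)))
          ...   | inj₂ h rewrite δ-false ne = trans (total v) (cong₂ _+_ (degM v (cong₂ (λ a b → not a ∧ not b) (δ-false ne) h)) (mult-zero ne h))
        go (inj₂ (sep , lt)) = contradiction (tabulate T , bipartite⁺ G T crossing) nonbip
          where
          open Tutte.Separation sep using (S; S⊑P; L; ℓ) renaming (closed to closedˢ; odds to oddsˢ; part to partˢ)
          T : Pred (order G)
          T v = S v ∨ N v
          -- All neighbours of x lie in T, so x becomes a part by itself, labelled `zero`.
          ℓ′ : V → Fin (suc L)
          ℓ′ v = if δ x v then zero else suc (ℓ v)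
          D⇒ : ∀ {v} → T v ≡ false → x ≢ v → (P v ∧ not (S v)) ≡ true
          D⇒ {v} h ne = ∧⁺ (∧⁺ (not⁺ (δ-false ne)) (not⁺ (≢true⇒false λ n → true≢false (∨⁺ʳ {S v} n) h))) (not⁺ (≢true⇒false λ s → true≢false (∨⁺ˡ s) h))
          closed : ∀ u v → T u ≡ false → T v ≡ false → Adj G u v ≡ true → ℓ′ u ≡ ℓ′ v
          closed u v p q a with x ≟ u | x ≟ v
          ... | yes refl | _ = ⊥-elim (true≢false (∨⁺ʳ {S v} a) q)
          ... | no _ | yes refl = ⊥-elim (true≢false (∨⁺ʳ {S u} (trans (adj-sym G x u) a)) p)
          ... | no nu | no nv rewrite δ-false nu | δ-false nv = cong suc (closedˢ u v (D⇒ p nu) (D⇒ q nv) a)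
          s′ : Tutte.Separation (Adj G) (adj-sym G) (const true)
          s′ = record { S = T ; S⊑P = λ _ _ → refl ; L = suc L ; ℓ = ℓ′ ; closed = λ u v p q → closed u v (not⁻ p) (not⁻ q) }
          open Tutte.Separation s′ using (odds-parity) renaming (odds to odds′; part to part′)
          Tx : T x ≡ false
          Tx = cong₂ _∨_ (≢true⇒false λ h → proj₁ (P⁻ (S⊑P x h)) refl) (adj-irrefl G x)
          part-x : ∀ v → part′ zero v ≡ δ x v
          part-x v with x ≟ v
          ... | yes refl rewrite Tx | δ-refl x = δ-refl zero
          ... | no ne rewrite δ-false ne = trans (cong (not (T v) ∧_) (δ-false λ ())) (Bool.∧-zeroʳ _)
          part-old : ∀ i v → part′ (suc i) v ≡ partˢ i v
          part-old i v with x ≟ v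
          ... | yes refl rewrite δ-refl x = trans (cong (not (T x) ∧_) (δ-false λ ())) (Bool.∧-zeroʳ _)
          ... | no ne rewrite δ-false ne = cong₂ _∧_ (dm (S v) (N v)) (≡-by-truth (λ h → subst (λ j → δ i j ≡ true) (Data.Fin.Properties.suc-injective (δ-true h)) (δ-refl i))
                  (λ h → subst (λ j → δ (suc i) (suc j) ≡ true) (δ-true h) (δ-refl (suc i))))
            where
            dm : ∀ s n → not (s ∨ n) ≡ (true ∧ not n) ∧ not s
            dm true  true  = refl
            dm true  false = refl
            dm false true  = refl
            dm false false = refl
          more : 2 + count S ≤ count odds′
          more = ≤-trans (s≤s lt) (≤-reflexive (sym (trans (count-suc odds′) (cong₂ _+_ (cong ⟦_⟧ (cong odd (trans (count-cong part-x) (count-δ x))))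
            (count-cong λ i → cong odd (count-cong (part-old i)))))))
          T≤ : count T ≤ 3 + count S
          T≤ = ≤-trans (count-∨-≤ S N) (≤-reflexive (trans (cong (count S +_) (count-Adj x smp)) (+-comm (count S) 3)))
          -- T has at most three vertices more than S, and there are at least two more odd parts
          -- than vertices in S. A deficit could only be one, which parity forbids.
          many : count T ≤ count odds′
          many with count T ≤? count odds′
          ... | yes le = le
          ... | no ≰ = ⊥-elim (true≢false (trans (cong odd c+c) (cong not (odd-double (count odds′))))
                  (trans odds-parity (trans (cong odd (count-full _)) (even-order G cubic))))
            where
            c≡ : count T ≡ suc (count odds′)
            c≡ = ≤-antisym (≤-trans T≤ (s≤s more)) (≰⇒> ≰)
            c+c : count T + count odds′ ≡ suc (count odds′ + count odds′)
            c+c = cong (_+ count odds′) c≡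
          open BarrierStructure T ℓ′ (λ e p q → closed (src e) (tgt e) p q (joins-adj G {e} (inj₁ (refl , refl)))) many
          nbr : ∃ λ z → N z ≡ true
          nbr = count-pos⁻ (≤-trans (s≤s z≤n) (≤-reflexive (sym (count-Adj x smp))))
          small : ∀ i u v → part i u ≡ true → part i v ≡ true → u ≢ v → ⊥
          small i u v pu pv ne = free (tabulate (part i)) (tightᴳ⁺ G (part i) two two′ λ F pm → trans (sym (part-crossing F pm i)) (trans (+-identityʳ _) (cong ⟦_⟧ isOdd)))
            where
            two : 2 ≤ count (part i)
            two = ≤-trans (s≤s (count-pos v (∖⁺ (part i) pv ne))) (≤-reflexive (sym (count-∖ u pu)))
            ¬x : part i x ≡ false
            ¬x = ≢true⇒false λ h → xcase (δ-true (proj₂ (∧⁻ {not (T x)} h))) two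
              where
              xcase : i ≡ ℓ′ x → 2 ≤ count (part i) → ⊥
              xcase e c rewrite δ-refl x | e | count-cong part-x | count-δ x = contradiction c λ { (s≤s ()) }
            ¬z : part i (proj₁ nbr) ≡ false
            ¬z = cong (λ b → not b ∧ δ i (ℓ′ (proj₁ nbr))) (∨⁺ʳ {S (proj₁ nbr)} (proj₂ nbr))
            two′ : 2 ≤ count (not ∘ part i)
            two′ = ≤-trans (s≤s (count-pos (proj₁ nbr) (∖⁺ (not ∘ part i) (not⁺ ¬z) λ e → true≢false (proj₂ nbr) (trans (cong N (sym e)) (adj-irrefl G x)))))
                     (≤-reflexive (sym (count-∖ x (not⁺ ¬x))))
            isOdd : odds i ≡ true
            isOdd = ≢false⇒true λ f → contradiction (≤-trans (three (part i) u x pu ¬x) (≤-reflexive (trans (sym (part-size i)) (cong (λ b → 3 * ⟦ b ⟧) f)))) λ ()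
          crossing : ∀ e → cutᴳ G T e ≡ true
          crossing e with bool (T (src e)) | bool (T (tgt e))
          ... | inj₁ p | inj₁ q = ⊥-elim (independent e p q)
          ... | inj₁ p | inj₂ q = cong₂ _xor_ p q
          ... | inj₂ p | inj₁ q = cong₂ _xor_ p q
          ... | inj₂ p | inj₂ q = ⊥-elim (small (ℓ′ (src e)) (src e) (tgt e) (∧⁺ (not⁺ p) (δ-refl _))
                  (∧⁺ (not⁺ q) (subst (λ j → δ (ℓ′ (src e)) j ≡ true) (closed (src e) (tgt e) p q (joins-adj G {e} (inj₁ (refl , refl)))) (δ-refl _))) (loopless e))

      abstract
        brick⇒matchable : TightCutFree G → ¬ Bipartite G → ∀ x → Factor G (δ x)
        brick⇒matchable = brick⇒matchable′

open Factors

-- Bipartite cubic graphs: adjacent vertices are doubly matchable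

module BipartiteGraphs where

  module Bip (G : Graph) (good : Good G) (A : Pred (order G)) (bip : ∀ e → cutᴳ G A e ≡ true) where
    open Graph G using (src; tgt; size; loopless; V; E; Joins)
    open Good good

    adj-side : ∀ {u v} → Adj G u v ≡ true → A v ≡ not (A u)
    adj-side {u} {v} h with adj-joins G h
    ... | e , inj₁ (refl , refl) = lem (A (src e)) (A (tgt e)) (bip e)
      where
      lem : ∀ a b → a xor b ≡ true → b ≡ not a
      lem true  false _ = refl
      lem false true  _ = refl
    ... | e , inj₂ (refl , refl) = lem (A (src e)) (A (tgt e)) (bip e)
      where
      lem : ∀ a b → a xor b ≡ true → a ≡ not b
      lem true  false _ = refl
      lem false true  _ = refl

    one-sided : ∀ (U : Pred (order G)) → U ⊑ A → ∀ w → sum (λ v → ⟦ U v ⟧ * wtᴳ G w (δ v)) ≡ wtᴳ G w U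
    one-sided U U⊑A w = trans (sum-cong λ v → cong (⟦ U v ⟧ *_) (wt-δᴳ G w v)) (trans (EdgeLemmas.handshake-cut src tgt w U)
      (trans (cong (wtᴳ G w U +_) (cong₂ _+_ none none)) (+-identityʳ _)))
      where
      none : Edges.inner src tgt w U ≡ 0
      none = lin-0 pt
        where
        pt : ∀ e → ⟦ U (src e) ∧ U (tgt e) ⟧ * w e ≡ 0
        pt e with bool (U (src e) ∧ U (tgt e))
        ... | inj₂ f rewrite f = refl
        ... | inj₁ t = ⊥-elim (true≢false (bip e) (cong₂ _xor_ (U⊑A _ (proj₁ (∧⁻ t))) (U⊑A _ (proj₂ (∧⁻ {U (src e)} t)))))

    one-sided-size : ∀ U → U ⊑ A → cutSize G U ≡ 3 * count U
    one-sided-size U U⊑A = trans (sym (one-sided U U⊑A (const 1))) (trans (sum-cong λ v → trans (cong (⟦ U v ⟧ *_) (cubic v)) (*-comm ⟦ U v ⟧ 3))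
      (trans (*-sum 3 _) (cong (3 *_) (sym (count≡sum U)))))

  module _ (G : Graph) (good : Good G) (A : Pred (order G)) (bip : ∀ e → cutᴳ G A e ≡ true) where
    open Graph G using (src; tgt; size; loopless; V; E; Joins)
    open Good good

    private
      Ā : Pred (order G)
      Ā = not ∘ A

      bip′ : ∀ e → cutᴳ G Ā e ≡ true
      bip′ e = trans (cut-not G A e) (bip e)

    balanced-sides : count A ≡ count Ā
    balanced-sides = *-cancelˡ-≡ _ _ 3 (trans (sym (Bip.one-sided-size G good A bip A (λ _ h → h)))
      (trans (sym (wt-not G (const 1) A)) (Bip.one-sided-size G good Ā bip′ Ā (λ _ h → h))))

    -- Both colour classes meet the same number of edges of a factor.
    one-sided-factor : ∀ Q → Q ⊑ A → Factor G Q → count Q ≡ 0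
    one-sided-factor Q Q⊑A (F , h) = *-cancelˡ-≡ _ 0 2 (+-cancelˡ-≡ (count A) _ 0 (begin
      count A + 2 * count Q                                 ≡⟨ cong₂ _+_ (count≡sum A) (trans (cong (2 *_) (count≡sum Q)) (sym (*-sum 2 _))) ⟩
      sum (λ v → ⟦ A v ⟧) + sum (λ v → 2 * ⟦ Q v ⟧)         ≡⟨ sum-+ _ _ ⟨
      sum (λ v → ⟦ A v ⟧ + 2 * ⟦ Q v ⟧)                     ≡⟨ sum-cong inA ⟨
      sum (λ v → ⟦ A v ⟧ * degᴳ G F v)                      ≡⟨ Bip.one-sided G good A bip A (λ _ h → h) (⟦_⟧ ∘ F) ⟩
      wtᴳ G (⟦_⟧ ∘ F) A                                     ≡⟨ wt-not G (⟦_⟧ ∘ F) A ⟨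
      wtᴳ G (⟦_⟧ ∘ F) Ā                                     ≡⟨ Bip.one-sided G good Ā bip′ Ā (λ _ h → h) (⟦_⟧ ∘ F) ⟨
      sum (λ v → ⟦ Ā v ⟧ * degᴳ G F v)                      ≡⟨ sum-cong inĀ ⟩
      sum (λ v → ⟦ Ā v ⟧)                                   ≡⟨ count≡sum Ā ⟨
      count Ā                                               ≡⟨ balanced-sides ⟨
      count A                                               ≡⟨ +-identityʳ _ ⟨
      count A + 0                                           ∎))
      where
      open ≡-Reasoning
      inA : ∀ v → ⟦ A v ⟧ * degᴳ G F v ≡ ⟦ A v ⟧ + 2 * ⟦ Q v ⟧
      inA v rewrite h v | want≡ Q v with bool (A v)
      ... | inj₁ t rewrite t = +-identityʳ _
      ... | inj₂ f rewrite f | ≢true⇒false {Q v} (λ q → true≢false (Q⊑A v q) f) = refl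
      inĀ : ∀ v → ⟦ Ā v ⟧ * degᴳ G F v ≡ ⟦ Ā v ⟧
      inĀ v rewrite h v | want≡ Q v with bool (A v)
      ... | inj₁ t rewrite t = refl
      ... | inj₂ f rewrite f | ≢true⇒false {Q v} (λ q → true≢false (Q⊑A v q) f) = refl

    -- The stars at y and v cover these two vertices and all their neighbours. What is left of the
    -- colour classes, `P` and `Q`, has to be matched perfectly. The third vertex `z₀` rules out the
    -- graph with two vertices and three parallel edges, so that each star reaches three different
    -- neighbours.
    module DoubleFrom (y v : V) (Ay : A y ≡ true) (yv : Adj G y v ≡ true) (z₀ : V) (z₀∉ : (δ y z₀ ∨ δ v z₀) ≡ false) where
      Av : A v ≡ false
      Av = trans (Bip.adj-side G good A bip yv) (cong not Ay)
      y≢v : y ≢ v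
      y≢v refl = true≢false Ay Av
      R = Adj G
      third : ∀ {u w} → y ≢ v → (∀ z → z ≡ u ⊎ z ≡ w) → (u ≡ y ⊎ u ≡ v) → ⊥
      third {u} {w} ne all (inj₁ refl) with all v | all z₀
      ... | inj₁ e | _ = ne (sym e)
      ... | inj₂ refl | inj₁ refl = true≢false (∨⁺ˡ (δ-refl u)) z₀∉
      ... | inj₂ refl | inj₂ refl = true≢false (∨⁺ʳ {δ y w} (δ-refl w)) z₀∉
      third {u} {w} ne all (inj₂ refl) with all y | all z₀
      ... | inj₁ e | _ = ne e
      ... | inj₂ refl | inj₁ refl = true≢false (∨⁺ʳ {δ y u} (δ-refl u)) z₀∉
      ... | inj₂ refl | inj₂ refl = true≢false (∨⁺ˡ (δ-refl w)) z₀∉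
      smp : ∀ u → u ≡ y ⊎ u ≡ v → ∀ z → u ≢ z → mult G u z ≤ 1
      smp u w z ne with simple G good ne
      ... | inj₂ le  = le
      ... | inj₁ all = ⊥-elim (third y≢v all w)
      P Q : Pred (order G)
      P z = A z ∧ not (R v z)
      Q z = not (A z) ∧ not (R y z)
      P⁻ : ∀ {z} → P z ≡ true → A z ≡ true × R v z ≡ false
      P⁻ {z} h = proj₁ (∧⁻ h) , not⁻ (proj₂ (∧⁻ {A z} h))
      Q⁻ : ∀ {z} → Q z ≡ true → A z ≡ false × R y z ≡ false
      Q⁻ {z} h = not⁻ (proj₁ (∧⁻ h)) , not⁻ (proj₂ (∧⁻ {not (A z)} h))
      countP : count A ≡ 3 + count P
      countP = trans (count-split A (R v)) (cong (_+ count P) (trans (count-cong λ z → ≡-by-truth (λ h → proj₂ (∧⁻ {A z} h))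
        (λ h → ∧⁺ (trans (Bip.adj-side G good A bip h) (cong not Av)) h)) (count-Adj G good v (smp v (inj₂ refl)))))
      countQ : count Ā ≡ 3 + count Q
      countQ = trans (count-split Ā (R y)) (cong (_+ count Q) (trans (count-cong λ z → ≡-by-truth (λ h → proj₂ (∧⁻ {not (A z)} h))
        (λ h → ∧⁺ (cong not (trans (Bip.adj-side G good A bip h) (cong not Ay))) h)) (count-Adj G good y (smp y (inj₁ refl)))))
      P≡Q : count P ≡ count Q
      P≡Q = +-cancelˡ-≡ 3 _ _ (trans (sym countP) (trans balanced-sides countQ))
      PQ : Pred (order G)
      PQ z = P z ∨ Q z

      mates : Matching R P Q → ∃ (Tutte.IsPM R (adj-sym G) PQ)
      mates m = mate , isPM
        where
        open Matching m
        back : V → V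
        back z = pick (λ a → P a ∧ δ (to a) z) y
        back-ok : ∀ z → Q z ≡ true → P (back z) ≡ true × to (back z) ≡ z
        back-ok z Qz with injection-onto P Q to to-∈ to-inj (≤-reflexive (sym P≡Q)) z Qz
        ... | a , Pa , refl = let h = pick-∈ (λ a → P a ∧ δ (to a) z) y (∧⁺ Pa (δ-refl (to a))) in proj₁ (∧⁻ h) , δ-true (proj₂ (∧⁻ {P (back z)} h))
        mate : V → V
        mate z = if A z then to z else back z
        mate-P : ∀ {z} → A z ≡ true → mate z ≡ to z
        mate-P {z} h rewrite h = refl
        mate-Q : ∀ {z} → A z ≡ false → mate z ≡ back z
        mate-Q {z} h rewrite h = refl
        pm-at : ∀ z → P z ≡ true ⊎ Q z ≡ true → PQ (mate z) ≡ true × R z (mate z) ≡ true × mate z ≢ z × mate (mate z) ≡ z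
        pm-at z (inj₁ Pz) rewrite mate-P (proj₁ (P⁻ Pz)) =
            ∨⁺ʳ {P (to z)} (to-∈ z Pz) , to-edge z Pz , (λ e → true≢false (proj₁ (P⁻ Pz)) (subst (λ x → A x ≡ false) e (proj₁ (Q⁻ (to-∈ z Pz)))))
          , trans (mate-Q (proj₁ (Q⁻ (to-∈ z Pz)))) (to-inj _ _ (proj₁ (back-ok _ (to-∈ z Pz))) Pz (proj₂ (back-ok _ (to-∈ z Pz))))
        pm-at z (inj₂ Qz) rewrite mate-Q (proj₁ (Q⁻ Qz)) = let (Pb , eq) = back-ok z Qz in
            ∨⁺ˡ Pb , trans (adj-sym G z (back z)) (subst (λ x → R (back z) x ≡ true) eq (to-edge (back z) Pb))
          , (λ e → true≢false (subst (λ x → A x ≡ true) e (proj₁ (P⁻ Pb))) (proj₁ (Q⁻ Qz))) , trans (mate-P (proj₁ (P⁻ Pb))) eq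
        isPM : Tutte.IsPM R (adj-sym G) PQ mate
        isPM = record { mate-∈ = λ z h → proj₁ (pm-at z (∨⁻ h)) ; mate-edge = λ z h → proj₁ (proj₂ (pm-at z (∨⁻ h)))
          ; mate-≢ = λ z h → proj₁ (proj₂ (proj₂ (pm-at z (∨⁻ h)))) ; mate-mate = λ z h → proj₂ (proj₂ (proj₂ (pm-at z (∨⁻ h)))) }

      from-mates : ∀ M → (∀ e → M e ≡ true → PQ (src e) ≡ true × PQ (tgt e) ≡ true) →
        (∀ z → PQ z ≡ true → Edges.dg src tgt (⟦_⟧ ∘ M) z ≡ 1) → Factor G (λ x → δ y x ∨ δ v x)
      from-mates M within degM = (λ e → M e ∨ (star G y e ∨ star G v e)) , degrees
        where
        ¬PQy : PQ y ≡ false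
        ¬PQy = cong₂ _∨_ (trans (cong (λ b → A y ∧ not b) (trans (adj-sym G v y) yv)) (Bool.∧-zeroʳ (A y))) (cong (λ b → not b ∧ not (R y y)) Ay)
        ¬PQv : PQ v ≡ false
        ¬PQv = cong₂ _∨_ (cong (λ b → b ∧ not (R v v)) Av) (trans (cong (λ b → not (A v) ∧ not b) yv) (Bool.∧-zeroʳ (not (A v))))
        total : ∀ z → degᴳ G (λ e → M e ∨ (star G y e ∨ star G v e)) z ≡ Edges.dg src tgt (⟦_⟧ ∘ M) z + degᴳ G (λ e → star G y e ∨ star G v e) z
        total z = trans (wt-δᴳ G _ z) (trans (EdgeLemmas.dg-∨ src tgt M (λ e → star G y e ∨ star G v e) disjoint z) (cong (_ +_) (sym (wt-δᴳ G _ z))))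
          where
          avoid : ∀ {u} → PQ u ≡ false → ∀ e → M e ≡ true → star G u e ≡ true → ⊥
          avoid ¬u e me st = let (a , b) = within e me in true≢false st (cong₂ _xor_ (δ-false λ { refl → true≢false a ¬u }) (δ-false λ { refl → true≢false b ¬u }))
          disjoint : ∀ e → M e ≡ true → (star G y e ∨ star G v e) ≡ true → ⊥
          disjoint e me h with ∨⁻ {star G y e} h
          ... | inj₁ s = avoid ¬PQy e me s
          ... | inj₂ s = avoid ¬PQv e me s
        out : ∀ z → PQ z ≡ false → Edges.dg src tgt (⟦_⟧ ∘ M) z ≡ 0
        out = EdgeLemmas.dg-outside src tgt PQ M within
        stars-y : degᴳ G (λ e → star G y e ∨ star G v e) y ≡ 3
        stars-y = trans (lin-cong λ e → lem (star G y e) (star G v e)) (cubic y)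
          where
          lem : ∀ a b → ⟦ a ⟧ * ⟦ a ∨ b ⟧ ≡ ⟦ a ⟧ * 1
          lem true  b = refl
          lem false b = refl
        stars-v : degᴳ G (λ e → star G y e ∨ star G v e) v ≡ 3
        stars-v = trans (lin-cong λ e → lem (star G y e) (star G v e)) (cubic v)
          where
          lem : ∀ a b → ⟦ b ⟧ * ⟦ a ∨ b ⟧ ≡ ⟦ b ⟧ * 1
          lem true  true  = refl
          lem false true  = refl
          lem a     false = refl
        stars : ∀ z → y ≢ z → v ≢ z → degᴳ G (λ e → star G y e ∨ star G v e) z ≡ mult G y z + mult G v z
        stars z ny nv = trans (lin-cong pt) (lin-+ _ (⟦_⟧ ∘ star G y) (⟦_⟧ ∘ star G v))
          where
          pt : ∀ e → ⟦ star G z e ⟧ * ⟦ star G y e ∨ star G v e ⟧ ≡ ⟦ star G z e ⟧ * (⟦ star G y e ⟧ + ⟦ star G v e ⟧)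
          pt e with star G z e in p | star G y e in q | star G v e in r
          ... | false | _     | _     = refl
          ... | true  | true  | false = refl
          ... | true  | false | _     = refl
          ... | true  | true  | true  with star-joins G {e = e} ny q p | star-joins G {e = e} nv r p
          ...   | inj₁ (a , b) | inj₁ (c , d) = contradiction (trans (sym a) c) y≢v
          ...   | inj₂ (a , b) | inj₂ (c , d) = contradiction (trans (sym b) d) y≢v
          ...   | inj₁ (a , b) | inj₂ (c , d) = contradiction (trans (sym a) c) ny
          ...   | inj₂ (a , b) | inj₁ (c , d) = contradiction (trans (sym c) a) nv
        degrees : ∀ z → degᴳ G (λ e → M e ∨ (star G y e ∨ star G v e)) z ≡ want (λ x → δ y x ∨ δ v x) z
        degrees z with y ≟ z | v ≟ z
        ... | yes refl | _ rewrite δ-refl y = trans (total y) (cong₂ _+_ (out y ¬PQy) stars-y)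
        ... | no ny | yes refl rewrite δ-refl v | Bool.∨-zeroʳ (δ y v) = trans (total v) (cong₂ _+_ (out v ¬PQv) stars-v)
        ... | no ny | no nv rewrite δ-false ny | δ-false nv = trans (total z) (trans (cong (_ +_) (stars z ny nv)) (side (bool (A z))))
          where
          side : A z ≡ true ⊎ A z ≡ false → Edges.dg src tgt (⟦_⟧ ∘ M) z + (mult G y z + mult G v z) ≡ 1
          side (inj₁ Az) with mult-zero G ny (≢true⇒false λ h → true≢false Az (trans (Bip.adj-side G good A bip h) (cong not Ay))) | bool (R v z)
          ... | my | inj₁ h = cong₂ _+_ (out z (cong₂ _∨_ (trans (cong (λ b → A z ∧ not b) h) (Bool.∧-zeroʳ (A z))) (cong (λ b → not b ∧ not (R y z)) Az)))
                                (cong₂ _+_ my (≤-antisym (smp v (inj₂ refl) z nv) (mult-pos G h)))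
          ... | my | inj₂ h = cong₂ _+_ (degM z (∨⁺ˡ (∧⁺ Az (not⁺ h)))) (cong₂ _+_ my (mult-zero G nv h))
          side (inj₂ Az) with mult-zero G nv (≢true⇒false λ h → true≢false (trans (Bip.adj-side G good A bip h) (cong not Av)) Az) | bool (R y z)
          ... | mv | inj₁ h = cong₂ _+_ (out z (cong₂ _∨_ (cong (λ b → b ∧ not (R v z)) Az) (trans (cong (λ b → not (A z) ∧ not b) h) (Bool.∧-zeroʳ (not (A z))))))
                                (cong₂ _+_ (≤-antisym (smp y (inj₁ refl) z ny) (mult-pos G h)) mv)
          ... | mv | inj₂ h = cong₂ _+_ (degM z (∨⁺ʳ {P z} (∧⁺ (not⁺ Az) (not⁺ h)))) (cong₂ _+_ (mult-zero G ny h) mv)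

      -- Let ZA be I with y, and let ZB consist of the neighbours of I in Q and those of y other
      -- than v. Since I violates Hall's condition, ZB is no larger than ZA. Every edge leaving ZA
      -- ends in ZB, except the one from y to v. Counting edges, the union of ZA and ZB has a cut of
      -- at most two edges although it separates y from v.
      no-violation : ∀ I → I ⊑ P → count (λ j → Q j ∧ Nb R I j) < count I → ⊥
      no-violation I I⊑P lt = contradiction (≤-trans (+-monoˡ-≤ (3 * suc (count I)) (three Z y v Zy Zv)) bound) (<⇒≱ ≤-refl)
        where
        ZA ZB Z : Pred (order G)
        ZA = I ⊕ y
        ZB z = (Q z ∧ Nb R I z) ∨ (R y ∖ v) z
        Z z = ZA z ∨ ZB z
        Iy : I y ≡ false
        Iy = ≢true⇒false λ h → true≢false (trans (adj-sym G v y) yv) (proj₂ (P⁻ (I⊑P y h)))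
        ZA⊑A : ZA ⊑ A
        ZA⊑A z h with ⊕⁻ I h
        ... | inj₁ i    = proj₁ (P⁻ (I⊑P z i))
        ... | inj₂ refl = Ay
        ZB⊑Ā : ZB ⊑ Ā
        ZB⊑Ā z h with ∨⁻ {Q z ∧ Nb R I z} h
        ... | inj₁ q = not⁺ (proj₁ (Q⁻ (proj₁ (∧⁻ {Q z} q))))
        ... | inj₂ r = cong not (trans (Bip.adj-side G good A bip (proj₁ (∖⁻ (R y) r))) (cong not Ay))
        countZB : count ZB ≤ suc (count I)
        countZB = begin
          count ZB                                          ≤⟨ count-∨-≤ _ _ ⟩
          count (λ z → Q z ∧ Nb R I z) + count (R y ∖ v)    ≡⟨ cong (count (λ z → Q z ∧ Nb R I z) +_)
                                                                  (suc-inj (trans (sym (count-∖ v yv)) (count-Adj G good y (smp y (inj₁ refl))))) ⟩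
          count (λ z → Q z ∧ Nb R I z) + 2                  ≡⟨ +-comm _ 2 ⟩
          2 + count (λ z → Q z ∧ Nb R I z)                  ≤⟨ s≤s lt ⟩
          suc (count I)                                     ∎
          where
          open ≤-Reasoning
          suc-inj : ∀ {m n} → suc m ≡ suc n → m ≡ n
          suc-inj refl = refl
        Zy : Z y ≡ true
        Zy = ∨⁺ˡ {ZA y} (∨⁺ʳ {I y} (δ-refl y))
        Zv : Z v ≡ false
        Zv = cong₂ _∨_ (≢true⇒false λ h → true≢false (ZA⊑A v h) Av) (cong₂ _∨_ (cong (λ b → (not (A v) ∧ not b) ∧ Nb R I v) yv ∙ zero∧ (not (A v)) (Nb R I v))
               (trans (cong (λ b → R y v ∧ not b) (δ-refl v)) (Bool.∧-zeroʳ (R y v))))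
          where
          _∙_ : ∀ {x y z : Bool} → x ≡ y → y ≡ z → x ≡ z
          _∙_ = trans
          zero∧ : ∀ a b → (a ∧ false) ∧ b ≡ false
          zero∧ a b rewrite Bool.∧-zeroʳ a = refl
        exits : ∀ {a b} → A a ≡ true → A b ≡ false → R a b ≡ true → ZA a ≡ true → ZB b ≡ true ⊎ (y ≡ a × v ≡ b)
        exits {a} {b} Aa Ab ab h with ⊕⁻ I h
        ... | inj₂ refl with v ≟ b
        ...   | yes refl = inj₂ (refl , refl)
        ...   | no ne    = inj₁ (∨⁺ʳ {Q b ∧ Nb R I b} (∖⁺ (R y) ab ne))
        exits {a} {b} Aa Ab ab h | inj₁ Ia with bool (R y b)
        ...   | inj₁ yb = inj₁ (∨⁺ʳ {Q b ∧ Nb R I b} (∖⁺ (R y) yb λ { refl → true≢false (trans (adj-sym G v a) ab) (proj₂ (P⁻ (I⊑P a Ia))) }))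
        ...   | inj₂ yb = inj₁ (∨⁺ˡ (∧⁺ (∧⁺ (not⁺ Ab) (not⁺ yb)) (Nb⁺ R Ia ab)))
        pt : ∀ e → ⟦ cutᴳ G Z e ⟧ + ⟦ cutᴳ G ZA e ⟧ ≤ ⟦ cutᴳ G ZB e ⟧ + 2 * (⟦ star G v e ⟧ * ⟦ star G y e ⟧)
        pt e with bool (A (src e))
        ... | inj₁ As = lem (src e) (tgt e) As At (exits As At (joins-adj G {e} (inj₁ (refl , refl)))) star≡
          where
          At : A (tgt e) ≡ false
          At = trans (Bip.adj-side G good A bip (joins-adj G {e} (inj₁ (refl , refl)))) (cong not As)
          star≡ : y ≡ src e × v ≡ tgt e → ⟦ star G v e ⟧ * ⟦ star G y e ⟧ ≡ 1
          star≡ (p , q) = cong₂ (λ a b → ⟦ a ⟧ * ⟦ b ⟧) (joins-star G {e = e} (inj₂ (sym p , sym q))) (joins-star G {e = e} (inj₁ (sym p , sym q)))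
          lem : ∀ a b → A a ≡ true → A b ≡ false → (ZA a ≡ true → ZB b ≡ true ⊎ (y ≡ a × v ≡ b)) → ∀ {s} → (y ≡ a × v ≡ b → s ≡ 1) →
            ⟦ Z a xor Z b ⟧ + ⟦ ZA a xor ZA b ⟧ ≤ ⟦ ZB a xor ZB b ⟧ + 2 * s
          lem a b Aa Ab ex {s} st rewrite ≢true⇒false {ZA b} (λ h → true≢false (ZA⊑A b h) Ab) | ≢true⇒false {ZB a} (λ h → true≢false Aa (not⁻ (ZB⊑Ā a h)))
            with ZA a | ZB b
          ... | false | true  = s≤s z≤n
          ... | false | false = z≤n
          ... | true  | true  = s≤s z≤n
          ... | true  | false with ex refl
          ...   | inj₂ pq rewrite st pq = s≤s (s≤s z≤n)
        ... | inj₂ As = lem (tgt e) (src e) At As (exits At As (joins-adj G {e} (inj₂ (refl , refl)))) star≡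
          where
          At : A (tgt e) ≡ true
          At = trans (Bip.adj-side G good A bip (joins-adj G {e} (inj₁ (refl , refl)))) (cong not As)
          star≡ : y ≡ tgt e × v ≡ src e → ⟦ star G v e ⟧ * ⟦ star G y e ⟧ ≡ 1
          star≡ (p , q) = cong₂ (λ a b → ⟦ a ⟧ * ⟦ b ⟧) (joins-star G {e = e} (inj₁ (sym q , sym p))) (joins-star G {e = e} (inj₂ (sym q , sym p)))
          lem : ∀ a b → A a ≡ true → A b ≡ false → (ZA a ≡ true → ZB b ≡ true ⊎ (y ≡ a × v ≡ b)) → ∀ {s} → (y ≡ a × v ≡ b → s ≡ 1) →
            ⟦ Z b xor Z a ⟧ + ⟦ ZA b xor ZA a ⟧ ≤ ⟦ ZB b xor ZB a ⟧ + 2 * s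
          lem a b Aa Ab ex {s} st rewrite ≢true⇒false {ZA b} (λ h → true≢false (ZA⊑A b h) Ab) | ≢true⇒false {ZB a} (λ h → true≢false Aa (not⁻ (ZB⊑Ā a h)))
            with ZA a | ZB b
          ... | false | true  = s≤s z≤n
          ... | false | false = z≤n
          ... | true  | true  = s≤s z≤n
          ... | true  | false with ex refl
          ...   | inj₂ pq rewrite st pq = s≤s (s≤s z≤n)
        bound : cutSize G Z + 3 * suc (count I) ≤ 2 + 3 * suc (count I)
        bound = begin
          cutSize G Z + 3 * suc (count I)                        ≡⟨ cong (λ n → cutSize G Z + 3 * n) (count-⊕ y Iy) ⟨
          cutSize G Z + 3 * count ZA                             ≡⟨ cong (cutSize G Z +_) (Bip.one-sided-size G good A bip ZA ZA⊑A) ⟨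
          cutSize G Z + cutSize G ZA                             ≡⟨ cong₂ _+_ (cutSize≡sum G Z) (cutSize≡sum G ZA) ⟩
          sum (λ e → ⟦ cutᴳ G Z e ⟧) + sum (λ e → ⟦ cutᴳ G ZA e ⟧) ≡⟨ sum-+ _ _ ⟨
          sum (λ e → ⟦ cutᴳ G Z e ⟧ + ⟦ cutᴳ G ZA e ⟧)           ≤⟨ sum-mono-≤ pt ⟩
          sum (λ e → ⟦ cutᴳ G ZB e ⟧ + 2 * (⟦ star G v e ⟧ * ⟦ star G y e ⟧)) ≡⟨ sum-+ _ _ ⟩
          sum (λ e → ⟦ cutᴳ G ZB e ⟧) + sum (λ e → 2 * (⟦ star G v e ⟧ * ⟦ star G y e ⟧)) ≡⟨ cong₂ _+_ (sym (cutSize≡sum G ZB)) (trans (*-sum 2 _) (cong (2 *_) (sym (lin≡sum _ _)))) ⟩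
          cutSize G ZB + 2 * mult G y v                          ≤⟨ +-mono-≤ (≤-reflexive (Bip.one-sided-size G good Ā bip′ ZB ZB⊑Ā)) (*-monoʳ-≤ 2 (smp y (inj₁ refl) v y≢v)) ⟩
          3 * count ZB + 2                                       ≤⟨ +-monoˡ-≤ 2 (*-monoʳ-≤ 3 countZB) ⟩
          3 * suc (count I) + 2                                  ≡⟨ +-comm (3 * suc (count I)) 2 ⟩
          2 + 3 * suc (count I)                                  ∎
          where open ≤-Reasoning


      factor : Factor G (λ x → δ y x ∨ δ v x)
      factor with hall R y P Q
      ... | inj₂ (I , I⊑P , lt) = ⊥-elim (no-violation I I⊑P lt)
      ... | inj₁ m with EdgeLemmas.realise src tgt (const 1) PQ (proj₁ (mates m)) (proj₂ (mates m))
      ...   | M , _ , within , degM = from-mates M within degM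

    double-from-A : ∀ y v → A y ≡ true → Adj G y v ≡ true → Double G y v
    double-from-A y v Ay yv = y≢v , factor
      where
      y≢v : y ≢ v
      y≢v e = joins-≢ G (proj₂ (adj-joins G yv)) e
      factor : Factor G (λ x → δ y x ∨ δ v x)
      factor with any? (λ z → (δ y z ∨ δ v z) Bool.≟ false)
      -- The graph consists of y and v only, and all its edges form the factor.
      ... | no ∄ = const true , λ z → trans (lin-cong λ e → refl) (trans (cubic z) (sym (cong (λ b → if b then 3 else 1) (≢false⇒true λ h → ∄ (z , h)))))
      ... | yes (z₀ , z₀∉) = DoubleFrom.factor y v Ay yv z₀ z₀∉

  adjacent⇒double : ∀ G → Good G → ∀ A → (∀ e → cutᴳ G A e ≡ true) → ∀ y v → Adj G y v ≡ true → Double G y v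
  adjacent⇒double G good A bip y v yv with bool (A y)
  ... | inj₁ Ay = double-from-A G good A bip y v Ay yv
  ... | inj₂ Ay = double-from-A G good (not ∘ A) (λ e → trans (cut-not G A e) (bip e)) y v (not⁺ Ay) yv

  bipartite⇒unmatchable : ∀ G → Good G → ∀ A → (∀ e → cutᴳ G A e ≡ true) → ∀ x → ¬ Factor G (δ x)
  bipartite⇒unmatchable G good A bip x f with bool (A x)
  ... | inj₁ Ax = contradiction (trans (sym (count-δ x)) (one-sided-factor G good A bip (δ x) (λ v h → subst (λ z → A z ≡ true) (δ-true h) Ax) f)) λ ()
  ... | inj₂ Ax = contradiction (trans (sym (count-δ x)) (one-sided-factor G good (not ∘ A) (λ e → trans (cut-not G A e) (bip e)) (δ x)
                    (λ v h → subst (λ z → not (A z) ≡ true) (δ-true h) (not⁺ Ax)) f)) λ ()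

open BipartiteGraphs

-- Quotient maps, shrinking a shore, and gluing factors across a cut

module Quotients where

  sum-reindex : ∀ {m k} (p : Fin m → Fin k) (g : Fin k → ℕ) → (∀ e f → p e ≡ p f → e ≡ f) →
                (∀ e → g e ≡ 0 ⊎ ∃ λ f → p f ≡ e) → sum g ≡ sum (g ∘ p)
  sum-reindex p g inj onto = sym (begin
    sum (λ f → g (p f))                            ≡⟨ sum-cong (λ f → sum-δ g (p f)) ⟨
    sum (λ f → sum (λ e → ⟦ δ (p f) e ⟧ * g e))    ≡⟨ sum-swap _ ⟩
    sum (λ e → sum (λ f → ⟦ δ (p f) e ⟧ * g e))    ≡⟨ sum-cong pt ⟩
    sum g                                          ∎)
    where
    open ≡-Reasoning
    pt : ∀ e → sum (λ f → ⟦ δ (p f) e ⟧ * g e) ≡ g e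
    pt e with onto e
    ... | inj₁ z rewrite z = sum-zero λ f → *-zeroʳ ⟦ δ (p f) e ⟧
    ... | inj₂ (f₀ , refl) = trans (sum-cong λ f → cong (λ b → ⟦ b ⟧ * g (p f₀)) (≡-by-truth
            (λ h → subst (λ x → δ f₀ x ≡ true) (sym (inj f f₀ (δ-true h))) (δ-refl f₀))
            (λ h → subst (λ x → δ (p x) (p f₀) ≡ true) (δ-true h) (δ-refl (p f₀))))) (sum-δ (const (g (p f₀))) f₀)

  -- H arises from G by identifying vertices and deleting the loops so created.
  infix 4 _↠_
  record _↠_ (G H : Graph) : Set where
    field
      q      : Graph.V G → Graph.V H
      sec    : Graph.V H → Graph.V G
      q-sec  : ∀ v → q (sec v) ≡ v
      p      : Graph.E H → Graph.E G
      p-inj  : ∀ e f → p e ≡ p f → e ≡ f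
      p-ends : ∀ e → Graph.Joins H e (q (Graph.src G (p e))) (q (Graph.tgt G (p e)))
      p-onto : ∀ e → q (Graph.src G e) ≡ q (Graph.tgt G e) ⊎ ∃ λ f → p f ≡ e
  open _↠_ public

  joins-unique : ∀ G {e a b c d} → Graph.Joins G e a b → Graph.Joins G e c d → (a ≡ c × b ≡ d) ⊎ (a ≡ d × b ≡ c)
  joins-unique G (inj₁ (refl , refl)) (inj₁ (refl , refl)) = inj₁ (refl , refl)
  joins-unique G (inj₁ (refl , refl)) (inj₂ (refl , refl)) = inj₂ (refl , refl)
  joins-unique G (inj₂ (refl , refl)) (inj₁ (refl , refl)) = inj₂ (refl , refl)
  joins-unique G (inj₂ (refl , refl)) (inj₂ (refl , refl)) = inj₁ (refl , refl)

  module _ {G H : Graph} (Q : G ↠ H) where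

    noloop : ∀ f → q Q (Graph.src G (p Q f)) ≢ q Q (Graph.tgt G (p Q f))
    noloop f = joins-≢ H {f} (p-ends Q f)

    joins-image : ∀ f {a b} → Graph.Joins G (p Q f) a b → Graph.Joins H f (q Q a) (q Q b)
    joins-image f (inj₁ (refl , refl)) = p-ends Q f
    joins-image f (inj₂ (refl , refl)) = joins-swap H {f} (p-ends Q f)

    cut-image : ∀ U f → cutᴳ G (U ∘ q Q) (p Q f) ≡ cutᴳ H U f
    cut-image U f with p-ends Q f
    ... | inj₁ (a , b) rewrite a | b = refl
    ... | inj₂ (a , b) rewrite a | b = Bool.xor-comm (U (q Q (Graph.src G (p Q f)))) _

    wt-image : ∀ w U → wtᴳ G w (U ∘ q Q) ≡ wtᴳ H (w ∘ p Q) U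
    wt-image w U = trans (lin≡sum _ _) (trans (sum-reindex (p Q) _ (p-inj Q) onto)
        (trans (sum-cong λ f → cong (λ b → ⟦ b ⟧ * w (p Q f)) (cut-image U f)) (sym (lin≡sum _ _))))
      where
      onto : ∀ e → ⟦ cutᴳ G (U ∘ q Q) e ⟧ * w e ≡ 0 ⊎ ∃ λ f → p Q f ≡ e
      onto e with p-onto Q e
      ... | inj₂ h = inj₂ h
      ... | inj₁ l rewrite l | Bool.xor-same (U (q Q (Graph.tgt G e))) = inj₁ refl

    lift : Pred (Graph.size H) → Pred (Graph.size G)
    lift F e = [ const false , F ∘ proj₁ ]′ (p-onto Q e)

    lift-p : ∀ F f → lift F (p Q f) ≡ F f
    lift-p F f with p-onto Q (p Q f)
    ... | inj₁ l = contradiction l (noloop f)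
    ... | inj₂ (g , e) = cong F (p-inj Q g f e)

    lift-loop : ∀ F e → q Q (Graph.src G e) ≡ q Q (Graph.tgt G e) → lift F e ≡ false
    lift-loop F e l with p-onto Q e
    ... | inj₁ _ = refl
    ... | inj₂ (g , refl) = contradiction l (noloop g)

    wt-lift : ∀ F U → wtᴳ G (⟦_⟧ ∘ lift F) (U ∘ q Q) ≡ wtᴳ H (⟦_⟧ ∘ F) U
    wt-lift F U = trans (wt-image (⟦_⟧ ∘ lift F) U) (lin-cong λ f → cong (λ b → ⟦ cutᴳ H U f ⟧ * ⟦ b ⟧) (lift-p F f))

  -- H is G/Z up to isomorphism, given by a quotient map with fibre Z over x and single vertices
  -- elsewhere. In this form contractions can be composed and factored through one another.
  record Shrink (G : Graph) (Z : Pred (order G)) (H : Graph) (x : Graph.V H) : Set where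
    field
      map      : G ↠ H
      shrunk   : ∀ v → Z v ≡ true → q map v ≡ x
      kept     : ∀ v → Z v ≡ false → q map v ≢ x
      kept-inj : ∀ u v → Z u ≡ false → Z v ≡ false → q map u ≡ q map v → u ≡ v
    to : Graph.V G → Graph.V H
    to = q map
    from : Graph.V H → Graph.V G
    from = sec map

    δ-x : ∀ v → δ x (to v) ≡ Z v
    δ-x v with bool (Z v)
    ... | inj₁ h = trans (trans (cong (δ x) (shrunk v h)) (δ-refl x)) (sym h)
    ... | inj₂ h = trans (δ-false (kept v h ∘ sym)) (sym h)

    δ-kept : ∀ {v} → Z v ≡ false → ∀ u → δ (to v) (to u) ≡ δ v u
    δ-kept {v} h u with v ≟ u
    ... | yes refl = trans (δ-refl (to v)) (sym (δ-refl v))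
    ... | no ne with bool (Z u)
    ...   | inj₂ hu = trans (δ-false (ne ∘ kept-inj v u h hu)) (sym (δ-false ne))
    ...   | inj₁ hu = trans (δ-false λ e → kept v h (trans e (shrunk u hu))) (sym (δ-false ne))

    Z-from : ∀ v → Z (from v) ≡ δ x v
    Z-from v = trans (sym (δ-x (from v))) (cong (δ x) (q-sec map v))

    from-kept : ∀ {v} → v ≢ x → Z (from v) ≡ false
    from-kept {v} ne = trans (Z-from v) (δ-false (ne ∘ sym))

    from-to : ∀ v → Z v ≡ false → from (to v) ≡ v
    from-to v h = kept-inj (from (to v)) v (from-kept (kept v h)) h (q-sec map (to v))

    wt-x : ∀ w → wtᴳ H (w ∘ p map) (δ x) ≡ wtᴳ G w Z
    wt-x w = trans (sym (wt-image map w (δ x))) (Edges.wt-cong _ _ w δ-x)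

    wt-kept : ∀ w {v} → Z v ≡ false → wtᴳ H (w ∘ p map) (δ (to v)) ≡ wtᴳ G w (δ v)
    wt-kept w {v} h = trans (sym (wt-image map w (δ (to v)))) (Edges.wt-cong _ _ w (δ-kept h))

    lift-x : ∀ F → wtᴳ G (⟦_⟧ ∘ lift map F) Z ≡ degᴳ H F x
    lift-x F = trans (Edges.wt-cong _ _ _ (λ v → sym (δ-x v))) (wt-lift map F (δ x))

    lift-kept : ∀ F {v} → Z v ≡ false → degᴳ G (lift map F) v ≡ degᴳ H F (to v)
    lift-kept F {v} h = trans (Edges.wt-cong _ _ _ (λ u → sym (δ-kept h u))) (wt-lift map F (δ (to v)))

    cut-p : ∀ f → cutᴳ G Z (p map f) ≡ star H x f
    cut-p f = trans (cong₂ _xor_ (sym (δ-x _)) (sym (δ-x _))) (cut-image map (δ x) f)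

    Z-inhabited : Z (from x) ≡ true
    Z-inhabited = trans (Z-from x) (δ-refl x)

  -- Every cut of H is a cut of G of the same size, and the star of x is the cut around Z. The
  -- vertex `v₀` outside Z guarantees a second vertex of H.
  shrink-good : ∀ {G Z H x} → Shrink G Z H x → Good G → cutSize G Z ≡ 3 → ∀ v → Z v ≡ false → Good H
  shrink-good {G} {Z} {H} {x} s good size3 v₀ v₀∉ = record { cubic = cubic′ ; three = three′ ; large = large′ }
    where
    open Shrink s
    open Good good
    cubic′ : ∀ v → cutSize H (δ v) ≡ 3
    cubic′ v with v ≟ x
    ... | yes refl = trans (wt-x (const 1)) size3
    ... | no ne = subst (λ u → cutSize H (δ u) ≡ 3) (q-sec map v) (trans (wt-kept (const 1) (from-kept ne)) (cubic (from v)))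
    three′ : ∀ U u v → U u ≡ true → U v ≡ false → 3 ≤ cutSize H U
    three′ U u v Uu Uv = ≤-trans (three (U ∘ to) (from u) (from v) (trans (cong U (q-sec map u)) Uu) (trans (cong U (q-sec map v)) Uv))
      (≤-reflexive (wt-image map (const 1) U))
    large′ : 2 ≤ order H
    large′ = ≤-trans (≤-trans (≤-reflexive (cong suc (sym (count-δ x))))
      (count-⊏ {q = const true} (to v₀) (λ _ _ → refl) (δ-false (kept v₀ v₀∉ ∘ sym)) refl)) (≤-reflexive (count-full _))

  record Cut (G : Graph) (Z : Pred (order G)) (G₁ : Graph) (x₁ : Graph.V G₁) (G₂ : Graph) (x₂ : Graph.V G₂) : Set where
    field
      side₁ : Shrink G Z G₁ x₁
      side₂ : Shrink G (not ∘ Z) G₂ x₂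

  shrink-cong : ∀ {G Z Z′ H x} → (∀ v → Z v ≡ Z′ v) → Shrink G Z H x → Shrink G Z′ H x
  shrink-cong e s = record
    { map = map ; shrunk = λ v h → shrunk v (trans (e v) h) ; kept = λ v h → kept v (trans (e v) h)
    ; kept-inj = λ u v h h′ → kept-inj u v (trans (e u) h) (trans (e v) h′) }
    where open Shrink s

  cut-swap : ∀ {G Z G₁ x₁ G₂ x₂} → Cut G Z G₁ x₁ G₂ x₂ → Cut G (not ∘ Z) G₂ x₂ G₁ x₁
  cut-swap c = record { side₁ = Cut.side₂ c ; side₂ = shrink-cong (λ v → sym (Bool.not-involutive _)) (Cut.side₁ c) }

  full-star : ∀ H x → cutSize H (δ x) ≡ 3 → ∀ F → degᴳ H F x ≡ 3 → ∀ f → star H x f ≡ true → F f ≡ true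
  full-star H x c3 F d3 f h = proj₂ (∧⁻ {star H x f} (count-⊑-≡ {p = λ e → star H x e ∧ F e} {star H x} (λ e → proj₁ ∘ ∧⁻)
    (≤-reflexive (trans (sym (cutSize≡count H (δ x))) (trans c3 (trans (sym d3) (lin-∧ (star H x) F))))) f h))

  unique-star : ∀ H x F → degᴳ H F x ≡ 1 → ∃ λ f → star H x f ≡ true × F f ≡ true × (∀ g → star H x g ≡ true → F g ≡ true → f ≡ g)
  unique-star H x F d1 with count-pos⁻ {p = λ e → star H x e ∧ F e} (≤-reflexive (trans (sym d1) (lin-∧ (star H x) F)))
  ... | f , h = f , proj₁ (∧⁻ h) , proj₂ (∧⁻ {star H x f} h)
    , λ g sg Fg → count-one (λ e → star H x e ∧ F e) (trans (sym (lin-∧ (star H x) F)) d1) f g h (∧⁺ sg Fg)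

  module _ {G : Graph} {Z : Pred (order G)} {G₁ : Graph} {x₁ : Graph.V G₁} {G₂ : Graph} {x₂ : Graph.V G₂} (c : Cut G Z G₁ x₁ G₂ x₂) where
    private
      module S₁ = Shrink (Cut.side₁ c)
      module S₂ = Shrink (Cut.side₂ c)

    cut⇒star₁ : ∀ e → cutᴳ G Z e ≡ true → ∃ λ f → p S₁.map f ≡ e × star G₁ x₁ f ≡ true
    cut⇒star₁ e h with p-onto S₁.map e
    ... | inj₂ (f , refl) = f , refl , trans (sym (S₁.cut-p f)) h
    ... | inj₁ l = ⊥-elim (true≢false h (trans (cong₂ _xor_ (sym (S₁.δ-x _)) (sym (S₁.δ-x _))) (trans (cong (λ y → δ x₁ y xor δ x₁ (S₁.to (Graph.tgt G e))) l) (Bool.xor-same (δ x₁ (S₁.to (Graph.tgt G e)))))))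

    glue-one-side : ∀ F₁ F₂ → (∀ e → cutᴳ G Z e ≡ true → lift S₁.map F₁ e ≡ lift S₂.map F₂ e) →
      ∀ v → Z v ≡ false → degᴳ G (λ e → lift S₁.map F₁ e ∨ lift S₂.map F₂ e) v ≡ degᴳ G₁ F₁ (S₁.to v)
    glue-one-side F₁ F₂ agree v h = trans (lin-cong pt) (S₁.lift-kept F₁ h)
      where
      pt : ∀ e → ⟦ star G v e ⟧ * ⟦ lift S₁.map F₁ e ∨ lift S₂.map F₂ e ⟧ ≡ ⟦ star G v e ⟧ * ⟦ lift S₁.map F₁ e ⟧
      pt e with bool (cutᴳ G Z e)
      ... | inj₁ ce rewrite agree e ce | Bool.∨-idem (lift S₂.map F₂ e) = refl
      ... | inj₂ nce with bool (star G v e)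
      ...   | inj₂ ns rewrite ns = refl
      ...   | inj₁ s = cong (λ b → ⟦ star G v e ⟧ * ⟦ b ⟧) (trans (cong (lift S₁.map F₁ e ∨_) (lift-loop S₂.map F₂ e loop)) (Bool.∨-identityʳ _))
        where
        same : Z (Graph.src G e) ≡ Z (Graph.tgt G e)
        same = lem (Z (Graph.src G e)) (Z (Graph.tgt G e)) nce
          where
          lem : ∀ a b → a xor b ≡ false → a ≡ b
          lem true  true  _ = refl
          lem false false _ = refl
        out : Z (Graph.src G e) ≡ false
        out with cut-elim G (δ v) e s
        ... | x , y , j , dx , _ with δ-true dx | j
        ...   | refl | inj₁ (refl , _) = h
        ...   | refl | inj₂ (_ , refl) = trans same h
        loop : S₂.to (Graph.src G e) ≡ S₂.to (Graph.tgt G e)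
        loop = trans (S₂.shrunk _ (not⁺ out)) (sym (S₂.shrunk _ (not⁺ (trans (sym same) out))))

  module _ {G : Graph} {Z : Pred (order G)} {G₁ : Graph} {x₁ : Graph.V G₁} {G₂ : Graph} {x₂ : Graph.V G₂} (c : Cut G Z G₁ x₁ G₂ x₂) where
    private
      module S₁ = Shrink (Cut.side₁ c)
      module S₂ = Shrink (Cut.side₂ c)

    cut⇒star₂ : ∀ e → cutᴳ G Z e ≡ true → ∃ λ f → p S₂.map f ≡ e × star G₂ x₂ f ≡ true
    cut⇒star₂ e h = cut⇒star₁ (cut-swap c) e (trans (cut-not G Z e) h)

    star⇒cut₁ : ∀ f → star G₁ x₁ f ≡ true → cutᴳ G Z (p S₁.map f) ≡ true
    star⇒cut₁ f h = trans (S₁.cut-p f) h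

    star⇒cut₂ : ∀ f → star G₂ x₂ f ≡ true → cutᴳ G Z (p S₂.map f) ≡ true
    star⇒cut₂ f h = trans (sym (cut-not G Z (p S₂.map f))) (trans (S₂.cut-p f) h)

    glue : ∀ F₁ F₂ → (∀ e → cutᴳ G Z e ≡ true → lift S₁.map F₁ e ≡ lift S₂.map F₂ e) → ∃ λ F →
      (∀ v → Z v ≡ false → degᴳ G F v ≡ degᴳ G₁ F₁ (S₁.to v)) × (∀ v → Z v ≡ true → degᴳ G F v ≡ degᴳ G₂ F₂ (S₂.to v))
      × wtᴳ G (⟦_⟧ ∘ F) Z ≡ degᴳ G₁ F₁ x₁ × (∀ f → F (p S₁.map f) ≡ F₁ f)
    glue F₁ F₂ agree = (λ e → lift S₁.map F₁ e ∨ lift S₂.map F₂ e) , glue-one-side c F₁ F₂ agree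
      , (λ v h → trans (degᴳ-cong G (λ e → Bool.∨-comm (lift S₁.map F₁ e) _) v)
          (glue-one-side (cut-swap c) F₂ F₁ (λ e h → sym (agree e (trans (sym (cut-not G Z e)) h))) v (cong not h)))
      , trans (lin-cong pt) (S₁.lift-x F₁)
      , F-p
      where
      pt : ∀ e → ⟦ cutᴳ G Z e ⟧ * ⟦ lift S₁.map F₁ e ∨ lift S₂.map F₂ e ⟧ ≡ ⟦ cutᴳ G Z e ⟧ * ⟦ lift S₁.map F₁ e ⟧
      pt e with bool (cutᴳ G Z e)
      ... | inj₁ ce rewrite sym (agree e ce) | Bool.∨-idem (lift S₁.map F₁ e) = refl
      ... | inj₂ nce rewrite nce = refl
      F-p : ∀ f → (lift S₁.map F₁ (p S₁.map f) ∨ lift S₂.map F₂ (p S₁.map f)) ≡ F₁ f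
      F-p f with bool (cutᴳ G Z (p S₁.map f))
      ... | inj₁ ce = trans (cong (_ ∨_) (sym (agree _ ce))) (trans (Bool.∨-idem _) (lift-p S₁.map F₁ f))
      ... | inj₂ nce = trans (cong (_ ∨_) (lift-loop S₂.map F₂ _ loop)) (trans (Bool.∨-identityʳ _) (lift-p S₁.map F₁ f))
        where
        e = p S₁.map f
        cases : ∀ a b → a xor b ≡ false → (a ≡ true × b ≡ true) ⊎ (a ≡ false × b ≡ false)
        cases true  true  _ = inj₁ (refl , refl)
        cases false false _ = inj₂ (refl , refl)
        loop : S₂.to (Graph.src G e) ≡ S₂.to (Graph.tgt G e)
        loop with cases (Z (Graph.src G e)) (Z (Graph.tgt G e)) nce
        ... | inj₁ (a , b) = contradiction (trans (S₁.shrunk _ a) (sym (S₁.shrunk _ b))) (noloop S₁.map f)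
        ... | inj₂ (a , b) = trans (S₂.shrunk _ (not⁺ a)) (sym (S₂.shrunk _ (not⁺ b)))

    module _ (good₁ : Good G₁) (good₂ : Good G₂) where

      -- A factor of G₁ of degree 1 at x₁ is completed by a perfect matching of G₂ through the same cut edge.
      extend′ : ∀ F₁ → degᴳ G₁ F₁ x₁ ≡ 1 → ∃ λ F → (∀ v → Z v ≡ false → degᴳ G F v ≡ degᴳ G₁ F₁ (S₁.to v))
        × (∀ v → Z v ≡ true → degᴳ G F v ≡ 1) × (∀ f → F (p S₁.map f) ≡ F₁ f)
      extend′ F₁ d1 with unique-star G₁ x₁ F₁ d1
      ... | f , sf , Ff , uf with cut⇒star₂ (p S₁.map f) (star⇒cut₁ f sf)
      ...   | g , g≡ , sg with perfect-edge G₂ good₂ g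
      ...     | F₂ , pm , Fg with glue F₁ F₂ agree
        where
        ug : ∀ g′ → star G₂ x₂ g′ ≡ true → F₂ g′ ≡ true → g ≡ g′
        ug g′ s h = count-one (λ e → star G₂ x₂ e ∧ F₂ e) (trans (sym (lin-∧ (star G₂ x₂) F₂)) (pm x₂)) g g′ (∧⁺ sg Fg) (∧⁺ s h)
        agree : ∀ e → cutᴳ G Z e ≡ true → lift S₁.map F₁ e ≡ lift S₂.map F₂ e
        agree e ce with cut⇒star₁ c e ce | cut⇒star₂ e ce
        ... | f′ , refl , sf′ | g′ , eg , sg′ = trans (lift-p S₁.map F₁ f′) (trans (≡-by-truth fwd bwd) (trans (sym (lift-p S₂.map F₂ g′)) (cong (lift S₂.map F₂) eg)))
          where
          fwd : F₁ f′ ≡ true → F₂ g′ ≡ true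
          fwd h with uf f′ sf′ h
          ... | refl = subst (λ x → F₂ x ≡ true) (p-inj S₂.map g g′ (trans g≡ (sym eg))) Fg
          bwd : F₂ g′ ≡ true → F₁ f′ ≡ true
          bwd h with ug g′ sg′ h
          ... | refl = subst (λ x → F₁ x ≡ true) (p-inj S₁.map f f′ (trans (sym g≡) eg)) Ff
      ...       | F , a , b , _ , d = F , a , (λ v h → trans (b v h) (pm (S₂.to v))) , d

      abstract
        extend : ∀ F₁ → degᴳ G₁ F₁ x₁ ≡ 1 → ∃ λ F → (∀ v → Z v ≡ false → degᴳ G F v ≡ degᴳ G₁ F₁ (S₁.to v))
          × (∀ v → Z v ≡ true → degᴳ G F v ≡ 1) × (∀ f → F (p S₁.map f) ≡ F₁ f)
        extend = extend′

      factor-extend : ∀ Q → Q x₁ ≡ false → Factor G₁ Q → Factor G (λ v → not (Z v) ∧ Q (S₁.to v))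
      factor-extend Q Qx (F₁ , h) with extend F₁ (trans (h x₁) (cong (λ b → if b then 3 else 1) Qx))
      ... | F , a , b , _ = F , degrees
        where
        degrees : ∀ v → degᴳ G F v ≡ want (λ v → not (Z v) ∧ Q (S₁.to v)) v
        degrees v with bool (Z v)
        ... | inj₁ t rewrite t = b v t
        ... | inj₂ f rewrite f = trans (a v f) (h (S₁.to v))

      -- Degree 3 at both contraction vertices makes the factors agree on the cut, since each
      -- contains all three of its edges. The number of crossings is recorded because it contradicts
      -- tightness when the result is a perfect matching.
      factor-join : ∀ Q₁ Q₂ → Q₁ x₁ ≡ true → Q₂ x₂ ≡ true → Factor G₁ Q₁ → Factor G₂ Q₂ →
        ∃ λ F → (∀ v → degᴳ G F v ≡ want (λ v → if Z v then Q₂ (S₂.to v) else Q₁ (S₁.to v)) v) × wtᴳ G (⟦_⟧ ∘ F) Z ≡ 3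
      factor-join Q₁ Q₂ Q₁x Q₂x (F₁ , h₁) (F₂ , h₂) with glue F₁ F₂ agree
        where
        three₁ : degᴳ G₁ F₁ x₁ ≡ 3
        three₁ = trans (h₁ x₁) (cong (λ b → if b then 3 else 1) Q₁x)
        three₂ : degᴳ G₂ F₂ x₂ ≡ 3
        three₂ = trans (h₂ x₂) (cong (λ b → if b then 3 else 1) Q₂x)
        agree : ∀ e → cutᴳ G Z e ≡ true → lift S₁.map F₁ e ≡ lift S₂.map F₂ e
        agree e ce with cut⇒star₁ c e ce | cut⇒star₂ e ce
        ... | f , refl , sf | g , eg , sg = trans (lift-p S₁.map F₁ f) (trans (trans (full-star G₁ x₁ (Good.cubic good₁ x₁) F₁ three₁ f sf)
                (sym (full-star G₂ x₂ (Good.cubic good₂ x₂) F₂ three₂ g sg))) (trans (sym (lift-p S₂.map F₂ g)) (cong (lift S₂.map F₂) eg)))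
      ... | F , a , b , w , _ = F , degrees , trans w (trans (h₁ x₁) (cong (λ b → if b then 3 else 1) Q₁x))
        where
        degrees : ∀ v → degᴳ G F v ≡ want (λ v → if Z v then Q₂ (S₂.to v) else Q₁ (S₁.to v)) v
        degrees v with bool (Z v)
        ... | inj₁ t rewrite t = trans (b v t) (h₂ (S₂.to v))
        ... | inj₂ f rewrite f = trans (a v f) (h₁ (S₁.to v))

open Quotients

-- Comparison with `Contraction`, existence and composition of quotients

module Contractions where

  ∈-unique : ∀ {k} {p : Subset k} {i} (h h′ : i ∈ p) → h ≡ h′
  ∈-unique here      here       = refl
  ∈-unique (there h) (there h′) = cong there (∈-unique h h′)

  El-≡ : ∀ {k} {p : Subset k} {a b : El p} → proj₁ a ≡ proj₁ b → a ≡ b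
  El-≡ {a = i , h} {.i , h′} refl = cong (i ,_) (∈-unique h h′)

  ∈∁ : ∀ {k} {p : Subset k} {i} → lookup p i ≡ false → i ∈ ∁ p
  ∈∁ h = x∉p⇒x∈∁p λ m → true≢false (∈⇒true m) h

  ∁-false : ∀ {k} {p : Subset k} {i} → i ∈ ∁ p → lookup p i ≡ false
  ∁-false m = ∉⇒false (x∈∁p⇒x∉p m)

  collapse-in : ∀ {k} (X : Subset k) v → lookup X v ≡ true → collapse X v ≡ nothing
  collapse-in X v h with v ∈? X
  ... | yes _ = refl
  ... | no  n = contradiction (true⇒∈ h) n

  collapse-out : ∀ {k} (X : Subset k) v → (m : v ∈ ∁ X) → collapse X v ≡ just (v , m)
  collapse-out X v m with v ∈? X
  ... | yes h = contradiction h (x∈∁p⇒x∉p m)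
  ... | no  n = cong just (El-≡ refl)

  lookup-within : ∀ G X e → lookup (Graph.within G X) e ≡ Edges.inside (Graph.src G) (Graph.tgt G) (lookup X) e
  lookup-within G X e = lookup∘tabulate _ e

  -- The element z is the chosen preimage of the new vertex; for empty X that vertex would have
  -- none.
  contraction⇒shrink : ∀ {G X H} z → lookup X z ≡ true → (c : Contraction G X H) → Shrink G (lookup X) H (Contraction.vertex c nothing)
  contraction⇒shrink {G} {X} {H} z₀ Xz₀ c = record { map = quot ; shrunk = shrunk ; kept = kept ; kept-inj = kept-inj }
    where
    open Contraction c
    module Vs = Inverse vertices
    module Es = Inverse edges
    to-v : Graph.V G → Graph.V H
    to-v v = vertex (collapse X v)
    pre : Maybe (El (∁ X)) → Graph.V G
    pre nothing        = z₀
    pre (just (v , _)) = v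
    collapse-pre : ∀ m → collapse X (pre m) ≡ m
    collapse-pre nothing        = collapse-in X z₀ Xz₀
    collapse-pre (just (v , m)) = collapse-out X v m
    edge-of : Graph.E H → Graph.E G
    edge-of f = proj₁ (Es.from f)
    onto : ∀ e → to-v (Graph.src G e) ≡ to-v (Graph.tgt G e) ⊎ ∃ λ f → edge-of f ≡ e
    onto e with bool (lookup (Graph.within G X) e)
    ... | inj₂ f = inj₂ (edge (e , ∈∁ f) , cong proj₁ (Es.strictlyInverseʳ (e , ∈∁ f)))
    ... | inj₁ t = inj₁ (cong vertex (trans (collapse-in X _ (proj₁ (∧⁻ h))) (sym (collapse-in X _ (proj₂ (∧⁻ {lookup X (Graph.src G e)} h))))))
      where h = trans (sym (lookup-within G X e)) t
    quot : G ↠ H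
    quot = record
      { q = to-v ; sec = pre ∘ Vs.from ; q-sec = λ v → trans (cong vertex (collapse-pre (Vs.from v))) (Vs.strictlyInverseˡ v)
      ; p = edge-of
      ; p-inj = λ e f h → trans (sym (Es.strictlyInverseˡ e)) (trans (cong edge (El-≡ h)) (Es.strictlyInverseˡ f))
      ; p-ends = λ f → subst (λ g → Graph.Joins H g _ _) (Es.strictlyInverseˡ f) (ends (Es.from f) _ _ (inj₁ (refl , refl)))
      ; p-onto = onto }
    vertex-inj : ∀ {a b} → vertex a ≡ vertex b → a ≡ b
    vertex-inj {a} {b} h = trans (sym (Vs.strictlyInverseʳ a)) (trans (cong Vs.from h) (Vs.strictlyInverseʳ b))
    shrunk : ∀ v → lookup X v ≡ true → to-v v ≡ vertex nothing
    shrunk v h = cong vertex (collapse-in X v h)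
    kept : ∀ v → lookup X v ≡ false → to-v v ≢ vertex nothing
    kept v h e with trans (sym (collapse-out X v (∈∁ h))) (vertex-inj e)
    ... | ()
    kept-inj : ∀ u v → lookup X u ≡ false → lookup X v ≡ false → to-v u ≡ to-v v → u ≡ v
    kept-inj u v hu hv e with trans (sym (collapse-out X u (∈∁ hu))) (trans (vertex-inj e) (collapse-out X v (∈∁ hv)))
    ... | refl = refl

  shrink⇒contraction : ∀ {G H x} X → Shrink G (lookup X) H x → Contraction G X H
  shrink⇒contraction {G} {H} {x} X s = record { vertices = mk↔ₛ′ vto vfrom vto-from vfrom-to ; edges = mk↔ₛ′ eto efrom eto-from efrom-to ; ends = ends }
    where
    open Shrink s
    vto : Maybe (El (∁ X)) → Graph.V H
    vto nothing        = x
    vto (just (v , _)) = to v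
    vfrom : Graph.V H → Maybe (El (∁ X))
    vfrom w with w ≟ x
    ... | yes _ = nothing
    ... | no ne = just (from w , ∈∁ (from-kept ne))
    vto-from : ∀ w → vto (vfrom w) ≡ w
    vto-from w with w ≟ x
    ... | yes e = sym e
    ... | no ne = q-sec map w
    vfrom-to : ∀ m → vfrom (vto m) ≡ m
    vfrom-to nothing with x ≟ x
    ... | yes _ = refl
    ... | no ne = contradiction refl ne
    vfrom-to (just (v , m)) with to v ≟ x
    ... | yes e = contradiction e (kept v (∁-false m))
    ... | no ne = cong just (El-≡ (from-to v (∁-false m)))
    not-within : ∀ f → lookup (Graph.within G X) (p map f) ≡ false
    not-within f = ≢true⇒false λ h → let h′ = trans (sym (lookup-within G X (p map f))) h in
      noloop map f (trans (shrunk _ (proj₁ (∧⁻ h′))) (sym (shrunk _ (proj₂ (∧⁻ {lookup X (Graph.src G (p map f))} h′)))))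
    pre : ∀ e → lookup (Graph.within G X) e ≡ false → ∃ λ f → p map f ≡ e
    pre e h with p-onto map e
    ... | inj₂ r = r
    ... | inj₁ l with bool (lookup X (Graph.src G e)) | bool (lookup X (Graph.tgt G e))
    ...   | inj₁ a | inj₁ b = ⊥-elim (true≢false (trans (lookup-within G X e) (∧⁺ a b)) h)
    ...   | inj₁ a | inj₂ b = contradiction (trans (sym l) (shrunk _ a)) (kept _ b)
    ...   | inj₂ a | inj₁ b = contradiction (trans l (shrunk _ b)) (kept _ a)
    ...   | inj₂ a | inj₂ b = contradiction (kept-inj _ _ a b l) (Graph.loopless G e)
    eto : El (∁ (Graph.within G X)) → Graph.E H
    eto (e , m) = proj₁ (pre e (∁-false m))
    efrom : Graph.E H → El (∁ (Graph.within G X))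
    efrom f = p map f , ∈∁ (not-within f)
    eto-from : ∀ f → eto (efrom f) ≡ f
    eto-from f = p-inj map _ f (proj₂ (pre (p map f) (∁-false {p = Graph.within G X} (proj₂ (efrom f)))))
    efrom-to : ∀ e → efrom (eto e) ≡ e
    efrom-to (e , m) = El-≡ (proj₂ (pre e (∁-false m)))
    vto-collapse : ∀ v → vto (collapse X v) ≡ to v
    vto-collapse v with bool (lookup X v)
    ... | inj₁ h = trans (cong vto (collapse-in X v h)) (sym (shrunk v h))
    ... | inj₂ h = cong vto (collapse-out X v (∈∁ h))
    ends : ∀ e u v → Graph.Joins G (proj₁ e) u v → Graph.Joins H (eto e) (vto (collapse X u)) (vto (collapse X v))
    ends (e , m) u v j = subst₂ (Graph.Joins H (eto (e , m))) (sym (vto-collapse u)) (sym (vto-collapse v))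
      (joins-image map _ (subst (λ g → Graph.Joins G g u v) (sym (proj₂ (pre e (∁-false m)))) j))

  record Enumeration {n : ℕ} (p : Pred n) : Set where
    field
      len     : ℕ
      at      : Fin len → Fin n
      at-∈    : ∀ i → p (at i) ≡ true
      at-inj  : ∀ i j → at i ≡ at j → i ≡ j
      at-onto : ∀ j → p j ≡ true → ∃ λ i → at i ≡ j

  enumerate : ∀ {n} (p : Pred n) → Enumeration p
  enumerate {zero} p = record { len = 0 ; at = λ () ; at-∈ = λ () ; at-inj = λ () ; at-onto = λ () }
  enumerate {suc n} p with enumerate (p ∘ suc) | bool (p zero)
  ... | E | inj₂ f = record
    { len = len ; at = suc ∘ at ; at-∈ = at-∈ ; at-inj = λ i j e → at-inj i j (Data.Fin.Properties.suc-injective e)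
    ; at-onto = λ { zero h → ⊥-elim (true≢false h f) ; (suc j) h → let (i , e) = at-onto j h in i , cong suc e } }
    where open Enumeration E
  ... | E | inj₁ t = record
    { len = suc len ; at = λ { zero → zero ; (suc i) → suc (at i) } ; at-∈ = λ { zero → t ; (suc i) → at-∈ i }
    ; at-inj = λ { zero zero e → refl ; (suc i) (suc j) e → cong suc (at-inj i j (Data.Fin.Properties.suc-injective e)) }
    ; at-onto = λ { zero h → zero , refl ; (suc j) h → let (i , e) = at-onto j h in suc i , cong suc e } }
    where open Enumeration E

  abstract
    -- The vertices of H are the fixed points of `rep`, which moves Z to `z₀`. Its edges are those
    -- that `rep` does not turn into loops. Both are renumbered by `enumerate`.
    shrink : ∀ G (Z : Pred (order G)) z → Z z ≡ true → ∃ λ H → ∃ λ x → Shrink G Z H x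
    shrink G Z z₀ Zz₀ = H , qv z₀ , record { map = quot ; shrunk = λ v h → qv-≡ (trans (rep-in v h) (sym (rep-in z₀ Zz₀))) ; kept = kept ; kept-inj = kept-inj }
      where
      rep : Graph.V G → Graph.V G
      rep v = if Z v then z₀ else v
      rep-in : ∀ v → Z v ≡ true → rep v ≡ z₀
      rep-in v h rewrite h = refl
      rep-out : ∀ v → Z v ≡ false → rep v ≡ v
      rep-out v h rewrite h = refl
      alive : Pred (order G)
      alive v = δ v (rep v)
      rep-alive : ∀ v → alive (rep v) ≡ true
      rep-alive v with bool (Z v)
      ... | inj₁ h = trans (cong (λ x → δ x (rep x)) (rep-in v h)) (trans (cong (δ z₀) (rep-in z₀ Zz₀)) (δ-refl z₀))
      ... | inj₂ h = trans (cong (λ x → δ x (rep x)) (rep-out v h)) (trans (cong (δ v) (rep-out v h)) (δ-refl v))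
      proper : Pred (Graph.size G)
      proper e = not (δ (rep (Graph.src G e)) (rep (Graph.tgt G e)))
      module EV = Enumeration (enumerate alive)
      module EE = Enumeration (enumerate proper)
      qv : Graph.V G → Fin EV.len
      qv v = proj₁ (EV.at-onto (rep v) (rep-alive v))
      at-qv : ∀ v → EV.at (qv v) ≡ rep v
      at-qv v = proj₂ (EV.at-onto (rep v) (rep-alive v))
      qv-≡ : ∀ {u v} → rep u ≡ rep v → qv u ≡ qv v
      qv-≡ {u} {v} e = EV.at-inj _ _ (trans (at-qv u) (trans e (sym (at-qv v))))
      qv-≡⁻ : ∀ {u v} → qv u ≡ qv v → rep u ≡ rep v
      qv-≡⁻ {u} {v} e = trans (sym (at-qv u)) (trans (cong EV.at e) (at-qv v))
      H : Graph
      H = record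
        { order = EV.len ; size = EE.len ; src = qv ∘ Graph.src G ∘ EE.at ; tgt = qv ∘ Graph.tgt G ∘ EE.at
        ; loopless = λ f e → δ-false⁻ (not⁻ (EE.at-∈ f)) (qv-≡⁻ e) }
      onto : ∀ e → qv (Graph.src G e) ≡ qv (Graph.tgt G e) ⊎ ∃ λ f → EE.at f ≡ e
      onto e with bool (proper e)
      ... | inj₁ h = inj₂ (EE.at-onto e h)
      ... | inj₂ h = inj₁ (qv-≡ (δ-true (≢false⇒true λ f → true≢false (not⁺ f) h)))
      quot : G ↠ H
      quot = record
        { q = qv ; sec = EV.at ; q-sec = λ i → EV.at-inj _ _ (trans (at-qv (EV.at i)) (sym (δ-true (EV.at-∈ i))))
        ; p = EE.at ; p-inj = EE.at-inj ; p-ends = λ f → inj₁ (refl , refl) ; p-onto = onto }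
      kept : ∀ v → Z v ≡ false → qv v ≢ qv z₀
      kept v h e = true≢false (subst (λ x → Z x ≡ true) (sym (trans (sym (rep-out v h)) (trans (qv-≡⁻ e) (rep-in z₀ Zz₀)))) Zz₀) h
      kept-inj : ∀ u v → Z u ≡ false → Z v ≡ false → qv u ≡ qv v → u ≡ v
      kept-inj u v hu hv e = trans (sym (rep-out u hu)) (trans (qv-≡⁻ e) (rep-out v hv))

  infixr 9 _⊚_
  _⊚_ : ∀ {G H K} → H ↠ K → G ↠ H → G ↠ K
  _⊚_ {G} {H} {K} R Q = record
    { q = q R ∘ q Q ; sec = sec Q ∘ sec R ; q-sec = λ v → trans (cong (q R) (q-sec Q (sec R v))) (q-sec R v)
    ; p = p Q ∘ p R ; p-inj = λ e f h → p-inj R e f (p-inj Q _ _ h)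
    ; p-ends = λ f → joins-image R f (p-ends Q (p R f))
    ; p-onto = onto }
    where
    onto : ∀ e → q R (q Q (Graph.src G e)) ≡ q R (q Q (Graph.tgt G e)) ⊎ ∃ λ f → p Q (p R f) ≡ e
    onto e with p-onto Q e
    ... | inj₁ l = inj₁ (cong (q R) l)
    ... | inj₂ (g , refl) with p-onto R g
    ...   | inj₂ (f , refl) = inj₂ (f , refl)
    ...   | inj₁ l with p-ends Q g
    ...     | inj₁ (a , b) = inj₁ (trans (cong (q R) (sym a)) (trans l (cong (q R) b)))
    ...     | inj₂ (a , b) = inj₁ (trans (cong (q R) (sym b)) (trans (sym l) (cong (q R) a)))

  module _ {G K A : Graph} (Q : G ↠ K) (R : G ↠ A) (ker : ∀ u v → q Q u ≡ q Q v → q R u ≡ q R v) where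

    through-q : Graph.V K → Graph.V A
    through-q k = q R (sec Q k)

    through-q-≡ : ∀ v → through-q (q Q v) ≡ q R v
    through-q-≡ v = ker _ _ (q-sec Q (q Q v))

    -- The universal property of the quotient Q: R factors through it because Q identifies no more
    -- than R does. For the same reason every edge surviving in A already survives in K.
    through : K ↠ A
    through = record
      { q = through-q ; sec = q Q ∘ sec R ; q-sec = λ a → trans (through-q-≡ (sec R a)) (q-sec R a)
      ; p = proj₁ ∘ pre
      ; p-inj = λ e f h → p-inj R e f (trans (sym (proj₂ (pre e))) (trans (cong (p Q) h) (proj₂ (pre f))))
      ; p-ends = ends ; p-onto = onto }
      where
      pre : ∀ e → ∃ λ f → p Q f ≡ p R e
      pre e with p-onto Q (p R e)
      ... | inj₂ r = r
      ... | inj₁ l = contradiction (ker _ _ l) (noloop R e)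
      ends : ∀ e → Graph.Joins A e (through-q (Graph.src K (proj₁ (pre e)))) (through-q (Graph.tgt K (proj₁ (pre e))))
      ends e with pre e
      ... | f , eq with p-ends Q f | subst (λ g → Graph.Joins A e (q R (Graph.src G g)) (q R (Graph.tgt G g))) (sym eq) (p-ends R e)
      ...   | inj₁ (a , b) | j = subst₂ (Graph.Joins A e) (trans (sym (through-q-≡ _)) (cong through-q (sym a))) (trans (sym (through-q-≡ _)) (cong through-q (sym b))) j
      ...   | inj₂ (a , b) | j = joins-swap A {e} (subst₂ (Graph.Joins A e) (trans (sym (through-q-≡ _)) (cong through-q (sym b))) (trans (sym (through-q-≡ _)) (cong through-q (sym a))) j)
      onto : ∀ f → through-q (Graph.src K f) ≡ through-q (Graph.tgt K f) ⊎ ∃ λ e → proj₁ (pre e) ≡ f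
      onto f with p-onto R (p Q f)
      ... | inj₂ (e , eq) = inj₂ (e , p-inj Q _ f (trans (proj₂ (pre e)) eq))
      ... | inj₁ l with p-ends Q f
      ...   | inj₁ (a , b) = inj₁ (trans (cong through-q a) (trans (through-q-≡ _) (trans l (trans (sym (through-q-≡ _)) (cong through-q (sym b))))))
      ...   | inj₂ (a , b) = inj₁ (trans (cong through-q a) (trans (through-q-≡ _) (trans (sym l) (trans (sym (through-q-≡ _)) (cong through-q (sym b))))))

open Contractions

-- Splicings and 3-way equivalence with pairs of contractions across a cut

module Splicings where

  lookup-∂ᵥ : ∀ G v e → lookup (Graph.∂ᵥ G v) e ≡ star G v e
  lookup-∂ᵥ G v e = trans (lookup-∂ G ⁅ v ⁆ e) (cong₂ _xor_ (lookup-⁅⁆ v _) (lookup-⁅⁆ v _))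

  ∂ᵥ⁺ : ∀ G {v e} → star G v e ≡ true → e ∈ Graph.∂ᵥ G v
  ∂ᵥ⁺ G {v} {e} h = true⇒∈ (trans (lookup-∂ᵥ G v e) h)

  ∂ᵥ⁻ : ∀ G {v e} → e ∈ Graph.∂ᵥ G v → star G v e ≡ true
  ∂ᵥ⁻ G {v} {e} h = trans (sym (lookup-∂ᵥ G v e)) (∈⇒true h)

  ∁∂ᵥ⁺ : ∀ G {v e} → star G v e ≡ false → e ∈ ∁ (Graph.∂ᵥ G v)
  ∁∂ᵥ⁺ G {v} {e} h = ∈∁ (trans (lookup-∂ᵥ G v e) h)

  ∁∂ᵥ⁻ : ∀ G {v e} → e ∈ ∁ (Graph.∂ᵥ G v) → star G v e ≡ false
  ∁∂ᵥ⁻ G {v} {e} h = trans (sym (lookup-∂ᵥ G v e)) (∁-false h)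

  ∁⁅⁆⁺ : ∀ {n} {v u : Fin n} → u ≢ v → u ∈ ∁ ⁅ v ⁆
  ∁⁅⁆⁺ {v = v} {u} h = ∈∁ (trans (lookup-⁅⁆ v u) (δ-false (h ∘ sym)))

  ∁⁅⁆⁻ : ∀ {n} {v u : Fin n} → u ∈ ∁ ⁅ v ⁆ → u ≢ v
  ∁⁅⁆⁻ {v = v} {u} h e = δ-false⁻ (trans (sym (lookup-⁅⁆ v u)) (∁-false h)) (sym e)

  star-other : ∀ G {v e} → star G v e ≡ true → ∃ λ x → x ≢ v × Graph.Joins G e v x
  star-other G {v} {e} h with cut-elim G (δ v) e h
  ... | a , b , j , da , db with δ-true da
  ...   | refl = b , (λ eq → δ-false⁻ db (sym eq)) , j

  far : ∀ G {v e} → star G v e ≡ false → Graph.src G e ≢ v × Graph.tgt G e ≢ v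
  far G {v} {e} h = (λ eq → true≢false (joins-star G {v} {Graph.tgt G e} {e} (inj₁ (eq , refl))) h)
                  , (λ eq → true≢false (joins-star G {v} {Graph.src G e} {e} (inj₂ (refl , eq))) h)

  joins-ends : ∀ {G H : Graph} (f : Graph.V G → Graph.V H) {e g a b} → Graph.Joins G e a b → Graph.Joins H g (f a) (f b) →
               Graph.Joins H g (f (Graph.src G e)) (f (Graph.tgt G e))
  joins-ends f (inj₁ (refl , refl)) j = j
  joins-ends {H = H} f {g = g} (inj₂ (refl , refl)) j = joins-swap H {g} j

  splicing-flip : ∀ {G₁ u G₂ v G} → Splicing G₁ u G₂ v G → Splicing G₂ v G₁ u G
  splicing-flip {G₁} {u} {G₂} {v} {G} s = record
    { π = ↔-sym π
    ; vertices = mk↔ₛ′ (vertex ∘ vswap) (vswap ∘ Vs.from) (λ x → trans (cong vertex (vswap² (Vs.from x))) (Vs.strictlyInverseˡ x))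
                   (λ x → trans (cong vswap (Vs.strictlyInverseʳ (vswap x))) (vswap² x))
    ; edges = mk↔ₛ′ (edge ∘ eswap) (eswap′ ∘ Es.from) (λ e → trans (cong edge (eswap-eswap′ (Es.from e))) (Es.strictlyInverseˡ e))
                (λ e → trans (cong eswap′ (Es.strictlyInverseʳ (eswap e))) (eswap′-eswap e))
    ; ends₁ = ends₂
    ; ends₂ = ends₁
    ; ends× = λ e x y j j′ → joins-swap G {edge (inj₂ (inj₂ (Inverse.from π e)))} (ends× (Inverse.from π e) y x j′
        (subst (λ g → Graph.Joins G₂ (proj₁ g) v (proj₁ x)) (sym (Inverse.strictlyInverseˡ π e)) j)) }
    where
    open Splicing s
    module Vs = Inverse vertices
    module Es = Inverse edges
    vswap : ∀ {A B : Set} → A ⊎ B → B ⊎ A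
    vswap (inj₁ a) = inj₂ a
    vswap (inj₂ b) = inj₁ b
    vswap² : ∀ {A B : Set} (x : A ⊎ B) → vswap (vswap x) ≡ x
    vswap² (inj₁ a) = refl
    vswap² (inj₂ b) = refl
    eswap : El (∁ (Graph.∂ᵥ G₂ v)) ⊎ El (∁ (Graph.∂ᵥ G₁ u)) ⊎ El (Graph.∂ᵥ G₂ v) → El (∁ (Graph.∂ᵥ G₁ u)) ⊎ El (∁ (Graph.∂ᵥ G₂ v)) ⊎ El (Graph.∂ᵥ G₁ u)
    eswap (inj₁ e)        = inj₂ (inj₁ e)
    eswap (inj₂ (inj₁ e)) = inj₁ e
    eswap (inj₂ (inj₂ e)) = inj₂ (inj₂ (Inverse.from π e))
    eswap′ : El (∁ (Graph.∂ᵥ G₁ u)) ⊎ El (∁ (Graph.∂ᵥ G₂ v)) ⊎ El (Graph.∂ᵥ G₁ u) → El (∁ (Graph.∂ᵥ G₂ v)) ⊎ El (∁ (Graph.∂ᵥ G₁ u)) ⊎ El (Graph.∂ᵥ G₂ v)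
    eswap′ (inj₁ e)        = inj₂ (inj₁ e)
    eswap′ (inj₂ (inj₁ e)) = inj₁ e
    eswap′ (inj₂ (inj₂ e)) = inj₂ (inj₂ (Inverse.to π e))
    eswap-eswap′ : ∀ e → eswap (eswap′ e) ≡ e
    eswap-eswap′ (inj₁ e)        = refl
    eswap-eswap′ (inj₂ (inj₁ e)) = refl
    eswap-eswap′ (inj₂ (inj₂ e)) = cong (inj₂ ∘ inj₂) (Inverse.strictlyInverseʳ π e)
    eswap′-eswap : ∀ e → eswap′ (eswap e) ≡ e
    eswap′-eswap (inj₁ e)        = refl
    eswap′-eswap (inj₂ (inj₁ e)) = refl
    eswap′-eswap (inj₂ (inj₂ e)) = cong (inj₂ ∘ inj₂) (Inverse.strictlyInverseˡ π e)

  module _ {G₁ u G₂ v G} (s : Splicing G₁ u G₂ v G) where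
    open Splicing s
    private
      module Vs = Inverse vertices
      module Es = Inverse edges

    second : Pred (order G)
    second x = [ const false , const true ]′ (Vs.from x)

    -- Shrinking the vertices that come from G₂ gives back G₁. The vertex z supplies an element of
    -- that shore, hence a preimage of u.
    splicing-shrink : ∀ z → z ≢ v → Shrink G second G₁ u
    splicing-shrink z z≢v = record { map = quot ; shrunk = shrunk ; kept = kept ; kept-inj = kept-inj }
      where
      down : El (∁ ⁅ u ⁆) ⊎ El (∁ ⁅ v ⁆) → Graph.V G₁
      down = [ proj₁ , const u ]′
      qv : Graph.V G → Graph.V G₁
      qv x = down (Vs.from x)
      qv-vertex : ∀ y → qv (vertex y) ≡ down y
      qv-vertex y = cong down (Vs.strictlyInverseʳ y)
      sv : Graph.V G₁ → Graph.V G
      sv w with w ≟ u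
      ... | yes _ = vertex (inj₂ (z , ∁⁅⁆⁺ z≢v))
      ... | no ne = vertex (inj₁ (w , ∁⁅⁆⁺ ne))
      qs : ∀ w → qv (sv w) ≡ w
      qs w with w ≟ u
      ... | yes e = trans (qv-vertex _) (sym e)
      ... | no ne = qv-vertex _
      tag : ∀ e → Dec (star G₁ u e ≡ true) → El (∁ (Graph.∂ᵥ G₁ u)) ⊎ El (∁ (Graph.∂ᵥ G₂ v)) ⊎ El (Graph.∂ᵥ G₁ u)
      tag e (yes h) = inj₂ (inj₂ (e , ∂ᵥ⁺ G₁ h))
      tag e (no h)  = inj₁ (e , ∁∂ᵥ⁺ G₁ (≢true⇒false h))
      under : El (∁ (Graph.∂ᵥ G₁ u)) ⊎ El (∁ (Graph.∂ᵥ G₂ v)) ⊎ El (Graph.∂ᵥ G₁ u) → Graph.E G₁ ⊎ Graph.E G₂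
      under (inj₁ e)        = inj₁ (proj₁ e)
      under (inj₂ (inj₁ e)) = inj₂ (proj₁ e)
      under (inj₂ (inj₂ e)) = inj₁ (proj₁ e)
      under-tag : ∀ e d → under (tag e d) ≡ inj₁ e
      under-tag e (yes _) = refl
      under-tag e (no _)  = refl
      pe : Graph.E G₁ → Graph.E G
      pe e = edge (tag e (star G₁ u e Bool.≟ true))
      inj₁-inj : ∀ {A B : Set} {x y : A} → _≡_ {A = A ⊎ B} (inj₁ x) (inj₁ y) → x ≡ y
      inj₁-inj refl = refl
      pe-inj : ∀ e f → pe e ≡ pe f → e ≡ f
      pe-inj e f h = inj₁-inj (trans (sym (under-tag e _)) (trans (cong under (trans (sym (Es.strictlyInverseʳ _)) (trans (cong Es.from h) (Es.strictlyInverseʳ _)))) (under-tag f _)))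
      ends-tag : ∀ e d → Graph.Joins G₁ e (qv (Graph.src G (edge (tag e d)))) (qv (Graph.tgt G (edge (tag e d))))
      ends-tag e (no h) = let (a , b) = far G₁ {u} {e} (≢true⇒false h) in
        joins-ends {G} {G₁} qv {edge (tag e (no h))} {e} (ends₁ (e , _) (_ , ∁⁅⁆⁺ a) (_ , ∁⁅⁆⁺ b) (inj₁ (refl , refl)))
          (inj₁ (sym (qv-vertex _) , sym (qv-vertex _)))
      ends-tag e (yes h) with star-other G₁ {u} {e} h | star-other G₂ {v} {proj₁ (Inverse.to π (e , ∂ᵥ⁺ G₁ h))} (∂ᵥ⁻ G₂ (proj₂ (Inverse.to π (e , ∂ᵥ⁺ G₁ h))))
      ... | x , nx , j | y , ny , j′ = joins-ends {G} {G₁} qv {edge (tag e (yes h))} {e} (ends× (e , ∂ᵥ⁺ G₁ h) (x , ∁⁅⁆⁺ nx) (y , ∁⁅⁆⁺ ny) j j′)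
            (subst₂ (Graph.Joins G₁ e) (sym (qv-vertex _)) (sym (qv-vertex _)) (joins-swap G₁ {e} j))
      loop₂ : ∀ e₂ → qv (Graph.src G (edge (inj₂ (inj₁ e₂)))) ≡ qv (Graph.tgt G (edge (inj₂ (inj₁ e₂))))
      loop₂ (e , m) with far G₂ {v} {e} (∁∂ᵥ⁻ G₂ m)
      ... | a , b with ends₂ (e , m) (_ , ∁⁅⁆⁺ a) (_ , ∁⁅⁆⁺ b) (inj₁ (refl , refl))
      ...   | inj₁ (p , q) = trans (cong qv p) (trans (qv-vertex _) (sym (trans (cong qv q) (qv-vertex _))))
      ...   | inj₂ (p , q) = trans (cong qv p) (trans (qv-vertex _) (sym (trans (cong qv q) (qv-vertex _))))
      tag-∂ : ∀ e (m : e ∈ Graph.∂ᵥ G₁ u) d → tag e d ≡ inj₂ (inj₂ (e , m))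
      tag-∂ e m (yes h) = cong (inj₂ ∘ inj₂) (El-≡ refl)
      tag-∂ e m (no h)  = contradiction (∂ᵥ⁻ G₁ m) h
      tag-∁ : ∀ e (m : e ∈ ∁ (Graph.∂ᵥ G₁ u)) d → tag e d ≡ inj₁ (e , m)
      tag-∁ e m (yes h) = ⊥-elim (true≢false h (∁∂ᵥ⁻ G₁ m))
      tag-∁ e m (no h)  = cong inj₁ (El-≡ refl)
      onto′ : ∀ t → qv (Graph.src G (edge t)) ≡ qv (Graph.tgt G (edge t)) ⊎ ∃ λ f → pe f ≡ edge t
      onto′ (inj₁ (e , m))        = inj₂ (e , cong edge (tag-∁ e m _))
      onto′ (inj₂ (inj₁ e))       = inj₁ (loop₂ e)
      onto′ (inj₂ (inj₂ (e , m))) = inj₂ (e , cong edge (tag-∂ e m _))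
      quot : G ↠ G₁
      quot = record { q = qv ; sec = sv ; q-sec = qs ; p = pe ; p-inj = pe-inj ; p-ends = λ e → ends-tag e _
        ; p-onto = λ e → subst (λ e → qv (Graph.src G e) ≡ qv (Graph.tgt G e) ⊎ ∃ λ f → pe f ≡ e) (Es.strictlyInverseˡ e) (onto′ (Es.from e)) }
      shrunk : ∀ x → second x ≡ true → qv x ≡ u
      shrunk x h with Vs.from x
      ... | inj₂ _ = refl
      kept : ∀ x → second x ≡ false → qv x ≢ u
      kept x h with Vs.from x
      ... | inj₁ (w , m) = ∁⁅⁆⁻ m
      kept-inj : ∀ x y → second x ≡ false → second y ≡ false → qv x ≡ qv y → x ≡ y
      kept-inj x y hx hy e with Vs.from x in ex | Vs.from y in ey
      ... | inj₁ a | inj₁ b = trans (sym (Vs.strictlyInverseˡ x)) (trans (cong vertex (trans ex (trans (cong inj₁ (El-≡ e)) (sym ey)))) (Vs.strictlyInverseˡ y))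

    lookup-transfer : ∀ R {z} (z≢v : z ≢ v) x → lookup (transfer R) x ≡ (not (second x) ∧ lookup R (Shrink.to (splicing-shrink z z≢v) x))
    lookup-transfer R z≢v x = trans (lookup∘tabulate _ x) lem
      where
      lem : [ (λ y → lookup R (proj₁ y)) , const false ]′ (Vs.from x) ≡ (not (second x) ∧ lookup R ([ proj₁ , const u ]′ (Vs.from x)))
      lem with Vs.from x
      ... | inj₁ _ = refl
      ... | inj₂ _ = refl

  splicing⇒cut : ∀ {G₁ u G₂ v G} (s : Splicing G₁ u G₂ v G) z₁ → z₁ ≢ u → ∀ z₂ → z₂ ≢ v → Cut G (second s) G₁ u G₂ v
  splicing⇒cut s z₁ n₁ z₂ n₂ = record { side₁ = splicing-shrink s z₂ n₂ ; side₂ = shrink-cong flip (splicing-shrink (splicing-flip s) z₁ n₁) }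
    where
    flip : ∀ x → second (splicing-flip s) x ≡ not (second s x)
    flip x with Inverse.from (Splicing.vertices s) x
    ... | inj₁ _ = refl
    ... | inj₂ _ = refl

  shrink-joins : ∀ {G Z H x} (s : Shrink G Z H x) f {a b} → Graph.Joins H f a b → ∃ λ c → ∃ λ d →
    Graph.Joins G (p (Shrink.map s) f) c d × Shrink.to s c ≡ a × Shrink.to s d ≡ b
  shrink-joins {G} {H = H} s f j with joins-unique H {f} j (p-ends (Shrink.map s) f)
  ... | inj₁ (a , b) = _ , _ , inj₁ (refl , refl) , sym a , sym b
  ... | inj₂ (a , b) = _ , _ , inj₂ (refl , refl) , sym a , sym b

  from-≡ : ∀ {G Z H x} (s : Shrink G Z H x) {c a} → Shrink.to s c ≡ a → a ≢ x → c ≡ Shrink.from s a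
  from-≡ {Z = Z} s {c} refl ne = sym (Shrink.from-to s c (≢true⇒false λ h → ne (Shrink.shrunk s c h)))

  -- The bijection π pairs the edges at `x₁` and `x₂` that stem from the same cut edge of G.
  cut⇒splicing : ∀ {G Z G₁ x₁ G₂ x₂} → Cut G Z G₁ x₁ G₂ x₂ → Splicing G₁ x₁ G₂ x₂ G
  cut⇒splicing {G} {Z} {G₁} {x₁} {G₂} {x₂} c = record
    { π = mk↔ₛ′ πto πfrom (λ { (g , m) → El-≡ (p-inj S₂.map _ _ (trans (proj₁ (proj₂ (across₁ (proj₁ (πfrom (g , m))) (∂ᵥ⁻ G₁ (proj₂ (πfrom (g , m))))))) (proj₁ (proj₂ (across₂ g (∂ᵥ⁻ G₂ m)))))) })
                          (λ { (f , m) → El-≡ (p-inj S₁.map _ _ (trans (proj₁ (proj₂ (across₂ (proj₁ (πto (f , m))) (∂ᵥ⁻ G₂ (proj₂ (πto (f , m))))))) (proj₁ (proj₂ (across₁ f (∂ᵥ⁻ G₁ m)))))) })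
    ; vertices = mk↔ₛ′ vto vfrom vto-from vfrom-to
    ; edges = mk↔ₛ′ eto efrom eto-from efrom-to
    ; ends₁ = λ { (f , m) (x , mx) (y , my) j → let (_ , _ , jc , ec , ed) = shrink-joins (Cut.side₁ c) f j in
        subst₂ (Graph.Joins G (p S₁.map f)) (from-≡ (Cut.side₁ c) ec (∁⁅⁆⁻ mx)) (from-≡ (Cut.side₁ c) ed (∁⁅⁆⁻ my)) jc }
    ; ends₂ = λ { (f , m) (x , mx) (y , my) j → let (_ , _ , jc , ec , ed) = shrink-joins (Cut.side₂ c) f j in
        subst₂ (Graph.Joins G (p S₂.map f)) (from-≡ (Cut.side₂ c) ec (∁⁅⁆⁻ mx)) (from-≡ (Cut.side₂ c) ed (∁⁅⁆⁻ my)) jc }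
    ; ends× = ends× }
    where
    module S₁ = Shrink (Cut.side₁ c)
    module S₂ = Shrink (Cut.side₂ c)
    across₁ : ∀ f → star G₁ x₁ f ≡ true → ∃ λ g → p S₂.map g ≡ p S₁.map f × star G₂ x₂ g ≡ true
    across₁ f h = cut⇒star₂ c (p S₁.map f) (star⇒cut₁ c f h)
    across₂ : ∀ g → star G₂ x₂ g ≡ true → ∃ λ f → p S₁.map f ≡ p S₂.map g × star G₁ x₁ f ≡ true
    across₂ g h = cut⇒star₁ c (p S₂.map g) (star⇒cut₂ c g h)
    πto : El (Graph.∂ᵥ G₁ x₁) → El (Graph.∂ᵥ G₂ x₂)
    πto (f , m) = let (g , _ , h) = across₁ f (∂ᵥ⁻ G₁ m) in g , ∂ᵥ⁺ G₂ h
    πfrom : El (Graph.∂ᵥ G₂ x₂) → El (Graph.∂ᵥ G₁ x₁)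
    πfrom (g , m) = let (f , _ , h) = across₂ g (∂ᵥ⁻ G₂ m) in f , ∂ᵥ⁺ G₁ h
    vto : El (∁ ⁅ x₁ ⁆) ⊎ El (∁ ⁅ x₂ ⁆) → Graph.V G
    vto (inj₁ (w , _)) = S₁.from w
    vto (inj₂ (w , _)) = S₂.from w
    vfrom′ : ∀ v → Z v ≡ true ⊎ Z v ≡ false → El (∁ ⁅ x₁ ⁆) ⊎ El (∁ ⁅ x₂ ⁆)
    vfrom′ v (inj₁ h) = inj₂ (S₂.to v , ∁⁅⁆⁺ (S₂.kept v (cong not h)))
    vfrom′ v (inj₂ h) = inj₁ (S₁.to v , ∁⁅⁆⁺ (S₁.kept v h))
    vfrom : Graph.V G → El (∁ ⁅ x₁ ⁆) ⊎ El (∁ ⁅ x₂ ⁆)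
    vfrom v = vfrom′ v (bool (Z v))
    vto-from : ∀ v → vto (vfrom v) ≡ v
    vto-from v with bool (Z v)
    ... | inj₁ h = S₂.from-to v (cong not h)
    ... | inj₂ h = S₁.from-to v h
    vfrom-to : ∀ a → vfrom (vto a) ≡ a
    vfrom-to (inj₁ (w , m)) with bool (Z (S₁.from w))
    ... | inj₁ h = ⊥-elim (true≢false h (S₁.from-kept (∁⁅⁆⁻ m)))
    ... | inj₂ h = cong inj₁ (El-≡ (q-sec S₁.map w))
    vfrom-to (inj₂ (w , m)) with bool (Z (S₂.from w))
    ... | inj₁ h = cong inj₂ (El-≡ (q-sec S₂.map w))
    ... | inj₂ h = ⊥-elim (true≢false (not⁺ h) (S₂.from-kept (∁⁅⁆⁻ m)))
    eto : El (∁ (Graph.∂ᵥ G₁ x₁)) ⊎ El (∁ (Graph.∂ᵥ G₂ x₂)) ⊎ El (Graph.∂ᵥ G₁ x₁) → Graph.E G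
    eto (inj₁ (f , _))        = p S₁.map f
    eto (inj₂ (inj₁ (f , _))) = p S₂.map f
    eto (inj₂ (inj₂ (f , _))) = p S₁.map f
    Kind : Graph.E G → Set
    Kind e = (∃ λ f → p S₁.map f ≡ e × star G₁ x₁ f ≡ false) ⊎ (∃ λ f → p S₂.map f ≡ e × star G₂ x₂ f ≡ false) ⊎ (∃ λ f → p S₁.map f ≡ e × star G₁ x₁ f ≡ true)
    kind : ∀ e → Kind e
    kind e with p-onto S₁.map e
    ... | inj₂ (f , refl) with bool (star G₁ x₁ f)
    ...   | inj₁ h = inj₂ (inj₂ (f , refl , h))
    ...   | inj₂ h = inj₁ (f , refl , h)
    kind e | inj₁ l with p-onto S₂.map e
    ...   | inj₂ (g , refl) = inj₂ (inj₁ (g , refl , ≢true⇒false λ h → let (f , eq , _) = across₂ g h in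
              noloop S₁.map f (subst (λ e → S₁.to (Graph.src G e) ≡ S₁.to (Graph.tgt G e)) (sym eq) l)))
    ...   | inj₁ l₂ with bool (Z (Graph.src G e)) | bool (Z (Graph.tgt G e))
    ...     | inj₁ a | inj₁ b = contradiction (S₂.kept-inj _ _ (cong not a) (cong not b) l₂) (Graph.loopless G e)
    ...     | inj₂ a | inj₂ b = contradiction (S₁.kept-inj _ _ a b l) (Graph.loopless G e)
    ...     | inj₁ a | inj₂ b = contradiction (trans (sym l) (S₁.shrunk _ a)) (S₁.kept _ b)
    ...     | inj₂ a | inj₁ b = contradiction (trans l (S₁.shrunk _ b)) (S₁.kept _ a)
    ekind : ∀ {e} → Kind e → El (∁ (Graph.∂ᵥ G₁ x₁)) ⊎ El (∁ (Graph.∂ᵥ G₂ x₂)) ⊎ El (Graph.∂ᵥ G₁ x₁)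
    ekind (inj₁ (f , _ , h))        = inj₁ (f , ∁∂ᵥ⁺ G₁ h)
    ekind (inj₂ (inj₁ (f , _ , h))) = inj₂ (inj₁ (f , ∁∂ᵥ⁺ G₂ h))
    ekind (inj₂ (inj₂ (f , _ , h))) = inj₂ (inj₂ (f , ∂ᵥ⁺ G₁ h))
    efrom : Graph.E G → El (∁ (Graph.∂ᵥ G₁ x₁)) ⊎ El (∁ (Graph.∂ᵥ G₂ x₂)) ⊎ El (Graph.∂ᵥ G₁ x₁)
    efrom e = ekind (kind e)
    eto-kind : ∀ {e} (k : Kind e) → eto (ekind k) ≡ e
    eto-kind (inj₁ (f , eq , _))        = eq
    eto-kind (inj₂ (inj₁ (f , eq , _))) = eq
    eto-kind (inj₂ (inj₂ (f , eq , _))) = eq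
    eto-from : ∀ e → eto (efrom e) ≡ e
    eto-from e = eto-kind (kind e)
    clash : ∀ f g → p S₁.map f ≡ p S₂.map g → star G₂ x₂ g ≡ false → ⊥
    clash f g eq h with bool (star G₁ x₁ f)
    ... | inj₁ t = let (g′ , eq′ , t′) = across₁ f t in true≢false (subst (λ x → star G₂ x₂ x ≡ true) (p-inj S₂.map g′ g (trans eq′ eq)) t′) h
    ... | inj₂ n with bool (Z (Graph.src G (p S₁.map f))) | bool (Z (Graph.tgt G (p S₁.map f)))
    ...   | inj₁ a | inj₁ b = noloop S₁.map f (trans (S₁.shrunk _ a) (sym (S₁.shrunk _ b)))
    ...   | inj₂ a | inj₂ b = noloop S₂.map g (subst (λ e → S₂.to (Graph.src G e) ≡ S₂.to (Graph.tgt G e)) eq (trans (S₂.shrunk _ (not⁺ a)) (sym (S₂.shrunk _ (not⁺ b)))))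
    ...   | inj₁ a | inj₂ b = true≢false (trans (sym (S₁.cut-p f)) (cong₂ _xor_ a b)) n
    ...   | inj₂ a | inj₁ b = true≢false (trans (sym (S₁.cut-p f)) (cong₂ _xor_ a b)) n
    efrom-to : ∀ a → efrom (eto a) ≡ a
    efrom-to a = lem a (kind (eto a))
      where
      lem : ∀ a (k : Kind (eto a)) → ekind k ≡ a
      lem (inj₁ (f , m)) (inj₁ (f′ , eq , h)) = cong inj₁ (El-≡ (p-inj S₁.map f′ f eq))
      lem (inj₁ (f , m)) (inj₂ (inj₁ (g , eq , h))) = ⊥-elim (clash f g (sym eq) h)
      lem (inj₁ (f , m)) (inj₂ (inj₂ (f′ , eq , h))) = ⊥-elim (true≢false (subst (λ x → star G₁ x₁ x ≡ true) (p-inj S₁.map f′ f eq) h) (∁∂ᵥ⁻ G₁ m))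
      lem (inj₂ (inj₁ (g , m))) (inj₁ (f , eq , h)) = ⊥-elim (clash f g eq (∁∂ᵥ⁻ G₂ m))
      lem (inj₂ (inj₁ (g , m))) (inj₂ (inj₁ (g′ , eq , h))) = cong (inj₂ ∘ inj₁) (El-≡ (p-inj S₂.map g′ g eq))
      lem (inj₂ (inj₁ (g , m))) (inj₂ (inj₂ (f , eq , h))) = ⊥-elim (clash f g eq (∁∂ᵥ⁻ G₂ m))
      lem (inj₂ (inj₂ (f , m))) (inj₁ (f′ , eq , h)) = ⊥-elim (true≢false (∂ᵥ⁻ G₁ m) (subst (λ x → star G₁ x₁ x ≡ false) (p-inj S₁.map f′ f eq) h))
      lem (inj₂ (inj₂ (f , m))) (inj₂ (inj₁ (g , eq , h))) = ⊥-elim (clash f g (sym eq) h)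
      lem (inj₂ (inj₂ (f , m))) (inj₂ (inj₂ (f′ , eq , h))) = cong (inj₂ ∘ inj₂) (El-≡ (p-inj S₁.map f′ f eq))
    ends× : ∀ (e : El (Graph.∂ᵥ G₁ x₁)) (x : El (∁ ⁅ x₁ ⁆)) (y : El (∁ ⁅ x₂ ⁆)) → Graph.Joins G₁ (proj₁ e) x₁ (proj₁ x) → Graph.Joins G₂ (proj₁ (πto e)) x₂ (proj₁ y) →
      Graph.Joins G (p S₁.map (proj₁ e)) (S₁.from (proj₁ x)) (S₂.from (proj₁ y))
    ends× (f , m) (x , mx) (y , my) j j′ with shrink-joins (Cut.side₁ c) f j | shrink-joins (Cut.side₂ c) (proj₁ (πto (f , m))) j′
    ... | b , a , jb , eb , ea | a′ , b′ , ja , ea′ , eb′ with joins-unique G {p S₁.map f} jb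
            (subst (λ e → Graph.Joins G e a′ b′) (proj₁ (proj₂ (across₁ f (∂ᵥ⁻ G₁ m)))) ja)
    ...   | inj₁ (refl , refl) = ⊥-elim (S₁.kept b (Z-out b ea′) eb)
      where
      Z-out : ∀ b → S₂.to b ≡ x₂ → Z b ≡ false
      Z-out b h = ≢true⇒false λ t → S₂.kept b (cong not t) h
    ...   | inj₂ (refl , refl) = joins-swap G {p S₁.map f} (subst₂ (Graph.Joins G (p S₁.map f)) (from-≡ (Cut.side₂ c) eb′ (∁⁅⁆⁻ my)) (from-≡ (Cut.side₁ c) ea (∁⁅⁆⁻ mx)) jb)

  cut-transfer : ∀ {G Z G₁ x₁ G₂ x₂} (c : Cut G Z G₁ x₁ G₂ x₂) R v →
    lookup (Splicing.transfer (cut⇒splicing c) R) v ≡ (not (Z v) ∧ lookup R (Shrink.to (Cut.side₁ c) v))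
  cut-transfer {Z = Z} c R v = trans (lookup∘tabulate _ v) lem
    where
    lem : [ (λ y → lookup R (proj₁ y)) , const false ]′ (Inverse.from (Splicing.vertices (cut⇒splicing c)) v)
        ≡ (not (Z v) ∧ lookup R (Shrink.to (Cut.side₁ c) v))
    lem with bool (Z v)
    ... | inj₁ h = cong (λ b → not b ∧ lookup R (Shrink.to (Cut.side₁ c) v)) (sym h)
    ... | inj₂ h = cong (λ b → not b ∧ lookup R (Shrink.to (Cut.side₁ c) v)) (sym h)

open Splicings

-- Associativity of splicing

module Associativity where

  lookup-ext : ∀ {n} (P Q : Subset n) → (∀ i → lookup P i ≡ lookup Q i) → P ≡ Q
  lookup-ext P Q h = trans (sym (tabulate∘lookup P)) (trans (tabulate-cong h) (tabulate∘lookup Q))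

  -- G is spliced at a vertex a outside the shore Z; the splicing can instead be carried out in G₁.
  record Associated {K′ Z′ G a J w} (cK : Cut K′ Z′ G a J w) {Z G₁ x₁ G₂ x₂} (c : Cut G Z G₁ x₁ G₂ x₂) : Set where
    to′ : Graph.V K′ → Graph.V G
    to′ = Shrink.to (Cut.side₁ cK)
    field
      K      : Graph
      xK     : Graph.V K
      outer  : Cut K′ (Z ∘ to′) K xK G₂ x₂
    fromK : Graph.V K → Graph.V K′
    fromK = Shrink.from (Cut.side₁ outer)
    field
      inner  : Cut K (Z′ ∘ fromK) G₁ (Shrink.to (Cut.side₁ c) a) J w
      inner-to   : ∀ k → Shrink.to (Cut.side₁ inner) k ≡ Shrink.to (Cut.side₁ c) (to′ (fromK k))
      outer-from : ∀ u → Shrink.from (Cut.side₂ outer) u ≡ Shrink.from (Cut.side₁ cK) (Shrink.from (Cut.side₂ c) u)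

  -- The shore Z′ of K′ is shrunk to a, which lies outside Z, so Z′ and the preimage of Z are
  -- disjoint and can be shrunk in either order. K is the result of shrinking only the preimage of
  -- Z.
  associate : ∀ {K′ Z′ G a J w} (cK : Cut K′ Z′ G a J w) {Z G₁ x₁ G₂ x₂} (c : Cut G Z G₁ x₁ G₂ x₂) → Z a ≡ false → Associated cK c
  associate {K′} {Z′} {G} {a} {J} {w} cK {Z} {G₁} {x₁} {G₂} {x₂} c Za with shrink K′ (Z ∘ Shrink.to (Cut.side₁ cK)) (Shrink.from (Cut.side₁ cK) (Shrink.from (Cut.side₁ c) x₁))
      (trans (cong Z (q-sec (Shrink.map (Cut.side₁ cK)) _)) (Shrink.Z-inhabited (Cut.side₁ c)))
  ... | K , xK , sK = record
    { K = K ; xK = xK ; outer = record { side₁ = sK ; side₂ = s₂ } ; inner = record { side₁ = i₁ ; side₂ = i₂ }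
    ; inner-to = λ k → refl ; outer-from = λ u → refl }
    where
    module A = Shrink (Cut.side₁ cK)
    module B = Shrink (Cut.side₂ cK)
    module S₁ = Shrink (Cut.side₁ c)
    module S₂ = Shrink (Cut.side₂ c)
    module K = Shrink sK
    Z″ : Pred (order K′)
    Z″ = Z ∘ A.to
    disjoint : ∀ v → Z″ v ≡ true → Z′ v ≡ false
    disjoint v h = ≢true⇒false λ h′ → true≢false (subst (λ x → Z x ≡ true) (A.shrunk v h′) h) Za
    s₂ : Shrink K′ (not ∘ Z″) G₂ x₂
    s₂ = record
      { map = S₂.map ⊚ A.map
      ; shrunk = λ v h → S₂.shrunk (A.to v) h
      ; kept = λ v h → S₂.kept (A.to v) h
      ; kept-inj = λ u v hu hv e → A.kept-inj u v (disjoint u (not-false hu)) (disjoint v (not-false hv)) (S₂.kept-inj _ _ hu hv e) }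
      where
      not-false : ∀ {b} → not b ≡ false → b ≡ true
      not-false {true} _ = refl
    same : ∀ u v → K.to u ≡ K.to v → u ≡ v ⊎ (Z″ u ≡ true × Z″ v ≡ true)
    same u v e with bool (Z″ u) | bool (Z″ v)
    ... | inj₁ p | inj₁ q = inj₂ (p , q)
    ... | inj₂ p | inj₂ q = inj₁ (K.kept-inj u v p q e)
    ... | inj₁ p | inj₂ q = contradiction (trans (sym e) (K.shrunk u p)) (K.kept v q)
    ... | inj₂ p | inj₁ q = contradiction (trans e (K.shrunk v q)) (K.kept u p)
    ker₁ : ∀ u v → K.to u ≡ K.to v → S₁.to (A.to u) ≡ S₁.to (A.to v)
    ker₁ u v e with same u v e
    ... | inj₁ refl = refl
    ... | inj₂ (p , q) = trans (S₁.shrunk _ p) (sym (S₁.shrunk _ q))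
    ker₂ : ∀ u v → K.to u ≡ K.to v → B.to u ≡ B.to v
    ker₂ u v e with same u v e
    ... | inj₁ refl = refl
    ... | inj₂ (p , q) = trans (B.shrunk _ (not⁺ (disjoint u p))) (sym (B.shrunk _ (not⁺ (disjoint v q))))
    i₁ : Shrink K (Z′ ∘ K.from) G₁ (S₁.to a)
    i₁ = record
      { map = through K.map (S₁.map ⊚ A.map) ker₁
      ; shrunk = λ k h → cong S₁.to (A.shrunk (K.from k) h)
      ; kept = kept
      ; kept-inj = kept-inj }
      where
      kept : ∀ k → Z′ (K.from k) ≡ false → S₁.to (A.to (K.from k)) ≢ S₁.to a
      kept k h e with bool (Z″ (K.from k))
      ... | inj₁ p = S₁.kept a Za (trans (sym e) (S₁.shrunk _ p))
      ... | inj₂ p = A.kept _ h (S₁.kept-inj _ _ p Za e)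
      kept-inj : ∀ k l → Z′ (K.from k) ≡ false → Z′ (K.from l) ≡ false → S₁.to (A.to (K.from k)) ≡ S₁.to (A.to (K.from l)) → k ≡ l
      kept-inj k l hk hl e with bool (Z″ (K.from k)) | bool (Z″ (K.from l))
      ... | inj₁ p | inj₁ q = trans (sym (q-sec K.map k)) (trans (K.shrunk _ p) (trans (sym (K.shrunk _ q)) (q-sec K.map l)))
      ... | inj₂ p | inj₂ q = trans (sym (q-sec K.map k)) (trans (cong K.to (A.kept-inj _ _ hk hl (S₁.kept-inj _ _ p q e))) (q-sec K.map l))
      ... | inj₁ p | inj₂ q = contradiction (trans (sym e) (S₁.shrunk _ p)) (S₁.kept _ q)
      ... | inj₂ p | inj₁ q = contradiction (trans e (S₁.shrunk _ q)) (S₁.kept _ p)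
    i₂ : Shrink K (not ∘ Z′ ∘ K.from) J w
    i₂ = record
      { map = through K.map B.map ker₂
      ; shrunk = λ k h → B.shrunk (K.from k) h
      ; kept = λ k h → B.kept (K.from k) h
      ; kept-inj = λ k l hk hl e → trans (sym (q-sec K.map k)) (trans (cong K.to (B.kept-inj _ _ hk hl e)) (q-sec K.map l)) }

  Filled : (G : Graph) → Pred (order G) → Set
  Filled G Y = ∀ R {G′} → (∀ v → lookup R v ≡ Y v) → SplicedAt G R G′ → 𝒢 G′

  filled-cong : ∀ {G} {Y Y′ : Pred (order G)} → (∀ v → Y v ≡ Y′ v) → Filled G Y → Filled G Y′
  filled-cong e f R h = f R λ v → trans (h v) (sym (e v))

  -- G is itself a splicing of G₁ at x₁ with G₂. Induction along the given splicings moves each of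
  -- them into the side that contains its vertex. Once none is left, G₂ has grown into a member of
  -- 𝒢, and inserting it at x₁ is one more admissible step for G₁. The hypothesis `edges` provides
  -- the vertices needed to read a splicing as a cut.
  filled-join : ∀ {G R G′} → SplicedAt G R G′ → ∀ {Z G₁ x₁ G₂ x₂} (c : Cut G Z G₁ x₁ G₂ x₂) →
    (∀ a → lookup R a ≡ true → ∃ λ e → star G a e ≡ true) →
    Filled G₁ (λ u → δ x₁ u ∨ lookup R (Shrink.from (Cut.side₁ c) u)) →
    Filled G₂ (λ u → not (δ x₂ u) ∧ lookup R (Shrink.from (Cut.side₂ c) u)) → 𝒢 G′
  filled-join {R = R} (done empty) {Z} {G₁} {x₁} {G₂} {x₂} c edges f₁ f₂ =
    f₁ (tabulate Y₁) (lookup∘tabulate Y₁) (step x₁ x₂ (true⇒∈ (trans (lookup∘tabulate Y₁ x₁) (∨⁺ˡ (δ-refl x₁)))) 𝒢₂ (cut⇒splicing c) (done none))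
    where
    module S₁ = Shrink (Cut.side₁ c)
    R∅ : ∀ v → lookup R v ≡ false
    R∅ v = ≢true⇒false λ h → empty (v , true⇒∈ h)
    Y₁ : Pred (order G₁)
    Y₁ u = δ x₁ u ∨ lookup R (S₁.from u)
    𝒢₂ : 𝒢 G₂
    𝒢₂ = f₂ (tabulate (const false)) (λ v → trans (lookup∘tabulate _ v) (sym (trans (cong (not (δ x₂ v) ∧_) (R∅ _)) (Bool.∧-zeroʳ _))))
      (done λ { (v , m) → true≢false (∈⇒true m) (lookup∘tabulate _ v) })
    none : Empty (Splicing.transfer (cut⇒splicing c) (tabulate Y₁))
    none (v , m) with ∧⁻ {not (Z v)} (trans (sym (cut-transfer c (tabulate Y₁) v)) (∈⇒true m))
    ... | nz , y with ∨⁻ {δ x₁ (S₁.to v)} (trans (sym (lookup∘tabulate Y₁ (S₁.to v))) y)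
    ...   | inj₁ d = true≢false (trans (sym (S₁.δ-x v)) d) (not⁻ nz)
    ...   | inj₂ r = true≢false r (R∅ _)
  filled-join {G} {R} (step {J = J} {K′ = K′} a w a∈ 𝒢J s rest) {Z} {G₁} {x₁} {G₂} {x₂} c edges f₁ f₂ with edges a (∈⇒true a∈)
  ... | e , se with star-other G {a} {e} se | star-other J {w} (∂ᵥ⁻ J (proj₂ (Inverse.to (Splicing.π s) (e , ∂ᵥ⁺ G se))))
  ...   | z₁ , n₁ , _ | z₂ , n₂ , _ = go (bool (Z a))
    where
    cK : Cut K′ (second s) G a J w
    cK = splicing⇒cut s z₁ n₁ z₂ n₂
    module A = Shrink (Cut.side₁ cK)
    Z′ : Pred (order K′)
    Z′ = second s
    trans-R : ∀ x → lookup (Splicing.transfer s R) x ≡ (not (Z′ x) ∧ lookup R (A.to x))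
    trans-R x = lookup-transfer s R n₂ x
    edges′ : ∀ x → lookup (Splicing.transfer s R) x ≡ true → ∃ λ e → star K′ x e ≡ true
    edges′ x h with ∧⁻ {not (Z′ x)} (trans (sym (trans-R x)) h)
    ... | nz , r with edges (A.to x) r
    ...   | e , se = p A.map e , trans (cong₂ _xor_ (sym (A.δ-kept (not⁻ nz) _)) (sym (A.δ-kept (not⁻ nz) _))) (trans (cut-image A.map (δ (A.to x)) e) se)
    unaffected : ∀ y → a ≢ y → lookup R y ≡ lookup (Splicing.transfer s R) (A.from y)
    unaffected y ne = sym (trans (trans-R (A.from y)) (cong₂ (λ b z → not b ∧ lookup R z) (trans (A.Z-from y) (δ-false ne)) (q-sec A.map y)))
    go : Z a ≡ true ⊎ Z a ≡ false → 𝒢 _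
    -- Here a survives in G₁: the splicing with J is carried out there, and `fK` passes it to `f₁`
    -- as an extra initial step. In the other case it goes to `f₂`.
    go (inj₂ Za) = filled-join rest outer edges′ fK (filled-cong same₂ f₂)
      where
      assoc = associate cK c Za
      open Associated assoc
      module S₁ = Shrink (Cut.side₁ c)
      module S₂ = Shrink (Cut.side₂ c)
      module O = Shrink (Cut.side₁ outer)
      Y₁ : Pred (order G₁)
      Y₁ u = δ x₁ u ∨ lookup R (S₁.from u)
      same₂ : ∀ u → (not (δ x₂ u) ∧ lookup R (S₂.from u)) ≡ (not (δ x₂ u) ∧ lookup (Splicing.transfer s R) (Shrink.from (Cut.side₂ outer) u))
      same₂ u with x₂ ≟ u
      ... | yes refl rewrite δ-refl x₂ = refl
      ... | no ne = cong (not (δ x₂ u) ∧_) (trans (unaffected (S₂.from u) λ { refl → true≢false (not⁺ Za) (S₂.from-kept (ne ∘ sym)) })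
                      (cong (lookup (Splicing.transfer s R)) (sym (outer-from u))))
      fK : Filled K (λ k → δ xK k ∨ lookup (Splicing.transfer s R) (O.from k))
      fK RK h sK = f₁ (tabulate Y₁) (lookup∘tabulate Y₁) (step (S₁.to a) w a₁∈ 𝒢J (cut⇒splicing inner)
          (subst (λ R → SplicedAt K R _) (lookup-ext RK _ λ k → trans (h k) (sym (trans (cut-transfer inner (tabulate Y₁) k) (moved k (bool (δ xK k)))))) sK))
        where
        a₁∈ : S₁.to a ∈ tabulate Y₁
        a₁∈ = true⇒∈ (trans (lookup∘tabulate Y₁ (S₁.to a)) (∨⁺ʳ {δ x₁ (S₁.to a)} (trans (cong (lookup R) (S₁.from-to a Za)) (∈⇒true a∈))))
        moved : ∀ k → δ xK k ≡ true ⊎ δ xK k ≡ false →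
          (not (Z′ (O.from k)) ∧ lookup (tabulate Y₁) (Shrink.to (Cut.side₁ inner) k)) ≡ (δ xK k ∨ lookup (Splicing.transfer s R) (O.from k))
        moved k d = trans (cong (not (Z′ (O.from k)) ∧_) (trans (lookup∘tabulate Y₁ _) (cong Y₁ (inner-to k)))) (lem d)
          where
          y = A.to (O.from k)
          Zy : Z y ≡ δ xK k
          Zy = O.Z-from k
          lem : δ xK k ≡ true ⊎ δ xK k ≡ false → (not (Z′ (O.from k)) ∧ (δ x₁ (S₁.to y) ∨ lookup R (S₁.from (S₁.to y)))) ≡ (δ xK k ∨ lookup (Splicing.transfer s R) (O.from k))
          lem (inj₁ t) = trans (cong₂ (λ b z → not b ∧ (z ∨ lookup R (S₁.from (S₁.to y))))
              (≢true⇒false {Z′ (O.from k)} λ h → true≢false (subst (λ x → Z x ≡ true) (A.shrunk _ h) (trans Zy t)) Za) (trans (S₁.δ-x y) (trans Zy t)))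
            (cong (_∨ lookup (Splicing.transfer s R) (O.from k)) (sym t))
          lem (inj₂ f) = trans (cong₂ (λ b z → not (Z′ (O.from k)) ∧ (b ∨ lookup R z)) (trans (S₁.δ-x y) (trans Zy f)) (S₁.from-to y (trans Zy f)))
            (trans (sym (trans-R (O.from k))) (cong (_∨ lookup (Splicing.transfer s R) (O.from k)) (sym f)))
    go (inj₁ Za) = filled-join rest (cut-swap outer) edges′ (filled-cong same₁ f₁) fK
      where
      c′ : Cut G (not ∘ Z) G₂ x₂ G₁ x₁
      c′ = cut-swap c
      assoc = associate cK c′ (cong not Za)
      open Associated assoc
      module S₁ = Shrink (Cut.side₁ c)
      module S₂ = Shrink (Cut.side₂ c)
      module O = Shrink (Cut.side₁ outer)
      Y₂ : Pred (order G₂)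
      Y₂ u = not (δ x₂ u) ∧ lookup R (S₂.from u)
      same₁ : ∀ u → (δ x₁ u ∨ lookup R (S₁.from u)) ≡ (δ x₁ u ∨ lookup (Splicing.transfer s R) (Shrink.from (Cut.side₁ (cut-swap outer)) u))
      same₁ u with x₁ ≟ u
      ... | yes refl rewrite δ-refl x₁ = refl
      ... | no ne = cong (δ x₁ u ∨_) (trans (unaffected (S₁.from u) λ { refl → true≢false Za (S₁.from-kept (ne ∘ sym)) })
                      (cong (lookup (Splicing.transfer s R)) (sym (outer-from u))))
      fK : Filled K (λ k → not (δ xK k) ∧ lookup (Splicing.transfer s R) (O.from k))
      fK RK h sK = f₂ (tabulate Y₂) (lookup∘tabulate Y₂) (step (S₂.to a) w a₂∈ 𝒢J (cut⇒splicing inner)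
          (subst (λ R → SplicedAt K R _) (lookup-ext RK _ λ k → trans (h k) (sym (trans (cut-transfer inner (tabulate Y₂) k) (moved k)))) sK))
        where
        a₂∈ : S₂.to a ∈ tabulate Y₂
        a₂∈ = true⇒∈ (trans (lookup∘tabulate Y₂ (S₂.to a)) (∧⁺ (not⁺ (trans (S₂.δ-x a) (cong not Za)))
                (trans (cong (lookup R) (S₂.from-to a (cong not Za))) (∈⇒true a∈))))
        moved : ∀ k → (not (Z′ (O.from k)) ∧ lookup (tabulate Y₂) (Shrink.to (Cut.side₁ inner) k)) ≡ (not (δ xK k) ∧ lookup (Splicing.transfer s R) (O.from k))
        moved k = trans (cong (not (Z′ (O.from k)) ∧_) (trans (lookup∘tabulate Y₂ _) (cong Y₂ (inner-to k)))) (lem (bool (δ xK k)))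
          where
          y = A.to (O.from k)
          Zy : not (Z y) ≡ δ xK k
          Zy = O.Z-from k
          lem : δ xK k ≡ true ⊎ δ xK k ≡ false → (not (Z′ (O.from k)) ∧ (not (δ x₂ (S₂.to y)) ∧ lookup R (S₂.from (S₂.to y)))) ≡ (not (δ xK k) ∧ lookup (Splicing.transfer s R) (O.from k))
          lem (inj₁ t) = trans (cong (λ b → not (Z′ (O.from k)) ∧ (not b ∧ lookup R (S₂.from (S₂.to y)))) (trans (S₂.δ-x y) (trans Zy t)))
            (trans (Bool.∧-zeroʳ _) (cong (λ b → not b ∧ lookup (Splicing.transfer s R) (O.from k)) (sym t)))
          lem (inj₂ f) = trans (cong₂ (λ b z → not (Z′ (O.from k)) ∧ (not b ∧ lookup R z)) (trans (S₂.δ-x y) (trans Zy f)) (S₂.from-to y (trans Zy f)))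
            (trans (sym (trans-R (O.from k))) (cong (λ b → not b ∧ lookup (Splicing.transfer s R) (O.from k)) (sym f)))

open Associativity

-- The inductive bound: bricks, braces, and tight cuts

module Bounds where

  -- The sets Y of the induction collect vertices that are still to be spliced.
  Reach : (G : Graph) → Pred (order G) → Fin (order G) → Set
  Reach G Y v = Factor G (δ v) ⊎ ∃ λ y → Y y ≡ true × Double G y v

  abstract
    reached : (G : Graph) → Pred (order G) → Pred (order G)
    reached G Y v = does (factor? G (δ v) ⊎-dec any? (λ y → (Y y Bool.≟ true) ×-dec double? G y v))

    reached⁺ : ∀ {G Y v} → Reach G Y v → reached G Y v ≡ true
    reached⁺ {G} {Y} {v} r = dec-true (factor? G (δ v) ⊎-dec any? (λ y → (Y y Bool.≟ true) ×-dec double? G y v)) r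

    reached⁻ : ∀ {G Y v} → reached G Y v ≡ true → Reach G Y v
    reached⁻ {G} {Y} {v} h = does⁻ (factor? G (δ v) ⊎-dec any? (λ y → (Y y Bool.≟ true) ×-dec double? G y v)) h

  Stable : (G : Graph) → Pred (order G) → Set
  Stable G Y = ∀ y → Y y ≡ true → Reach G Y y → ⊥

  -- For a bipartite graph with empty Y the bound reads 0 ≤ 0 while nothing is covered; this
  -- explains the proviso in `exact`.
  record Bound (G : Graph) (b : ℕ) (Y : Pred (order G)) : Set where
    field
      lower : b + count Y ≤ count (reached G Y)
      exact : count (reached G Y) ≤ b + count Y → (∃ λ y → Y y ≡ true) ⊎ ¬ Bipartite G →
              (∀ v → reached G Y v ≡ true ⊎ Y v ≡ true) × Filled G Y

  matching-covered : ∀ G → Good G → MatchingCovered G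
  matching-covered G good = connected , Good.large good , λ e → let (F , pm , Fe) = perfect-edge G good e in
      tabulate F , perfect⁻ G F pm , true⇒∈ (trans (lookup∘tabulate F e) Fe)
    where
    connected : Connected G
    connected u v = Star.map proj₁ (proj₂ (proj₁ (good⁻ G good)) S∅ small u v none none)
      where
      S∅ : Subset (order G)
      S∅ = tabulate (const false)
      small : ∣ S∅ ∣ < 3
      small = s≤s (≤-trans (≤-reflexive (trans (∣∣≡count S∅) (count-empty (lookup∘tabulate (const false))))) z≤n)
      none : ∀ {x} → x ∉ S∅
      none {x} m = true≢false (∈⇒true m) (lookup∘tabulate (const false) x)

  brick-bound : ∀ G → Good G → TightCutFree G → ¬ Bipartite G → ∀ Y → Stable G Y → Bound G (order G) Y
  brick-bound G good free nonbip Y stable = record { lower = lower ; exact = λ _ _ → (λ v → inj₁ (all v)) , filled }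
    where
    all : ∀ v → reached G Y v ≡ true
    all v = reached⁺ (inj₁ (brick⇒matchable G good free nonbip v))
    Y∅ : ∀ v → Y v ≡ false
    Y∅ v = ≢true⇒false λ h → stable v h (inj₁ (brick⇒matchable G good free nonbip v))
    lower : order G + count Y ≤ count (reached G Y)
    lower = ≤-reflexive (trans (cong (order G +_) (count-empty Y∅)) (trans (+-identityʳ _) (sym (trans (count-cong all) (count-full _)))))
    filled : Filled G Y
    filled R h (done _) = cubicBrick (proj₂ (good⁻ G good)) (matching-covered G good , free , nonbip)
    filled R h (step a _ a∈ _ _ _) = ⊥-elim (true≢false (∈⇒true a∈) (trans (h a) (Y∅ a)))

  -- Every neighbour of a vertex of Y lies in W, which is disjoint from Y. So Y is independent and
  -- its cut is contained in that of W, whose size is at most three times the size of W. Equality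
  -- makes W independent with the same cut, so the union of Y and W is closed under adjacency and is
  -- everything.
  brace-bound : ∀ G → Good G → Bipartite G → ∀ Y → Stable G Y → Bound G 0 Y
  brace-bound G good (X , isBip) Y stable = record { lower = lower ; exact = exact }
    where
    open Graph G using (src; tgt; Joins)
    open Good good
    W : Pred (order G)
    W = reached G Y
    next : ∀ {e u v} → Joins e u v → Y u ≡ true → W v ≡ true
    next {e} {u} {v} j Yu = reached⁺ (inj₂ (u , Yu , adjacent⇒double G good (lookup X) (bipartite⁻ G X isBip) u v (joins-adj G {e} j)))
    YW : ∀ v → Y v ≡ true → W v ≡ false
    YW v Yv = ≢true⇒false λ h → stable v Yv (reached⁻ h)
    inner-Y : Edges.inner src tgt (const 1) Y ≡ 0
    inner-Y = lin-0 λ e → cong (λ b → ⟦ b ⟧ * 1) (≢true⇒false λ h →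
      true≢false (next {e} (inj₁ (refl , refl)) (proj₁ (∧⁻ h))) (YW _ (proj₂ (∧⁻ {Y (src e)} h))))
    shake : ∀ U → 3 * count U ≡ cutSize G U + (Edges.inner src tgt (const 1) U + Edges.inner src tgt (const 1) U)
    shake U = trans (sym (EdgeLemmas.sum-const-deg src tgt (const 1) U 3 λ v _ → trans (sym (wt-δᴳ G _ v)) (cubic v))) (EdgeLemmas.handshake-cut src tgt (const 1) U)
    size-Y : cutSize G Y ≡ 3 * count Y
    size-Y = sym (trans (shake Y) (trans (cong (λ x → cutSize G Y + (x + x)) inner-Y) (+-identityʳ _)))
    cut-⊑ : ∀ e → cutᴳ G Y e ≡ true → cutᴳ G W e ≡ true
    cut-⊑ e h with cut-elim G Y e h
    ... | x , y , j , Yx , Yy = cut-intro G {W} {e} (joins-swap G {e} j) (next {e} j Yx) (YW x Yx)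
    size-le : cutSize G Y ≤ cutSize G W
    size-le = lin-mono λ e → *-monoˡ-≤ 1 (⟦⟧-mono (cut-⊑ e))
    lower : count Y ≤ count W
    lower = *-cancelˡ-≤ 3 (≤-trans (≤-reflexive (sym size-Y)) (≤-trans size-le (≤-trans (m≤m+n _ _) (≤-reflexive (sym (shake W))))))
    exact : count W ≤ count Y → (∃ λ y → Y y ≡ true) ⊎ ¬ Bipartite G → (∀ v → W v ≡ true ⊎ Y v ≡ true) × Filled G Y
    exact le (inj₂ nb) = contradiction (X , isBip) nb
    exact le (inj₁ (y₀ , Yy₀)) = (λ v → cover v (bool (Z v))) , filled
      where
      sizes : cutSize G W + (Edges.inner src tgt (const 1) W + Edges.inner src tgt (const 1) W) ≤ cutSize G Y
      sizes = ≤-trans (≤-reflexive (sym (shake W))) (≤-trans (*-monoʳ-≤ 3 le) (≤-reflexive (sym size-Y)))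
      inner-W : Edges.inner src tgt (const 1) W ≡ 0
      inner-W = m+n≡0⇒m≡0 _ (n≤0⇒n≡0 (+-cancelˡ-≤ (cutSize G W) _ 0 (≤-trans sizes (≤-trans size-le (≤-reflexive (sym (+-identityʳ _)))))))
      cut-⊒ : ∀ e → cutᴳ G W e ≡ true → cutᴳ G Y e ≡ true
      cut-⊒ = count-⊑-≡ cut-⊑ (≤-trans (≤-reflexive (sym (cutSize≡count G W))) (≤-trans (≤-trans (m≤m+n _ _) sizes) (≤-reflexive (cutSize≡count G Y))))
      independent-W : ∀ e → W (src e) ≡ true → W (tgt e) ≡ true → ⊥
      independent-W e p q = contradiction (≤-trans (≤-reflexive (sym (cong (λ b → ⟦ b ⟧ * 1) (∧⁺ p q))))
          (≤-trans (≤-sum (λ e → ⟦ Edges.inside src tgt W e ⟧ * 1) e) (≤-reflexive (trans (sym (lin≡sum _ _)) inner-W)))) λ ()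
      Z : Pred (order G)
      Z v = Y v ∨ W v
      closed : ∀ {e u v} → Joins e u v → Z u ≡ true → Z v ≡ true
      closed {e} {u} {v} j h with ∨⁻ {Y u} h
      ... | inj₁ Yu = ∨⁺ʳ {Y v} (next {e} j Yu)
      ... | inj₂ Wu with bool (W v)
      ...   | inj₁ Wv = ∨⁺ʳ {Y v} Wv
      ...   | inj₂ Wv with cut-elim G Y e (cut-⊒ e (cut-intro G {W} {e} j Wu Wv))
      ...     | x , y , j′ , Yx , _ with joins-unique G {e} j j′
      ...       | inj₁ (refl , refl) = ⊥-elim (true≢false Wu (YW _ Yx))
      ...       | inj₂ (refl , refl) = ∨⁺ˡ Yx
      cover : ∀ v → Z v ≡ true ⊎ Z v ≡ false → W v ≡ true ⊎ Y v ≡ true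
      cover v (inj₁ h) with ∨⁻ {Y v} h
      ... | inj₁ a = inj₂ a
      ... | inj₂ b = inj₁ b
      cover v (inj₂ h) = contradiction (≤-trans (three Z y₀ v (∨⁺ˡ Yy₀) h) (≤-reflexive (lin-0 λ e → cong (λ b → ⟦ b ⟧ * 1) (≢true⇒false λ c →
        let (x , y , j , Zx , Zy) = cut-elim G Z e c in true≢false (closed {e} j Zx) Zy)))) λ ()
      isBipY : ∀ e → cutᴳ G Y e ≡ true
      isBipY e with cover (src e) (bool _) | cover (tgt e) (bool _)
      ... | inj₁ p | inj₁ q = ⊥-elim (independent-W e p q)
      ... | inj₂ p | inj₂ q = ⊥-elim (true≢false (next {e} (inj₁ (refl , refl)) p) (YW _ q))
      ... | inj₂ p | inj₁ q = cut-intro G {Y} {e} (inj₁ (refl , refl)) p (≢true⇒false λ Yt → true≢false q (YW _ Yt))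
      ... | inj₁ p | inj₂ q = cut-intro G {Y} {e} (inj₂ (refl , refl)) q (≢true⇒false λ Ys → true≢false p (YW _ Ys))
      filled : Filled G Y
      filled R h s = spliced G R (proj₁ (good⁻ G good)) (proj₂ (good⁻ G good))
        (λ e → true⇒∈ (trans (lookup-∂ G R e) (trans (cong₂ _xor_ (h _) (h _)) (isBipY e)))) s

  bip? : ∀ G → Dec (Bipartite G)
  bip? G = anySubset? λ A → all? λ e → Data.Fin.Subset.Properties._∈?_ e (Graph.∂ G A)

  side-count : ∀ {G Z H x} (s : Shrink G Z H x) (A : Pred (order G)) →
    count (λ v → A v ∧ not (Z v)) ≡ count (λ u → A (Shrink.from s u) ∧ not (δ x u))
  side-count {G} {Z} {H} {x} s A = trans (count≡sum _) (trans (sum-reindex from _ inj onto)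
      (trans (sum-cong λ u → cong (λ b → ⟦ A (from u) ∧ not b ⟧) (Z-from u)) (sym (count≡sum _))))
    where
    open Shrink s
    inj : ∀ u v → from u ≡ from v → u ≡ v
    inj u v e = trans (sym (q-sec map u)) (trans (cong to e) (q-sec map v))
    onto : ∀ v → ⟦ A v ∧ not (Z v) ⟧ ≡ 0 ⊎ ∃ λ u → from u ≡ v
    onto v with bool (Z v)
    ... | inj₁ h rewrite h = inj₁ (cong ⟦_⟧ (Bool.∧-zeroʳ (A v)))
    ... | inj₂ h = inj₂ (to v , from-to v h)

  restrictTo : ∀ {G Z H x} → Shrink G Z H x → Pred (order G) → Pred (order H)
  restrictTo {x = x} s A u = A (Shrink.from s u) ∧ not (δ x u)

  cut-count : ∀ {G Z G₁ x₁ G₂ x₂} (c : Cut G Z G₁ x₁ G₂ x₂) A →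
    count A ≡ count (restrictTo (Cut.side₁ c) A) + count (restrictTo (Cut.side₂ c) A)
  cut-count {Z = Z} c A = trans (count-split A Z) (trans (+-comm (count (λ v → A v ∧ Z v)) _) (cong₂ _+_ (side-count (Cut.side₁ c) A)
    (trans (count-cong λ v → cong (A v ∧_) (sym (Bool.not-involutive (Z v)))) (side-count (Cut.side₂ c) A))))

  module _ {G Z G₁ x₁ G₂ x₂} (c : Cut G Z G₁ x₁ G₂ x₂) (good₁ : Good G₁) (good₂ : Good G₂) where
    private
      module S₁ = Shrink (Cut.side₁ c)
      module S₂ = Shrink (Cut.side₂ c)

    factor-up : ∀ {v} → Z v ≡ false → Factor G₁ (δ (S₁.to v)) → Factor G (δ v)
    factor-up {v} h f = factor-cong G pt (factor-extend c good₁ good₂ (δ (S₁.to v)) (δ-false (S₁.kept v h)) f)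
      where
      pt : ∀ u → (not (Z u) ∧ δ (S₁.to v) (S₁.to u)) ≡ δ v u
      pt u rewrite S₁.δ-kept h u with v ≟ u
      ... | yes refl rewrite h = refl
      ... | no ne rewrite δ-false ne = Bool.∧-zeroʳ (not (Z u))

    double-up : ∀ {y v} → Z y ≡ false → Z v ≡ false → Double G₁ (S₁.to y) (S₁.to v) → Double G y v
    double-up {y} {v} hy hv (ne , f) = (λ e → ne (cong S₁.to e)) , factor-cong G pt
        (factor-extend c good₁ good₂ (λ u → δ (S₁.to y) u ∨ δ (S₁.to v) u) (cong₂ _∨_ (δ-false (S₁.kept y hy)) (δ-false (S₁.kept v hv))) f)
      where
      pt : ∀ u → (not (Z u) ∧ (δ (S₁.to y) (S₁.to u) ∨ δ (S₁.to v) (S₁.to u))) ≡ (δ y u ∨ δ v u)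
      pt u rewrite S₁.δ-kept hy u | S₁.δ-kept hv u with bool (Z u)
      ... | inj₂ f rewrite f = refl
      ... | inj₁ t rewrite t | δ-false {i = y} {u} (λ { refl → true≢false t hy }) | δ-false {i = v} {u} (λ { refl → true≢false t hv }) = refl

    -- A factor of degree 3 at both contraction vertices uses all three cut edges on both sides.
    join-up : ∀ {v} → Z v ≡ false → Double G₁ x₁ (S₁.to v) → ∀ Q → Q x₂ ≡ true → Factor G₂ Q →
              Factor G (λ u → (Z u ∧ Q (S₂.to u)) ∨ δ v u)
    join-up {v} h (ne , f) Q Qx fQ with factor-join c good₁ good₂ (λ u → δ x₁ u ∨ δ (S₁.to v) u) Q (∨⁺ˡ (δ-refl x₁)) Qx f fQ
    ... | F , dg , _ = F , λ u → trans (dg u) (cong (λ b → if b then 3 else 1) (pt u))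
      where
      pt : ∀ u → (if Z u then Q (S₂.to u) else (δ x₁ (S₁.to u) ∨ δ (S₁.to v) (S₁.to u))) ≡ ((Z u ∧ Q (S₂.to u)) ∨ δ v u)
      pt u rewrite S₁.δ-x u | S₁.δ-kept h u with bool (Z u)
      ... | inj₂ f rewrite f = refl
      ... | inj₁ t rewrite t | δ-false {i = v} {u} (λ { refl → true≢false t h }) = sym (Bool.∨-identityʳ _)

    -- The double factor of x₁ and v is glued to an x₂-matching, which leaves a v-matching of G, or
    -- to a double factor of y and x₂, which leaves a double factor of y and v. This is how reaching
    -- x₂ pays for placing x₁ in Y.
    link : ∀ {Y v} → Z v ≡ false → Reach G₂ (restrictTo (Cut.side₂ c) Y) x₂ → Double G₁ x₁ (S₁.to v) → Reach G Y v
    link {Y} {v} h (inj₁ f₂) d = inj₁ (factor-cong G pt (join-up h d (δ x₂) (δ-refl x₂) f₂))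
      where
      pt : ∀ u → ((Z u ∧ δ x₂ (S₂.to u)) ∨ δ v u) ≡ δ v u
      pt u rewrite S₂.δ-x u with Z u
      ... | true  = refl
      ... | false = refl
    link {Y} {v} h (inj₂ (y , Yy , (y≢ , f₂))) d = inj₂ (S₂.from y , proj₁ (∧⁻ Yy)
        , (λ e → true≢false (subst (λ x → Z x ≡ true) e Zy) h) , factor-cong G pt (join-up h d (λ u → δ y u ∨ δ x₂ u) (∨⁺ʳ {δ y x₂} (δ-refl x₂)) f₂))
      where
      nZy : not (Z (S₂.from y)) ≡ false
      nZy = S₂.from-kept y≢
      Zy : Z (S₂.from y) ≡ true
      Zy = ≢false⇒true λ e → true≢false (not⁺ e) nZy
      pt : ∀ u → ((Z u ∧ (δ y (S₂.to u) ∨ δ x₂ (S₂.to u))) ∨ δ v u) ≡ (δ (S₂.from y) u ∨ δ v u)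
      pt u rewrite S₂.δ-x u = cong (_∨ δ v u) (trans (cong (λ z → Z u ∧ (δ z (S₂.to u) ∨ not (Z u))) (sym (q-sec S₂.map y)))
          (trans (cong (λ b → Z u ∧ (b ∨ not (Z u))) (S₂.δ-kept nZy u)) (lem (bool (Z u)))))
        where
        lem : Z u ≡ true ⊎ Z u ≡ false → (Z u ∧ (δ (S₂.from y) u ∨ not (Z u))) ≡ δ (S₂.from y) u
        lem (inj₁ t) rewrite t = Bool.∨-identityʳ _
        lem (inj₂ f) rewrite f = sym (δ-false λ { refl → true≢false Zy f })

    reach-up : ∀ {Y u} → u ≢ x₁ → Reach G₁ (restrictTo (Cut.side₁ c) Y) u → Reach G Y (S₁.from u)
    reach-up {Y} {u} ne (inj₁ f) = inj₁ (factor-up (S₁.from-kept ne) (subst (λ z → Factor G₁ (δ z)) (sym (q-sec S₁.map u)) f))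
    reach-up {Y} {u} ne (inj₂ (y , Yy , d)) = inj₂ (S₁.from y , proj₁ (∧⁻ Yy)
      , double-up (S₁.from-kept (λ e → δ-false⁻ (not⁻ (proj₂ (∧⁻ {Y (S₁.from y)} Yy))) (sym e))) (S₁.from-kept ne) (subst₂ (Double G₁) (sym (q-sec S₁.map y)) (sym (q-sec S₁.map u)) d))

    stable-down : ∀ {Y} → Stable G Y → Stable G₁ (restrictTo (Cut.side₁ c) Y)
    stable-down {Y} st u Yu r = st (S₁.from u) (proj₁ (∧⁻ Yu)) (reach-up (λ e → δ-false⁻ (not⁻ (proj₂ (∧⁻ {Y (S₁.from u)} Yu))) (sym e)) r)

    module CaseC {Y} (stable : Stable G Y) (x₁∉ : ¬ Factor G₁ (δ x₁)) (x₂∈ : Reach G₂ (restrictTo (Cut.side₂ c) Y) x₂) where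
      Y₁ : Pred (order G₁)
      Y₁ = restrictTo (Cut.side₁ c) Y
      Y₁⁺ : Pred (order G₁)
      Y₁⁺ = Y₁ ⊕ x₁

      Y₁⇒ : ∀ {u} → Y₁ u ≡ true → Y (S₁.from u) ≡ true × u ≢ x₁
      Y₁⇒ {u} h = proj₁ (∧⁻ h) , λ e → δ-false⁻ (not⁻ (proj₂ (∧⁻ {Y (S₁.from u)} h))) (sym e)

      reach⁺ : ∀ {u} → u ≢ x₁ → Reach G₁ Y₁⁺ u → Reach G Y (S₁.from u)
      reach⁺ ne (inj₁ f) = reach-up ne (inj₁ f)
      reach⁺ {u} ne (inj₂ (y , Yy , d)) with ⊕⁻ Y₁ Yy
      ... | inj₁ h    = reach-up ne (inj₂ (y , h , d))
      ... | inj₂ refl = link (S₁.from-kept ne) x₂∈ (subst (Double G₁ x₁) (sym (q-sec S₁.map u)) d)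

      -- If x₁ were doubly matchable with some y in Y, then `link` would make y itself reached in G,
      -- against the stability of Y. A vertex reached only through x₁ is reached in G for the same
      -- reason.
      stable⁺ : Stable G₁ Y₁⁺
      stable⁺ u Yu r with u ≟ x₁
      stable⁺ u Yu r | no ne with ⊕⁻ Y₁ Yu
      ... | inj₁ h = stable (S₁.from u) (proj₁ (Y₁⇒ h)) (reach⁺ ne r)
      ... | inj₂ e = ne (sym e)
      stable⁺ .x₁ Yu (inj₁ f) | yes refl = x₁∉ f
      stable⁺ .x₁ Yu (inj₂ (y , Yy , d)) | yes refl with ⊕⁻ Y₁ Yy
      ... | inj₂ refl = proj₁ d refl
      ... | inj₁ h = stable (S₁.from y) (proj₁ (Y₁⇒ h)) (link (S₁.from-kept (proj₂ (Y₁⇒ h))) x₂∈ (subst (Double G₁ x₁) (sym (q-sec S₁.map y)) (double-sym G₁ d)))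

      x₁∉W : reached G₁ Y₁⁺ x₁ ≡ false
      x₁∉W = ≢true⇒false λ h → stable⁺ x₁ (∨⁺ʳ {Y₁ x₁} (δ-refl x₁)) (reached⁻ h)

      count-W₁ : count (reached G₁ Y₁⁺) ≤ count (restrictTo (Cut.side₁ c) (reached G Y))
      count-W₁ = count-mono λ u h → let ne = λ (e : u ≡ x₁) → true≢false h (subst (λ z → reached G₁ Y₁⁺ z ≡ false) (sym e) x₁∉W) in
        ∧⁺ (reached⁺ (reach⁺ ne (reached⁻ h))) (not⁺ (δ-false (ne ∘ sym)))

  count-Y₁⁺ : ∀ {G Z H x} (s : Shrink G Z H x) Y → count (restrictTo s Y ⊕ x) ≡ suc (count (restrictTo s Y))
  count-Y₁⁺ {x = x} s Y = count-⊕ {p = restrictTo s Y} x (trans (cong (λ b → Y (Shrink.from s x) ∧ not b) (δ-refl x)) (Bool.∧-zeroʳ _))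

  colour : ∀ {G H} (Q : G ↠ H) A → (∀ f → cutᴳ H A f ≡ true) → ∀ e → q Q (Graph.src G e) ≢ q Q (Graph.tgt G e) → (A (q Q (Graph.src G e)) xor A (q Q (Graph.tgt G e))) ≡ true
  colour Q A bip e ne with p-onto Q e
  ... | inj₁ l = contradiction l ne
  ... | inj₂ (f , refl) = trans (cut-image Q A f) (bip f)

  bipartite-glue : ∀ {G Z G₁ x₁ G₂ x₂} → Cut G Z G₁ x₁ G₂ x₂ → Bipartite G₁ → Bipartite G₂ → Bipartite G
  bipartite-glue {G} {Z} {G₁} {x₁} {G₂} {x₂} c (X₁ , b₁) (X₂ , b₂) = tabulate A , bipartite⁺ G A crossing
    where
    module S₁ = Shrink (Cut.side₁ c)
    module S₂ = Shrink (Cut.side₂ c)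
    A₁ = lookup X₁
    A₂ = lookup X₂
    A : Pred (order G)
    -- Colours are taken relative to the contraction vertices and reversed on one side, so that the
    -- two ends of a cut edge differ.
    A v = if Z v then not (A₂ (S₂.to v) xor A₂ x₂) else (A₁ (S₁.to v) xor A₁ x₁)
    crossing : ∀ e → cutᴳ G A e ≡ true
    crossing e with colour S₁.map A₁ (bipartite⁻ G₁ X₁ b₁) e | colour S₂.map A₂ (bipartite⁻ G₂ X₂ b₂) e | bool (Z (Graph.src G e)) | bool (Z (Graph.tgt G e))
    ... | h₁ | h₂ | inj₂ a | inj₂ b rewrite a | b = lem (A₁ (S₁.to (Graph.src G e))) _ _ (h₁ λ l → Graph.loopless G e (S₁.kept-inj _ _ a b l))
      where
      lem : ∀ x y z → x xor y ≡ true → (x xor z) xor (y xor z) ≡ true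
      lem true  false true  _ = refl
      lem true  false false _ = refl
      lem false true  true  _ = refl
      lem false true  false _ = refl
    ... | h₁ | h₂ | inj₁ a | inj₁ b rewrite a | b = lem (A₂ (S₂.to (Graph.src G e))) _ _ (h₂ λ l → Graph.loopless G e (S₂.kept-inj _ _ (cong not a) (cong not b) l))
      where
      lem : ∀ x y z → x xor y ≡ true → not (x xor z) xor not (y xor z) ≡ true
      lem true  false true  _ = refl
      lem true  false false _ = refl
      lem false true  true  _ = refl
      lem false true  false _ = refl
    ... | h₁ | h₂ | inj₁ a | inj₂ b rewrite a | b = lem (A₂ (S₂.to (Graph.src G e))) (A₂ x₂) (A₁ (S₁.to (Graph.tgt G e))) (A₁ x₁)
            (subst (λ z → (A₂ (S₂.to (Graph.src G e)) xor A₂ z) ≡ true) (S₂.shrunk _ (not⁺ b)) (h₂ λ l → S₂.kept _ (cong not a) (trans l (S₂.shrunk _ (not⁺ b)))))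
            (subst (λ z → (A₁ z xor A₁ (S₁.to (Graph.tgt G e))) ≡ true) (S₁.shrunk _ a) (h₁ λ l → S₁.kept _ b (trans (sym l) (S₁.shrunk _ a))))
      where
      lem : ∀ x y z w → x xor y ≡ true → w xor z ≡ true → not (x xor y) xor (z xor w) ≡ true
      lem true  false true  false _ _ = refl
      lem true  false false true  _ _ = refl
      lem false true  true  false _ _ = refl
      lem false true  false true  _ _ = refl
    ... | h₁ | h₂ | inj₂ a | inj₁ b rewrite a | b = lem (A₂ (S₂.to (Graph.tgt G e))) (A₂ x₂) (A₁ (S₁.to (Graph.src G e))) (A₁ x₁)
            (subst (λ z → (A₂ z xor A₂ (S₂.to (Graph.tgt G e))) ≡ true) (S₂.shrunk _ (not⁺ a)) (h₂ λ l → S₂.kept _ (cong not b) (trans (sym l) (S₂.shrunk _ (not⁺ a)))))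
            (subst (λ z → (A₁ (S₁.to (Graph.src G e)) xor A₁ z) ≡ true) (S₁.shrunk _ b) (h₁ λ l → S₁.kept _ a (trans l (S₁.shrunk _ b))))
      where
      lem : ∀ x y z w → y xor x ≡ true → z xor w ≡ true → (z xor w) xor not (x xor y) ≡ true
      lem true  false true  false _ _ = refl
      lem true  false false true  _ _ = refl
      lem false true  true  false _ _ = refl
      lem false true  false true  _ _ = refl

  -- Adding the unmatchable x₁ to Y in G₁ pays for x₂, which is reached in G₂ but is no vertex of G.
  caseC-bound : ∀ {G Z G₁ x₁ G₂ x₂} (c : Cut G Z G₁ x₁ G₂ x₂) → Good G → Good G₁ → Good G₂ → ∀ {b₁ b₂} →
    (∀ Y → Stable G₁ Y → Bound G₁ b₁ Y) → (∀ Y → Stable G₂ Y → Bound G₂ b₂ Y) → ∀ Y → Stable G Y →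
    ¬ Factor G₁ (δ x₁) → Reach G₂ (restrictTo (Cut.side₂ c) Y) x₂ → Bound G (b₁ + b₂) Y
  caseC-bound {G} {Z} {G₁} {x₁} {G₂} {x₂} c good good₁ good₂ {b₁} {b₂} ih₁ ih₂ Y stable x₁∉ x₂∈ = record { lower = lower ; exact = exact }
    where
    module S₁ = Shrink (Cut.side₁ c)
    module S₂ = Shrink (Cut.side₂ c)
    c′ = cut-swap c
    Y₁ = restrictTo (Cut.side₁ c) Y
    Y₁⁺ = Y₁ ⊕ x₁
    Y₂ = restrictTo (Cut.side₂ c) Y
    W₁ = reached G₁ Y₁⁺
    W₂ = reached G₂ Y₂
    W = reached G Y
    stable₁ : Stable G₁ Y₁⁺
    stable₁ = CaseC.stable⁺ c good₁ good₂ stable x₁∉ x₂∈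
    stable₂ : Stable G₂ Y₂
    stable₂ = stable-down c′ good₂ good₁ stable
    B₁ = ih₁ Y₁⁺ stable₁
    B₂ = ih₂ Y₂ stable₂
    W₂x : W₂ x₂ ≡ true
    W₂x = reached⁺ x₂∈
    count-W₂ : count W₂ ≤ suc (count (restrictTo (Cut.side₂ c) W))
    count-W₂ = ≤-trans (≤-reflexive (count-∖ x₂ W₂x)) (s≤s (count-mono λ u h → let (Wu , ne) = ∖⁻ W₂ h in
      ∧⁺ (reached⁺ (reach-up c′ good₂ good₁ (ne ∘ sym) (reached⁻ Wu))) (not⁺ (δ-false ne))))
    count-W : suc (count W) ≥ count W₁ + count W₂
    count-W = begin
      count W₁ + count W₂  ≤⟨ +-mono-≤ (CaseC.count-W₁ c good₁ good₂ stable x₁∉ x₂∈) count-W₂ ⟩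
      count (restrictTo (Cut.side₁ c) W) + suc (count (restrictTo (Cut.side₂ c) W)) ≡⟨ +-suc _ _ ⟩
      suc (count (restrictTo (Cut.side₁ c) W) + count (restrictTo (Cut.side₂ c) W)) ≡⟨ cong suc (cut-count c W) ⟨
      suc (count W)        ∎
      where open ≤-Reasoning
    total : (b₁ + count Y₁⁺) + (b₂ + count Y₂) ≡ suc (b₁ + b₂ + count Y)
    total = trans (cong (λ x → (b₁ + x) + (b₂ + count Y₂)) (count-Y₁⁺ (Cut.side₁ c) Y)) (trans (shuffle b₁ (count Y₁) b₂ (count Y₂)) (cong (λ x → suc (b₁ + b₂ + x)) (sym (cut-count c Y))))
      where
      shuffle : ∀ a b c d → (a + suc b) + (c + d) ≡ suc (a + c + (b + d))
      shuffle = solve-∀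
    lower : b₁ + b₂ + count Y ≤ count W
    lower = ≤-pred (≤-trans (≤-reflexive (sym total)) (≤-trans (+-mono-≤ (Bound.lower B₁) (Bound.lower B₂)) count-W))
    exact : count W ≤ b₁ + b₂ + count Y → (∃ λ y → Y y ≡ true) ⊎ ¬ Bipartite G → (∀ v → W v ≡ true ⊎ Y v ≡ true) × Filled G Y
    exact le _ = cover , filled
      where
      upper : count W₁ + count W₂ ≤ (b₁ + count Y₁⁺) + (b₂ + count Y₂)
      upper = ≤-trans count-W (≤-trans (s≤s le) (≤-reflexive (sym total)))
      le₁ : count W₁ ≤ b₁ + count Y₁⁺
      le₁ = +-cancelʳ-≤ (b₂ + count Y₂) _ _ (≤-trans (+-monoʳ-≤ (count W₁) (Bound.lower B₂)) upper)
      le₂ : count W₂ ≤ b₂ + count Y₂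
      le₂ = +-cancelˡ-≤ (b₁ + count Y₁⁺) _ _ (≤-trans (+-monoˡ-≤ (count W₂) (Bound.lower B₁)) upper)
      -- That x₂ is reached supplies the proviso of exactness in G₂: a factor at x₂ excludes a
      -- bipartition, and a double factor exhibits a vertex of Y.
      nonempty₂ : Reach G₂ Y₂ x₂ → (∃ λ y → Y₂ y ≡ true) ⊎ ¬ Bipartite G₂
      nonempty₂ (inj₁ f) = inj₂ λ { (X , b) → bipartite⇒unmatchable G₂ good₂ (lookup X) (bipartite⁻ G₂ X b) x₂ f }
      nonempty₂ (inj₂ (y , Yy , _)) = inj₁ (y , Yy)
      E₁ = Bound.exact B₁ le₁ (inj₁ (x₁ , ∨⁺ʳ {Y₁ x₁} (δ-refl x₁)))
      E₂ = Bound.exact B₂ le₂ (nonempty₂ x₂∈)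
      cover : ∀ v → W v ≡ true ⊎ Y v ≡ true
      cover v with bool (Z v)
      cover v | inj₂ h with proj₁ E₁ (S₁.to v)
      ... | inj₁ Wu = inj₁ (subst (λ z → W z ≡ true) (S₁.from-to v h) (reached⁺ (CaseC.reach⁺ c good₁ good₂ stable x₁∉ x₂∈ (S₁.kept v h) (reached⁻ Wu))))
      ... | inj₂ Yu with ⊕⁻ Y₁ Yu
      ...   | inj₁ Y₁u = inj₂ (subst (λ z → Y z ≡ true) (S₁.from-to v h) (proj₁ (∧⁻ Y₁u)))
      ...   | inj₂ e = contradiction (sym e) (S₁.kept v h)
      cover v | inj₁ h with proj₁ E₂ (S₂.to v)
      ... | inj₁ Wu = inj₁ (subst (λ z → W z ≡ true) (S₂.from-to v (cong not h)) (reached⁺ (reach-up c′ good₂ good₁ (S₂.kept v (cong not h)) (reached⁻ Wu))))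
      ... | inj₂ Yu = inj₂ (subst (λ z → Y z ≡ true) (S₂.from-to v (cong not h)) (proj₁ (∧⁻ Yu)))
      filled : Filled G Y
      filled R hR s = filled-join s c (λ a _ → count-pos⁻ (≤-trans (s≤s z≤n) (≤-reflexive (sym (trans (sym (cutSize≡count G (δ a))) (Good.cubic good a))))))
          (filled-cong pt₁ (proj₂ E₁)) (filled-cong pt₂ (proj₂ E₂))
        where
        pt₁ : ∀ u → Y₁⁺ u ≡ (δ x₁ u ∨ lookup R (S₁.from u))
        pt₁ u rewrite hR (S₁.from u) with δ x₁ u
        ... | true  = Bool.∨-zeroʳ _
        ... | false = trans (Bool.∨-identityʳ _) (Bool.∧-identityʳ _)
        pt₂ : ∀ u → Y₂ u ≡ (not (δ x₂ u) ∧ lookup R (S₂.from u))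
        pt₂ u rewrite hR (S₂.from u) = Bool.∧-comm (Y (S₂.from u)) _

  bound-swap : ∀ {G b₁ b₂ Y} → Bound G (b₂ + b₁) Y → Bound G (b₁ + b₂) Y
  bound-swap {G} {b₁} {b₂} {Y} = subst (λ b → Bound G b Y) (+-comm b₂ b₁)

  -- If both contraction vertices are λ-matchable, the glued factor is a perfect matching crossing
  -- the tight cut three times. If one is unmatchable while the other is reached, `caseC-bound`
  -- applies. If neither is reached, the bounds simply add up; equality would then be exact on some
  -- side and would have to cover its contraction vertex, which is neither reached nor in Y.
  split-bound : ∀ {G Z G₁ x₁ G₂ x₂} (c : Cut G Z G₁ x₁ G₂ x₂) → Good G → Good G₁ → Good G₂ →
    (∀ F → Perfect G F → wtᴳ G (⟦_⟧ ∘ F) Z ≡ 1) → ∀ {b₁ b₂} →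
    (∀ Y → Stable G₁ Y → Bound G₁ b₁ Y) → (∀ Y → Stable G₂ Y → Bound G₂ b₂ Y) → ∀ Y → Stable G Y → Bound G (b₁ + b₂) Y
  split-bound {G} {Z} {G₁} {x₁} {G₂} {x₂} c good good₁ good₂ tight {b₁} {b₂} ih₁ ih₂ Y stable
    with factor? G₁ (δ x₁) | factor? G₂ (δ x₂) | bool (reached G₁ (restrictTo (Cut.side₁ c) Y) x₁) | bool (reached G₂ (restrictTo (Cut.side₂ c) Y) x₂)
  ... | yes f₁ | yes f₂ | _ | _ = contradiction (trans (sym (tight F perfect)) three) λ ()
    where
    joined = factor-join c good₁ good₂ (δ x₁) (δ x₂) (δ-refl x₁) (δ-refl x₂) f₁ f₂
    F = proj₁ joined
    three = proj₂ (proj₂ joined)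
    perfect : Perfect G F
    perfect v = trans (proj₁ (proj₂ joined) v) (cong (λ b → if b then 3 else 1) (pt (bool (Z v))))
      where
      pt : Z v ≡ true ⊎ Z v ≡ false → (if Z v then δ x₂ (Shrink.to (Cut.side₂ c) v) else δ x₁ (Shrink.to (Cut.side₁ c) v)) ≡ false
      pt (inj₁ t) rewrite Shrink.δ-x (Cut.side₂ c) v | Shrink.δ-x (Cut.side₁ c) v | t = refl
      pt (inj₂ f) rewrite Shrink.δ-x (Cut.side₂ c) v | Shrink.δ-x (Cut.side₁ c) v | f = refl
  ... | no n₁ | _ | _ | inj₁ r₂ = caseC-bound c good good₁ good₂ ih₁ ih₂ Y stable n₁ (reached⁻ r₂)
  ... | _ | no n₂ | inj₁ r₁ | _ = bound-swap {b₁ = b₁} {b₂} (caseC-bound (cut-swap c) good good₂ good₁ ih₂ ih₁ Y stable n₂ (reached⁻ r₁))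
  ... | yes f₁ | no _ | inj₂ r₁ | _ = ⊥-elim (true≢false (reached⁺ (inj₁ f₁)) r₁)
  ... | no _ | yes f₂ | _ | inj₂ r₂ = ⊥-elim (true≢false (reached⁺ (inj₁ f₂)) r₂)
  ... | no n₁ | no n₂ | inj₂ r₁ | inj₂ r₂ = record { lower = lower ; exact = exact }
    where
    c′ = cut-swap c
    Y₁ = restrictTo (Cut.side₁ c) Y
    Y₂ = restrictTo (Cut.side₂ c) Y
    W₁ = reached G₁ Y₁
    W₂ = reached G₂ Y₂
    W = reached G Y
    B₁ = ih₁ Y₁ (stable-down c good₁ good₂ stable)
    B₂ = ih₂ Y₂ (stable-down c′ good₂ good₁ stable)
    count-W : count W₁ + count W₂ ≤ count W
    count-W = ≤-trans (+-mono-≤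
        (count-mono λ u h → let ne = λ (e : u ≡ x₁) → true≢false h (subst (λ z → W₁ z ≡ false) (sym e) r₁) in
          ∧⁺ (reached⁺ (reach-up c good₁ good₂ ne (reached⁻ h))) (not⁺ (δ-false (ne ∘ sym))))
        (count-mono λ u h → let ne = λ (e : u ≡ x₂) → true≢false h (subst (λ z → W₂ z ≡ false) (sym e) r₂) in
          ∧⁺ (reached⁺ (reach-up c′ good₂ good₁ ne (reached⁻ h))) (not⁺ (δ-false (ne ∘ sym)))))
      (≤-reflexive (sym (cut-count c W)))
    total : (b₁ + count Y₁) + (b₂ + count Y₂) ≡ b₁ + b₂ + count Y
    total = trans (shuffle b₁ (count Y₁) b₂ (count Y₂)) (cong (b₁ + b₂ +_) (sym (cut-count c Y)))
      where
      shuffle : ∀ a b c d → (a + b) + (c + d) ≡ a + c + (b + d)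
      shuffle = solve-∀
    lower : b₁ + b₂ + count Y ≤ count W
    lower = ≤-trans (≤-reflexive (sym total)) (≤-trans (+-mono-≤ (Bound.lower B₁) (Bound.lower B₂)) count-W)
    exact : count W ≤ b₁ + b₂ + count Y → (∃ λ y → Y y ≡ true) ⊎ ¬ Bipartite G → (∀ v → W v ≡ true ⊎ Y v ≡ true) × Filled G Y
    exact le reason = ⊥-elim (impossible reason)
      where
      upper : count W₁ + count W₂ ≤ (b₁ + count Y₁) + (b₂ + count Y₂)
      upper = ≤-trans count-W (≤-trans le (≤-reflexive (sym total)))
      le₁ : count W₁ ≤ b₁ + count Y₁
      le₁ = +-cancelʳ-≤ (b₂ + count Y₂) _ _ (≤-trans (+-monoʳ-≤ (count W₁) (Bound.lower B₂)) upper)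
      le₂ : count W₂ ≤ b₂ + count Y₂
      le₂ = +-cancelˡ-≤ (b₁ + count Y₁) _ _ (≤-trans (+-monoˡ-≤ (count W₂) (Bound.lower B₁)) upper)
      outside : ∀ {H Z x} (s : Shrink G Z H x) → restrictTo s Y x ≡ false
      outside {x = x} s = trans (cong (λ b → Y (Shrink.from s x) ∧ not b) (δ-refl x)) (Bool.∧-zeroʳ _)
      not₁ : (∃ λ y → Y₁ y ≡ true) ⊎ ¬ Bipartite G₁ → ⊥
      not₁ r with proj₁ (Bound.exact B₁ le₁ r) x₁
      ... | inj₁ w = true≢false w r₁
      ... | inj₂ y = true≢false y (outside (Cut.side₁ c))
      not₂ : (∃ λ y → Y₂ y ≡ true) ⊎ ¬ Bipartite G₂ → ⊥
      not₂ r with proj₁ (Bound.exact B₂ le₂ r) x₂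
      ... | inj₁ w = true≢false w r₂
      ... | inj₂ y = true≢false y (outside (Cut.side₂ c))
      bip : ∀ {H} → (¬ Bipartite H → ⊥) → Bipartite H
      bip {H} h with bip? H
      ... | yes b = b
      ... | no nb = ⊥-elim (h nb)
      impossible : (∃ λ y → Y y ≡ true) ⊎ ¬ Bipartite G → ⊥
      impossible (inj₂ nb) = nb (bipartite-glue c (bip {G₁} (not₁ ∘ inj₂)) (bip {G₂} (not₂ ∘ inj₂)))
      impossible (inj₁ (y , Yy)) with bool (Z y)
      ... | inj₂ h = not₁ (inj₁ (Shrink.to (Cut.side₁ c) y , ∧⁺ (trans (cong Y (Shrink.from-to (Cut.side₁ c) y h)) Yy) (not⁺ (δ-false (Shrink.kept (Cut.side₁ c) y h ∘ sym)))))
      ... | inj₁ h = not₂ (inj₁ (Shrink.to (Cut.side₂ c) y , ∧⁺ (trans (cong Y (Shrink.from-to (Cut.side₂ c) y (cong not h))) Yy)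
                       (not⁺ (δ-false (Shrink.kept (Cut.side₂ c) y (cong not h) ∘ sym)))))

  record SplitCut (G : Graph) (X : Graph.VSet G) (H₁ H₂ : Graph) : Set where
    field
      {x₁}  : Graph.V H₁
      {x₂}  : Graph.V H₂
      cut   : Cut G (lookup X) H₁ x₁ H₂ x₂
      three : cutSize G (lookup X) ≡ 3
      tight : ∀ F → Perfect G F → wtᴳ G (⟦_⟧ ∘ F) (lookup X) ≡ 1
      good₁ : Good H₁
      good₂ : Good H₂

  split-cut : ∀ {G X H₁ H₂} → Good G → NontrivialTightCut G X → Contraction G X H₁ → Contraction G (∁ X) H₂ → SplitCut G X H₁ H₂
  split-cut {G} {X} {H₁} {H₂} good t c₁ c₂ = record { cut = record { side₁ = s₁ ; side₂ = s₂ } ; three = size3 ; tight = tight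
      ; good₁ = shrink-good s₁ good size3 (proj₁ z₂) (not⁻ (proj₂ z₂))
      ; good₂ = shrink-good s₂ good (trans (wt-not G (const 1) (lookup X)) size3) (proj₁ z₁) (cong not (proj₂ z₁)) }
    where
    t′ = tightᴳ⁻ G X t
    tight = proj₂ (proj₂ t′)
    size3 = tight⇒3 G good (lookup X) tight
    z₁ : ∃ λ v → lookup X v ≡ true
    z₁ = count-pos⁻ (≤-trans (s≤s z≤n) (proj₁ t′))
    z₂ : ∃ λ v → not (lookup X v) ≡ true
    z₂ = count-pos⁻ (≤-trans (s≤s z≤n) (proj₁ (proj₂ t′)))
    s₁ : Shrink G (lookup X) H₁ _
    s₁ = contraction⇒shrink (proj₁ z₁) (proj₂ z₁) c₁
    s₂ : Shrink G (not ∘ lookup X) H₂ _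
    s₂ = shrink-cong (λ v → lookup-map v not X) (contraction⇒shrink (proj₁ z₂) (trans (lookup-map (proj₁ z₂) not X) (proj₂ z₂)) c₂)

  bound : ∀ {G} (D : TightCutDecomposition G) → Good G → ∀ Y → Stable G Y → Bound G (β D) Y
  bound {G} (brick free nonbip) good = brick-bound G good free nonbip
  bound {G} (brace free bip) good = brace-bound G good bip
  bound {G} (split X {H₁} {H₂} t c₁ c₂ D₁ D₂) good = split-bound cut good good₁ good₂ tight (bound D₁ good₁) (bound D₂ good₂)
    where open SplitCut (split-cut good t c₁ c₂)

open Bounds

-- Rearranging a tight cut decomposition along a given tight 3-cut

module Refinement where

  two : ∀ {n} (U : Pred n) u v → U u ≡ true → U v ≡ true → u ≢ v → 2 ≤ count U
  two U u v Uu Uv ne = ≤-trans (s≤s (count-pos v (∖⁺ U Uv ne))) (≤-reflexive (sym (count-∖ u Uu)))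

  two⁻ : ∀ {n} (U : Pred n) → 2 ≤ count U → ∃ λ u → ∃ λ v → U u ≡ true × U v ≡ true × u ≢ v
  two⁻ U le with count-pos⁻ (≤-trans (s≤s z≤n) le)
  ... | u , Uu with another U u Uu
  ...   | inj₂ (v , Uv , ne) = u , v , Uu , Uv , ne
  ...   | inj₁ only = contradiction (≤-trans le (≤-reflexive (trans (count-cong only) (count-δ u)))) λ { (s≤s ()) }

  contraction-of : ∀ {G H x} (U : Pred (order G)) → Shrink G U H x → Contraction G (tabulate U) H
  contraction-of U s = shrink⇒contraction (tabulate U) (shrink-cong (λ v → sym (lookup∘tabulate U v)) s)

  contraction-of-∁ : ∀ {G H x} (U : Pred (order G)) → Shrink G (not ∘ U) H x → Contraction G (∁ (tabulate U)) H
  contraction-of-∁ U s = shrink⇒contraction (∁ (tabulate U))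
    (shrink-cong (λ v → sym (trans (lookup-map v not (tabulate U)) (cong not (lookup∘tabulate U v)))) s)

  shrink-through : ∀ {G K X P x} (Q : G ↠ K) (s : Shrink G X P x) →
    (∀ u v → q Q u ≡ q Q v → Shrink.to s u ≡ Shrink.to s v) → Shrink K (X ∘ sec Q) P x
  shrink-through Q s ker = record
    { map = through Q map ker ; shrunk = λ k h → shrunk (sec Q k) h ; kept = λ k h → kept (sec Q k) h
    ; kept-inj = λ k l hk hl e → trans (sym (q-sec Q k)) (trans (cong (q Q) (kept-inj _ _ hk hl e)) (q-sec Q l)) }
    where open Shrink s

  shrink-same : ∀ {G Z H x} (s : Shrink G Z H x) u v → Shrink.to s u ≡ Shrink.to s v → u ≡ v ⊎ (Z u ≡ true × Z v ≡ true)
  shrink-same {Z = Z} s u v e with bool (Z u) | bool (Z v)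
  ... | inj₁ p | inj₁ q = inj₂ (p , q)
  ... | inj₂ p | inj₂ q = inj₁ (Shrink.kept-inj s u v p q e)
  ... | inj₁ p | inj₂ q = contradiction (trans (sym e) (Shrink.shrunk s u p)) (Shrink.kept s v q)
  ... | inj₂ p | inj₁ q = contradiction (trans e (Shrink.shrunk s v q)) (Shrink.kept s u p)

  module _ {G H : Graph} (Q : G ↠ H) (inj : ∀ u v → q Q u ≡ q Q v → u ≡ v) where
    private
      sec-q : ∀ v → sec Q (q Q v) ≡ v
      sec-q v = inj _ v (q-sec Q (q Q v))

      δ-q : ∀ u v → δ (q Q u) (q Q v) ≡ δ u v
      δ-q u v = ≡-by-truth (λ h → trans (cong (δ u) (sym (inj u v (δ-true h)))) (δ-refl u))
                           (λ h → trans (cong (λ z → δ (q Q u) (q Q z)) (sym (δ-true h))) (δ-refl (q Q u)))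

      count-pull : ∀ (A : Pred (order H)) → count (A ∘ q Q) ≡ count A
      count-pull A = trans (count≡sum _) (trans (sum-reindex (sec Q) _ (λ u v e → trans (sym (q-sec Q u)) (trans (cong (q Q) e) (q-sec Q v))) (λ v → inj₂ (q Q v , sec-q v)))
        (trans (sum-cong λ u → cong (⟦_⟧ ∘ A) (q-sec Q u)) (sym (count≡sum A))))

      order≡ : order G ≡ order H
      order≡ = trans (sym (count-full _)) (trans (count-pull (const true)) (count-full _))

      perfect-push : ∀ F → Perfect G F → Perfect H (F ∘ p Q)
      perfect-push F pm v = trans (sym (wt-image Q (⟦_⟧ ∘ F) (δ v))) (trans (Edges.wt-cong _ _ _ λ u →
        trans (cong (λ z → δ z (q Q u)) (sym (q-sec Q v))) (δ-q (sec Q v) u)) (pm (sec Q v)))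

      perfect-pull : ∀ F → Perfect H F → Perfect G (lift Q F)
      perfect-pull F pm v = trans (Edges.wt-cong _ _ _ (λ u → sym (δ-q v u))) (trans (wt-lift Q F (δ (q Q v))) (pm (q Q v)))

      bip-pull : Bipartite H → Bipartite G
      bip-pull (X , b) = tabulate (lookup X ∘ q Q) , bipartite⁺ G _ λ e → colour Q (lookup X) (bipartite⁻ H X b) e (λ l → Graph.loopless G e (inj _ _ l))

      bip-push : Bipartite G → Bipartite H
      bip-push (X , b) = tabulate (lookup X ∘ sec Q) , bipartite⁺ H _ λ f → trans (sym (cut-image Q (lookup X ∘ sec Q) f))
        (trans (cong₂ _xor_ (cong (lookup X) (sec-q _)) (cong (lookup X) (sec-q _))) (bipartite⁻ G X b (p Q f)))

      free-push : TightCutFree G → TightCutFree H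
      free-push free X t = let (a , b , tight) = tightᴳ⁻ H X t in
        free (tabulate (lookup X ∘ q Q)) (tightᴳ⁺ G (lookup X ∘ q Q) (≤-trans a (≤-reflexive (sym (count-pull (lookup X))))) (≤-trans b (≤-reflexive (sym (count-pull (not ∘ lookup X)))))
          λ F pm → trans (wt-image Q (⟦_⟧ ∘ F) (lookup X)) (tight (F ∘ p Q) (perfect-push F pm)))

    -- An injective quotient map is an isomorphism. At a split only the vertex set X has to be
    -- moved; the contractions and their decompositions are reused unchanged.
    transport : (D : TightCutDecomposition G) → ∃ λ (D′ : TightCutDecomposition H) → β D′ ≡ β D
    transport (brick free nonbip) = brick (free-push free) (nonbip ∘ bip-pull) , sym order≡
    transport (brace free bip) = brace (free-push free) (bip-push bip) , refl
    transport (split X t c₁ c₂ D₁ D₂) = split (tabulate X′) t′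
        (contraction-of X′ (shrink-through Q s₁ λ u v e → cong (Shrink.to s₁) (inj u v e)))
        (contraction-of-∁ X′ (shrink-through Q s₂ λ u v e → cong (Shrink.to s₂) (inj u v e))) D₁ D₂ , refl
      where
      X′ : Pred (order H)
      X′ = lookup X ∘ sec Q
      X≡ : ∀ v → X′ (q Q v) ≡ lookup X v
      X≡ v = cong (lookup X) (sec-q v)
      tX = tightᴳ⁻ G X t
      z₁ = count-pos⁻ {p = lookup X} (≤-trans (s≤s z≤n) (proj₁ tX))
      z₂ = count-pos⁻ {p = not ∘ lookup X} (≤-trans (s≤s z≤n) (proj₁ (proj₂ tX)))
      s₁ = contraction⇒shrink (proj₁ z₁) (proj₂ z₁) c₁
      s₂ = shrink-cong (λ v → lookup-map v not X) (contraction⇒shrink (proj₁ z₂) (trans (lookup-map (proj₁ z₂) not X) (proj₂ z₂)) c₂)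
      t′ : NontrivialTightCut H (tabulate X′)
      t′ = tightᴳ⁺ H X′ (≤-trans (proj₁ tX) (≤-reflexive (trans (count-cong λ v → sym (X≡ v)) (count-pull X′))))
        (≤-trans (proj₁ (proj₂ tX)) (≤-reflexive (trans (count-cong λ v → cong not (sym (X≡ v))) (count-pull (not ∘ X′)))))
        λ F pm → trans (sym (wt-lift Q F X′)) (trans (Edges.wt-cong _ _ _ X≡) (proj₂ (proj₂ tX) (lift Q F) (perfect-pull F pm)))

  same-shrink : ∀ {G Z H x H′ x′} → Shrink G Z H x → Shrink G Z H′ x′ → (D : TightCutDecomposition H) → ∃ λ (D′ : TightCutDecomposition H′) → β D′ ≡ β D
  same-shrink {Z = Z} s s′ = transport (through (Shrink.map s) (Shrink.map s′) ker) inj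
    where
    ker : ∀ u v → Shrink.to s u ≡ Shrink.to s v → Shrink.to s′ u ≡ Shrink.to s′ v
    ker u v e with shrink-same s u v e
    ... | inj₁ refl = refl
    ... | inj₂ (p , q) = trans (Shrink.shrunk s′ u p) (sym (Shrink.shrunk s′ v q))
    inj : ∀ k l → Shrink.to s′ (Shrink.from s k) ≡ Shrink.to s′ (Shrink.from s l) → k ≡ l
    inj k l e with shrink-same s′ _ _ e
    ... | inj₁ eq = trans (sym (q-sec (Shrink.map s) k)) (trans (cong (Shrink.to s) eq) (q-sec (Shrink.map s) l))
    ... | inj₂ (p , r) = trans (sym (q-sec (Shrink.map s) k)) (trans (Shrink.shrunk s _ p) (trans (sym (Shrink.shrunk s _ r)) (q-sec (Shrink.map s) l)))

  Tight : (G : Graph) → Pred (order G) → Set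
  Tight G Z = ∀ F → Perfect G F → wtᴳ G (⟦_⟧ ∘ F) Z ≡ 1

  Refined : ∀ {G} → TightCutDecomposition G → Graph → Graph → Set
  Refined D G₁ G₂ = ∃ λ (D₁ : TightCutDecomposition G₁) → ∃ λ (D₂ : TightCutDecomposition G₂) → β D ≡ β D₁ + β D₂

  Refinable : ∀ {G} → TightCutDecomposition G → Set
  Refinable {G} D = ∀ {Z G₁ x₁ G₂ x₂} → Cut G Z G₁ x₁ G₂ x₂ → cutSize G Z ≡ 3 → Tight G Z → Refined D G₁ G₂

  refined-swap : ∀ {G} {D : TightCutDecomposition G} {G₁ G₂} → Refined D G₁ G₂ → Refined D G₂ G₁
  refined-swap (D₁ , D₂ , e) = D₂ , D₁ , trans e (+-comm (β D₁) (β D₂))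

  -- With a single vertex in Z, G₁ is isomorphic to G, and G₂ has two vertices and is a brace
  -- contributing nothing to β. A trivial shore does arise, namely from splicing at a vertex of a
  -- two-vertex graph.
  trivial-cut : ∀ {G Z G₁ x₁ G₂ x₂} (D : TightCutDecomposition G) → Cut G Z G₁ x₁ G₂ x₂ → ¬ 2 ≤ count Z → Refined D G₁ G₂
  trivial-cut {G} {Z} {G₁} {x₁} {G₂} {x₂} D c small with transport S₁.map inj D
    where
    module S₁ = Shrink (Cut.side₁ c)
    inj : ∀ u v → S₁.to u ≡ S₁.to v → u ≡ v
    inj u v e with shrink-same (Cut.side₁ c) u v e
    ... | inj₁ eq = eq
    ... | inj₂ (p , r) with u ≟ v
    ...   | yes eq = eq
    ...   | no ne = contradiction (two Z u v p r ne) small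
  ... | D₁ , eq = D₁ , brace free (tabulate (δ x₂) , bipartite⁺ G₂ (δ x₂) bip) , trans (sym eq) (sym (+-identityʳ _))
    where
    module S₂ = Shrink (Cut.side₂ c)
    in-Z : ∀ u → u ≢ x₂ → Z (S₂.from u) ≡ true
    in-Z u ne = ≢false⇒true λ h → true≢false (not⁺ h) (S₂.from-kept ne)
    others : ∀ u v → u ≢ x₂ → v ≢ x₂ → u ≡ v
    others u v nu nv with S₂.from u ≟ S₂.from v
    ... | yes e = trans (sym (q-sec S₂.map u)) (trans (cong S₂.to e) (q-sec S₂.map v))
    ... | no ne = contradiction (two Z _ _ (in-Z u nu) (in-Z v nv) ne) small
    missing : ∀ A → 2 ≤ count A → A x₂ ≡ false → ⊥
    missing A le h with two⁻ A le
    ... | u , v , Au , Av , ne = ne (others u v (λ { refl → true≢false Au h }) (λ { refl → true≢false Av h }))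
    free : TightCutFree G₂
    free X t with tightᴳ⁻ G₂ X t | bool (lookup X x₂)
    ... | _ , le , _ | inj₁ h = missing (not ∘ lookup X) le (cong not h)
    ... | le , _ , _ | inj₂ h = missing (lookup X) le h
    bip : ∀ f → star G₂ x₂ f ≡ true
    bip f with Graph.src G₂ f ≟ x₂ | Graph.tgt G₂ f ≟ x₂
    ... | yes a | _ = joins-star G₂ {x₂} {Graph.tgt G₂ f} {f} (inj₁ (a , refl))
    ... | no _ | yes b = joins-star G₂ {x₂} {Graph.src G₂ f} {f} (inj₂ (refl , b))
    ... | no a | no b = contradiction (others _ _ a b) (Graph.loopless G₂ f)

  -- X lies in the shore of Z that survives in G₁; a proper inclusion turns X into a tight cut of G₁.
  module NestedCut {G X P xP Q xQ Z G₁ x₁ G₂ x₂} (cX : Cut G X P xP Q xQ) (cZ : Cut G Z G₁ x₁ G₂ x₂)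
    (goodP : Good P) (goodQ : Good Q) (good₁ : Good G₁) (good₂ : Good G₂)
    (tightX : Tight G X) (tightZ : Tight G Z) (sizeZ : cutSize G Z ≡ 3) (disjoint : ∀ v → X v ≡ true → Z v ≡ false) where
    private
      sP = Cut.side₁ cX
      sQ = Cut.side₂ cX
      s₁ = Cut.side₁ cZ
      s₂ = Cut.side₂ cZ
      module SP = Shrink sP
      module SQ = Shrink sQ
      module S₁ = Shrink s₁
      module S₂ = Shrink s₂

    Z∌X : ∀ {v} → Z v ≡ true → X v ≡ false
    Z∌X {v} h = ≢true⇒false λ t → true≢false h (disjoint v t)

    ZP : Pred (order P)
    ZP = Z ∘ SP.from

    ZP-to : ∀ v → ZP (SP.to v) ≡ Z v
    ZP-to v with bool (X v)
    ... | inj₂ h = cong Z (SP.from-to v h)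
    ... | inj₁ h = trans (cong ZP (SP.shrunk v h)) (trans (disjoint _ SP.Z-inhabited) (sym (disjoint v h)))

    X₁ : Pred (order G₁)
    X₁ = X ∘ S₁.from

    X₁-to : ∀ v → X₁ (S₁.to v) ≡ X v
    X₁-to v with bool (Z v)
    ... | inj₂ h = cong X (S₁.from-to v h)
    ... | inj₁ h = trans (cong X₁ (S₁.shrunk v h)) (trans (Z∌X S₁.Z-inhabited) (sym (Z∌X h)))

    shrink-P₂ : Shrink P (not ∘ ZP) G₂ x₂
    shrink-P₂ = shrink-through SP.map s₂ ker
      where
      ker : ∀ u v → SP.to u ≡ SP.to v → S₂.to u ≡ S₂.to v
      ker u v e with shrink-same sP u v e
      ... | inj₁ refl = refl
      ... | inj₂ (p , r) = trans (S₂.shrunk u (not⁺ (disjoint u p))) (sym (S₂.shrunk v (not⁺ (disjoint v r))))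

    shrink-Q₁ : Shrink G₁ (not ∘ X₁) Q xQ
    shrink-Q₁ = shrink-through S₁.map sQ ker
      where
      ker : ∀ u v → S₁.to u ≡ S₁.to v → SQ.to u ≡ SQ.to v
      ker u v e with shrink-same s₁ u v e
      ... | inj₁ refl = refl
      ... | inj₂ (p , r) = trans (SQ.shrunk u (not⁺ (Z∌X p))) (sym (SQ.shrunk v (not⁺ (Z∌X r))))

    size-P : cutSize P ZP ≡ 3
    size-P = trans (sym (wt-image SP.map (const 1) ZP)) (trans (Edges.wt-cong _ _ _ ZP-to) sizeZ)

    -- A perfect matching of P extends across X to one of G without changing its edges in P, so
    -- tightness of Z can be read off in G.
    tight-P : Tight P ZP
    tight-P F pm with extend cX goodP goodQ F (pm xP)
    ... | F′ , out , in′ , F≡ = trans (lin-cong λ f → cong (λ b → ⟦ cutᴳ P ZP f ⟧ * ⟦ b ⟧) (sym (F≡ f)))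
        (trans (sym (wt-image SP.map (⟦_⟧ ∘ F′) ZP)) (trans (Edges.wt-cong _ _ _ ZP-to) (tightZ F′ perfect′)))
      where
      perfect′ : Perfect G F′
      perfect′ v with bool (X v)
      ... | inj₁ h = in′ v h
      ... | inj₂ h = trans (out v h) (pm (SP.to v))

    tight-X₁ : Tight G₁ X₁
    tight-X₁ F pm with extend cZ good₁ good₂ F (pm x₁)
    ... | F′ , out , in′ , F≡ = trans (lin-cong λ f → cong (λ b → ⟦ cutᴳ G₁ X₁ f ⟧ * ⟦ b ⟧) (sym (F≡ f)))
        (trans (sym (wt-image S₁.map (⟦_⟧ ∘ F′) X₁)) (trans (Edges.wt-cong _ _ _ X₁-to) (tightX F′ perfect′)))
      where
      perfect′ : Perfect G F′
      perfect′ v with bool (Z v)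
      ... | inj₁ h = in′ v h
      ... | inj₂ h = trans (out v h) (pm (S₁.to v))

    nontrivial : 2 ≤ count X → ∀ v → X v ≡ false → Z v ≡ false → NontrivialTightCut G₁ (tabulate X₁)
    nontrivial le v Xv Zv with two⁻ X le
    ... | a , b , Xa , Xb , ne = tightᴳ⁺ G₁ X₁
        (two X₁ (S₁.to a) (S₁.to b) (trans (X₁-to a) Xa) (trans (X₁-to b) Xb) (λ e → ne (S₁.kept-inj a b (disjoint a Xa) (disjoint b Xb) e)))
        (two (not ∘ X₁) x₁ (S₁.to v) (not⁺ (Z∌X S₁.Z-inhabited)) (not⁺ (trans (X₁-to v) Xv)) (S₁.kept v Zv ∘ sym))
        tight-X₁

    module _ {R xR} (sR : Shrink P ZP R xR) where
      private module SR = Shrink sR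

      -- X and Z are disjoint, so shrinking X before Z or Z before X gives the same graph.
      shrink-R : Shrink G₁ X₁ R (SR.to xP)
      shrink-R = record { map = through S₁.map (SR.map ⊚ SP.map) ker ; shrunk = λ g h → cong SR.to (SP.shrunk _ h) ; kept = kept ; kept-inj = kept-inj }
        where
        ker : ∀ u v → S₁.to u ≡ S₁.to v → SR.to (SP.to u) ≡ SR.to (SP.to v)
        ker u v e with shrink-same s₁ u v e
        ... | inj₁ refl = refl
        ... | inj₂ (p , r) = trans (SR.shrunk _ (trans (ZP-to u) p)) (sym (SR.shrunk _ (trans (ZP-to v) r)))
        ZPx : ZP xP ≡ false
        ZPx = disjoint _ SP.Z-inhabited
        kept : ∀ g → X₁ g ≡ false → SR.to (SP.to (S₁.from g)) ≢ SR.to xP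
        kept g h e with shrink-same sR _ _ e
        ... | inj₁ eq = SP.kept _ h eq
        ... | inj₂ (_ , r) = true≢false r ZPx
        kept-inj : ∀ g l → X₁ g ≡ false → X₁ l ≡ false → SR.to (SP.to (S₁.from g)) ≡ SR.to (SP.to (S₁.from l)) → g ≡ l
        kept-inj g l hg hl e with shrink-same sR _ _ e
        ... | inj₁ eq = trans (sym (q-sec S₁.map g)) (trans (cong S₁.to (SP.kept-inj _ _ hg hl eq)) (q-sec S₁.map l))
        ... | inj₂ (p , r) = trans (sym (q-sec S₁.map g)) (trans (S₁.shrunk _ (trans (sym (ZP-to _)) p))
                (trans (sym (S₁.shrunk _ (trans (sym (ZP-to _)) r))) (q-sec S₁.map l)))

    -- If some vertex lies in neither X nor Z, the decomposition of P is refined along Z and X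
    -- becomes the initial cut of G₁. Otherwise Z is the complement of X, so G₁ and G₂ are Q and P
    -- up to isomorphism.
    nested : (DP : TightCutDecomposition P) (DQ : TightCutDecomposition Q) → Refinable DP → 2 ≤ count X →
      ∃ λ (D₁ : TightCutDecomposition G₁) → ∃ λ (D₂ : TightCutDecomposition G₂) → β DP + β DQ ≡ β D₁ + β D₂
    nested DP DQ ref le with any? (λ v → (X v Bool.≟ false) ×-dec (Z v Bool.≟ false))
    ... | yes (v , Xv , Zv) = go (shrink P ZP (SP.to (S₁.from x₁)) (trans (ZP-to _) S₁.Z-inhabited))
      where
      go : (∃ λ R → ∃ λ xR → Shrink P ZP R xR) → ∃ λ (D₁ : TightCutDecomposition G₁) → ∃ λ (D₂ : TightCutDecomposition G₂) → β DP + β DQ ≡ β D₁ + β D₂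
      go (R , xR , sR) with ref (record { side₁ = sR ; side₂ = shrink-P₂ }) size-P tight-P
      ... | DR , D₂ , eq = split (tabulate X₁) (nontrivial le v Xv Zv) (contraction-of X₁ (shrink-R sR)) (contraction-of-∁ X₁ shrink-Q₁) DR DQ
          , D₂ , trans (cong (_+ β DQ) eq) (rot (β DR) (β D₂) (β DQ))
        where
        rot : ∀ a b c → a + b + c ≡ a + c + b
        rot = solve-∀
    ... | no ∄ with same-shrink sQ (shrink-cong Z≡¬X s₁) DQ | same-shrink sP (shrink-cong ¬Z≡X s₂) DP
      where
      ¬Z≡X : ∀ v → not (Z v) ≡ X v
      ¬Z≡X v with bool (X v)
      ... | inj₁ h = trans (cong not (disjoint v h)) (sym h)
      ... | inj₂ h = trans (cong not (≢false⇒true λ z → ∄ (v , h , z))) (sym h)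
      Z≡¬X : ∀ v → Z v ≡ not (X v)
      Z≡¬X v = trans (sym (Bool.not-involutive _)) (cong not (¬Z≡X v))
    ...   | D₁ , e₁ | D₂ , e₂ = D₁ , D₂ , trans (+-comm (β DP) (β DQ)) (cong₂ _+_ (sym e₁) (sym e₂))

  -- Nonempty even cuts have at least four edges, so by submodularity two 3-cuts cannot cross.
  laminar : ∀ G → Good G → ∀ X Z → cutSize G X ≡ 3 → cutSize G Z ≡ 3 →
    ((∀ v → X v ≡ true → Z v ≡ false) ⊎ (∀ v → not (X v) ≡ true → not (Z v) ≡ false)) ⊎
    ((∀ v → X v ≡ true → not (Z v) ≡ false) ⊎ (∀ v → not (X v) ≡ true → Z v ≡ false))
  laminar G good X Z sX sZ = decide (bool (odd (count XZ)))
    where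
    open Good good
    open Graph G using (src; tgt)
    XZ X∖Z Z∖X X∪Z : Pred (order G)
    XZ v = X v ∧ Z v
    X∖Z v = X v ∧ not (Z v)
    Z∖X v = not (X v) ∧ Z v
    X∪Z v = X v ∨ Z v
    oddX : odd (count X) ≡ true
    oddX = trans (sym (cubic-parity G cubic X)) (cong odd sX)
    oddZ : odd (count Z) ≡ true
    oddZ = trans (sym (cubic-parity G cubic Z)) (cong odd sZ)
    four : ∀ U u v → U u ≡ true → U v ≡ false → odd (count U) ≡ false → 4 ≤ cutSize G U
    four U u v Uu Uv ev with m≤n⇒m<n∨m≡n (three U u v Uu Uv)
    ... | inj₁ lt = lt
    ... | inj₂ eq = ⊥-elim (true≢false (cong odd (sym eq)) (trans (cubic-parity G cubic U) ev))
    sums : ∀ A B → (∀ e → ⟦ cutᴳ G A e ⟧ + ⟦ cutᴳ G B e ⟧ ≤ ⟦ cutᴳ G X e ⟧ + ⟦ cutᴳ G Z e ⟧) → cutSize G A + cutSize G B ≤ 6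
    sums A B h = begin
      cutSize G A + cutSize G B                                ≡⟨ cong₂ _+_ (cutSize≡sum G A) (cutSize≡sum G B) ⟩
      sum (λ e → ⟦ cutᴳ G A e ⟧) + sum (λ e → ⟦ cutᴳ G B e ⟧)  ≡⟨ sum-+ _ _ ⟨
      sum (λ e → ⟦ cutᴳ G A e ⟧ + ⟦ cutᴳ G B e ⟧)              ≤⟨ sum-mono-≤ h ⟩
      sum (λ e → ⟦ cutᴳ G X e ⟧ + ⟦ cutᴳ G Z e ⟧)              ≡⟨ sum-+ _ _ ⟩
      sum (λ e → ⟦ cutᴳ G X e ⟧) + sum (λ e → ⟦ cutᴳ G Z e ⟧)  ≡⟨ cong₂ _+_ (cutSize≡sum G X) (cutSize≡sum G Z) ⟨
      cutSize G X + cutSize G Z                                ≡⟨ cong₂ _+_ sX sZ ⟩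
      6                                                        ∎
      where open ≤-Reasoning
    eight : ∀ {A B} → 4 ≤ cutSize G A → 4 ≤ cutSize G B → cutSize G A + cutSize G B ≤ 6 → ⊥
    eight p r le = contradiction (≤-trans (+-mono-≤ p r) le) λ { (s≤s (s≤s (s≤s (s≤s (s≤s (s≤s ())))))) }
    diff-sum : cutSize G X∖Z + cutSize G Z∖X ≤ 6
    diff-sum = sums X∖Z Z∖X λ e → ≤ᵇ⁻ (tautology⁻ 4 (λ { (a ∷ b ∷ c ∷ d ∷ []) →
        (⟦ (a ∧ not b) xor (c ∧ not d) ⟧ + ⟦ (not a ∧ b) xor (not c ∧ d) ⟧) ℕ.≤ᵇ (⟦ a xor c ⟧ + ⟦ b xor d ⟧) }) refl (X (src e) ∷ Z (src e) ∷ X (tgt e) ∷ Z (tgt e) ∷ []))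
    meet-sum : cutSize G XZ + cutSize G X∪Z ≤ 6
    meet-sum = sums XZ X∪Z λ e → ≤ᵇ⁻ (tautology⁻ 4 (λ { (a ∷ b ∷ c ∷ d ∷ []) →
        (⟦ (a ∧ b) xor (c ∧ d) ⟧ + ⟦ (a ∨ b) xor (c ∨ d) ⟧) ℕ.≤ᵇ (⟦ a xor c ⟧ + ⟦ b xor d ⟧) }) refl (X (src e) ∷ Z (src e) ∷ X (tgt e) ∷ Z (tgt e) ∷ []))
    parity : ∀ {a} b c → a ≡ b + c → odd a ≡ true → odd c ≡ not (odd b)
    parity b c eq h = lem (odd b) (odd c) (trans (sym (odd-+ b c)) (trans (cong odd (sym eq)) h))
      where
      lem : ∀ x y → x xor y ≡ true → y ≡ not x
      lem true  false _ = refl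
      lem false true  _ = refl
    decide : odd (count XZ) ≡ true ⊎ odd (count XZ) ≡ false → _
    decide (inj₁ o) with any? (λ v → X∖Z v Bool.≟ true) | any? (λ v → Z∖X v Bool.≟ true)
    ... | no ∄ | _ = inj₂ (inj₁ λ v h → ≢true⇒false λ nz → ∄ (v , ∧⁺ h nz))
    ... | yes _ | no ∄ = inj₂ (inj₂ λ v h → ≢true⇒false λ z → ∄ (v , ∧⁺ h z))
    ... | yes (u , hu) | yes (v , hv) = ⊥-elim (eight {X∖Z} {Z∖X}
          (four X∖Z u v hu (trans (cong (λ b → X v ∧ not b) (proj₂ (∧⁻ {not (X v)} hv))) (Bool.∧-zeroʳ (X v)))
            (trans (parity (count XZ) (count X∖Z) (count-split X Z) oddX) (cong not o)))
          (four Z∖X v u hv (cong (λ b → not b ∧ Z u) (proj₁ (∧⁻ hu)))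
            (trans (parity (count XZ) (count Z∖X) (trans (count-split Z X) (cong₂ _+_ (count-cong λ v → Bool.∧-comm (Z v) (X v)) (count-cong λ v → Bool.∧-comm (Z v) (not (X v))))) oddZ) (cong not o)))
          diff-sum)
    decide (inj₂ ev) with any? (λ v → XZ v Bool.≟ true) | any? (λ v → X∪Z v Bool.≟ false)
    ... | no ∄ | _ = inj₁ (inj₁ λ v h → ≢true⇒false λ z → ∄ (v , ∧⁺ h z))
    ... | yes _ | no ∄ = inj₁ (inj₂ λ v h → cong not (≢false⇒true λ z → ∄ (v , cong₂ _∨_ (not⁻ h) z)))
    ... | yes (u , hu) | yes (v , hv) = ⊥-elim (eight {XZ} {X∪Z}
          (four XZ u v hu (cong (_∧ Z v) (≢true⇒false λ x → true≢false (∨⁺ˡ x) hv)) ev)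
          (four X∪Z u v (∨⁺ˡ {X u} (proj₁ (∧⁻ {X u} hu))) hv even-union) meet-sum)
      where
      even-union : odd (count X∪Z) ≡ false
      even-union = lem (odd (count X∪Z)) (odd (count XZ)) ev (trans (sym (odd-+ (count X∪Z) _)) (trans (cong odd (count-∨ X Z)) (trans (odd-+ (count X) _) (cong₂ _xor_ oddX oddZ))))
        where
        lem : ∀ x y → y ≡ false → x xor y ≡ false → x ≡ false
        lem false false _ _ = refl

  cut-goods : ∀ {G Z G₁ x₁ G₂ x₂} → Cut G Z G₁ x₁ G₂ x₂ → Good G → cutSize G Z ≡ 3 → Good G₁ × Good G₂
  cut-goods {G} {Z} c good size =
      shrink-good (Cut.side₁ c) good size (Shrink.from (Cut.side₂ c) _) (not⁻ (Shrink.Z-inhabited (Cut.side₂ c)))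
    , shrink-good (Cut.side₂ c) good (trans (wt-not G (const 1) Z) size) (Shrink.from (Cut.side₁ c) _) (cong not (Shrink.Z-inhabited (Cut.side₁ c)))

  refine-free : ∀ {G} (D : TightCutDecomposition G) → TightCutFree G → Refinable D
  refine-free {G} D free {Z} c size tight with 2 ≤? count Z | 2 ≤? count (not ∘ Z)
  ... | no small | _ = trivial-cut D c small
  ... | yes _ | no small = refined-swap {D = D} (trivial-cut D (cut-swap c) small)
  ... | yes a | yes b = ⊥-elim (free (tabulate Z) (tightᴳ⁺ G Z a b tight))

  -- The four positions allowed by `laminar` all become the case of disjoint shores after
  -- complementing X, Z or both. Then only one of the two subdecompositions has to be refined
  -- recursively.
  refine-decomposition : ∀ {G} (D : TightCutDecomposition G) → Good G → Refinable D
  refine-decomposition D@(brick free _) good = refine-free D free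
  refine-decomposition D@(brace free _) good = refine-free D free
  refine-decomposition {G} D@(split X {H₁} {H₂} t c₁ c₂ D₁ D₂) good {Z} {G₁} {x₁} {G₂} {x₂} c size tightZ = go (laminar G good (lookup X) Z three size)
    where
    open SplitCut (split-cut good t c₁ c₂)
    tX = tightᴳ⁻ G X t
    goods = cut-goods c good size
    not-tight : ∀ {U} → Tight G U → Tight G (not ∘ U)
    not-tight {U} h F pm = trans (wt-not G (⟦_⟧ ∘ F) U) (h F pm)
    size′ : cutSize G (not ∘ Z) ≡ 3
    size′ = trans (wt-not G (const 1) Z) size
    flip : ∀ {A B : Graph} → (∃ λ (E₁ : TightCutDecomposition A) → ∃ λ (E₂ : TightCutDecomposition B) → β D₂ + β D₁ ≡ β E₁ + β E₂) → Refined D A B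
    flip (E₁ , E₂ , eq) = E₁ , E₂ , trans (+-comm (β D₁) (β D₂)) eq
    go : _ → Refined D G₁ G₂
    go (inj₁ (inj₁ dis)) = NestedCut.nested cut c good₁ good₂ (proj₁ goods) (proj₂ goods) tight tightZ size dis D₁ D₂ (refine-decomposition D₁ good₁) (proj₁ tX)
    go (inj₁ (inj₂ dis)) = refined-swap {D = D} (flip (NestedCut.nested (cut-swap cut) (cut-swap c) good₂ good₁ (proj₂ goods) (proj₁ goods)
      (not-tight {lookup X} tight) (not-tight {Z} tightZ) size′ dis D₂ D₁ (refine-decomposition D₂ good₂) (proj₁ (proj₂ tX))))
    go (inj₂ (inj₁ dis)) = refined-swap {D = D} (NestedCut.nested cut (cut-swap c) good₁ good₂ (proj₂ goods) (proj₁ goods)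
      tight (not-tight {Z} tightZ) size′ dis D₁ D₂ (refine-decomposition D₁ good₁) (proj₁ tX))
    go (inj₂ (inj₂ dis)) = flip (NestedCut.nested (cut-swap cut) c good₂ good₁ (proj₁ goods) (proj₂ goods)
      (not-tight {lookup X} tight) tightZ size dis D₂ D₁ (refine-decomposition D₂ good₂) (proj₁ (proj₂ tX)))

open Refinement

-- Members of 𝒢: tightness of the splicing cuts and the value of β

module Members where

  AllCubic : Graph → Set
  AllCubic G = ∀ v → cutSize G (δ v) ≡ 3

  cubic⇒edge : ∀ {G} → AllCubic G → ∀ v → ∃ λ e → star G v e ≡ true
  cubic⇒edge {G} cub v = count-pos⁻ (≤-trans (s≤s z≤n) (≤-reflexive (sym (trans (sym (cutSize≡count G (δ v))) (cub v)))))

  abstract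
    splicing-cut : ∀ {K a J w K′} → AllCubic K → (s : Splicing K a J w K′) → ∃ λ (c : Cut K′ (second s) K a J w) →
      ∀ R v → lookup (Splicing.transfer s R) v ≡ (not (second s v) ∧ lookup R (Shrink.to (Cut.side₁ c) v))
    splicing-cut {K} {a} {J} {w} cub s = splicing⇒cut s (proj₁ o₁) (proj₁ (proj₂ o₁)) (proj₁ o₂) (proj₁ (proj₂ o₂))
        , λ R v → lookup-transfer s R (proj₁ (proj₂ o₂)) v
      where
      f : ∃ λ e → star K a e ≡ true
      f = cubic⇒edge {K} cub a
      g : El (Graph.∂ᵥ J w)
      g = Inverse.to (Splicing.π s) (proj₁ f , ∂ᵥ⁺ K (proj₂ f))
      o₁ : ∃ λ x → x ≢ a × Graph.Joins K (proj₁ f) a x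
      o₁ = star-other K {a} {proj₁ f} (proj₂ f)
      o₂ : ∃ λ x → x ≢ w × Graph.Joins J (proj₁ g) w x
      o₂ = star-other J {w} (∂ᵥ⁻ J (proj₂ g))

  cubic-splice : ∀ {K a J w K′} → AllCubic K → AllCubic J → Splicing K a J w K′ → AllCubic K′
  cubic-splice cubK cubJ s v with proj₁ (splicing-cut cubK s) | bool (second s v)
  ... | c | inj₂ h = trans (sym (Shrink.wt-kept (Cut.side₁ c) (const 1) h)) (cubK _)
  ... | c | inj₁ h = trans (sym (Shrink.wt-kept (Cut.side₂ c) (const 1) (cong not h))) (cubJ _)

  cubic⁺ : ∀ {G} → Cubic G → AllCubic G
  cubic⁺ {G} cub v = trans (sym (∣∂ᵥ∣≡ G v)) (cub v)

  mutual
    𝒢-cubic : ∀ {G} → 𝒢 G → AllCubic G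
    𝒢-cubic {G} (cubicBrick cub _)     = cubic⁺ {G} cub
    𝒢-cubic (spliced H A _ cub _ s)    = spliced-cubic s (cubic⁺ {H} cub)

    spliced-cubic : ∀ {K R G} → SplicedAt K R G → AllCubic K → AllCubic G
    spliced-cubic (done _)               cub = cub
    spliced-cubic (step a w _ g s rest)  cub = spliced-cubic rest (cubic-splice cub (𝒢-cubic g) s)

  restrict-factor : ∀ {G Z G₁ x₁ G₂ x₂} (c : Cut G Z G₁ x₁ G₂ x₂) Q → (∀ v → Q v ≡ true → Z v ≡ false) → ∀ F → (∀ v → degᴳ G F v ≡ want Q v) →
    ∀ (b : Bool) → wtᴳ G (⟦_⟧ ∘ F) Z ≡ (if b then 3 else 1) → Factor G₁ (λ u → if δ x₁ u then b else Q (Shrink.from (Cut.side₁ c) u))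
  restrict-factor {G} {Z} {G₁} {x₁} c Q Q∌Z F dg b wt≡ = F ∘ p map , degrees
    where
    open Shrink (Cut.side₁ c)
    degrees : ∀ u → degᴳ G₁ (F ∘ p map) u ≡ want (λ u → if δ x₁ u then b else Q (from u)) u
    degrees u with x₁ ≟ u
    ... | yes refl rewrite δ-refl x₁ = trans (wt-x (⟦_⟧ ∘ F)) wt≡
    ... | no ne rewrite δ-false ne = trans (cong (degᴳ G₁ (F ∘ p map)) (sym (q-sec map u))) (trans (wt-kept (⟦_⟧ ∘ F) (from-kept (ne ∘ sym))) (dg (from u)))

  -- K need not stay bipartite under splicing. This is the property of the colour class that
  -- survives, with R the set of vertices still to be spliced.
  Rigid : (K : Graph) → Pred (order K) → Set
  Rigid K R = ∀ Q → Q ⊑ R → Factor K Q → count Q ≡ 0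

  one-or-three : ∀ m → m ≤ 3 → odd m ≡ true → m ≡ 1 ⊎ m ≡ 3
  one-or-three 1 _ _ = inj₁ refl
  one-or-three 3 _ _ = inj₂ refl
  one-or-three (suc (suc (suc (suc m)))) (s≤s (s≤s (s≤s ()))) _

  abstract
    -- The number of crossings has the parity of the size of Z, which is also the parity of the cut
    -- size 3.
    crossing-number : ∀ G Z → AllCubic G → cutSize G Z ≡ 3 → ∀ F → (∀ v → odd (degᴳ G F v) ≡ true) → wtᴳ G (⟦_⟧ ∘ F) Z ≡ 1 ⊎ wtᴳ G (⟦_⟧ ∘ F) Z ≡ 3
    crossing-number G Z cub size F od = one-or-three _ (≤-trans (lin-mono λ e → *-monoʳ-≤ ⟦ cutᴳ G Z e ⟧ (⟦⟧≤1 (F e))) (≤-reflexive size))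
      (trans (odd-cut G F Z od) (trans (sym (cubic-parity G cub Z)) (cong odd size)))

  module SpliceStep {K a J w K′} (cubK : AllCubic K) (cubJ : AllCubic J) (s : Splicing K a J w K′) (R : Subset (order K)) (Ra : lookup R a ≡ true)
    (rigid : Rigid K (lookup R)) where
    c : Cut K′ (second s) K a J w
    c = proj₁ (splicing-cut cubK s)
    private
      module S = Shrink (Cut.side₁ c)
      Z : Pred (order K′)
      Z = second s
    R′ : Pred (order K′)
    R′ = lookup (Splicing.transfer s R)

    R′≡ : ∀ v → R′ v ≡ (not (Z v) ∧ lookup R (S.to v))
    R′≡ = proj₂ (splicing-cut cubK s) R

    cub′ : AllCubic K′
    cub′ = cubic-splice cubK cubJ s

    size3 : cutSize K′ Z ≡ 3
    size3 = trans (sym (S.wt-x (const 1))) (cubK a)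

    -- A factor crossing the cut in three edges would give one of K containing a.
    no-triple : ∀ Q → Q ⊑ R′ → ∀ F → (∀ v → degᴳ K′ F v ≡ want Q v) → wtᴳ K′ (⟦_⟧ ∘ F) Z ≡ 3 → ⊥
    no-triple Q Q⊑ F dg eq = contradiction (count-pos {p = Q₁} a (cong (λ b → if b then true else Q (S.from a)) (δ-refl a)))
        (subst (λ n → ¬ 1 ≤ n) (sym (rigid Q₁ Q₁⊑ (restrict-factor c Q Q∌Z F dg true eq))) λ ())
      where
      Q₁ : Pred (order K)
      Q₁ u = if δ a u then true else Q (S.from u)
      Q∌Z : ∀ v → Q v ≡ true → Z v ≡ false
      Q∌Z v h = not⁻ (proj₁ (∧⁻ (trans (sym (R′≡ v)) (Q⊑ v h))))
      Q₁⊑ : Q₁ ⊑ lookup R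
      Q₁⊑ u h with a ≟ u
      ... | yes refl = Ra
      ... | no ne rewrite δ-false ne = trans (cong (lookup R) (sym (q-sec S.map u))) (proj₂ (∧⁻ {not (Z (S.from u))} (trans (sym (R′≡ _)) (Q⊑ _ h))))

    rigid′ : Rigid K′ R′
    rigid′ Q Q⊑ (F , dg) with crossing-number K′ Z cub′ size3 F (λ v → trans (cong odd (dg v)) (odd-want Q v))
    ... | inj₂ eq = ⊥-elim (no-triple Q Q⊑ F dg eq)
    ... | inj₁ eq = count-empty empty
      where
      Q∌Z : ∀ v → Q v ≡ true → Z v ≡ false
      Q∌Z v h = not⁻ (proj₁ (∧⁻ (trans (sym (R′≡ v)) (Q⊑ v h))))
      Q₁ : Pred (order K)
      Q₁ u = if δ a u then false else Q (S.from u)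
      Q₁⊑ : Q₁ ⊑ lookup R
      Q₁⊑ u h with a ≟ u
      ... | yes refl = Ra
      ... | no ne rewrite δ-false ne = trans (cong (lookup R) (sym (q-sec S.map u))) (proj₂ (∧⁻ {not (Z (S.from u))} (trans (sym (R′≡ _)) (Q⊑ _ h))))
      zero₁ : count Q₁ ≡ 0
      zero₁ = rigid Q₁ Q₁⊑ (restrict-factor c Q Q∌Z F dg false eq)
      empty : ∀ v → Q v ≡ false
      empty v = ≢true⇒false λ h → true≢false (trans (cong₂ (λ b z → if b then false else Q z) (trans (S.δ-x v) (Q∌Z v h)) (S.from-to v (Q∌Z v h))) h)
        (count-zero zero₁ (S.to v))

    -- A perfect matching crossing three times would restrict to a factor of K with degree 3 exactly
    -- at a, which rigidity forbids.
    tight : Tight K′ Z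
    tight F pm with crossing-number K′ Z cub′ size3 F (λ v → cong odd (pm v))
    ... | inj₁ eq = eq
    ... | inj₂ eq = ⊥-elim (no-triple (const false) (λ _ ()) F pm eq)

    count-R : count (lookup R) ≡ suc (count R′)
    count-R = trans (count-∖ a Ra) (cong suc (sym (trans (count-cong λ v → trans (R′≡ v) (Bool.∧-comm (not (Z v)) _))
      (trans (side-count (Cut.side₁ c) (lookup R ∘ S.to)) (count-cong λ u → cong (λ z → lookup R z ∧ not (δ a u)) (q-sec S.map u))))))

    order-K′ : 2 + order K′ ≡ order K + order J
    order-K′ = trans (cong (2 +_) (trans (sym (count-full _)) (cut-count c (const true)))) (trans (shift _ _)
        (cong₂ _+_ (one-less K a) (one-less J w)))
      where
      shift : ∀ m n → 2 + (m + n) ≡ suc m + suc n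
      shift = solve-∀
      one-less : ∀ H x → suc (count (λ u → true ∧ not (δ x u))) ≡ order H
      one-less H x = trans (sym (count-∖ {p = const true} x refl)) (count-full _)

  record StepFacts {K a J w K′} (s : Splicing K a J w K′) (R : Subset (order K)) : Set where
    field
      cut    : Cut K′ (second s) K a J w
      cubic  : AllCubic K′
      rigid  : Rigid K′ (lookup (Splicing.transfer s R))
      size   : cutSize K′ (second s) ≡ 3
      tight  : Tight K′ (second s)
      drop   : count (lookup R) ≡ suc (count (lookup (Splicing.transfer s R)))
      orders : 2 + order K′ ≡ order K + order J

  abstract
    step-facts : ∀ {K a J w K′} → AllCubic K → AllCubic J → (s : Splicing K a J w K′) → ∀ R → lookup R a ≡ true →
      Rigid K (lookup R) → StepFacts s R
    step-facts cubK cubJ s R Ra rigid = record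
      { cut = S.c ; cubic = S.cub′ ; rigid = S.rigid′ ; size = S.size3 ; tight = S.tight ; drop = S.count-R ; orders = S.order-K′ }
      where module S = SpliceStep cubK cubJ s R Ra rigid

  -- With Y empty no vertex of a bipartite graph is reached, so the lower bound leaves nothing for
  -- β.
  bipartite-β : ∀ {G} (D : TightCutDecomposition G) → Good G → Bipartite G → β D ≡ 0
  bipartite-β {G} D good (X , b) = n≤0⇒n≡0 (≤-trans (m≤m+n _ _) (≤-trans (Bound.lower (bound D good (const false) λ _ ()))
    (≤-reflexive (count-empty λ v → ≢true⇒false λ h → none v (reached⁻ h)))))
    where
    none : ∀ v → Reach G (const false) v → ⊥
    none v (inj₁ f) = bipartite⇒unmatchable G good (lookup X) (bipartite⁻ G X b) v f

  mutual
    𝒢-β : ∀ {G} → 𝒢 G → Good G → (D : TightCutDecomposition G) → β D ≡ order G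
    𝒢-β (cubicBrick _ (_ , _ , _))       good (brick _ _)         = refl
    𝒢-β (cubicBrick _ (_ , _ , nonbip))  good (brace _ bip)       = contradiction bip nonbip
    𝒢-β (cubicBrick _ (_ , free , _))    good (split X t _ _ _ _) = contradiction t (free X)
    𝒢-β {G} (spliced H A conn cub bip s) good D = conclude (chain s (cubic⁺ {H} cub)
        (one-sided-factor H (good⁺ H conn cub) (lookup A) (bipartite⁻ H A bip)) good)
      where
      conclude : Good H × (∀ (D : TightCutDecomposition G) → ∃ λ (DH : TightCutDecomposition H) → order G + (2 * count (lookup A) + β DH) ≡ order H + β D) →
                 β D ≡ order G
      conclude (goodH , ds) = sym (+-cancelʳ-≡ (2 * count (lookup A)) _ _ (trans (cong (order G +_) (sym (trans (cong (2 * count (lookup A) +_)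
          (bipartite-β (proj₁ (ds D)) goodH (A , bip))) (+-identityʳ _)))) (trans (proj₂ (ds D)) (trans (+-comm (order H) (β D)) (cong (β D +_) size)))))
        where
        size : order H ≡ 2 * count (lookup A)
        size = trans (sym (count-full _)) (trans (count-split (const true) (lookup A)) (trans (cong (count (lookup A) +_) (sym (balanced-sides H goodH (lookup A) (bipartite⁻ H A bip))))
          (cong (count (lookup A) +_) (sym (+-identityʳ _)))))

    -- Splicing in J adds `order J` to β but two vertices fewer to the order. The term with
    -- `count (lookup R)` accounts for the splicings still to come, without subtraction. For H the
    -- order is twice the size of A and β is 0, which yields `β D ≡ order G`. `Good` is passed
    -- backwards, from G to K and J by contraction across 3-cuts, so preservation of 3-connectedness
    -- by splicing never has to be proved.
    chain : ∀ {K R G} → SplicedAt K R G → AllCubic K → Rigid K (lookup R) → Good G →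
      Good K × (∀ (D : TightCutDecomposition G) → ∃ λ (DK : TightCutDecomposition K) → order G + (2 * count (lookup R) + β DK) ≡ order K + β D)
    chain {K} {R} (done empty) cub rigid good = good , λ D → D , cong (λ n → order K + (2 * n + β D)) (count-empty λ v → ≢true⇒false λ h → empty (v , true⇒∈ h))
    chain {K} {R} {G} (step {J = J} {K′ = K′} a w a∈ g s rest) cub rigid good = conclude (step-facts cub (𝒢-cubic g) s R (∈⇒true a∈) rigid)
      where
      R′ : Pred (order K′)
      R′ = lookup (Splicing.transfer s R)
      conclude : StepFacts s R → Good K × (∀ (D : TightCutDecomposition G) → ∃ λ (DK : TightCutDecomposition K) → order G + (2 * count (lookup R) + β DK) ≡ order K + β D)
      conclude f = through-rest (chain rest F.cubic F.rigid good)
        where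
        module F = StepFacts f
        through-rest : Good K′ × (∀ (D : TightCutDecomposition G) → ∃ λ (DK′ : TightCutDecomposition K′) → order G + (2 * count R′ + β DK′) ≡ order K′ + β D) →
          Good K × (∀ (D : TightCutDecomposition G) → ∃ λ (DK : TightCutDecomposition K) → order G + (2 * count (lookup R) + β DK) ≡ order K + β D)
        through-rest (goodK′ , ds) = proj₁ goods , λ D → go D (ds D)
          where
          goods = cut-goods F.cut goodK′ F.size
          go : ∀ D → (∃ λ (DK′ : TightCutDecomposition K′) → order G + (2 * count R′ + β DK′) ≡ order K′ + β D) →
               ∃ λ (DK : TightCutDecomposition K) → order G + (2 * count (lookup R) + β DK) ≡ order K + β D
          go D (DK′ , eq) = split-off (refine-decomposition DK′ goodK′ F.cut F.size F.tight)
            where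
            e₁ : ∀ a b c d → a + (2 * suc b + c) + d ≡ 2 + (a + (2 * b + (c + d)))
            e₁ = solve-∀
            e₂ : ∀ a b c → a + b + c ≡ a + c + b
            e₂ = solve-∀
            split-off : Refined DK′ K J → ∃ λ (DK : TightCutDecomposition K) → order G + (2 * count (lookup R) + β DK) ≡ order K + β D
            split-off (DK , DJ , eq′) = DK , +-cancelʳ-≡ (order J) _ _ (begin
              order G + (2 * count (lookup R) + β DK) + order J   ≡⟨ cong₂ (λ x y → order G + (2 * x + β DK) + y) F.drop (sym (𝒢-β g (proj₂ goods) DJ)) ⟩
              order G + (2 * suc (count R′) + β DK) + β DJ        ≡⟨ e₁ (order G) (count R′) (β DK) (β DJ) ⟩
              2 + (order G + (2 * count R′ + (β DK + β DJ)))      ≡⟨ cong (λ x → 2 + (order G + (2 * count R′ + x))) eq′ ⟨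
              2 + (order G + (2 * count R′ + β DK′))              ≡⟨ cong (2 +_) eq ⟩
              2 + (order K′ + β D)                                ≡⟨ +-assoc 2 (order K′) (β D) ⟨
              2 + order K′ + β D                                  ≡⟨ cong (_+ β D) F.orders ⟩
              order K + order J + β D                             ≡⟨ e₂ (order K) (order J) (β D) ⟩
              order K + β D + order J                             ∎)
              where open ≡-Reasoning

  matchable⁺ : ∀ G v → LambdaMatchable G v → Factor G (δ v)
  matchable⁺ G v (F , d3 , d1) = lookup F , degrees
    where
    degrees : ∀ u → degᴳ G (lookup F) u ≡ want (δ v) u
    degrees u with v ≟ u
    ... | yes refl rewrite δ-refl v = trans (sym (degreeIn≡ G F v)) d3
    ... | no ne rewrite δ-false ne = trans (sym (degreeIn≡ G F u)) (d1 u (ne ∘ sym))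

  matchable⁻ : ∀ G v → Factor G (δ v) → LambdaMatchable G v
  matchable⁻ G v (F , dg) = tabulate F , trans (degreeIn-tabulate G F v) (trans (dg v) (cong (λ b → if b then 3 else 1) (δ-refl v)))
    , λ u ne → trans (degreeIn-tabulate G F u) (trans (dg u) (cong (λ b → if b then 3 else 1) (δ-false (ne ∘ sym))))

  λ#≡ : ∀ G → λ# G ≡ count (reached G (const false))
  λ#≡ G = trans (∣∣≡count (Λ G)) (count-cong λ v → trans (lookup∘tabulate _ v) (≡-by-truth (to v) (from v)))
    where
    to : ∀ v → does (lambdaMatchable? G v) ≡ true → reached G (const false) v ≡ true
    to v h = reached⁺ (inj₁ (matchable⁺ G v (does⁻ (lambdaMatchable? G v) h)))
    from : ∀ v → reached G (const false) v ≡ true → does (lambdaMatchable? G v) ≡ true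
    from v h with reached⁻ h
    ... | inj₁ f = dec-true (lambdaMatchable? G v) (matchable⁻ G v f)

open Members

-- The inequality, the bipartite case and the equivalences

theorem3p8 : (G : Graph) → ThreeConnected G → Cubic G →
    (D : TightCutDecomposition G) →
    (β D ≤ λ# G)
    × (Bipartite G → (λ# G ≡ 0) × (β D ≡ 0))
    × (¬ Bipartite G → ((λ# G ≡ β D) ⇔ (β D ≡ order G)) × ((β D ≡ order G) ⇔ 𝒢 G))
theorem3p8 G conn cub D = β≤λ , bipartite , nonbipartite
  where
  good : Good G
  good = good⁺ G conn cub
  B : Bound G (β D) (const false)
  B = bound D good (const false) λ _ ()
  β+0 : β D + count {order G} (const false) ≡ β D
  β+0 = trans (cong (β D +_) (count-empty λ _ → refl)) (+-identityʳ _)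
  β≤λ : β D ≤ λ# G
  β≤λ = ≤-trans (≤-reflexive (sym β+0)) (≤-trans (Bound.lower B) (≤-reflexive (sym (λ#≡ G))))
  λ≤n : λ# G ≤ order G
  λ≤n = ≤-trans (≤-reflexive (λ#≡ G)) (≤-trans (count-mono {q = const true} λ _ _ → refl) (≤-reflexive (count-full _)))
  bipartite : Bipartite G → (λ# G ≡ 0) × (β D ≡ 0)
  bipartite (X , b) = trans (λ#≡ G) (count-empty λ v → ≢true⇒false λ h → none v (reached⁻ h)) , bipartite-β D good (X , b)
    where
    none : ∀ v → Reach G (const false) v → ⊥
    none v (inj₁ f) = bipartite⇒unmatchable G good (lookup X) (bipartite⁻ G X b) v f
  nonbipartite : ¬ Bipartite G → ((λ# G ≡ β D) ⇔ (β D ≡ order G)) × ((β D ≡ order G) ⇔ 𝒢 G)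
  nonbipartite nonbip = mk⇔ all-matchable (λ e → ≤-antisym (≤-trans λ≤n (≤-reflexive (sym e))) β≤λ)
      -- `Filled G` for the empty set is applied to the splicing at no vertex, whose result is G
      -- itself.
      , mk⇔ (λ e → proj₂ (extremal (≤-trans λ≤n (≤-reflexive (sym e)))) (tabulate (const false)) (lookup∘tabulate _)
          (done λ { (v , m) → true≢false (∈⇒true m) (lookup∘tabulate _ v) }))
        (λ g → 𝒢-β g good D)
    where
    extremal : λ# G ≤ β D → (∀ v → reached G (const false) v ≡ true ⊎ false ≡ true) × Filled G (const false)
    extremal le = Bound.exact B (≤-trans (≤-reflexive (sym (λ#≡ G))) (≤-trans le (≤-reflexive (sym β+0)))) (inj₂ nonbip)
    all-matchable : λ# G ≡ β D → β D ≡ order G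
    all-matchable e = trans (sym e) (trans (λ#≡ G) (trans (count-cong every) (count-full _)))
      where
      every : ∀ v → reached G (const false) v ≡ true
      every v with proj₁ (extremal (≤-reflexive e)) v
      ... | inj₁ h = h
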